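{- $C_{\mathtt{HAM}} \le 1.81701$, where $\mathtt{HAM}$ is the property of containing a Hamiltonian cycle.
   Context: The semi-random graph process on vertex set $[n]=\{1,\dots,n\}$: start with the empty graph $G_0$ on $[n]$. In each round $t=1,2,\dots$, a vertex $u_t$ is chosen independently and uniformly at random from $[n]$; a strategy then chooses a vertex $v_t\in[n]\setminus\{u_t\}$ (deterministically or according to a distribution), where the choice may depend on $u_1,v_1,\dots,u_{t-1},v_{t-1},u_t$; the edge $u_tv_t$ is added, giving the multigraph $G_t$. A strategy $\mathcal S$ specifies these choices for every $n$. For an increasing graph property $\mathcal P$, a strategy $\mathcal S$ and $0<q<1$, let $m_{\mathcal P}(\mathcal S,q,n)$ be the minimum $t\ge 0$ with $\mathbb P[G_t\in\mathcal P]\ge q$ (or $\infty$ if none), let $m_{\mathcal P}(q,n)=\inf_{\mathcal S} m_{\mathcal P}(\mathcal S,q,n)$, and define $C_{\mathcal P}=\lim_{q\to 1^- }\limsup_{n\to\infty} m_{\mathcal P}(q,n)/n$. -}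

module Defs where

open import Data.Nat using (ℕ; zero; suc; _∸_; _^_; _≥_)
open import Data.Integer using (+_)
open import Data.Rational using (ℚ; _/_; _*_; _+_; _≤_)
open import Data.Fin using (Fin; toℕ)
open import Data.Fin.Permutation using (Permutation′; _⟨$⟩ʳ_)
open import Data.Product using (Σ; ∃; _×_; _,_; proj₁)
open import Data.Sum using (_⊎_)
open import Data.List using (List; []; _∷_; _++_; [_]; length)
open import Data.List.Membership.Propositional using (_∈_)
open import Data.List.Relation.Unary.All using (All)
open import Data.List.Relation.Unary.Unique.Propositional using (Unique)
open import Data.Vec using (Vec)
import Data.Vec as V
open import Relation.Binary.PropositionalEquality using (_≡_; _≢_)

toℚ : ℕ → ℚ
toℚ k = + k / 1

-- A multigraph on [n] = Fin n, given as the list of its edges (in order of addition).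
Edge : ℕ → Set
Edge n = Fin n × Fin n

EdgeList : ℕ → Set
EdgeList n = List (Edge n)

Adjacent : ∀ {n} → EdgeList n → Fin n → Fin n → Set
Adjacent E a b = ((a , b) ∈ E) ⊎ ((b , a) ∈ E)

CycSucc : ∀ {n} → Fin n → Fin n → Set
CycSucc {n} i j = (toℕ j ≡ suc (toℕ i)) ⊎ ((toℕ i ≡ n ∸ 1) × (toℕ j ≡ 0))

IsHamiltonian : ∀ {n} → EdgeList n → Set
IsHamiltonian {n} E =
  (n ≥ 3) × Σ (Permutation′ n) (λ σ →
    ∀ (i j : Fin n) → CycSucc i j → Adjacent E (σ ⟨$⟩ʳ i) (σ ⟨$⟩ʳ j))

-- A (deterministic) strategy: given the history (u₁,v₁),...,(u_{t-1},v_{t-1})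
-- and the current random vertex u_t, choose v_t ≠ u_t.
Strategy : ℕ → Set
Strategy n = EdgeList n → (u : Fin n) → Σ (Fin n) (λ v → v ≢ u)

runFrom : ∀ {n} → Strategy n → EdgeList n → List (Fin n) → EdgeList n
runFrom S hist []       = hist
runFrom S hist (u ∷ us) = runFrom S (hist ++ [ (u , proj₁ (S hist u)) ]) us

run : ∀ {n t} → Strategy n → Vec (Fin n) t → EdgeList n
run S us = runFrom S [] (V.toList us)

-- P[G_t ∈ HAM] ≥ q, where (u₁,...,u_t) is uniform on [n]^t:
-- at least q · n^t distinct sequences yield a Hamiltonian G_t.
HamProbAtLeast : ∀ {n} → Strategy n → ℚ → ℕ → Set
HamProbAtLeast {n} S q t =
  Σ (List (Vec (Fin n) t)) (λ L →
    Unique L × All (λ us → IsHamiltonian (run S us)) L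
      × (q * toℚ (n ^ t) ≤ toℚ (length L)))

MHamAtMost : ℚ → ℕ → ℚ → Set
MHamAtMost q n x = Σ ℕ (λ t → (toℚ t ≤ x) × Σ (Strategy n) (λ S → HamProbAtLeast S q t))

CHamAtMost : ℚ → Set
CHamAtMost c =
  ∀ (q : ℚ) → Data.Rational._<_ (toℚ 0) q → Data.Rational._<_ q (toℚ 1) →
  ∀ (ε : ℚ) → Data.Rational._<_ (toℚ 0) ε →
  ∃ λ (N : ℕ) → ∀ (n : ℕ) → n ≥ N → MHamAtMost q n ((c + ε) * toℚ n)

{-# OPTIONS --safe #-}
-- The strategy first grows disjoint paths, the segments: a vertex outside all segments is joined to another such
-- vertex, and so is the end of a short segment. It then merges the segments into one main path. When the end of a
-- segment comes up, the segment is appended to the main path. When an inner vertex r of the main path comes up, it is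
-- joined to the head of a segment; if later a neighbour x of r comes up, it is joined to the tail of that segment,
-- and the main path makes a detour through the segment in place of the edge x r. The targets are chosen so that the
-- segments always have d or d + 1 such vertices each. Finally the same device closes a Hamiltonian path to a cycle.
--
-- The number of components serves as the clock. In terms of it, the number of single vertices, the number of waiting
-- vertices r, the total size of the segments and the time still needed are bounded by piecewise linear functions,
-- obtained by solving the differential equations of the process numerically. The bounds are chosen so that
-- each of the four quantities has no drift across its bound; the squared excess therefore grows by at most a constant
-- per step, and an excess linear in n has probability O(1/n). When only few components are left, Markov's
-- inequality for an explicit bound on the expected remaining time suffices. The total time is about 1.8135 n.
module Submission where

open import Defs
open import Data.Empty using (⊥; ⊥-elim)
open import Data.Fin as Fin using (Fin; zero; suc; toℕ)
open import Data.Fin.Permutation using (permutation)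
import Data.Fin.Properties as Finₚ
open import Data.Integer as ℤ using (ℤ; +_; -[1+_]; ∣_∣; 0ℤ; -_; _+_; _*_; _-_; _≤_; _<_)
import Data.Integer.Properties as ℤₚ
import Data.Integer.Tactic.RingSolver as ℤS
open import Data.List as List using (List; []; _∷_; _++_; [_]; length; map; concatMap; reverse; lookup; foldl)
import Data.List.Properties as Listₚ
open import Data.List.Membership.Propositional using (_∈_)
import Data.List.Membership.Propositional.Properties as ∈ₚ
open import Data.List.Relation.Binary.Permutation.Propositional as ↭ using (_↭_)
import Data.List.Relation.Binary.Permutation.Propositional.Properties as ↭ₚ
open import Data.List.Relation.Unary.All as All using (All; []; _∷_)
import Data.List.Relation.Unary.All.Properties as Allₚ
import Data.List.Relation.Unary.AllPairs as AllPairs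
open import Data.List.Relation.Unary.Any using (here; there)
open import Data.List.Relation.Unary.Unique.Propositional using (Unique)
import Data.List.Relation.Unary.Unique.Propositional.Properties as Uniqueₚ
open import Data.Maybe using (Maybe; just; nothing; maybe′)
open import Data.Nat as ℕ using (ℕ; zero; suc; z≤n; s≤s; _^_)
import Data.Nat.DivMod as ℕd
import Data.Nat.Properties as ℕₚ
import Data.Nat.Tactic.RingSolver as ℕS
open import Data.Product using (Σ; ∃; _×_; _,_; proj₁; proj₂)
open import Data.Rational as ℚ using (ℚ; _/_; mkℚ; ↧ₙ_)
import Data.Rational.Properties as ℚₚ
import Data.Rational.Unnormalised as ℚᵘ
import Data.Rational.Unnormalised.Properties as ℚᵘₚ
open import Data.Sum using (_⊎_; inj₁; inj₂)
open import Data.Unit using (⊤; tt)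
open import Data.Vec as Vec using (Vec; []; _∷_)
open import Function using (_∘_)
open import Relation.Binary.PropositionalEquality hiding ([_])
open import Relation.Nullary using (Dec; yes; no; ¬_)
open import Relation.Nullary.Decidable using (_×-dec_; _⊎-dec_; toWitness)

-- Probabilities are counts of sequences, so every estimate is an inequality between integers; the
-- differential equations only suggest the slopes of the table, and what is proved is a finite
-- system of inequalities at its breakpoints. One-sided bounds are enough because the drift of a
-- quantity is needed at most where it exceeds its own bound, with the others within `b` of theirs;
-- the four squared excesses form one sum `W`. The obstacle is the end of the merging. With c
-- segments of degree d left, a removal takes of the order of n / ((d + 1) c) steps, so degrees must
-- grow, but blocks cost time too; the cap `D c`, about the square root of n / c, balances the two.
-- It is unbounded as c / n tends to 0, and so are the increments. The second moment argument
-- therefore stops at a density `ce` that depends on the denominator of q; the expected time left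
-- there is so small a part of n that Markov's inequality suffices. All bounds are multiplied by S =
-- 1000 and measured in units of H, about n / 10000000, so that one integer table serves every large
-- n.

-- Finite sums and concatenations over the choices of the random vertex.

∑ : ∀ {n} → (Fin n → ℕ) → ℕ
∑ {zero}  f = 0
∑ {suc n} f = f zero ℕ.+ ∑ (f ∘ suc)

∑-mono : ∀ {n} {f g : Fin n → ℕ} → (∀ u → f u ℕ.≤ g u) → ∑ f ℕ.≤ ∑ g
∑-mono {zero}  h = z≤n
∑-mono {suc n} h = ℕₚ.+-mono-≤ (h zero) (∑-mono (h ∘ suc))

∑-const : ∀ {n} c → ∑ {n} (λ _ → c) ≡ n ℕ.* c
∑-const {zero}  c = refl
∑-const {suc n} c = cong (c ℕ.+_) (∑-const {n} c)

∑-+ : ∀ {n} (f g : Fin n → ℕ) → ∑ (λ u → f u ℕ.+ g u) ≡ ∑ f ℕ.+ ∑ g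
∑-+ {zero}  f g = refl
∑-+ {suc n} f g rewrite ∑-+ (f ∘ suc) (g ∘ suc) =
  ℕ-interchange (f zero) (g zero) (∑ (f ∘ suc)) (∑ (g ∘ suc))
  where
  open import Algebra.Properties.CommutativeSemigroup ℕₚ.+-commutativeSemigroup
    using () renaming (interchange to ℕ-interchange)

∑-*ʳ : ∀ {n} (f : Fin n → ℕ) c → ∑ (λ u → f u ℕ.* c) ≡ ∑ f ℕ.* c
∑-*ʳ {zero}  f c = refl
∑-*ʳ {suc n} f c rewrite ∑-*ʳ (f ∘ suc) c = sym (ℕₚ.*-distribʳ-+ c (f zero) (∑ (f ∘ suc)))

∑-*ˡ : ∀ {n} (f : Fin n → ℕ) c → ∑ (λ u → c ℕ.* f u) ≡ c ℕ.* ∑ f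
∑-*ˡ {zero}  f c = sym (ℕₚ.*-zeroʳ c)
∑-*ˡ {suc n} f c rewrite ∑-*ˡ (f ∘ suc) c = sym (ℕₚ.*-distribˡ-+ c (f zero) (∑ (f ∘ suc)))

concatF : ∀ {a} {A : Set a} {n} → (Fin n → List A) → List A
concatF {n = zero}  f = []
concatF {n = suc n} f = f zero ++ concatF (f ∘ suc)

length-concatF : ∀ {a} {A : Set a} {n} (f : Fin n → List A) → length (concatF f) ≡ ∑ (length ∘ f)
length-concatF {n = zero}  f = refl
length-concatF {n = suc n} f = trans (Listₚ.length-++ (f zero)) (cong (length (f zero) ℕ.+_) (length-concatF (f ∘ suc)))

∈-concatF : ∀ {a} {A : Set a} {n} (f : Fin n → List A) {x} → x ∈ concatF f → ∃ λ u → x ∈ f u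
∈-concatF {n = suc n} f x∈ with ∈ₚ.∈-++⁻ (f zero) x∈
... | inj₁ p = zero , p
... | inj₂ p with ∈-concatF (f ∘ suc) p
... | u , q = suc u , q

All-concatF : ∀ {a p} {A : Set a} {P : A → Set p} {n} (f : Fin n → List A) →
              (∀ u → All P (f u)) → All P (concatF f)
All-concatF {n = zero}  f h = []
All-concatF {n = suc n} f h = Allₚ.++⁺ (h zero) (All-concatF (f ∘ suc) (h ∘ suc))

Unique-concatF : ∀ {a} {A : Set a} {n} (f : Fin n → List A) → (∀ u → Unique (f u)) →
                 (∀ u v x → x ∈ f u → x ∈ f v → u ≡ v) → Unique (concatF f)
Unique-concatF {n = zero}  f h d = AllPairs.[]
Unique-concatF {n = suc n} f h d =
  Uniqueₚ.++⁺ (h zero) (Unique-concatF (f ∘ suc) (h ∘ suc) (λ u v x p q → Finₚ.suc-injective (d (suc u) (suc v) x p q)))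
    λ { {x} (p , q) → disj x p (∈-concatF (f ∘ suc) q) }
  where
  disj : ∀ x → x ∈ f zero → (∃ λ u → x ∈ f (suc u)) → ⊥
  disj x p (u , q) with d zero (suc u) x p q
  ... | ()

-- Counting unfinished runs, and strategies that follow a state.

module Chain {n : ℕ} {St : Set} (step : St → Fin n → St) (alive : St → ℕ) where

  -- Of the n ^ k continuations of s, those that leave the game unfinished; divided by n ^ k this is
  -- the probability of failure.
  cnt : ℕ → St → ℕ
  cnt zero    s = alive s
  cnt (suc k) s = ∑ (λ u → cnt k (step s u))

  cnt≤ : (∀ s → alive s ℕ.≤ 1) → ∀ k s → cnt k s ℕ.≤ n ^ k
  cnt≤ a zero    s = a s
  cnt≤ a (suc k) s = ℕₚ.≤-trans (∑-mono (λ u → cnt≤ a k (step s u))) (ℕₚ.≤-reflexive (∑-const {n} (n ^ k)))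

  steps : St → List (Fin n) → St
  steps = foldl step

  goods₀ : ℕ → List (Vec (Fin n) 0)
  goods₀ zero    = [ [] ]
  goods₀ (suc _) = []

  -- The successes are listed and not only counted, because `HamProbAtLeast` asks for a list without
  -- repetitions.
  goods : ∀ k → St → List (Vec (Fin n) k)
  goods zero    s = goods₀ (alive s)
  goods (suc k) s = concatF (λ u → map (u ∷_) (goods k (step s u)))

  goods-length : (∀ s → alive s ℕ.≤ 1) → ∀ k s → length (goods k s) ℕ.+ cnt k s ≡ n ^ k
  goods-length a zero s with alive s | a s
  ... | zero        | _ = refl
  ... | suc zero    | _ = refl
  ... | suc (suc _) | s≤s ()
  goods-length a (suc k) s = begin
    length (concatF f) ℕ.+ cnt (suc k) s                       ≡⟨ cong (ℕ._+ cnt (suc k) s) (length-concatF f) ⟩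
    ∑ (length ∘ f) ℕ.+ ∑ (λ u → cnt k (step s u))              ≡⟨ sym (∑-+ (length ∘ f) _) ⟩
    ∑ (λ u → length (f u) ℕ.+ cnt k (step s u))                ≡⟨ ∑-cong (λ u → trans (cong (ℕ._+ cnt k (step s u)) (Listₚ.length-map (u ∷_) (goods k (step s u)))) (goods-length a k (step s u))) ⟩
    ∑ {n} (λ u → n ^ k)                                        ≡⟨ ∑-const {n} (n ^ k) ⟩
    n ^ suc k ∎
    where
    open ≡-Reasoning
    f : Fin n → List (Vec (Fin n) (suc k))
    f u = map (u ∷_) (goods k (step s u))
    ∑-cong : ∀ {m} {g h : Fin m → ℕ} → (∀ u → g u ≡ h u) → ∑ g ≡ ∑ h
    ∑-cong {zero}  e = refl
    ∑-cong {suc m} e = cong₂ ℕ._+_ (e zero) (∑-cong (e ∘ suc))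

  goods-unique : ∀ k s → Unique (goods k s)
  goods-unique zero s with alive s
  ... | zero  = [] AllPairs.∷ AllPairs.[]
  ... | suc _ = AllPairs.[]
  goods-unique (suc k) s = Unique-concatF _
    (λ u → Uniqueₚ.map⁺ (λ { refl → refl }) (goods-unique k (step s u)))
    (λ u v x p q → same u v x (∈ₚ.∈-map⁻ (u ∷_) p) (∈ₚ.∈-map⁻ (v ∷_) q))
    where
    same : ∀ u v (x : Vec (Fin n) (suc k)) {xs ys : List (Vec (Fin n) k)} →
           (∃ λ y → y ∈ xs × x ≡ u ∷ y) → (∃ λ y → y ∈ ys × x ≡ v ∷ y) → u ≡ v
    same u v x (_ , _ , refl) (_ , _ , refl) = refl

  goods-dead : ∀ k s → All (λ us → alive (steps s (Vec.toList us)) ≡ 0) (goods k s)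
  goods-dead zero s with alive s in eq
  ... | zero  = eq ∷ []
  ... | suc _ = []
  goods-dead (suc k) s = All-concatF _ (λ u → Allₚ.map⁺ (goods-dead k (step s u)))

-- As q < 1, its numerator is at most its denominator minus one, so failures that make up at most
-- one part in `↧ₙ q` leave enough successes. Only the denominator of q enters the rest of the
-- proof.
toℚ-count : ∀ (q : ℚ) → q ℚ.< toℚ 1 → ∀ m g c → g ℕ.+ c ≡ m → c ℕ.* ↧ₙ q ℕ.≤ m → q ℚ.* toℚ m ℚ.≤ toℚ g
toℚ-count q@(mkℚ p d-1 _) q<1 m g c e h = ℚₚ.toℚᵘ-cancel-≤ (begin
    ℚ.toℚᵘ (q ℚ.* toℚ m)                    ≃⟨ ℚₚ.toℚᵘ-homo-* q (toℚ m) ⟩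
    ℚ.toℚᵘ q ℚᵘ.* ℚ.toℚᵘ (toℚ m)            ≃⟨ ℚᵘₚ.*-congˡ {ℚ.toℚᵘ q} (ℚₚ.toℚᵘ-fromℚᵘ (ℚᵘ.mkℚᵘ (+ m) 0)) ⟩
    ℚ.toℚᵘ q ℚᵘ.* ℚᵘ.mkℚᵘ (+ m) 0           ≤⟨ ℚᵘ.*≤* ineq ⟩
    ℚᵘ.mkℚᵘ (+ g) 0                         ≃⟨ ℚᵘₚ.≃-sym (ℚₚ.toℚᵘ-fromℚᵘ (ℚᵘ.mkℚᵘ (+ g) 0)) ⟩
    ℚ.toℚᵘ (toℚ g) ∎)
  where
  open ℚᵘₚ.≤-Reasoning
  d : ℕ
  d = suc d-1
  p<d : p < + d
  p<d = subst₂ ℤ._<_ (ℤₚ.*-identityʳ p) (ℤₚ.*-identityˡ (+ d)) (ℚᵘₚ.drop-*<* (ℚₚ.toℚᵘ-mono-< q<1))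
  core : p * + m ≤ + (g ℕ.* d)
  core = ℤₚ.≤-trans (ℤₚ.*-monoʳ-≤-nonNeg (+ m) (ℤₚ.i<j⇒i≤pred[j] p<d))
           (subst (ℤ._≤ + (g ℕ.* d)) (ℤₚ.pos-* d-1 m) (ℤ.+≤+ nat))
    where
    nat : d-1 ℕ.* m ℕ.≤ g ℕ.* d
    nat = ℕₚ.+-cancelˡ-≤ m (d-1 ℕ.* m) (g ℕ.* d) (ℕₚ.≤-trans
      (ℕₚ.≤-reflexive (trans (ℕₚ.*-comm d m) (trans (cong (ℕ._* d) (sym e)) (ℕₚ.*-distribʳ-+ d g c))))
      (ℕₚ.≤-trans (ℕₚ.+-monoʳ-≤ (g ℕ.* d) h) (ℕₚ.≤-reflexive (ℕₚ.+-comm (g ℕ.* d) m))))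
  ineq : (p * + m) * (+ 1) ≤ + g * + (d ℕ.* 1)
  ineq = subst₂ ℤ._≤_ (sym (ℤₚ.*-identityʳ (p * + m)))
           (trans (ℤₚ.pos-* g d) (cong (λ z → + g * + z) (sym (ℕₚ.*-identityʳ d)))) core

module Strat {n : ℕ} {St : Set} (step : St → Fin n → St) (alive : St → ℕ) (alive≤1 : ∀ s → alive s ℕ.≤ 1)
  (init : St) (choose : St → (u : Fin n) → Σ (Fin n) (λ v → v ≢ u))
  (Inv : EdgeList n → St → Set) (inv₀ : Inv [] init)
  (invₛ : ∀ E s u → Inv E s → Inv (E ++ [ (u , proj₁ (choose s u)) ]) (step s u))
  (fin : ∀ E s → Inv E s → alive s ≡ 0 → IsHamiltonian E) where

  open Chain step alive

  -- A strategy sees only the edges played. The state can be recovered from them because `step` uses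
  -- the random vertices alone, not the answers.
  replay : EdgeList n → St
  replay = foldl (λ s e → step s (proj₁ e)) init

  strategy : Strategy n
  strategy E u = choose (replay E) u

  replay-snoc : ∀ E u v → replay (E ++ [ (u , v) ]) ≡ step (replay E) u
  replay-snoc E u v = Listₚ.foldl-++ _ init E [ (u , v) ]

  run-inv : ∀ E us → Inv E (replay E) → Inv (runFrom strategy E us) (steps (replay E) us)
  run-inv E []       i = i
  run-inv E (u ∷ us) i = subst (λ s → Inv (runFrom strategy E′ us) (steps s us)) (replay-snoc E u _)
    (run-inv E′ us (subst (Inv E′) (sym (replay-snoc E u _)) (invₛ E (replay E) u i)))
    where E′ = E ++ [ (u , proj₁ (choose (replay E) u)) ]

  hamProb : ∀ q → q ℚ.< toℚ 1 → ∀ t → cnt t init ℕ.* ↧ₙ q ℕ.≤ n ^ t → HamProbAtLeast strategy q t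
  hamProb q q<1 t h = goods t init , goods-unique t init ,
    All.map (λ {us} e → fin _ _ (run-inv [] (Vec.toList us) inv₀) e) (goods-dead t init) ,
    toℚ-count q q<1 (n ^ t) (length (goods t init)) (cnt t init) (goods-length alive≤1 t init) h

-- Drifts as sums over moves, and the second moment of an excess.

∑ℤ : ∀ {n} → (Fin n → ℤ) → ℤ
∑ℤ {zero}  f = 0ℤ
∑ℤ {suc n} f = f zero + ∑ℤ (f ∘ suc)

∑ℤ-cong : ∀ {n} {f g : Fin n → ℤ} → (∀ u → f u ≡ g u) → ∑ℤ f ≡ ∑ℤ g
∑ℤ-cong {zero}  e = refl
∑ℤ-cong {suc n} e = cong₂ ℤ._+_ (e zero) (∑ℤ-cong (e ∘ suc))

∑ℤ-+ : ∀ {n} (f g : Fin n → ℤ) → ∑ℤ (λ u → f u + g u) ≡ ∑ℤ f + ∑ℤ g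
∑ℤ-+ {zero}  f g = refl
∑ℤ-+ {suc n} f g rewrite ∑ℤ-+ (f ∘ suc) (g ∘ suc) = inter (f zero) (g zero) (∑ℤ (f ∘ suc)) (∑ℤ (g ∘ suc))
  where
  inter : ∀ a b c d → (a + b) + (c + d) ≡ (a + c) + (b + d)
  inter = ℤS.solve-∀

∑ℤ-const : ∀ {n} c → ∑ℤ {n} (λ _ → c) ≡ + n * c
∑ℤ-const {zero}  c = sym (ℤₚ.*-zeroˡ c)
∑ℤ-const {suc n} c rewrite ∑ℤ-const {n} c = sym (one (+ n) c)
  where
  one : ∀ z c → (+ 1 + z) * c ≡ c + z * c
  one = ℤS.solve-∀

∑ℤ-0 : ∀ {n} → ∑ℤ {n} (λ _ → 0ℤ) ≡ 0ℤ
∑ℤ-0 {n} = trans (∑ℤ-const {n} 0ℤ) (ℤₚ.*-zeroʳ (+ n))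

⟦_≟_⟧ : ∀ {n} → Fin n → Fin n → ℕ
⟦ u ≟ v ⟧ with u Fin.≟ v
... | yes _ = 1
... | no  _ = 0

-- Vertex sets are handled through multiplicities: value 1 at every vertex says at once that nothing
-- is missed and nothing repeated, and multiplicities add up under concatenation.
occ : ∀ {n} → Fin n → List (Fin n) → ℕ
occ u []       = 0
occ u (v ∷ vs) = ⟦ u ≟ v ⟧ ℕ.+ occ u vs

⟦≟⟧-refl : ∀ {n} (u : Fin n) → ⟦ u ≟ u ⟧ ≡ 1
⟦≟⟧-refl u with u Fin.≟ u
... | yes _ = refl
... | no ¬p = ⊥-elim (¬p refl)

⟦≟⟧-suc : ∀ {n} (u v : Fin n) → ⟦ suc u ≟ suc v ⟧ ≡ ⟦ u ≟ v ⟧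
⟦≟⟧-suc u v with u Fin.≟ v
... | yes refl = refl
... | no _     = refl

∑ℤ-indicator : ∀ {n} (k : Fin n) c → ∑ℤ (λ u → + ⟦ u ≟ k ⟧ * c) ≡ c
∑ℤ-indicator {suc n} zero c = trans (cong₂ ℤ._+_ (ℤₚ.*-identityˡ c)
  (trans (∑ℤ-cong {n} (λ u → ℤₚ.*-zeroˡ c)) (∑ℤ-0 {n}))) (ℤₚ.+-identityʳ c)
∑ℤ-indicator {suc n} (suc k) c = trans (cong₂ ℤ._+_ (ℤₚ.*-zeroˡ c)
  (trans (∑ℤ-cong (λ u → cong (λ z → + z * c) (⟦≟⟧-suc u k))) (∑ℤ-indicator k c))) (ℤₚ.+-identityˡ c)

∑-indicator : ∀ {n} (k : Fin n) → ∑ (λ u → ⟦ u ≟ k ⟧) ≡ 1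
∑-indicator {suc n} zero = cong suc (trans (∑-const {n} 0) (ℕₚ.*-zeroʳ n))
∑-indicator {suc n} (suc k) = trans (∑-cong′ (λ u → ⟦≟⟧-suc u k)) (∑-indicator k)
  where
  ∑-cong′ : ∀ {m} {g h : Fin m → ℕ} → (∀ u → g u ≡ h u) → ∑ g ≡ ∑ h
  ∑-cong′ {zero}  e = refl
  ∑-cong′ {suc m} e = cong₂ ℕ._+_ (e zero) (∑-cong′ (e ∘ suc))

find : ∀ {n} {A : Set} → Fin n → List (Fin n × A) → Maybe A
find u []             = nothing
find u ((k , a) ∷ xs) with u Fin.≟ k
... | yes _ = just a
... | no  _ = find u xs

sumℤ : List ℤ → ℤ
sumℤ []       = 0ℤ
sumℤ (x ∷ xs) = x + sumℤ xs

sumℤ-++ : ∀ xs ys → sumℤ (xs ++ ys) ≡ sumℤ xs + sumℤ ys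
sumℤ-++ []       ys = sym (ℤₚ.+-identityˡ _)
sumℤ-++ (x ∷ xs) ys rewrite sumℤ-++ xs ys = sym (ℤₚ.+-assoc x (sumℤ xs) (sumℤ ys))

find-occ0 : ∀ {n} {A : Set} (u : Fin n) (L : List (Fin n × A)) → occ u (map proj₁ L) ≡ 0 → find u L ≡ nothing
find-occ0 u [] e = refl
find-occ0 u ((k , a) ∷ L) e with u Fin.≟ k
find-occ0 u ((k , a) ∷ L) () | yes _
... | no _ = find-occ0 u L e

-- If every vertex triggers at most one move, no entry of the list is shadowed by an earlier one.
-- Drifts, which are sums over the random vertex, thereby become sums over the list of moves.
∑ℤ-find : ∀ {n} {A : Set} (δ : A → ℤ) (L : List (Fin n × A)) → (∀ u → occ u (map proj₁ L) ℕ.≤ 1) →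
          ∑ℤ (λ u → maybe′ δ 0ℤ (find u L)) ≡ sumℤ (map (δ ∘ proj₂) L)
∑ℤ-find {n} δ [] h = ∑ℤ-0 {n}
∑ℤ-find {n} δ ((k , a) ∷ L) h = begin
  ∑ℤ (λ u → maybe′ δ 0ℤ (find u ((k , a) ∷ L)))                            ≡⟨ ∑ℤ-cong split ⟩
  ∑ℤ (λ u → + ⟦ u ≟ k ⟧ * δ a + maybe′ δ 0ℤ (find u L))                 ≡⟨ ∑ℤ-+ {n} _ _ ⟩
  ∑ℤ (λ u → + ⟦ u ≟ k ⟧ * δ a) + ∑ℤ (λ u → maybe′ δ 0ℤ (find u L))      ≡⟨ cong₂ ℤ._+_ (∑ℤ-indicator k (δ a))
                                                                               (∑ℤ-find δ L (λ u → ℕₚ.≤-trans (ℕₚ.m≤n+m _ _) (h u))) ⟩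
  δ a + sumℤ (map (δ ∘ proj₂) L) ∎
  where
  open ≡-Reasoning
  split : ∀ u → maybe′ δ 0ℤ (find u ((k , a) ∷ L)) ≡ + ⟦ u ≟ k ⟧ * δ a + maybe′ δ 0ℤ (find u L)
  split u with u Fin.≟ k | h u
  ... | no _ | _ = sym (trans (cong (ℤ._+ maybe′ δ 0ℤ (find u L)) (ℤₚ.*-zeroˡ (δ a))) (ℤₚ.+-identityˡ _))
  ... | yes refl | s≤s le = sym (trans (cong₂ ℤ._+_ (ℤₚ.*-identityˡ (δ a))
          (cong (maybe′ δ 0ℤ) (find-occ0 u L (ℕₚ.n≤0⇒n≡0 le)))) (ℤₚ.+-identityʳ (δ a)))

sq⁺ : ℤ → ℕ
sq⁺ (+ x)    = x ℕ.* x
sq⁺ -[1+ _ ] = 0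

sq⁺-mono : ∀ {X Y} → X ≤ Y → sq⁺ X ℕ.≤ sq⁺ Y
sq⁺-mono (ℤ.-≤- _)     = z≤n
sq⁺-mono ℤ.-≤+         = z≤n
sq⁺-mono (ℤ.+≤+ le)    = ℕₚ.*-mono-≤ le le

sq⁺≤ : ∀ X → + sq⁺ X ≤ X * X
sq⁺≤ (+ x)      = ℤₚ.≤-reflexive (ℤₚ.pos-* x x)
sq⁺≤ (-[1+ x ]) = ℤ.+≤+ z≤n

square-∣∣ : ∀ D → D * D ≡ + (∣ D ∣ ℕ.* ∣ D ∣)
square-∣∣ (+ x)    = sym (ℤₚ.pos-* x x)
square-∣∣ -[1+ x ] = refl

i≤+∣i∣ : ∀ i → i ≤ + ∣ i ∣
i≤+∣i∣ (+ x)    = ℤₚ.≤-refl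
i≤+∣i∣ -[1+ x ] = ℤ.-≤+

∑sq : ∀ {m} (Y : Fin m → ℕ) (D : Fin m → ℤ) x B → (∀ u → Y u ℕ.≤ sq⁺ (+ x + D u)) → (∀ u → ∣ D u ∣ ℕ.≤ B) →
      + ∑ Y ≤ + (m ℕ.* (x ℕ.* x ℕ.+ B ℕ.* B)) + (+ (x ℕ.+ x)) * ∑ℤ D
∑sq {zero} Y D x B h b = ℤₚ.≤-reflexive (sym (trans (ℤₚ.+-identityˡ _) (ℤₚ.*-zeroʳ (+ (x ℕ.+ x)))))
∑sq {suc m} Y D x B h b = begin
  + (Y zero) + + ∑ (Y ∘ suc)
    ≤⟨ ℤₚ.+-mono-≤ first (∑sq (Y ∘ suc) (D ∘ suc) x B (h ∘ suc) (b ∘ suc)) ⟩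
  (+ (x ℕ.* x ℕ.+ B ℕ.* B) + + (x ℕ.+ x) * D zero) + (+ (m ℕ.* (x ℕ.* x ℕ.+ B ℕ.* B)) + + (x ℕ.+ x) * ∑ℤ (D ∘ suc))
    ≡⟨ arr (+ (x ℕ.* x ℕ.+ B ℕ.* B)) (+ (x ℕ.+ x)) (D zero) (+ (m ℕ.* (x ℕ.* x ℕ.+ B ℕ.* B))) (∑ℤ (D ∘ suc)) ⟩
  + (suc m ℕ.* (x ℕ.* x ℕ.+ B ℕ.* B)) + + (x ℕ.+ x) * ∑ℤ D ∎
  where
  open ℤₚ.≤-Reasoning
  arr : ∀ a y d c s → (a + y * d) + (c + y * s) ≡ (a + c) + y * (d + s)
  arr = ℤS.solve-∀
  expand : ∀ z d → (z + d) * (z + d) ≡ (z * z + d * d) + (z + z) * d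
  expand = ℤS.solve-∀
  first : + Y zero ≤ + (x ℕ.* x ℕ.+ B ℕ.* B) + + (x ℕ.+ x) * D zero
  first = begin
    + Y zero                                 ≤⟨ ℤ.+≤+ (h zero) ⟩
    + sq⁺ (+ x + D zero)                   ≤⟨ sq⁺≤ (+ x + D zero) ⟩
    (+ x + D zero) * (+ x + D zero)    ≡⟨ expand (+ x) (D zero) ⟩
    (+ x * + x + D zero * D zero) + (+ x + + x) * D zero
      ≤⟨ ℤₚ.+-monoˡ-≤ _ (ℤₚ.+-mono-≤ (ℤₚ.≤-reflexive (sym (ℤₚ.pos-* x x)))
           (ℤₚ.≤-trans (ℤₚ.≤-reflexive (square-∣∣ (D zero))) (ℤ.+≤+ (ℕₚ.*-mono-≤ (b zero) (b zero))))) ⟩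
    + (x ℕ.* x ℕ.+ B ℕ.* B) + + (x ℕ.+ x) * D zero ∎

-- The positive part of a supermartingale with increments at most B gains at most B² in mean square per step;
-- the drift only matters where the process is nonnegative.
∑-sq⁺ : ∀ {n} (Y : Fin n → ℕ) (D : Fin n → ℤ) X B → (∀ u → Y u ℕ.≤ sq⁺ (X + D u)) → (∀ u → ∣ D u ∣ ℕ.≤ B) →
        (0ℤ ≤ X → ∑ℤ D ≤ 0ℤ) → ∑ Y ℕ.≤ n ℕ.* (sq⁺ X ℕ.+ B ℕ.* B)
∑-sq⁺ {n} Y D (+ x) B h b d = ℤₚ.drop‿+≤+ (ℤₚ.≤-trans (∑sq Y D x B h b)
  (ℤₚ.≤-trans (ℤₚ.+-monoʳ-≤ (+ (n ℕ.* (x ℕ.* x ℕ.+ B ℕ.* B)))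
     (ℤₚ.≤-trans (ℤₚ.*-monoˡ-≤-nonNeg (+ (x ℕ.+ x)) (d (ℤ.+≤+ z≤n))) (ℤₚ.≤-reflexive (ℤₚ.*-zeroʳ (+ (x ℕ.+ x))))))
     (ℤₚ.≤-reflexive (ℤₚ.+-identityʳ _))))
∑-sq⁺ {n} Y D X@(-[1+ y ]) B h b d = ℕₚ.≤-trans (∑-mono bound) (ℕₚ.≤-reflexive (∑-const {n} (B ℕ.* B)))
  where
  bound : ∀ u → Y u ℕ.≤ B ℕ.* B
  bound u = ℕₚ.≤-trans (h u) (sq⁺-mono {X + D u} {+ B} (ℤₚ.≤-trans (ℤₚ.+-monoˡ-≤ (D u) (ℤ.-≤+ {y} {0}))
    (ℤₚ.≤-trans (ℤₚ.≤-reflexive (ℤₚ.+-identityˡ (D u))) (ℤₚ.≤-trans (i≤+∣i∣ (D u)) (ℤ.+≤+ (b u))))))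

-- Failure bounds from a first and from a second moment.

module Hit {n : ℕ} {St : Set} (step : St → Fin n → St) (alive : St → ℕ) (alive≤1 : ∀ s → alive s ℕ.≤ 1)
  (P : St → Set) (stepP : ∀ s u → P s → P (step s u)) where

  open Chain step alive

  module Markov (Z : St → Set) (stepZ : ∀ s u → P s → Z s → Z (step s u)) (Φ : St → ℕ) (S : ℕ)
    (dead : ∀ s u → alive s ≡ 0 → step s u ≡ s)
    (drift : ∀ s → P s → Z s → alive s ≡ 1 → ∑ (λ u → Φ (step s u)) ℕ.+ n ℕ.* S ℕ.≤ n ℕ.* Φ s) where

    cnt-dead : ∀ k s → alive s ≡ 0 → cnt k s ≡ 0
    cnt-dead zero    s e = e
    cnt-dead (suc k) s e = trans (trans (∑-cong″ λ u → trans (cong (cnt k) (dead s u e)) (cnt-dead k s e)) (∑-const {n} 0)) (ℕₚ.*-zeroʳ n)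
      where
      ∑-cong″ : ∀ {m} {g h : Fin m → ℕ} → (∀ u → g u ≡ h u) → ∑ g ≡ ∑ h
      ∑-cong″ {zero}  e = refl
      ∑-cong″ {suc m} e = cong₂ ℕ._+_ (e zero) (∑-cong″ (e ∘ suc))

    -- The expected time to finish is at most Φ / S, and Markov's inequality bounds the chance of
    -- needing more than k steps. The induction does this without defining an expectation: a step
    -- either finds the game over or pays S out of Φ on average.
    markov : ∀ k s → P s → Z s → cnt k s ℕ.* (k ℕ.* S) ℕ.≤ n ^ k ℕ.* Φ s
    markov zero s p z = ℕₚ.≤-trans (ℕₚ.≤-reflexive (ℕₚ.*-zeroʳ (alive s))) z≤n
    markov (suc k) s p z with alive s in eq | alive≤1 s
    ... | zero | _ rewrite cnt-dead (suc k) s eq = z≤n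
    ... | suc (suc _) | s≤s ()
    -- The summand n ^ k (n S) is added to both sides so that the drift hypothesis applies without
    -- subtraction.
    ... | suc zero | _ = ℕₚ.+-cancelʳ-≤ (n ^ k ℕ.* (n ℕ.* S)) _ _ (begin
      cnt (suc k) s ℕ.* (suc k ℕ.* S) ℕ.+ n ^ k ℕ.* (n ℕ.* S)
        ≡⟨ cong (ℕ._+ n ^ k ℕ.* (n ℕ.* S)) (ℕₚ.*-distribˡ-+ (cnt (suc k) s) S (k ℕ.* S)) ⟩
      cnt (suc k) s ℕ.* S ℕ.+ cnt (suc k) s ℕ.* (k ℕ.* S) ℕ.+ n ^ k ℕ.* (n ℕ.* S)
        ≤⟨ ℕₚ.+-monoˡ-≤ (n ^ k ℕ.* (n ℕ.* S)) (ℕₚ.+-mono-≤ (ℕₚ.*-monoˡ-≤ S (cnt≤ alive≤1 (suc k) s)) rest) ⟩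
      n ^ suc k ℕ.* S ℕ.+ n ^ k ℕ.* ∑ (λ u → Φ (step s u)) ℕ.+ n ^ k ℕ.* (n ℕ.* S)
        ≡⟨ arr n (n ^ k) S (∑ (λ u → Φ (step s u))) ⟩
      n ^ k ℕ.* (n ℕ.* S) ℕ.+ n ^ k ℕ.* (∑ (λ u → Φ (step s u)) ℕ.+ n ℕ.* S)
        ≤⟨ ℕₚ.+-monoʳ-≤ (n ^ k ℕ.* (n ℕ.* S)) (ℕₚ.*-monoʳ-≤ (n ^ k) (drift s p z eq)) ⟩
      n ^ k ℕ.* (n ℕ.* S) ℕ.+ n ^ k ℕ.* (n ℕ.* Φ s)
        ≡⟨ arr₂ n (n ^ k) S (Φ s) ⟩
      n ^ suc k ℕ.* Φ s ℕ.+ n ^ k ℕ.* (n ℕ.* S) ∎)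
      where
      open ℕₚ.≤-Reasoning
      arr : ∀ a b c d → a ℕ.* b ℕ.* c ℕ.+ b ℕ.* d ℕ.+ b ℕ.* (a ℕ.* c) ≡ b ℕ.* (a ℕ.* c) ℕ.+ b ℕ.* (d ℕ.+ a ℕ.* c)
      arr = ℕS.solve-∀
      arr₂ : ∀ a b c d → b ℕ.* (a ℕ.* c) ℕ.+ b ℕ.* (a ℕ.* d) ≡ a ℕ.* b ℕ.* d ℕ.+ b ℕ.* (a ℕ.* c)
      arr₂ = ℕS.solve-∀
      rest : cnt (suc k) s ℕ.* (k ℕ.* S) ℕ.≤ n ^ k ℕ.* ∑ (λ u → Φ (step s u))
      rest = ℕₚ.≤-trans (ℕₚ.≤-reflexive (sym (∑-*ʳ (λ u → cnt k (step s u)) (k ℕ.* S))))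
        (ℕₚ.≤-trans (∑-mono (λ u → markov k (step s u) (stepP s u p) (stepZ s u p z)))
          (ℕₚ.≤-reflexive (∑-*ˡ (λ u → Φ (step s u)) (n ^ k))))

  module Super (W : St → ℕ → ℕ) (R C E : ℕ) (big : St → Set) (big? : ∀ s → Dec (big s))
    (W₀ : ∀ s → P s → big s → R ℕ.≤ W s 0)
    (Wₛ : ∀ s k → P s → big s → W s (suc k) ℕ.< R → ∑ (λ u → W (step s u) k) ℕ.≤ n ℕ.* (W s (suc k) ℕ.+ C))
    (small : ∀ s k → P s → ¬ big s → W s k ℕ.< R → cnt k s ℕ.* R ℕ.≤ n ^ k ℕ.* E) where

    -- W grows by at most C per step on average, until one of two things happens: W reaches R, where
    -- the trivial bound n ^ k is already good enough, or the state is no longer `big`, where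
    -- `small` takes over at cost E. Running out of time while `big` falls under the first case by
    -- `W₀`.
    super : ∀ k s → P s → cnt k s ℕ.* R ℕ.≤ n ^ k ℕ.* (W s k ℕ.+ C ℕ.* k ℕ.+ E)
    super k s p with R ℕ.≤? W s k
    ... | yes R≤ = ℕₚ.*-mono-≤ (cnt≤ alive≤1 k s) (ℕₚ.≤-trans R≤ (ℕₚ.≤-trans (ℕₚ.m≤m+n _ (C ℕ.* k)) (ℕₚ.m≤m+n _ E)))
    ... | no R≰ with big? s
    ... | no ¬b = ℕₚ.≤-trans (small s k p ¬b (ℕₚ.≰⇒> R≰)) (ℕₚ.*-monoʳ-≤ (n ^ k) (ℕₚ.m≤n+m E _))
    super zero s p | no R≰ | yes b = ⊥-elim (R≰ (W₀ s p b))
    super (suc k) s p | no R≰ | yes b = begin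
      ∑ (λ u → cnt k (step s u)) ℕ.* R             ≡⟨ sym (∑-*ʳ (λ u → cnt k (step s u)) R) ⟩
      ∑ (λ u → cnt k (step s u) ℕ.* R)             ≤⟨ ∑-mono (λ u → super k (step s u) (stepP s u p)) ⟩
      ∑ (λ u → n ^ k ℕ.* (W (step s u) k ℕ.+ C ℕ.* k ℕ.+ E))  ≡⟨ ∑-*ˡ {n} _ (n ^ k) ⟩
      n ^ k ℕ.* ∑ (λ u → W (step s u) k ℕ.+ C ℕ.* k ℕ.+ E)    ≡⟨ cong (n ^ k ℕ.*_) (trans (∑-+ (λ u → W (step s u) k ℕ.+ C ℕ.* k) (λ _ → E))
                                                                   (cong₂ ℕ._+_ (trans (∑-+ (λ u → W (step s u) k) (λ _ → C ℕ.* k)) (cong (∑ (λ u → W (step s u) k) ℕ.+_) (∑-const {n} (C ℕ.* k)))) (∑-const {n} E))) ⟩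
      n ^ k ℕ.* (∑ (λ u → W (step s u) k) ℕ.+ n ℕ.* (C ℕ.* k) ℕ.+ n ℕ.* E)
        ≤⟨ ℕₚ.*-monoʳ-≤ (n ^ k) (ℕₚ.+-monoˡ-≤ (n ℕ.* E) (ℕₚ.+-monoˡ-≤ (n ℕ.* (C ℕ.* k)) (Wₛ s k p b (ℕₚ.≰⇒> R≰)))) ⟩
      n ^ k ℕ.* (n ℕ.* (W s (suc k) ℕ.+ C) ℕ.+ n ℕ.* (C ℕ.* k) ℕ.+ n ℕ.* E)
        ≡⟨ arr n (n ^ k) (W s (suc k)) C k E ⟩
      n ^ suc k ℕ.* (W s (suc k) ℕ.+ C ℕ.* suc k ℕ.+ E) ∎
      where
      open ℕₚ.≤-Reasoning
      arr : ∀ a b w c k e → b ℕ.* (a ℕ.* (w ℕ.+ c) ℕ.+ a ℕ.* (c ℕ.* k) ℕ.+ a ℕ.* e) ≡ a ℕ.* b ℕ.* (w ℕ.+ c ℕ.* (1 ℕ.+ k) ℕ.+ e)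
      arr = ℕS.solve-∀

-- Segments, blocks and the main path.

occ-++ : ∀ {n} (v : Fin n) xs ys → occ v (xs ++ ys) ≡ occ v xs ℕ.+ occ v ys
occ-++ v []       ys = refl
occ-++ v (x ∷ xs) ys = trans (cong (⟦ v ≟ x ⟧ ℕ.+_) (occ-++ v xs ys)) (sym (ℕₚ.+-assoc ⟦ v ≟ x ⟧ (occ v xs) (occ v ys)))

occ-reverse : ∀ {n} (v : Fin n) xs → occ v (reverse xs) ≡ occ v xs
occ-reverse v []       = refl
occ-reverse v (x ∷ xs) = begin
  occ v (reverse (x ∷ xs))                 ≡⟨ cong (occ v) (Listₚ.unfold-reverse x xs) ⟩
  occ v (reverse xs ++ [ x ])              ≡⟨ occ-++ v (reverse xs) [ x ] ⟩
  occ v (reverse xs) ℕ.+ (⟦ v ≟ x ⟧ ℕ.+ 0) ≡⟨ cong₂ ℕ._+_ (occ-reverse v xs) (ℕₚ.+-identityʳ _) ⟩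
  occ v xs ℕ.+ ⟦ v ≟ x ⟧                   ≡⟨ ℕₚ.+-comm (occ v xs) _ ⟩
  occ v (x ∷ xs) ∎
  where open ≡-Reasoning

occ-self : ∀ {n} (v : Fin n) xs → 1 ℕ.≤ occ v (v ∷ xs)
occ-self v xs = subst (λ z → 1 ℕ.≤ z ℕ.+ occ v xs) (sym (⟦≟⟧-refl v)) (s≤s z≤n)

-- Separate fields for the two ends make every segment have at least two vertices; each segment then
-- offers two triggers, and c segments contain at least 2 c vertices.
record Seg (n : ℕ) : Set where
  constructor seg
  field
    hd : Fin n
    md : List (Fin n)
    tl : Fin n
open Seg public

-- Entries of the main path. bk x r y t stands for three consecutive vertices; r has an edge to the head of the segment t,
-- so that an edge from x or y to the tail of t lets the path take a detour through t.
data Item (n : ℕ) (T : Set) : Set where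
  pl : Fin n → Item n T
  bk : (x r y : Fin n) → T → Item n T

module _ {n : ℕ} where

  toL : Seg n → List (Fin n)
  toL (seg e m f) = e ∷ m ++ [ f ]

  rv : Seg n → Seg n
  rv (seg e m f) = seg f (reverse m) e

  size : Seg n → ℕ
  size B = 2 ℕ.+ length (md B)

  length-toL : ∀ B → length (toL B) ≡ size B
  length-toL (seg e m f) = cong suc (trans (Listₚ.length-++ m) (ℕₚ.+-comm (length m) 1))

  toL-rv : ∀ B → toL (rv B) ≡ reverse (toL B)
  toL-rv (seg e m f) = sym (trans (Listₚ.unfold-reverse e (m ++ [ f ])) (cong (_++ [ e ]) (Listₚ.reverse-++ m [ f ])))

  occ-rv : ∀ v B → occ v (toL (rv B)) ≡ occ v (toL B)
  occ-rv v B = trans (cong (occ v) (toL-rv B)) (occ-reverse v (toL B))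

  occS : Fin n → List (Seg n) → ℕ
  occS v []       = 0
  occS v (B ∷ Bs) = occ v (toL B) ℕ.+ occS v Bs

  occS-++ : ∀ v As Bs → occS v (As ++ Bs) ≡ occS v As ℕ.+ occS v Bs
  occS-++ v []       Bs = refl
  occS-++ v (A ∷ As) Bs = trans (cong (occ v (toL A) ℕ.+_) (occS-++ v As Bs)) (sym (ℕₚ.+-assoc (occ v (toL A)) (occS v As) (occS v Bs)))

  occS-∈ : ∀ {B Bs} → B ∈ Bs → 1 ℕ.≤ occS (hd B) Bs
  occS-∈ {B} {_ ∷ Bs} (here refl) = ℕₚ.≤-trans (occ-self (hd B) (md B ++ [ tl B ])) (ℕₚ.m≤m+n _ (occS (hd B) Bs))
  occS-∈ {B} {A ∷ Bs} (there p)   = ℕₚ.≤-trans (occS-∈ p) (ℕₚ.m≤n+m _ (occ (hd B) (toL A)))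

  -- Segments are addressed by their heads in `del`, `strip` and `deg`. This is sound because a head
  -- shared by two segments would be counted twice.
  hd-distinct : ∀ {A B Bs} → occS (hd A) (A ∷ Bs) ℕ.≤ 1 → B ∈ Bs → hd A ≢ hd B
  hd-distinct {A} {B} {Bs} h p e with ℕₚ.≤-trans (ℕₚ.+-mono-≤ (occ-self (hd A) (md A ++ [ tl A ]))
                                            (subst (λ z → 1 ℕ.≤ occS z Bs) (sym e) (occS-∈ p))) h
  ... | s≤s ()

  flat : ∀ {T} → List (Item n T) → List (Fin n)
  flat []                  = []
  flat (pl v ∷ M)          = v ∷ flat M
  flat (bk x r y _ ∷ M)    = x ∷ r ∷ y ∷ flat M

  flat-++ : ∀ {T} (M N : List (Item n T)) → flat (M ++ N) ≡ flat M ++ flat N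
  flat-++ []               N = refl
  flat-++ (pl v ∷ M)       N = cong (v ∷_) (flat-++ M N)
  flat-++ (bk x r y _ ∷ M) N = cong (λ z → x ∷ r ∷ y ∷ z) (flat-++ M N)

  flat-pl : ∀ {T} xs → flat {T} (map pl xs) ≡ xs
  flat-pl []       = refl
  flat-pl (x ∷ xs) = cong (x ∷_) (flat-pl xs)

  nb : ∀ {T} → List (Item n T) → ℕ
  nb []                = 0
  nb (pl _ ∷ M)        = nb M
  nb (bk _ _ _ _ ∷ M)  = suc (nb M)

  nb-++ : ∀ {T} (M N : List (Item n T)) → nb (M ++ N) ≡ nb M ℕ.+ nb N
  nb-++ []               N = refl
  nb-++ (pl v ∷ M)       N = nb-++ M N
  nb-++ (bk x r y _ ∷ M) N = cong suc (nb-++ M N)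

  nb-pl : ∀ {T} xs → nb {T} (map pl xs) ≡ 0
  nb-pl []       = refl
  nb-pl (x ∷ xs) = nb-pl xs

  -- The degree of a segment in the sense of the strategy: how many blocks are waiting for it.
  deg : Fin n → List (Item n (Seg n)) → ℕ
  deg h []               = 0
  deg h (pl _ ∷ M)       = deg h M
  deg h (bk _ _ _ B ∷ M) = ⟦ h ≟ hd B ⟧ ℕ.+ deg h M

  deg-++ : ∀ h M N → deg h (M ++ N) ≡ deg h M ℕ.+ deg h N
  deg-++ h []               N = refl
  deg-++ h (pl v ∷ M)       N = deg-++ h M N
  deg-++ h (bk x r y B ∷ M) N = trans (cong (⟦ h ≟ hd B ⟧ ℕ.+_) (deg-++ h M N)) (sym (ℕₚ.+-assoc ⟦ h ≟ hd B ⟧ _ _))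

  deg-pl : ∀ h xs → deg h (map pl xs) ≡ 0
  deg-pl h []       = refl
  deg-pl h (x ∷ xs) = deg-pl h xs

  -- Once a segment is merged, the blocks that waited for it turn back into plain vertices and can
  -- be used again.
  strip : Fin n → List (Item n (Seg n)) → List (Item n (Seg n))
  strip h []               = []
  strip h (pl v ∷ M)       = pl v ∷ strip h M
  strip h (bk x r y B ∷ M) with h Fin.≟ hd B
  ... | yes _ = pl x ∷ pl r ∷ pl y ∷ strip h M
  ... | no  _ = bk x r y B ∷ strip h M

  flat-strip : ∀ h M → flat (strip h M) ≡ flat M
  flat-strip h []               = refl
  flat-strip h (pl v ∷ M)       = cong (v ∷_) (flat-strip h M)
  flat-strip h (bk x r y B ∷ M) with h Fin.≟ hd B
  ... | yes _ = cong (λ z → x ∷ r ∷ y ∷ z) (flat-strip h M)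
  ... | no  _ = cong (λ z → x ∷ r ∷ y ∷ z) (flat-strip h M)

  nb-strip : ∀ h M → nb (strip h M) ℕ.+ deg h M ≡ nb M
  nb-strip h []               = refl
  nb-strip h (pl v ∷ M)       = nb-strip h M
  nb-strip h (bk x r y B ∷ M) with h Fin.≟ hd B
  ... | yes _ = trans (ℕₚ.+-suc _ _) (cong suc (nb-strip h M))
  ... | no  _ = cong suc (nb-strip h M)

  deg-strip : ∀ h h′ M → h ≢ h′ → deg h′ (strip h M) ≡ deg h′ M
  deg-strip h h′ []               ne = refl
  deg-strip h h′ (pl v ∷ M)       ne = deg-strip h h′ M ne
  deg-strip h h′ (bk x r y B ∷ M) ne with h Fin.≟ hd B
  ... | no  _ = cong (⟦ h′ ≟ hd B ⟧ ℕ.+_) (deg-strip h h′ M ne)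
  ... | yes refl with h′ Fin.≟ hd B
  ...   | yes refl = ⊥-elim (ne refl)
  ...   | no _     = deg-strip h h′ M ne

  del : Fin n → List (Seg n) → List (Seg n)
  del h []       = []
  del h (B ∷ Bs) with h Fin.≟ hd B
  ... | yes _ = del h Bs
  ... | no  _ = B ∷ del h Bs

  del-++ : ∀ h As Bs → del h (As ++ Bs) ≡ del h As ++ del h Bs
  del-++ h []       Bs = refl
  del-++ h (A ∷ As) Bs with h Fin.≟ hd A
  ... | yes _ = del-++ h As Bs
  ... | no  _ = cong (A ∷_) (del-++ h As Bs)

  del-∈ : ∀ {h B Bs} → B ∈ Bs → h ≢ hd B → B ∈ del h Bs
  del-∈ {h} {B} {A ∷ Bs} p ne with h Fin.≟ hd A
  del-∈ {h} {B} {A ∷ Bs} (here refl) ne | yes e = ⊥-elim (ne e)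
  del-∈ {h} {B} {A ∷ Bs} (there p)   ne | yes e = del-∈ p ne
  del-∈ {h} {B} {A ∷ Bs} (here refl) ne | no _  = here refl
  del-∈ {h} {B} {A ∷ Bs} (there p)   ne | no _  = there (del-∈ p ne)

  del-All : ∀ {p} {P : Seg n → Set p} {h Bs} → All P Bs → All (λ B → h ≢ hd B × P B) (del h Bs)
  del-All {h = h} {[]}     []       = []
  del-All {h = h} {B ∷ Bs} (x ∷ xs) with h Fin.≟ hd B
  ... | yes _ = del-All xs
  ... | no ne = (ne , x) ∷ del-All xs

  del-id : ∀ h Bs → (∀ {B} → B ∈ Bs → h ≢ hd B) → del h Bs ≡ Bs
  del-id h []       f = refl
  del-id h (B ∷ Bs) f with h Fin.≟ hd B
  ... | yes e = ⊥-elim (f (here refl) e)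
  ... | no  _ = cong (B ∷_) (del-id h Bs (f ∘ there))

  -- A sum over segments with distinct heads drops by exactly the summand of the deleted one.
  del-sum : ∀ (w : Seg n → ℕ) (wS : List (Seg n) → ℕ) → (∀ B Bs → wS (B ∷ Bs) ≡ w B ℕ.+ wS Bs) →
            ∀ {B Bs} → B ∈ Bs → (∀ v → occS v Bs ℕ.≤ 1) → wS Bs ≡ w B ℕ.+ wS (del (hd B) Bs)
  del-sum w wS e {B} {A ∷ Bs} (here refl) h with hd B Fin.≟ hd B
  ... | no ¬p = ⊥-elim (¬p refl)
  ... | yes _ = trans (e B Bs) (cong (λ z → w B ℕ.+ wS z) (sym (del-id (hd B) Bs (λ p → hd-distinct {B} (h (hd B)) p))))
  del-sum w wS e {B} {A ∷ Bs} (there p) h with hd B Fin.≟ hd A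
  ... | yes q = ⊥-elim (hd-distinct {A} (h (hd A)) p (sym q))
  ... | no _ = begin
    wS (A ∷ Bs)                            ≡⟨ e A Bs ⟩
    w A ℕ.+ wS Bs                          ≡⟨ cong (w A ℕ.+_) (del-sum w wS e p (λ v → ℕₚ.≤-trans (ℕₚ.m≤n+m _ (occ v (toL A))) (h v))) ⟩
    w A ℕ.+ (w B ℕ.+ wS (del (hd B) Bs))   ≡⟨ swap (w A) (w B) _ ⟩
    w B ℕ.+ (w A ℕ.+ wS (del (hd B) Bs))   ≡⟨ cong (w B ℕ.+_) (sym (e A _)) ⟩
    w B ℕ.+ wS (A ∷ del (hd B) Bs) ∎
    where
    open ≡-Reasoning
    swap : ∀ a b c → a ℕ.+ (b ℕ.+ c) ≡ b ℕ.+ (a ℕ.+ c)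
    swap = ℕS.solve-∀

-- States and moves of the strategy.

picks : ∀ {a} {A : Set a} → List A → List (A × List A)
picks []       = []
picks (x ∷ xs) = (x , xs) ∷ map (λ { (y , ys) → y , x ∷ ys }) (picks xs)

-- Four caps: segments are extended only below size `L`, a segment gets at most `D c` blocks while c
-- segments are left, there are at most `Rc` blocks during merging and at most `K` during closing.
-- Size and degree caps bound the increments of the potentials; `Rc` limits how many segments can be
-- of high degree when the degrees are small.
module Process (n : ℕ) (L : ℕ) (D : ℕ → ℕ) (Rc K : ℕ) where

  private V = Fin n

  -- In main d B low high N, the segments B ∷ low are each the target of d blocks of N, those of high of d + 1.
  data St : Set where
    grow : V → List V → List (Seg n) → St
    main : ℕ → Seg n → List (Seg n) → List (Seg n) → List (Item n (Seg n)) → St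
    clos : List (Item n ⊤) → St
    done : St

  data Lab : Set where
    pair ext close colour : Lab
    rem : Seg n → Lab

  -- The vertex that triggers the move, the one it is joined to, the new state, and the kind of the move.
  Move : Set
  Move = V × (V × St × Lab)

  -- Restores the normal form. When no segment of the lower degree is left, the higher ones become
  -- the new `low`; when none is left at all, the main path is Hamiltonian and starts the closing
  -- phase without blocks.
  mk : ℕ → List (Seg n) → List (Seg n) → List (Item n (Seg n)) → St
  mk d (B ∷ low) high       M = main d B low high M
  mk d []        (B ∷ high) M = main (suc d) B high [] M
  mk d []        []         M = clos (map pl (flat M))

  toSt : List V → List (Seg n) → St
  toSt []       Bs = mk 0 Bs [] []
  toSt (s ∷ ss) Bs = grow s ss Bs

  lastOr : V → List V → V
  lastOr v []        = v
  lastOr v (x ∷ xs)  = lastOr x xs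

  pairMove : List (Seg n) → V × List V → List Move
  pairMove Bs (x , [])     = []
  pairMove Bs (x , y ∷ ys) = (x , y , toSt ys (seg x [] y ∷ Bs) , pair) ∷ []

  extMove : V → List V → Seg n × List (Seg n) → List Move
  extMove s ss (B , Bs) with size B ℕ.<? L
  ... | yes _ = (hd B , s , toSt ss (seg s (hd B ∷ md B) (tl B) ∷ Bs) , ext)
              ∷ (tl B , s , toSt ss (seg (hd B) (md B ++ [ tl B ]) s ∷ Bs) , ext) ∷ []
  ... | no _ = []

  remove : ℕ → List (Seg n) → List (Seg n) → Seg n → List (Item n (Seg n)) → St
  remove d low high B M = mk d (del (hd B) low) (del (hd B) high) (strip (hd B) M)

  module Main (d : ℕ) (B₀ : Seg n) (low high : List (Seg n)) where

    remSt : Seg n → List (Item n (Seg n)) → St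
    remSt = remove d (B₀ ∷ low) high

    attach : List (Item n (Seg n)) → Seg n → List Move
    attach M B = (hd B , lastOr (hd B) (flat M) , remSt B (M ++ map pl (toL B)) , rem B)
               ∷ (tl B , lastOr (tl B) (flat M) , remSt B (M ++ map pl (toL (rv B))) , rem B) ∷ []

    -- In a block x r y the vertex r is joined to the head of B. An edge from x to the tail yields
    -- x, tail to head, r, y, hence `rv B`; an edge from y yields x, r, head to tail, y. So each
    -- block offers two triggers.
    insertMoves : List (Item n (Seg n)) → List (Item n (Seg n)) → List Move
    insertMoves pre []                    = []
    insertMoves pre (pl v ∷ post)         = insertMoves (pre ++ [ pl v ]) post
    insertMoves pre (bk x r y B ∷ post)   =
        (x , tl B , remSt B (pre ++ pl x ∷ map pl (toL (rv B)) ++ pl r ∷ pl y ∷ post) , rem B)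
      ∷ (y , tl B , remSt B (pre ++ pl x ∷ pl r ∷ map pl (toL B) ++ pl y ∷ post) , rem B)
      ∷ insertMoves (pre ++ [ bk x r y B ]) post

    -- Three consecutive plain entries are required, so blocks never overlap and no vertex serves as
    -- neighbour in two of them. The target `B₀` is one of least degree, which keeps all degrees
    -- within one of each other.
    colourHere : List (Item n (Seg n)) → List (Item n (Seg n)) → List Move
    colourHere pre (pl p ∷ pl u ∷ pl q ∷ post) =
      (u , hd B₀ , mk d low (B₀ ∷ high) (pre ++ bk p u q B₀ ∷ post) , colour) ∷ []
    colourHere pre _ = []

    colourMoves : List (Item n (Seg n)) → List (Item n (Seg n)) → List Move
    colourMoves pre []       = []
    colourMoves pre (i ∷ M)  = colourHere pre (i ∷ M) ++ colourMoves (pre ++ [ i ]) M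

    count : ℕ
    count = suc (length low ℕ.+ length high)

    allowed : List (Item n (Seg n)) → List Move → List Move
    allowed M ms with suc d ℕ.≤? D count | suc (nb M) ℕ.≤? Rc
    ... | yes _ | yes _ = ms
    ... | _     | _     = []

    moves : List (Item n (Seg n)) → List Move
    moves M = concatMap (attach M) ((B₀ ∷ low) ++ high) ++ (insertMoves [] M ++ allowed M (colourMoves [] M))

  module Clos (e f : V) where

    -- Here r is joined to the first vertex e. An edge from its predecessor x to the last vertex f
    -- gives the cycle e .. x, f .. r, e. The successor would not do, so a block offers one trigger
    -- only.
    closeMoves : List (Item n ⊤) → List Move
    closeMoves []                  = []
    closeMoves (pl v ∷ M)          = closeMoves M
    closeMoves (bk x r y _ ∷ M)    = (x , f , done , close) ∷ closeMoves M

    colourHere : List (Item n ⊤) → List (Item n ⊤) → List Move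
    colourHere pre (pl p ∷ pl u ∷ pl q ∷ post) = (u , e , clos (pre ++ bk p u q tt ∷ post) , colour) ∷ []
    colourHere pre _ = []

    colourMoves : List (Item n ⊤) → List (Item n ⊤) → List Move
    colourMoves pre []       = []
    colourMoves pre (i ∷ M)  = colourHere pre (i ∷ M) ++ colourMoves (pre ++ [ i ]) M

    allowed : List (Item n ⊤) → List Move → List Move
    allowed M ms with suc (nb M) ℕ.≤? K
    ... | yes _ = ms
    ... | no  _ = []

    moves : List (Item n ⊤) → List Move
    moves M = closeMoves M ++ allowed M (colourMoves [] M)

  closMoves : List (Item n ⊤) → List V → List Move
  closMoves M []       = []
  closMoves M (v ∷ vs) = Clos.moves v (lastOr v vs) M

  moves : St → List Move
  moves (grow s ss Bs)         = concatMap (pairMove Bs) (picks (s ∷ ss)) ++ concatMap (extMove s ss) (picks Bs)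
  moves (main d B low high M)  = Main.moves d B low high M
  moves (clos M)               = closMoves M (flat M)
  moves done                   = []

  alive : St → ℕ
  alive done = 0
  alive _    = 1

  alive≤1 : ∀ s → alive s ℕ.≤ 1
  alive≤1 (grow _ _ _)     = s≤s z≤n
  alive≤1 (main _ _ _ _ _) = s≤s z≤n
  alive≤1 (clos _)         = s≤s z≤n
  alive≤1 done             = z≤n

  next : St → Maybe (V × St × Lab) → St
  next s (just (_ , s′ , _)) = s′
  next s nothing             = s

  step : St → V → St
  step s u = next s (find u (moves s))

  module _ (other : (u : V) → Σ V (λ v → v ≢ u)) where

    -- The prescribed partner can be u itself: `lastOr` returns it while the main path is still
    -- empty. Nothing has to be linked then, and any other vertex may be played.
    avoid : (u v : V) → Σ V (λ v → v ≢ u)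
    avoid u v with v Fin.≟ u
    ... | yes _ = other u
    ... | no ne = v , ne

    choose : St → (u : V) → Σ V (λ v → v ≢ u)
    choose s u with find u (moves s)
    ... | just (v , _) = avoid u v
    ... | nothing      = other u

-- Invariants of the game.

⟦≟⟧-no : ∀ {n} {u v : Fin n} → u ≢ v → ⟦ u ≟ v ⟧ ≡ 0
⟦≟⟧-no {u = u} {v} ne with u Fin.≟ v
... | yes e = ⊥-elim (ne e)
... | no _  = refl

All-concatMap : ∀ {a b p} {A : Set a} {B : Set b} {P : B → Set p} (f : A → List B) xs →
                All (λ x → All P (f x)) xs → All P (concatMap f xs)
All-concatMap f []       []       = []
All-concatMap f (x ∷ xs) (h ∷ hs) = Allₚ.++⁺ h (All-concatMap f xs hs)

picks-↭ : ∀ {a} {A : Set a} (xs : List A) → All (λ p → xs ↭ proj₁ p ∷ proj₂ p) (picks xs)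
picks-↭ []       = []
picks-↭ (x ∷ xs) = ↭.refl ∷ Allₚ.map⁺ (All.map (λ p → ↭.trans (↭.prep x p) (↭.swap x _ ↭.refl)) (picks-↭ xs))

occ-↭ : ∀ {n} (v : Fin n) {xs ys} → xs ↭ ys → occ v xs ≡ occ v ys
occ-↭ v ↭.refl         = refl
occ-↭ v (↭.prep x p)   = cong (⟦ v ≟ x ⟧ ℕ.+_) (occ-↭ v p)
occ-↭ v (↭.swap x y p) = trans (cong (λ z → ⟦ v ≟ x ⟧ ℕ.+ (⟦ v ≟ y ⟧ ℕ.+ z)) (occ-↭ v p)) (sw ⟦ v ≟ x ⟧ ⟦ v ≟ y ⟧ _)
  where
  sw : ∀ a b c → a ℕ.+ (b ℕ.+ c) ≡ b ℕ.+ (a ℕ.+ c)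
  sw = ℕS.solve-∀
occ-↭ v (↭.trans p q)  = trans (occ-↭ v p) (occ-↭ v q)

occS-↭ : ∀ {n} (v : Fin n) {xs ys} → xs ↭ ys → occS v xs ≡ occS v ys
occS-↭ v ↭.refl         = refl
occS-↭ v (↭.prep x p)   = cong (occ v (toL x) ℕ.+_) (occS-↭ v p)
occS-↭ v (↭.swap x y p) = trans (cong (λ z → occ v (toL x) ℕ.+ (occ v (toL y) ℕ.+ z)) (occS-↭ v p)) (sw (occ v (toL x)) (occ v (toL y)) _)
  where
  sw : ∀ a b c → a ℕ.+ (b ℕ.+ c) ≡ b ℕ.+ (a ℕ.+ c)
  sw = ℕS.solve-∀
occS-↭ v (↭.trans p q)  = trans (occS-↭ v p) (occS-↭ v q)

module Paths {n : ℕ} (R : Fin n → Fin n → Set) (R-sym : ∀ {a b} → R a b → R b a) where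

  Path : List (Fin n) → Set
  Path []           = ⊤
  Path (x ∷ [])     = ⊤
  Path (x ∷ y ∷ zs) = R x y × Path (y ∷ zs)

  pApp : ∀ xs {a ys} → Path (xs ++ [ a ]) → Path (a ∷ ys) → Path (xs ++ a ∷ ys)
  pApp []            p       q = q
  pApp (x ∷ [])      (r , _) q = r , q
  pApp (x ∷ y ∷ xs)  (r , p) q = r , pApp (y ∷ xs) p q

  pApp′ : ∀ xs {a ys} → Path (xs ++ [ a ]) → Path (a ∷ ys) → Path ((xs ++ [ a ]) ++ ys)
  pApp′ xs {a} {ys} p q = subst Path (sym (Listₚ.++-assoc xs [ a ] ys)) (pApp xs p q)

  pL : ∀ xs {a ys} → Path (xs ++ a ∷ ys) → Path (xs ++ [ a ])
  pL []           p       = tt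
  pL (x ∷ [])     (r , _) = r , tt
  pL (x ∷ y ∷ xs) (r , p) = r , pL (y ∷ xs) p

  pR : ∀ xs {a ys} → Path (xs ++ a ∷ ys) → Path (a ∷ ys)
  pR []           p       = p
  pR (x ∷ [])     (_ , p) = p
  pR (x ∷ y ∷ xs) (_ , p) = pR (y ∷ xs) p

  pTail : ∀ {x xs} → Path (x ∷ xs) → Path xs
  pTail {xs = []}     _       = tt
  pTail {xs = _ ∷ _}  (_ , p) = p

  pRev : ∀ xs → Path xs → Path (reverse xs)
  pRev []           p       = tt
  pRev (x ∷ [])     p       = tt
  pRev (x ∷ y ∷ xs) (r , p) = subst Path (sym (trans (Listₚ.unfold-reverse x (y ∷ xs)) (trans (cong (_++ [ x ]) (Listₚ.unfold-reverse y xs)) (Listₚ.++-assoc (reverse xs) [ y ] [ x ]))))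
    (pApp (reverse xs) (subst Path (Listₚ.unfold-reverse y xs) (pRev (y ∷ xs) p)) (R-sym r , tt))

module Invariants (n L : ℕ) (D : ℕ → ℕ) (Rc K : ℕ) (D-anti : ∀ {a b} → a ℕ.≤ b → D b ℕ.≤ D a) where

  open Process n L D Rc K
  private V = Fin n

  -- The relation is abstract because the invariants serve twice: with adjacency in the edges played
  -- so far, for correctness, and with the relation that always holds, for counting.
  module WithR (R : V → V → Set) (R-sym : ∀ {a b} → R a b → R b a) where

    open Paths R R-sym public

    OkSeg : Seg n → Set
    OkSeg B = Path (toL B) × size B ℕ.≤ L

    BkOk : List (Seg n) → Item n (Seg n) → Set
    BkOk Bs (pl _)       = ⊤
    BkOk Bs (bk x r y B) = R r (hd B) × B ∈ Bs

    BkC : V → Item n ⊤ → Set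
    BkC e (pl _)       = ⊤
    BkC e (bk x r y _) = R r e

    record MInv (d : ℕ) (low high : List (Seg n)) (M : List (Item n (Seg n))) : Set where
      field
        once : ∀ v → occ v (flat M) ℕ.+ occS v (low ++ high) ≡ 1
        path : Path (flat M)
        okL  : All OkSeg low
        okH  : All OkSeg high
        blk  : All (BkOk (low ++ high)) M
        degL : All (λ B → deg (hd B) M ≡ d) low
        degH : All (λ B → deg (hd B) M ≡ suc d) high
        dbL  : 0 ℕ.< length low → d ℕ.≤ D (length low ℕ.+ length high)
        dbH  : 0 ℕ.< length high → suc d ℕ.≤ D (length low ℕ.+ length high)
        few  : nb M ℕ.≤ Rc
    open MInv public

    Cycle : Set
    Cycle = Σ V λ w → Σ (List V) λ ws → (∀ v → occ v (w ∷ ws) ≡ 1) × Path (w ∷ ws ++ [ w ])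

    Inv : St → Set
    Inv (grow s ss Bs)        = (∀ v → occ v (s ∷ ss) ℕ.+ occS v Bs ≡ 1) × All OkSeg Bs
    Inv (main d B low high M) = MInv d (B ∷ low) high M
    Inv (clos M)              = (∀ v → occ v (flat M) ≡ 1) × Path (flat M) × (∀ e vs → flat M ≡ e ∷ vs → All (BkC e) M)
    Inv done                  = Cycle

    once≤ : ∀ {d low high M} → MInv d low high M → ∀ v → occS v (low ++ high) ℕ.≤ 1
    once≤ i v = ℕₚ.≤-trans (ℕₚ.m≤n+m _ _) (ℕₚ.≤-reflexive (once i v))

    mkInv : ∀ d low high M → MInv d low high M → Inv (mk d low high M)
    mkInv d (B ∷ low) high M i = i
    mkInv d [] (B ∷ high) M i = record
      { once = λ v → trans (cong (λ z → occ v (flat M) ℕ.+ occS v z) (Listₚ.++-identityʳ (B ∷ high))) (once i v)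
      ; path = path i ; okL = okH i ; okH = []
      ; blk = subst (λ z → All (BkOk z) M) (sym (Listₚ.++-identityʳ (B ∷ high))) (blk i)
      ; degL = degH i ; degH = []
      ; dbL = λ _ → subst (λ z → suc d ℕ.≤ D z) (sym (ℕₚ.+-identityʳ (suc (length high)))) (dbH i (s≤s z≤n))
      ; dbH = λ () ; few = few i }
    mkInv d [] [] M i =
      (λ v → trans (cong (occ v) (flat-pl (flat M))) (trans (sym (ℕₚ.+-identityʳ _)) (once i v))) ,
      subst Path (sym (flat-pl (flat M))) (path i) ,
      (λ e vs _ → Allₚ.map⁺ (All.universal (λ _ → tt) (flat M)))

    All-bk : ∀ {Bs M} {h : V} → All (BkOk Bs) M → All (BkOk (del h Bs)) (strip h M)
    All-bk {M = []} [] = []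
    All-bk {M = pl v ∷ M} (_ ∷ a) = tt ∷ All-bk a
    All-bk {M = bk x r y B ∷ M} {h} ((rr , m) ∷ a) with h Fin.≟ hd B
    ... | yes _ = tt ∷ tt ∷ tt ∷ All-bk a
    ... | no ne = (rr , del-∈ m ne) ∷ All-bk a

    length-del : ∀ h (Bs : List (Seg n)) → length (del h Bs) ℕ.≤ length Bs
    length-del h []       = z≤n
    length-del h (B ∷ Bs) with h Fin.≟ hd B
    ... | yes _ = ℕₚ.m≤n⇒m≤1+n (length-del h Bs)
    ... | no _  = s≤s (length-del h Bs)

    -- Appending a segment and making a detour differ only in the new path M′. All that matters is
    -- that M′ gains exactly the vertices of B and leaves the blocks of the other segments alone.
    removeInv : ∀ {d low high M} B M′ → MInv d low high M → B ∈ low ++ high →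
      (∀ v → occ v (flat M′) ≡ occ v (flat M) ℕ.+ occ v (toL B)) → Path (flat M′) → All (BkOk (low ++ high)) M′ →
      (∀ h → hd B ≢ h → deg h M′ ≡ deg h M) → nb M′ ℕ.≤ nb M → Inv (remove d low high B M′)
    removeInv {d} {low} {high} {M} B M′ i B∈ oc p bl dg nb≤ = mkInv d _ _ _ (record
      { once = λ v → trans (cong₂ ℕ._+_ (trans (cong (occ v) (flat-strip h M′)) (oc v)) (cong (occS v) (sym (del-++ h low high))))
                 (trans (ℕₚ.+-assoc (occ v (flat M)) _ _) (trans (cong (occ v (flat M) ℕ.+_) (sym (del-sum (λ B → occ v (toL B)) (occS v) (λ _ _ → refl) B∈ (once≤ i)))) (once i v)))
      ; path = subst Path (sym (flat-strip h M′)) p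
      ; okL = All.map proj₂ (del-All (okL i)) ; okH = All.map proj₂ (del-All (okH i))
      ; blk = subst (λ z → All (BkOk z) (strip h M′)) (del-++ h low high) (All-bk bl)
      ; degL = All.map (λ {B′} → degEq {B′ = B′}) (del-All (degL i)) ; degH = All.map (λ {B′} → degEq {B′ = B′}) (del-All (degH i))
      -- With fewer segments the degree cap can only rise.
      ; dbL = λ lt → ℕₚ.≤-trans (dbL i (ℕₚ.≤-trans lt (length-del h low))) (D-anti le)
      ; dbH = λ lt → ℕₚ.≤-trans (dbH i (ℕₚ.≤-trans lt (length-del h high))) (D-anti le)
      ; few = ℕₚ.≤-trans (ℕₚ.m+n≤o⇒m≤o (nb (strip h M′)) (ℕₚ.≤-reflexive (nb-strip h M′))) (ℕₚ.≤-trans nb≤ (few i)) })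
      where
      h = hd B
      le = ℕₚ.+-mono-≤ (length-del h low) (length-del h high)
      degEq : ∀ {e} {B′ : Seg n} → h ≢ hd B′ × deg (hd B′) M ≡ e → deg (hd B′) (strip h M′) ≡ e
      degEq {e} {B′} (ne , q) = trans (deg-strip h (hd B′) M′ ne) (trans (dg (hd B′) ne) q)

    module _ {d : ℕ} {B₀ : Seg n} {low high : List (Seg n)} {M : List (Item n (Seg n))} (i : MInv d (B₀ ∷ low) high M) where

      open Main d B₀ low high hiding (moves)

      private
        Bs = (B₀ ∷ low) ++ high

        Good : Move → Set
        Good (u , v , s′ , _) = R u v → Inv s′

        okSeg : ∀ {B} → B ∈ Bs → OkSeg B
        okSeg B∈ = All.lookup (Allₚ.++⁺ (okL i) (okH i)) B∈

        pathRv : ∀ B → Path (toL B) → Path (toL (rv B))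
        pathRv B p = subst Path (sym (toL-rv B)) (pRev (toL B) p)

        pExt : ∀ xs w ws → Path xs → R w (lastOr w xs) → Path (w ∷ ws) → Path (xs ++ w ∷ ws)
        pExt []           w ws p r q = q
        pExt (x ∷ [])     w ws p r q = R-sym r , q
        pExt (x ∷ y ∷ xs) w ws (a , p) r q = a , pExt (y ∷ xs) w ws p r q

      attachGood : ∀ B → B ∈ Bs → All Good (attach M B)
      attachGood B B∈ = one (toL B) (hd B) (md B ++ [ tl B ]) refl (λ v → refl) (proj₁ (okSeg B∈))
                      ∷ one (toL (rv B)) (tl B) _ refl (λ v → occ-rv v B) (pathRv B (proj₁ (okSeg B∈))) ∷ []
        where
        one : ∀ xs w ws → xs ≡ w ∷ ws → (∀ v → occ v xs ≡ occ v (toL B)) → Path xs →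
              R w (lastOr w (flat M)) → Inv (remSt B (M ++ map pl xs))
        one xs w ws refl oc p r = removeInv B _ i B∈
          (λ v → trans (cong (occ v) fl) (trans (occ-++ v (flat M) xs) (cong (occ v (flat M) ℕ.+_) (oc v))))
          (subst Path (sym fl) (pExt (flat M) w ws (path i) r p))
          (Allₚ.++⁺ (blk i) (Allₚ.map⁺ (All.universal (λ _ → tt) xs)))
          (λ h _ → trans (deg-++ h M _) (trans (cong (deg h M ℕ.+_) (deg-pl h xs)) (ℕₚ.+-identityʳ _)))
          (ℕₚ.≤-reflexive (trans (nb-++ M _) (trans (cong (nb M ℕ.+_) (nb-pl xs)) (ℕₚ.+-identityʳ _))))
          where
          fl : flat (M ++ map pl xs) ≡ flat M ++ xs
          fl = trans (flat-++ M (map pl xs)) (cong (flat M ++_) (flat-pl xs))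

      insertGood : ∀ pre post → pre ++ post ≡ M → All Good (insertMoves pre post)
      insertGood pre [] e = []
      insertGood pre (pl v ∷ post) e = insertGood (pre ++ [ pl v ]) post (trans (Listₚ.++-assoc pre [ pl v ] post) e)
      insertGood pre (bk x r y B ∷ post) refl =
          (λ rel → ins (pl x ∷ map pl (toL (rv B)) ++ pl r ∷ pl y ∷ post) (toL (rv B) ++ r ∷ y ∷ flat post)
             (cong (x ∷_) (trans (flat-++ (map pl (toL (rv B))) _) (cong (_++ r ∷ y ∷ flat post) (flat-pl (toL (rv B))))))
             (λ v → occL v)
             (rel , pApp′ (tl B ∷ reverse (md B)) (pathRv B pB) (R-sym rB , pTail pM))
             (tt ∷ Allₚ.++⁺ (Allₚ.map⁺ (All.universal (λ _ → tt) (toL (rv B)))) (tt ∷ tt ∷ aPost))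
             (λ h → trans (deg-++ h (map pl (toL (rv B))) _) (cong (ℕ._+ deg h post) (deg-pl h (toL (rv B)))))
             (trans (nb-++ (map pl (toL (rv B))) _) (cong (ℕ._+ nb post) (nb-pl (toL (rv B))))))
        ∷ (λ rel → ins (pl x ∷ pl r ∷ map pl (toL B) ++ pl y ∷ post) (r ∷ toL B ++ y ∷ flat post)
             (cong (λ z → x ∷ r ∷ z) (trans (flat-++ (map pl (toL B)) _) (cong (_++ y ∷ flat post) (flat-pl (toL B)))))
             (λ v → occR v)
             (proj₁ pM , rB , pApp′ (hd B ∷ md B) pB (R-sym rel , pTail (pTail pM)))
             (tt ∷ tt ∷ Allₚ.++⁺ (Allₚ.map⁺ (All.universal (λ _ → tt) (toL B))) (tt ∷ aPost))
             (λ h → trans (deg-++ h (map pl (toL B)) _) (cong (ℕ._+ deg h post) (deg-pl h (toL B))))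
             (trans (nb-++ (map pl (toL B)) _) (cong (ℕ._+ nb post) (nb-pl (toL B)))))
        ∷ insertGood (pre ++ [ bk x r y B ]) post (Listₚ.++-assoc pre [ bk x r y B ] post)
        where
        aAll = Allₚ.++⁻ʳ pre (blk i)
        aPre = Allₚ.++⁻ˡ pre (blk i)
        rB : R r (hd B)
        rB = proj₁ (All.head aAll)
        B∈ : B ∈ Bs
        B∈ = proj₂ (All.head aAll)
        aPost = All.tail aAll
        pB = proj₁ (okSeg B∈)
        flM : flat (pre ++ bk x r y B ∷ post) ≡ flat pre ++ x ∷ r ∷ y ∷ flat post
        flM = flat-++ pre _
        pM : Path (x ∷ r ∷ y ∷ flat post)
        pM = pR (flat pre) (subst Path flM (path i))
        occL : ∀ v → occ v (x ∷ toL (rv B) ++ r ∷ y ∷ flat post) ≡ occ v (x ∷ r ∷ y ∷ flat post) ℕ.+ occ v (toL B)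
        occL v = trans (cong (⟦ v ≟ x ⟧ ℕ.+_) (trans (occ-++ v (toL (rv B)) _) (trans (cong (ℕ._+ occ v (r ∷ y ∷ flat post)) (occ-rv v B)) (ℕₚ.+-comm (occ v (toL B)) _))))
          (sym (ℕₚ.+-assoc ⟦ v ≟ x ⟧ _ _))
        occR : ∀ v → occ v (x ∷ r ∷ toL B ++ y ∷ flat post) ≡ occ v (x ∷ r ∷ y ∷ flat post) ℕ.+ occ v (toL B)
        occR v = trans (cong (λ z → ⟦ v ≟ x ⟧ ℕ.+ (⟦ v ≟ r ⟧ ℕ.+ z)) (trans (occ-++ v (toL B) _) (ℕₚ.+-comm (occ v (toL B)) _)))
          (asc ⟦ v ≟ x ⟧ ⟦ v ≟ r ⟧ (occ v (y ∷ flat post)) (occ v (toL B)))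
          where
          asc : ∀ a b c d → a ℕ.+ (b ℕ.+ (c ℕ.+ d)) ≡ a ℕ.+ (b ℕ.+ c) ℕ.+ d
          asc = ℕS.solve-∀
        ins : ∀ N ns → flat N ≡ x ∷ ns → (∀ v → occ v (x ∷ ns) ≡ occ v (x ∷ r ∷ y ∷ flat post) ℕ.+ occ v (toL B)) →
              Path (x ∷ ns) → All (BkOk Bs) N → (∀ h → deg h N ≡ deg h post) → nb N ≡ nb post →
              Inv (remSt B (pre ++ N))
        ins N ns fN oc p a dg nbN = removeInv B _ i B∈
          (λ v → trans (cong (occ v) fl) (trans (occ-++ v (flat pre) (x ∷ ns)) (trans (cong (occ v (flat pre) ℕ.+_) (oc v))
             (trans (sym (ℕₚ.+-assoc (occ v (flat pre)) _ _)) (cong (ℕ._+ occ v (toL B)) (trans (sym (occ-++ v (flat pre) _)) (cong (occ v) (sym flM))))))))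
          (subst Path (sym fl) (pApp (flat pre) (pL (flat pre) (subst Path flM (path i))) p))
          (Allₚ.++⁺ aPre a)
          (λ h ne → trans (deg-++ h pre N) (trans (cong (deg h pre ℕ.+_) (trans (dg h) (sym (cong (ℕ._+ deg h post) (⟦≟⟧-no (ne ∘ sym))))))
             (sym (deg-++ h pre _))))
          (ℕₚ.≤-trans (ℕₚ.≤-reflexive (trans (nb-++ pre N) (cong (nb pre ℕ.+_) nbN))) (ℕₚ.≤-trans (ℕₚ.+-monoʳ-≤ (nb pre) (ℕₚ.n≤1+n _)) (ℕₚ.≤-reflexive (sym (nb-++ pre _)))))
          where
          fl : flat (pre ++ N) ≡ flat pre ++ x ∷ ns
          fl = trans (flat-++ pre N) (cong (flat pre ++_) fN)

      colourGood : suc d ℕ.≤ D count → suc (nb M) ℕ.≤ Rc → ∀ pre post → pre ++ post ≡ M → All Good (colourMoves pre post)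
      colourGood dD nR pre [] e = []
      colourGood dD nR pre (it ∷ post) e = Allₚ.++⁺ (here′ it post e)
        (colourGood dD nR (pre ++ [ it ]) post (trans (Listₚ.++-assoc pre [ it ] post) e))
        where
        here′ : ∀ it post → pre ++ it ∷ post ≡ M → All Good (colourHere pre (it ∷ post))
        here′ (bk _ _ _ _) post                    e = []
        here′ (pl p) []                            e = []
        here′ (pl p) (bk _ _ _ _ ∷ post)           e = []
        here′ (pl p) (pl u ∷ [])                   e = []
        here′ (pl p) (pl u ∷ bk _ _ _ _ ∷ post)    e = []
        here′ (pl p) (pl u ∷ pl q ∷ post)          refl = (λ rel → mkInv d low (B₀ ∷ high) M′ (record
          { once = λ v → trans (cong₂ ℕ._+_ (cong (occ v) fl) (trans (occS-++ v low (B₀ ∷ high)) (trans (sw (occS v low) (occ v (toL B₀)) (occS v high)) (cong (occ v (toL B₀) ℕ.+_) (sym (occS-++ v low high)))))) (once i v)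
          ; path = subst Path (sym fl) (path i)
          ; okL = All.tail (okL i) ; okH = All.head (okL i) ∷ okH i
          ; blk = Allₚ.++⁺ (All.map (λ {a} → move a) (Allₚ.++⁻ˡ pre (blk i)))
                    ((rel , ∈ₚ.∈-++⁺ʳ low (here refl)) ∷ All.map (λ {a} → move a) (All.tail (All.tail (All.tail (Allₚ.++⁻ʳ pre (blk i))))))
          ; degL = All.zipWith (λ {B} (ne , q) → trans (dg′ (hd B)) (trans (cong (ℕ._+ deg (hd B) M) (⟦≟⟧-no (ne ∘ sym))) q)) (lowNe , All.tail (degL i))
          ; degH = trans (dg′ (hd B₀)) (cong₂ ℕ._+_ (⟦≟⟧-refl (hd B₀)) (All.head (degL i)))
                   ∷ All.zipWith (λ {B} (ne , q) → trans (dg′ (hd B)) (trans (cong (ℕ._+ deg (hd B) M) (⟦≟⟧-no (ne ∘ sym))) q)) (highNe , degH i)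
          ; dbL = λ _ → subst (λ z → d ℕ.≤ D z) cEq (ℕₚ.≤-trans (ℕₚ.n≤1+n d) dD)
          ; dbH = λ _ → subst (λ z → suc d ℕ.≤ D z) cEq dD
          ; few = ℕₚ.≤-trans (ℕₚ.≤-reflexive (trans (nb-++ pre _) (trans (ℕₚ.+-suc (nb pre) (nb post)) (cong suc (sym (nb-++ pre _)))))) nR })) ∷ []
          where
          M′ = pre ++ bk p u q B₀ ∷ post
          fl : flat M′ ≡ flat (pre ++ pl p ∷ pl u ∷ pl q ∷ post)
          fl = trans (flat-++ pre _) (sym (flat-++ pre _))
          sw : ∀ a b c → a ℕ.+ (b ℕ.+ c) ≡ b ℕ.+ (a ℕ.+ c)
          sw = ℕS.solve-∀
          cEq : count ≡ length low ℕ.+ suc (length high)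
          cEq = sym (ℕₚ.+-suc (length low) (length high))
          dg′ : ∀ h → deg h M′ ≡ ⟦ h ≟ hd B₀ ⟧ ℕ.+ deg h (pre ++ pl p ∷ pl u ∷ pl q ∷ post)
          dg′ h = trans (deg-++ h pre _) (trans (sw (deg h pre) ⟦ h ≟ hd B₀ ⟧ (deg h post)) (cong (⟦ h ≟ hd B₀ ⟧ ℕ.+_) (sym (deg-++ h pre _))))
          ne∈ : ∀ {B} → B ∈ low ++ high → hd B₀ ≢ hd B
          ne∈ = hd-distinct {A = B₀} (once≤ i (hd B₀))
          lowNe : All (λ B → hd B₀ ≢ hd B) low
          lowNe = All.tabulate (λ p → ne∈ (∈ₚ.∈-++⁺ˡ p))
          highNe : All (λ B → hd B₀ ≢ hd B) high
          highNe = All.tabulate (λ p → ne∈ (∈ₚ.∈-++⁺ʳ low p))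
          mv : ∀ {B} → B ∈ Bs → B ∈ low ++ B₀ ∷ high
          mv (here refl) = ∈ₚ.∈-++⁺ʳ low (here refl)
          mv (there p) with ∈ₚ.∈-++⁻ low p
          ... | inj₁ a = ∈ₚ.∈-++⁺ˡ a
          ... | inj₂ b = ∈ₚ.∈-++⁺ʳ low (there b)
          move : ∀ a → BkOk Bs a → BkOk (low ++ B₀ ∷ high) a
          move (pl _)       _       = tt
          move (bk x r y B) (a , b) = a , mv b

      mainGood : All Good (Main.moves d B₀ low high M)
      mainGood = Allₚ.++⁺ (All-concatMap (attach M) Bs (All.tabulate (λ {B} p → attachGood B p)))
                   (Allₚ.++⁺ (insertGood [] M refl) al)
        where
        al : All Good (allowed M (colourMoves [] M))
        al with suc d ℕ.≤? D count | suc (nb M) ℕ.≤? Rc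
        ... | yes a | yes b = colourGood a b [] M refl
        ... | yes _ | no _  = []
        ... | no _  | _     = []

    toStInv : ∀ ss Bs → (∀ v → occ v ss ℕ.+ occS v Bs ≡ 1) → All OkSeg Bs → Inv (toSt ss Bs)
    toStInv (s ∷ ss) Bs o a = o , a
    toStInv []       Bs o a = mkInv 0 Bs [] [] (record
      { once = λ v → trans (cong (occS v) (Listₚ.++-identityʳ Bs)) (o v) ; path = tt ; okL = a ; okH = [] ; blk = []
      ; degL = All.universal (λ _ → refl) Bs ; degH = [] ; dbL = λ _ → z≤n ; dbH = λ () ; few = z≤n })

    growGood : 2 ℕ.≤ L → ∀ s ss Bs → Inv (grow s ss Bs) → All (λ { (u , v , s′ , _) → R u v → Inv s′ }) (moves (grow s ss Bs))
    growGood 2≤L s ss Bs (o , a) = Allₚ.++⁺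
      (All-concatMap (pairMove Bs) _ (All.map (λ {p} → pr p) (picks-↭ (s ∷ ss))))
      (All-concatMap (extMove s ss) _ (All.map (λ {p} → ex p) (picks-↭ Bs)))
      where
      G : Move → Set
      G (u , v , s′ , _) = R u v → Inv s′
      pr : ∀ p → (s ∷ ss) ↭ proj₁ p ∷ proj₂ p → All G (pairMove Bs p)
      pr (x , [])     e = []
      pr (x , y ∷ ys) e = (λ r → toStInv ys _ (λ v → trans (arr (occ v ys) ⟦ v ≟ x ⟧ ⟦ v ≟ y ⟧ (occS v Bs)) (trans (cong (ℕ._+ occS v Bs) (sym (occ-↭ v e))) (o v)))
                             (((r , tt) , 2≤L) ∷ a)) ∷ []
        where
        arr : ∀ a b c d → a ℕ.+ (b ℕ.+ (c ℕ.+ 0) ℕ.+ d) ≡ b ℕ.+ (c ℕ.+ a) ℕ.+ d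
        arr = ℕS.solve-∀
      ex : ∀ p → Bs ↭ proj₁ p ∷ proj₂ p → All G (extMove s ss p)
      ex (B , Cs) e with size B ℕ.<? L
      ... | no _ = []
      ... | yes lt = (λ r → toStInv ss _ (λ v → trans (arr (occ v ss) ⟦ v ≟ s ⟧ (occ v (toL B)) (occS v Cs)) (eqB v))
                               (((R-sym r , proj₁ okB) , lt) ∷ All.tail aa))
                   ∷ (λ r → toStInv ss _ (λ v → trans (cong (λ z → occ v ss ℕ.+ (z ℕ.+ occS v Cs)) (trans (occ-++ v (toL B) [ s ]) (cong (occ v (toL B) ℕ.+_) (ℕₚ.+-identityʳ ⟦ v ≟ s ⟧))))
                                             (trans (arr₂ (occ v ss) ⟦ v ≟ s ⟧ (occ v (toL B)) (occS v Cs)) (eqB v)))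
                               ((pApp′ (hd B ∷ md B) (proj₁ okB) (r , tt) , subst (ℕ._≤ L) (cong (2 ℕ.+_) (sym (trans (Listₚ.length-++ (md B)) (ℕₚ.+-comm (length (md B)) 1)))) lt) ∷ All.tail aa)) ∷ []
        where
        aa = ↭ₚ.All-resp-↭ e a
        okB = All.head aa
        eqB : ∀ v → ⟦ v ≟ s ⟧ ℕ.+ occ v ss ℕ.+ (occ v (toL B) ℕ.+ occS v Cs) ≡ 1
        eqB v = trans (cong (λ z → ⟦ v ≟ s ⟧ ℕ.+ occ v ss ℕ.+ z) (sym (occS-↭ v e))) (o v)
        arr : ∀ a b c d → a ℕ.+ (b ℕ.+ c ℕ.+ d) ≡ b ℕ.+ a ℕ.+ (c ℕ.+ d)
        arr = ℕS.solve-∀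
        arr₂ : ∀ a b c d → a ℕ.+ (c ℕ.+ b ℕ.+ d) ≡ b ℕ.+ a ℕ.+ (c ℕ.+ d)
        arr₂ = ℕS.solve-∀

    module _ {M : List (Item n ⊤)} {e : V} {vs : List V} (once′ : ∀ v → occ v (flat M) ≡ 1) (path′ : Path (flat M))
             (fl : flat M ≡ e ∷ vs) (bks : All (BkC e) M) where

      private
        f = lastOr e vs
        G : Move → Set
        G (u , v , s′ , _) = R u v → Inv s′

      open Clos e f hiding (moves)

      lastOr-++ : ∀ a xs b ys → lastOr a (xs ++ b ∷ ys) ≡ lastOr b ys
      lastOr-++ a []       b ys = refl
      lastOr-++ a (x ∷ xs) b ys = lastOr-++ x xs b ys

      pSnoc : ∀ a as {x} → Path (a ∷ as) → R (lastOr a as) x → Path (a ∷ as ++ [ x ])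
      pSnoc a []       p       r = r , tt
      pSnoc a (b ∷ bs) (q , p) r = q , pSnoc b bs p r

      cycle : ∀ P x r Q → flat M ≡ P ++ x ∷ r ∷ Q → R r e → R x f → Cycle
      cycle P x r Q eq re xf = build P eq full onceW
        where
        lastQ : ∀ P → flat M ≡ P ++ x ∷ r ∷ Q → lastOr r Q ≡ f
        lastQ []       eq′ with trans (sym eq′) fl
        ... | refl = refl
        lastQ (a ∷ P)  eq′ with trans (sym eq′) fl
        ... | refl = sym (lastOr-++ a P x (r ∷ Q))
        pQ : Path (r ∷ Q)
        pQ = pTail (pR P (subst Path eq path′))
        -- The part of the path after x is walked backwards: from x over the new edge to f, down to
        -- r, and over the waiting edge to e.
        back : Path (x ∷ reverse (r ∷ Q) ++ [ e ])
        back = subst Path (trans (Listₚ.reverse-++ (e ∷ r ∷ Q) [ x ]) (cong (x ∷_) (Listₚ.unfold-reverse e (r ∷ Q))))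
                 (pRev (e ∷ r ∷ Q ++ [ x ]) (R-sym re , pSnoc r Q pQ (subst (λ z → R z x) (sym (lastQ P eq)) (R-sym xf))))
        full : Path ((P ++ x ∷ reverse (r ∷ Q)) ++ [ e ])
        full = subst Path (sym (Listₚ.++-assoc P (x ∷ reverse (r ∷ Q)) [ e ])) (pApp P (pL P (subst Path eq path′)) back)
        onceW : ∀ v → occ v (P ++ x ∷ reverse (r ∷ Q)) ≡ 1
        onceW v = trans (occ-++ v P _) (trans (cong (λ z → occ v P ℕ.+ (⟦ v ≟ x ⟧ ℕ.+ z)) (occ-reverse v (r ∷ Q)))
                    (trans (sym (occ-++ v P (x ∷ r ∷ Q))) (trans (cong (occ v) (sym eq)) (once′ v))))
        build : ∀ P′ → flat M ≡ P′ ++ x ∷ r ∷ Q → Path ((P′ ++ x ∷ reverse (r ∷ Q)) ++ [ e ]) →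
                (∀ v → occ v (P′ ++ x ∷ reverse (r ∷ Q)) ≡ 1) → Cycle
        build [] eq′ fu on with trans (sym eq′) fl
        ... | refl = e , reverse (r ∷ Q) , on , fu
        build (a ∷ P′) eq′ fu on with trans (sym eq′) fl
        ... | refl = e , P′ ++ x ∷ reverse (r ∷ Q) , on , fu

      closeGood : ∀ pre post → pre ++ post ≡ M → All G (closeMoves post)
      closeGood pre [] eq = []
      closeGood pre (pl v ∷ post) eq = closeGood (pre ++ [ pl v ]) post (trans (Listₚ.++-assoc pre [ pl v ] post) eq)
      closeGood pre (bk x r y t ∷ post) refl =
        (λ xf → cycle (flat pre) x r (y ∷ flat post) (flat-++ pre _) (All.head (Allₚ.++⁻ʳ pre bks)) xf)
        ∷ closeGood (pre ++ [ bk x r y t ]) post (Listₚ.++-assoc pre [ bk x r y t ] post)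

      colourGoodC : ∀ pre post → pre ++ post ≡ M → All G (colourMoves pre post)
      colourGoodC pre [] eq = []
      colourGoodC pre (it ∷ post) eq = Allₚ.++⁺ (here′ it post eq)
        (colourGoodC (pre ++ [ it ]) post (trans (Listₚ.++-assoc pre [ it ] post) eq))
        where
        here′ : ∀ it post → pre ++ it ∷ post ≡ M → All G (colourHere pre (it ∷ post))
        here′ (bk _ _ _ _) post                    eq = []
        here′ (pl p) []                            eq = []
        here′ (pl p) (bk _ _ _ _ ∷ post)           eq = []
        here′ (pl p) (pl u ∷ [])                   eq = []
        here′ (pl p) (pl u ∷ bk _ _ _ _ ∷ post)    eq = []
        here′ (pl p) (pl u ∷ pl q ∷ post)          refl = (λ rel →
          (λ v → trans (cong (occ v) fl′) (once′ v)) , subst Path (sym fl′) path′ ,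
          (λ e′ vs′ q′ → subst (λ z → All (BkC z) _) (hdEq (trans (sym fl) (trans (sym fl′) q′)))
             (Allₚ.++⁺ (Allₚ.++⁻ˡ pre bks) (rel ∷ All.tail (All.tail (All.tail (Allₚ.++⁻ʳ pre bks))))))) ∷ []
          where
          fl′ : flat (pre ++ bk p u q tt ∷ post) ≡ flat (pre ++ pl p ∷ pl u ∷ pl q ∷ post)
          fl′ = trans (flat-++ pre _) (sym (flat-++ pre _))
          hdEq : ∀ {a b : V} {as bs : List V} → a List.∷ as ≡ b List.∷ bs → a ≡ b
          hdEq refl = refl

      closGood : All G (Clos.moves e f M)
      closGood = Allₚ.++⁺ (closeGood [] M refl) al
        where
        al : All G (allowed M (colourMoves [] M))
        al with suc (nb M) ℕ.≤? K
        ... | yes _ = colourGoodC [] M refl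
        ... | no _  = []

    movesGood : 2 ℕ.≤ L → ∀ s → Inv s → All (λ { (u , v , s′ , _) → R u v → Inv s′ }) (moves s)
    movesGood 2≤L (grow s ss Bs)        i = growGood 2≤L s ss Bs i
    movesGood 2≤L (main d B low high M) i = mainGood i
    movesGood 2≤L (clos M) (o , p , b) = go (flat M) refl
      where
      go : ∀ xs → flat M ≡ xs → All _ (closMoves M xs)
      go []       e = []
      go (x ∷ xs) e = closGood o p e (b x xs e)
    movesGood 2≤L done                  i = []

  -- A played edge enlarges the relation; the old invariant is carried over first, and only then the
  -- new edge is used by the move.
  Inv-mono : ∀ {R R′ : V → V → Set} (s : ∀ {a b} → R a b → R b a) (s′ : ∀ {a b} → R′ a b → R′ b a) →
             (∀ {a b} → R a b → R′ a b) → ∀ st → WithR.Inv R s st → WithR.Inv R′ s′ st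
  Inv-mono {R} {R′} s s′ f = go
    where
    module A = WithR R s
    module B = WithR R′ s′
    pm : ∀ xs → A.Path xs → B.Path xs
    pm []           p       = tt
    pm (x ∷ [])     p       = tt
    pm (x ∷ y ∷ xs) (r , p) = f r , pm (y ∷ xs) p
    om : ∀ {C} → A.OkSeg C → B.OkSeg C
    om {C} (p , q) = pm (toL C) p , q
    bm : ∀ {Bs} it → A.BkOk Bs it → B.BkOk Bs it
    bm (pl _)       _       = tt
    bm (bk x r y B) (p , q) = f p , q
    cm : ∀ {e} it → A.BkC e it → B.BkC e it
    cm (pl _)       _ = tt
    cm (bk x r y B) p = f p
    go : ∀ st → A.Inv st → B.Inv st
    go (grow x ss Bs) (o , a) = o , All.map om a
    go (main d C low high M) i = record
      { once = A.once i ; path = pm (flat M) (A.path i) ; okL = All.map om (A.okL i) ; okH = All.map om (A.okH i)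
      ; blk = All.map (λ {it} → bm it) (A.blk i) ; degL = A.degL i ; degH = A.degH i ; dbL = A.dbL i ; dbH = A.dbH i ; few = A.few i }
    go (clos M) (o , p , b) = o , pm (flat M) p , λ e vs eq → All.map (λ {it} → cm it) (b e vs eq)
    go done (w , ws , o , p) = w , ws , o , pm _ p

-- From a cyclic list of all vertices to a Hamiltonian cycle, and correctness of the strategy.

∑-occ : ∀ {n} (xs : List (Fin n)) → ∑ (λ v → occ v xs) ≡ length xs
∑-occ {n} []   = trans (∑-const {n} 0) (ℕₚ.*-zeroʳ n)
∑-occ (x ∷ xs) = trans (∑-+ (λ v → ⟦ v ≟ x ⟧) (λ v → occ v xs)) (cong₂ ℕ._+_ (∑-indicator x) (∑-occ xs))

length-once : ∀ {n} (xs : List (Fin n)) → (∀ v → occ v xs ≡ 1) → length xs ≡ n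
length-once {n} xs h = trans (sym (∑-occ xs)) (trans (ext xs h) (trans (∑-const {n} 1) (ℕₚ.*-identityʳ n)))
  where
  ∑-≡ : ∀ {m} {f g : Fin m → ℕ} → (∀ u → f u ≡ g u) → ∑ f ≡ ∑ g
  ∑-≡ {zero}  e = refl
  ∑-≡ {suc m} e = cong₂ ℕ._+_ (e zero) (∑-≡ (e ∘ suc))
  ext : ∀ xs → (∀ v → occ v xs ≡ 1) → ∑ {n} (λ v → occ v xs) ≡ ∑ {n} (λ _ → 1)
  ext xs h = ∑-≡ h

index : ∀ {n} (v : Fin n) xs → 1 ℕ.≤ occ v xs → Σ (Fin (length xs)) (λ i → lookup xs i ≡ v)
index v (x ∷ xs) h with v Fin.≟ x
... | yes e = zero , sym e
... | no _ with index v xs h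
...   | i , e = suc i , e

occ-lookup : ∀ {n} (xs : List (Fin n)) i → 1 ℕ.≤ occ (lookup xs i) xs
occ-lookup (x ∷ xs) zero    = occ-self x xs
occ-lookup (x ∷ xs) (suc i) = ℕₚ.≤-trans (occ-lookup xs i) (ℕₚ.m≤n+m _ ⟦ lookup xs i ≟ x ⟧)

lookup-inj : ∀ {n} (xs : List (Fin n)) → (∀ v → occ v xs ℕ.≤ 1) → ∀ i j → lookup xs i ≡ lookup xs j → i ≡ j
lookup-inj (x ∷ xs) h zero zero e = refl
lookup-inj (x ∷ xs) h (suc i) (suc j) e = cong suc (lookup-inj xs (λ v → ℕₚ.≤-trans (ℕₚ.m≤n+m _ ⟦ v ≟ x ⟧) (h v)) i j e)
lookup-inj (x ∷ xs) h zero (suc j) e with ℕₚ.≤-trans (ℕₚ.+-mono-≤ (ℕₚ.≤-reflexive (sym (⟦≟⟧-refl x))) (subst (λ z → 1 ℕ.≤ occ z xs) (sym e) (occ-lookup xs j))) (h x)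
... | s≤s ()
lookup-inj (x ∷ xs) h (suc i) zero e with ℕₚ.≤-trans (ℕₚ.+-mono-≤ (ℕₚ.≤-reflexive (sym (⟦≟⟧-refl x))) (subst (λ z → 1 ℕ.≤ occ z xs) e (occ-lookup xs i))) (h x)
... | s≤s ()

-- Equality is allowed alongside adjacency so that the bookkeeping never has to exclude v = u; a cycle that
-- visits every vertex exactly once rules it out at the end.
Link : ∀ {n} → EdgeList n → Fin n → Fin n → Set
Link E a b = a ≡ b ⊎ Adjacent E a b

Link-sym : ∀ {n} {E : EdgeList n} {a b} → Link E a b → Link E b a
Link-sym (inj₁ e)        = inj₁ (sym e)
Link-sym (inj₂ (inj₁ p)) = inj₂ (inj₂ p)
Link-sym (inj₂ (inj₂ p)) = inj₂ (inj₁ p)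

Link-mono : ∀ {n} {E : EdgeList n} {e a b} → Link E a b → Link (E ++ [ e ]) a b
Link-mono (inj₁ e)        = inj₁ e
Link-mono (inj₂ (inj₁ p)) = inj₂ (inj₁ (∈ₚ.∈-++⁺ˡ p))
Link-mono (inj₂ (inj₂ p)) = inj₂ (inj₂ (∈ₚ.∈-++⁺ˡ p))

module Hamiltonian {n : ℕ} (E : EdgeList n) where

  open Paths (Link E) Link-sym

  path-lookup : ∀ xs → Path xs → ∀ i j → toℕ j ≡ suc (toℕ i) → Link E (lookup xs i) (lookup xs j)
  path-lookup (x ∷ y ∷ xs) (r , p) zero    (suc zero)    e  = r
  path-lookup (x ∷ y ∷ xs) (r , p) zero    (suc (suc j)) ()
  path-lookup (x ∷ y ∷ xs) (r , p) (suc i) (suc j)       e  = path-lookup (y ∷ xs) p i j (ℕₚ.suc-injective e)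
  path-lookup (x ∷ [])     p       zero    (suc ())      e
  path-lookup (x ∷ [])     p       (suc ()) j            e
  path-lookup (x ∷ y ∷ xs) p       zero    zero          ()
  path-lookup (x ∷ xs)     p       (suc i) zero          ()
  path-lookup (x ∷ [])     p       zero    zero          ()

  path-last : ∀ xs z → Path (xs ++ [ z ]) → ∀ i → suc (toℕ i) ≡ length xs → Link E (lookup xs i) z
  path-last (x ∷ [])     z (r , _) zero    e = r
  path-last (x ∷ y ∷ xs) z (_ , p) zero    ()
  path-last (x ∷ y ∷ xs) z (_ , p) (suc i) e = path-last (y ∷ xs) z p i (ℕₚ.suc-injective e)

  hamiltonian : 3 ℕ.≤ n → ∀ w ws → (∀ v → occ v (w ∷ ws) ≡ 1) → Path (w ∷ ws ++ [ w ]) → IsHamiltonian E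
  hamiltonian 3≤n w ws once p = go (length-once W once) 3≤n
    where
    W = w ∷ ws
    once≤ : ∀ v → occ v W ℕ.≤ 1
    once≤ v = ℕₚ.≤-reflexive (once v)
    pW : Path W
    pW = subst Path (Listₚ.++-identityʳ W) (subst Path (Listₚ.++-identityʳ (W ++ [])) (dropLast W p))
      where
      dropLast : ∀ xs → Path (xs ++ [ w ]) → Path ((xs ++ []) ++ [])
      dropLast [] q = tt
      dropLast (x ∷ []) q = tt
      dropLast (x ∷ y ∷ xs) (r , q) = r , dropLast (y ∷ xs) q
    go : length W ≡ n → 3 ℕ.≤ n → IsHamiltonian E
    go e 3≤ = 3≤ , permutation to from (λ x → toFrom {x} refl) (λ x → fromTo {x} refl) , adj
      where
      to from : Fin n → Fin n
      to i   = lookup W (Fin.cast (sym e) i)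
      from v = Fin.cast e (proj₁ (index v W (ℕₚ.≤-reflexive (sym (once v)))))
      toFrom : ∀ {x y} → y ≡ from x → to y ≡ x
      toFrom {x} refl = trans (cong (lookup W) (Finₚ.cast-involutive (sym e) e _)) (proj₂ (index x W _))
      inj-to : ∀ {i j} → to i ≡ to j → i ≡ j
      inj-to {i} {j} q = trans (sym (Finₚ.cast-involutive e (sym e) i)) (trans (cong (Fin.cast e) (lookup-inj W once≤ _ _ q)) (Finₚ.cast-involutive e (sym e) j))
      fromTo : ∀ {x y} → y ≡ to x → from y ≡ x
      fromTo {x} refl = inj-to (toFrom {to x} refl)
      strict : ∀ {i j} → i ≢ j → Link E (to i) (to j) → Adjacent E (to i) (to j)
      strict ne (inj₁ q) = ⊥-elim (ne (inj-to q))
      strict ne (inj₂ a) = a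
      adj : ∀ i j → CycSucc i j → Adjacent E (to i) (to j)
      adj i j (inj₁ q) = strict (λ { refl → ℕₚ.1+n≢n (sym q) })
        (path-lookup W pW _ _ (trans (Finₚ.toℕ-cast (sym e) j) (trans q (cong suc (sym (Finₚ.toℕ-cast (sym e) i))))))
      adj i j (inj₂ (q₁ , q₂)) = strict ne (subst (Link E (to i)) (sym toj)
          (path-last W w p _ (trans (cong suc (Finₚ.toℕ-cast (sym e) i)) (trans (cong suc q₁) (trans (sucpred 3≤) (sym e))))))
        where
        sucpred : ∀ {m} → 3 ℕ.≤ m → suc (m ℕ.∸ 1) ≡ m
        sucpred (s≤s _) = refl
        ne : i ≢ j
        ne refl with subst (3 ℕ.≤_) (trans (sym (sucpred 3≤)) (cong suc (trans (sym q₁) q₂))) 3≤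
        ... | s≤s ()
        toj : to j ≡ w
        toj = cong (lookup W) zj
          where
          zj : Fin.cast (sym e) j ≡ zero
          zj = Finₚ.toℕ-injective (trans (Finₚ.toℕ-cast (sym e) j) q₂)

find-All : ∀ {n} {A : Set} {P : Fin n × A → Set} (u : Fin n) (ms : List (Fin n × A)) {a} → All P ms → find u ms ≡ just a → P (u , a)
find-All u ((k , b) ∷ ms) (p ∷ ps) e with u Fin.≟ k
find-All u ((k , b) ∷ ms) (p ∷ ps) refl | yes refl = p
... | no _ = find-All u ms ps e

⟦≟⟧-sym : ∀ {n} (u v : Fin n) → ⟦ u ≟ v ⟧ ≡ ⟦ v ≟ u ⟧
⟦≟⟧-sym u v with u Fin.≟ v
... | yes refl = sym (⟦≟⟧-refl u)
... | no ne    = sym (⟦≟⟧-no (ne ∘ sym))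

occ-tabulate : ∀ {n m} (v : Fin n) (f : Fin m → Fin n) → occ v (List.tabulate f) ≡ ∑ (λ i → ⟦ v ≟ f i ⟧)
occ-tabulate {m = zero}  v f = refl
occ-tabulate {m = suc m} v f = cong (⟦ v ≟ f zero ⟧ ℕ.+_) (occ-tabulate v (f ∘ suc))

occ-allFin : ∀ {n} (v : Fin n) → occ v (List.allFin n) ≡ 1
occ-allFin {n} v = trans (occ-tabulate v (λ i → i)) (trans (flip v) (∑-indicator v))
  where
  ∑-≡ : ∀ {m} {f g : Fin m → ℕ} → (∀ u → f u ≡ g u) → ∑ f ≡ ∑ g
  ∑-≡ {zero}  e = refl
  ∑-≡ {suc m} e = cong₂ ℕ._+_ (e zero) (∑-≡ (e ∘ suc))
  flip : ∀ v → ∑ (λ i → ⟦ v ≟ i ⟧) ≡ ∑ (λ i → ⟦ i ≟ v ⟧)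
  flip v = ∑-≡ (⟦≟⟧-sym v)

otherThan : ∀ {n} → 3 ℕ.≤ n → (u : Fin n) → Σ (Fin n) (λ v → v ≢ u)
otherThan (s≤s (s≤s _)) zero    = suc zero , λ ()
otherThan (s≤s (s≤s _)) (suc u) = zero , λ ()

module Assembly (n : ℕ) (3≤n : 3 ℕ.≤ n) (L : ℕ) (2≤L : 2 ℕ.≤ L) (D : ℕ → ℕ) (Rc K : ℕ)
                (D-anti : ∀ {a b} → a ℕ.≤ b → D b ℕ.≤ D a) where

  open Process n L D Rc K
  open Invariants n L D Rc K D-anti

  Inv : EdgeList n → St → Set
  Inv E = WithR.Inv (Link E) Link-sym

  init : St
  init = toSt (List.allFin n) []

  pick : St → (u : Fin n) → Σ (Fin n) (λ v → v ≢ u)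
  pick = choose (otherThan 3≤n)

  inv₀ : Inv [] init
  inv₀ = WithR.toStInv (Link []) Link-sym (List.allFin n) [] (λ v → trans (ℕₚ.+-identityʳ _) (occ-allFin v)) []

  invₛ : ∀ E s u → Inv E s → Inv (E ++ [ (u , proj₁ (pick s u)) ]) (step s u)
  invₛ E s u i with find u (moves s) in eq
  ... | nothing = Inv-mono Link-sym Link-sym Link-mono s i
  ... | just (v , s′ , l) = find-All u (moves s)
          (WithR.movesGood (Link E′) Link-sym 2≤L s (Inv-mono Link-sym Link-sym Link-mono s i)) eq link
    where
    E′ = E ++ [ (u , proj₁ (avoid (otherThan 3≤n) u v)) ]
    link : Link E′ u v
    link with v Fin.≟ u
    ... | yes e = inj₁ (sym e)
    ... | no _  = inj₂ (inj₁ (∈ₚ.∈-++⁺ʳ E (here refl)))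

  fin : ∀ E s → Inv E s → alive s ≡ 0 → IsHamiltonian E
  fin E done (w , ws , o , p) _ = Hamiltonian.hamiltonian E 3≤n w ws o p

  open Strat step alive alive≤1 init pick Inv inv₀ invₛ fin public

-- Numbers of moves of each kind, and their effects.

sizeS : ∀ {n} → List (Seg n) → ℕ
sizeS []       = 0
sizeS (B ∷ Bs) = size B ℕ.+ sizeS Bs

sizeS-++ : ∀ {n} (As Bs : List (Seg n)) → sizeS (As ++ Bs) ≡ sizeS As ℕ.+ sizeS Bs
sizeS-++ []       Bs = refl
sizeS-++ (A ∷ As) Bs = trans (cong (size A ℕ.+_) (sizeS-++ As Bs)) (sym (ℕₚ.+-assoc (size A) (sizeS As) (sizeS Bs)))

sizeS-≥ : ∀ {n} (Bs : List (Seg n)) → 2 ℕ.* length Bs ℕ.≤ sizeS Bs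
sizeS-≥ []       = z≤n
sizeS-≥ (B ∷ Bs) = ℕₚ.≤-trans (ℕₚ.≤-reflexive (ℕₚ.*-suc 2 (length Bs))) (ℕₚ.+-mono-≤ (s≤s (s≤s z≤n)) (sizeS-≥ Bs))

∑-occS : ∀ {n} (Bs : List (Seg n)) → ∑ (λ v → occS v Bs) ≡ sizeS Bs
∑-occS {n} []   = trans (∑-const {n} 0) (ℕₚ.*-zeroʳ n)
∑-occS (B ∷ Bs) = trans (∑-+ (λ v → occ v (toL B)) (λ v → occS v Bs)) (cong₂ ℕ._+_ (trans (∑-occ (toL B)) (length-toL B)) (∑-occS Bs))

∑-ext : ∀ {m} {f g : Fin m → ℕ} → (∀ u → f u ≡ g u) → ∑ f ≡ ∑ g
∑-ext {zero}  e = refl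
∑-ext {suc m} e = cong₂ ℕ._+_ (e zero) (∑-ext (e ∘ suc))

total : ∀ {n} (xs : List (Fin n)) Bs → (∀ v → occ v xs ℕ.+ occS v Bs ≡ 1) → length xs ℕ.+ sizeS Bs ≡ n
total {n} xs Bs h = begin
  length xs ℕ.+ sizeS Bs                       ≡⟨ cong₂ ℕ._+_ (sym (∑-occ xs)) (sym (∑-occS Bs)) ⟩
  ∑ (λ v → occ v xs) ℕ.+ ∑ (λ v → occS v Bs)   ≡⟨ sym (∑-+ (λ v → occ v xs) (λ v → occS v Bs)) ⟩
  ∑ {n} (λ v → occ v xs ℕ.+ occS v Bs)         ≡⟨ ∑-ext h ⟩
  ∑ {n} (λ _ → 1)                              ≡⟨ trans (∑-const {n} 1) (ℕₚ.*-identityʳ n) ⟩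
  n ∎
  where open ≡-Reasoning

sumBk : ∀ {n} → (Seg n → ℤ) → List (Item n (Seg n)) → ℤ
sumBk f []               = 0ℤ
sumBk f (pl _ ∷ M)       = sumBk f M
sumBk f (bk _ _ _ B ∷ M) = f B + sumBk f M

sumS : ∀ {n} → (Seg n → ℤ) → List (Seg n) → ℤ
sumS f []       = 0ℤ
sumS f (B ∷ Bs) = f B + sumS f Bs

sumS-cong : ∀ {n} {f g : Seg n → ℤ} Bs → (∀ B → f B ≡ g B) → sumS f Bs ≡ sumS g Bs
sumS-cong []       e = refl
sumS-cong (B ∷ Bs) e = cong₂ ℤ._+_ (e B) (sumS-cong Bs e)

sumS-+ : ∀ {n} (f g : Seg n → ℤ) Bs → sumS (λ B → f B + g B) Bs ≡ sumS f Bs + sumS g Bs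
sumS-+ f g []       = refl
sumS-+ f g (B ∷ Bs) = trans (cong (λ z → (f B + g B) + z) (sumS-+ f g Bs)) (arr (f B) (g B) (sumS f Bs) (sumS g Bs))
  where
  arr : ∀ a b c d → (a + b) + (c + d) ≡ (a + c) + (b + d)
  arr = ℤS.solve-∀

sumS-++ : ∀ {n} (f : Seg n → ℤ) As Bs → sumS f (As ++ Bs) ≡ sumS f As + sumS f Bs
sumS-++ f []       Bs = sym (ℤₚ.+-identityˡ _)
sumS-++ f (A ∷ As) Bs = trans (cong (λ z → f A + z) (sumS-++ f As Bs)) (sym (ℤₚ.+-assoc (f A) (sumS f As) (sumS f Bs)))

sumS-0 : ∀ {n} (Bs : List (Seg n)) → sumS (λ _ → 0ℤ) Bs ≡ 0ℤ
sumS-0 []       = refl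
sumS-0 (_ ∷ Bs) = trans (ℤₚ.+-identityˡ _) (sumS-0 Bs)

sumS-zero : ∀ {n} (f : Seg n → ℤ) (h : Fin n) Bs → (∀ {B} → B ∈ Bs → hd B ≢ h) → sumS (λ B → + ⟦ hd B ≟ h ⟧ * f B) Bs ≡ 0ℤ
sumS-zero f h []       ne = refl
sumS-zero f h (B ∷ Bs) ne = trans (cong₂ ℤ._+_ (trans (cong (λ z → + z * f B) (⟦≟⟧-no (ne (here refl)))) (ℤₚ.*-zeroˡ (f B)))
                                   (sumS-zero f h Bs (ne ∘ there))) refl

sumS-indicator : ∀ {n} (f : Seg n → ℤ) {T : Seg n} Bs → T ∈ Bs → (∀ v → occS v Bs ℕ.≤ 1) →
                 sumS (λ B → + ⟦ hd B ≟ hd T ⟧ * f B) Bs ≡ f T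
sumS-indicator f {T} (B ∷ Bs) (here refl) h = trans (cong₂ ℤ._+_ (trans (cong (λ z → + z * f T) (⟦≟⟧-refl (hd T))) (ℤₚ.*-identityˡ (f T)))
  (sumS-zero f (hd T) Bs (λ p → hd-distinct {A = T} (h (hd T)) p ∘ sym))) (ℤₚ.+-identityʳ (f T))
sumS-indicator f {T} (B ∷ Bs) (there p) h = trans (cong₂ ℤ._+_
  (trans (cong (λ z → + z * f B) (⟦≟⟧-no (hd-distinct {A = B} (h (hd B)) p))) (ℤₚ.*-zeroˡ (f B)))
  (sumS-indicator f Bs p (λ v → ℕₚ.≤-trans (ℕₚ.m≤n+m _ (occ v (toL B))) (h v)))) (ℤₚ.+-identityˡ (f T))

Target∈ : ∀ {n} → List (Seg n) → Item n (Seg n) → Set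
Target∈ Bs (pl _)       = ⊤
Target∈ Bs (bk _ _ _ B) = B ∈ Bs

-- Double counting: every block is charged to its target, and a segment is charged once for each
-- unit of its degree.
sumBk-double : ∀ {n} (f : Seg n → ℤ) Bs (M : List (Item n (Seg n))) → (∀ v → occS v Bs ℕ.≤ 1) →
               All (Target∈ Bs) M →
               sumBk f M ≡ sumS (λ B → + deg (hd B) M * f B) Bs
sumBk-double f Bs [] h [] = sym (trans (sumS-cong Bs (λ B → ℤₚ.*-zeroˡ (f B))) (sumS-0 Bs))
sumBk-double f Bs (pl v ∷ M) h (_ ∷ a) = sumBk-double f Bs M h a
sumBk-double f Bs (bk x r y T ∷ M) h (T∈ ∷ a) = begin
  f T + sumBk f M
    ≡⟨ cong₂ ℤ._+_ (sym (sumS-indicator f Bs T∈ h)) (sumBk-double f Bs M h a) ⟩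
  sumS (λ B → + ⟦ hd B ≟ hd T ⟧ * f B) Bs + sumS (λ B → + deg (hd B) M * f B) Bs
    ≡⟨ sym (sumS-+ _ _ Bs) ⟩
  sumS (λ B → + ⟦ hd B ≟ hd T ⟧ * f B + + deg (hd B) M * f B) Bs
    ≡⟨ sumS-cong Bs (λ B → sym (ℤₚ.*-distribʳ-+ (f B) (+ ⟦ hd B ≟ hd T ⟧) (+ deg (hd B) M))) ⟩
  sumS (λ B → + deg (hd B) (bk x r y T ∷ M) * f B) Bs ∎
  where open ≡-Reasoning

sumBk-1 : ∀ {n} (M : List (Item n (Seg n))) → sumBk (λ _ → + 1) M ≡ + nb M
sumBk-1 []               = refl
sumBk-1 (pl _ ∷ M)       = sumBk-1 M
sumBk-1 (bk _ _ _ _ ∷ M) = cong (λ z → + 1 + z) (sumBk-1 M)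

sumS-const-deg : ∀ {n} (M : List (Item n (Seg n))) k a ω β Bs → All (λ B → deg (hd B) M ≡ k) Bs →
  sumS (λ B → (+ 2 * (+ 1 + + deg (hd B) M)) * (a + ω * + size B + β * + deg (hd B) M)) Bs
  ≡ (+ 2 * (+ 1 + + k)) * ((a + β * + k) * + length Bs + ω * + sizeS Bs)
sumS-const-deg M k a ω β [] [] = base (+ k) a ω β
  where
  base : ∀ k a ω β → 0ℤ ≡ (+ 2 * (+ 1 + k)) * ((a + β * k) * 0ℤ + ω * 0ℤ)
  base = ℤS.solve-∀
sumS-const-deg M k a ω β (B ∷ Bs) (refl ∷ ps) = trans (cong (λ z → F + z) (sumS-const-deg M k a ω β Bs ps))
  (ind (+ k) a ω β (+ size B) (+ length Bs) (+ sizeS Bs))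
  where
  F = (+ 2 * (+ 1 + + k)) * (a + ω * + size B + β * + k)
  ind : ∀ k a ω β s l m → (+ 2 * (+ 1 + k)) * (a + ω * s + β * k) + (+ 2 * (+ 1 + k)) * ((a + β * k) * l + ω * m)
        ≡ (+ 2 * (+ 1 + k)) * ((a + β * k) * (+ 1 + l) + ω * (s + m))
  ind = ℤS.solve-∀

module Sums (n L : ℕ) (D : ℕ → ℕ) (Rc K : ℕ) (D-anti : ∀ {a b} → a ℕ.≤ b → D b ℕ.≤ D a) where

  open Process n L D Rc K
  open Invariants n L D Rc K D-anti

  -- Counting does not look at the edges, so the relation that always holds is enough.
  open WithR (λ _ _ → ⊤) (λ _ → tt) using (Inv; MInv; BkOk; movesGood; once≤; OkSeg) public
  open MInv

  lab : Move → Lab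
  lab m = proj₂ (proj₂ (proj₂ m))

  -- By `∑ℤ-find` this is n times the expected increment when a move with label l changes the
  -- quantity by δ l.
  σ : (Lab → ℤ) → List Move → ℤ
  σ δ ms = sumℤ (map (δ ∘ lab) ms)

  σ-++ : ∀ δ ms ns → σ δ (ms ++ ns) ≡ σ δ ms + σ δ ns
  σ-++ δ ms ns = trans (cong sumℤ (Listₚ.map-++ (δ ∘ lab) ms ns)) (sumℤ-++ (map (δ ∘ lab) ms) _)

  keys : List Move → List (Fin n)
  keys = map proj₁

  occ-keys-++ : ∀ u ms ns → occ u (keys (ms ++ ns)) ≡ occ u (keys ms) ℕ.+ occ u (keys ns)
  occ-keys-++ u ms ns = trans (cong (occ u) (Listₚ.map-++ proj₁ ms ns)) (occ-++ u (keys ms) _)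

  occB occP : ∀ {T} → Fin n → List (Item n T) → ℕ
  occB u []                = 0
  occB u (pl _ ∷ M)        = occB u M
  occB u (bk x r y _ ∷ M)  = occ u (x ∷ r ∷ y ∷ []) ℕ.+ occB u M
  occP u []                = 0
  occP u (pl v ∷ M)        = ⟦ u ≟ v ⟧ ℕ.+ occP u M
  occP u (bk x r y _ ∷ M)  = occP u M

  occBP : ∀ {T} u (M : List (Item n T)) → occB u M ℕ.+ occP u M ≡ occ u (flat M)
  occBP u []               = refl
  occBP u (pl v ∷ M)       = trans (sw (occB u M) ⟦ u ≟ v ⟧ (occP u M)) (cong (⟦ u ≟ v ⟧ ℕ.+_) (occBP u M))
    where
    sw : ∀ a b c → a ℕ.+ (b ℕ.+ c) ≡ b ℕ.+ (a ℕ.+ c)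
    sw = ℕS.solve-∀
  occBP u (bk x r y _ ∷ M) = trans (sw ⟦ u ≟ x ⟧ ⟦ u ≟ r ⟧ ⟦ u ≟ y ⟧ (occB u M) (occP u M))
      (cong (λ z → ⟦ u ≟ x ⟧ ℕ.+ (⟦ u ≟ r ⟧ ℕ.+ (⟦ u ≟ y ⟧ ℕ.+ z))) (occBP u M))
    where
    sw : ∀ a b c d f → a ℕ.+ (b ℕ.+ (c ℕ.+ 0)) ℕ.+ d ℕ.+ f ≡ a ℕ.+ (b ℕ.+ (c ℕ.+ (d ℕ.+ f)))
    sw = ℕS.solve-∀

  occP-tail : ∀ {T} u i (M : List (Item n T)) → occP u M ℕ.≤ occP u (i ∷ M)
  occP-tail u (pl v) M       = ℕₚ.m≤n+m _ ⟦ u ≟ v ⟧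
  occP-tail u (bk _ _ _ _) M = ℕₚ.≤-refl

  dropHd : ∀ {T} → List (Item n T) → List (Item n T)
  dropHd []      = []
  dropHd (_ ∷ M) = M

  module ColourMain (d : ℕ) (B₀ : Seg n) (low high : List (Seg n)) where

    open Main d B₀ low high hiding (moves)

    private
      ms : List (Item n (Seg n)) → List Move
      ms M = moves (main d B₀ low high M)

    -- A block spoils at most five possible centres, its three vertices and the plain vertex on
    -- either side; the two ends of the path are no centres either.
    windows : ∀ pre M → length (flat M) ℕ.≤ length (colourMoves pre M) ℕ.+ 5 ℕ.* nb M ℕ.+ 2
    windows pre [] = z≤n
    windows pre (bk x r y B ∷ M) = ℕₚ.≤-trans (ℕₚ.+-monoʳ-≤ 3 (windows (pre ++ [ bk x r y B ]) M))
      (ℕₚ.≤-trans (ℕₚ.m≤n+m _ 2) (ℕₚ.≤-reflexive (arr (length (colourMoves (pre ++ [ bk x r y B ]) M)) (nb M))))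
      where
      arr : ∀ a b → 2 ℕ.+ (3 ℕ.+ (a ℕ.+ 5 ℕ.* b ℕ.+ 2)) ≡ a ℕ.+ 5 ℕ.* (1 ℕ.+ b) ℕ.+ 2
      arr = ℕS.solve-∀
    windows pre (pl p ∷ []) = s≤s z≤n
    windows pre (pl p ∷ bk x r y B ∷ M) = ℕₚ.≤-trans (ℕₚ.+-monoʳ-≤ 4 (windows (((pre ++ [ pl p ]) ++ [ bk x r y B ])) M))
      (ℕₚ.≤-trans (ℕₚ.m≤n+m _ 1) (ℕₚ.≤-reflexive (arr (length (colourMoves ((pre ++ [ pl p ]) ++ [ bk x r y B ]) M)) (nb M))))
      where
      arr : ∀ a b → 1 ℕ.+ (4 ℕ.+ (a ℕ.+ 5 ℕ.* b ℕ.+ 2)) ≡ a ℕ.+ 5 ℕ.* (1 ℕ.+ b) ℕ.+ 2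
      arr = ℕS.solve-∀
    windows pre (pl p ∷ pl u ∷ []) = s≤s (s≤s z≤n)
    windows pre (pl p ∷ pl u ∷ bk x r y B ∷ M) = ℕₚ.≤-trans (ℕₚ.+-monoʳ-≤ 5 (windows (((pre ++ [ pl p ]) ++ [ pl u ]) ++ [ bk x r y B ]) M))
      (ℕₚ.≤-reflexive (arr (length (colourMoves (((pre ++ [ pl p ]) ++ [ pl u ]) ++ [ bk x r y B ]) M)) (nb M)))
      where
      arr : ∀ a b → 5 ℕ.+ (a ℕ.+ 5 ℕ.* b ℕ.+ 2) ≡ a ℕ.+ 5 ℕ.* (1 ℕ.+ b) ℕ.+ 2
      arr = ℕS.solve-∀
    windows pre (pl p ∷ pl u ∷ pl q ∷ M) = s≤s (windows (pre ++ [ pl p ]) (pl u ∷ pl q ∷ M))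

    colour-keys : ∀ u pre M → occ u (keys (colourMoves pre M)) ℕ.≤ occP u (dropHd M)
    colour-keys u pre [] = z≤n
    colour-keys u pre (bk x r y B ∷ M) = ℕₚ.≤-trans (colour-keys u (pre ++ [ bk x r y B ]) M) (dr M)
      where
      dr : ∀ M → occP u (dropHd M) ℕ.≤ occP u M
      dr []      = z≤n
      dr (i ∷ M) = occP-tail u i M
    colour-keys u pre (pl p ∷ []) = z≤n
    colour-keys u pre (pl p ∷ bk x r y B ∷ M) = colour-keys u (pre ++ [ pl p ]) (bk x r y B ∷ M)
    colour-keys u pre (pl p ∷ pl v ∷ []) = z≤n
    colour-keys u pre (pl p ∷ pl v ∷ bk x r y B ∷ M) = ℕₚ.≤-trans (colour-keys u (pre ++ [ pl p ]) (pl v ∷ bk x r y B ∷ M)) (ℕₚ.m≤n+m _ ⟦ u ≟ v ⟧)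
    colour-keys u pre (pl p ∷ pl v ∷ pl q ∷ M) = ℕₚ.+-monoʳ-≤ ⟦ u ≟ v ⟧ (colour-keys u (pre ++ [ pl p ]) (pl v ∷ pl q ∷ M))

    σ-colour : ∀ δ pre M → σ δ (colourMoves pre M) ≡ δ colour * + length (colourMoves pre M)
    σ-colour δ pre M = go (colourMoves pre M) (labs pre M)
      where
      labs : ∀ pre M → All (λ m → lab m ≡ colour) (colourMoves pre M)
      labs pre [] = []
      labs pre (i ∷ M) = Allₚ.++⁺ (lab-here i M) (labs (pre ++ [ i ]) M)
        where
        lab-here : ∀ i M → All (λ m → lab m ≡ colour) (colourHere pre (i ∷ M))
        lab-here (bk _ _ _ _) M = []
        lab-here (pl _) [] = []
        lab-here (pl _) (bk _ _ _ _ ∷ _) = []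
        lab-here (pl _) (pl _ ∷ []) = []
        lab-here (pl _) (pl _ ∷ bk _ _ _ _ ∷ _) = []
        lab-here (pl _) (pl _ ∷ pl _ ∷ _) = refl ∷ []
      go : ∀ ms → All (λ m → lab m ≡ colour) ms → σ δ ms ≡ δ colour * + length ms
      go []       []       = sym (ℤₚ.*-zeroʳ (δ colour))
      go (m ∷ ms) (e ∷ es) = trans (cong₂ ℤ._+_ (cong δ e) (go ms es)) (arr (δ colour) (+ length ms))
        where
        arr : ∀ a b → a + a * b ≡ a * (+ 1 + b)
        arr = ℤS.solve-∀

    σ-insert : ∀ δ pre M → σ δ (insertMoves pre M) ≡ sumBk (λ B → δ (rem B) + δ (rem B)) M
    σ-insert δ pre [] = refl
    σ-insert δ pre (pl v ∷ M) = σ-insert δ (pre ++ [ pl v ]) M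
    σ-insert δ pre (bk x r y B ∷ M) = trans (cong (λ z → δ (rem B) + (δ (rem B) + z)) (σ-insert δ (pre ++ [ bk x r y B ]) M))
      (sym (ℤₚ.+-assoc (δ (rem B)) (δ (rem B)) _))

    insert-keys : ∀ u pre M → occ u (keys (insertMoves pre M)) ℕ.≤ occB u M
    insert-keys u pre [] = z≤n
    insert-keys u pre (pl v ∷ M) = insert-keys u (pre ++ [ pl v ]) M
    insert-keys u pre (bk x r y B ∷ M) = ℕₚ.≤-trans (ℕₚ.+-monoʳ-≤ ⟦ u ≟ x ⟧ (ℕₚ.+-monoʳ-≤ ⟦ u ≟ y ⟧ (insert-keys u (pre ++ [ bk x r y B ]) M)))
      (ℕₚ.≤-trans (ℕₚ.m≤n+m _ ⟦ u ≟ r ⟧) (ℕₚ.≤-reflexive (arr ⟦ u ≟ x ⟧ ⟦ u ≟ r ⟧ ⟦ u ≟ y ⟧ (occB u M))))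
      where
      arr : ∀ a b c d → b ℕ.+ (a ℕ.+ (c ℕ.+ d)) ≡ a ℕ.+ (b ℕ.+ (c ℕ.+ 0)) ℕ.+ d
      arr = ℕS.solve-∀

    σ-attach : ∀ δ M Bs → σ δ (concatMap (attach M) Bs) ≡ sumS (λ B → δ (rem B) + δ (rem B)) Bs
    σ-attach δ M []       = refl
    σ-attach δ M (B ∷ Bs) = trans (cong (λ z → δ (rem B) + (δ (rem B) + z)) (σ-attach δ M Bs)) (sym (ℤₚ.+-assoc (δ (rem B)) (δ (rem B)) _))

    attach-keys : ∀ u M Bs → occ u (keys (concatMap (attach M) Bs)) ℕ.≤ occS u Bs
    attach-keys u M []       = z≤n
    attach-keys u M (B ∷ Bs) = ℕₚ.≤-trans (ℕₚ.+-monoʳ-≤ ⟦ u ≟ hd B ⟧ (ℕₚ.+-monoʳ-≤ ⟦ u ≟ tl B ⟧ (attach-keys u M Bs)))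
      (ℕₚ.≤-trans (ℕₚ.m≤n+m _ (occ u (md B))) (ℕₚ.≤-reflexive (trans (arr (occ u (md B)) ⟦ u ≟ hd B ⟧ ⟦ u ≟ tl B ⟧ (occS u Bs))
         (cong (λ z → ⟦ u ≟ hd B ⟧ ℕ.+ z ℕ.+ occS u Bs) (sym (occ-++ u (md B) [ tl B ]))))))
      where
      arr : ∀ a b c d → a ℕ.+ (b ℕ.+ (c ℕ.+ d)) ≡ b ℕ.+ (a ℕ.+ (c ℕ.+ 0)) ℕ.+ d
      arr = ℕS.solve-∀

    nAllowed : List (Item n (Seg n)) → ℕ
    nAllowed M = length (allowed M (colourMoves [] M))

    -- The triggers of the three kinds of move lie in disjoint places: attaching uses vertices of
    -- segments, detours use vertices of blocks, colouring uses plain vertices.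
    main-keys : ∀ M → MInv d (B₀ ∷ low) high M → ∀ u → occ u (keys (ms M)) ℕ.≤ 1
    main-keys M i u = begin
      occ u (keys (ms M))
        ≡⟨ trans (occ-keys-++ u (concatMap (attach M) Bs) _) (cong (occ u (keys (concatMap (attach M) Bs)) ℕ.+_) (occ-keys-++ u (insertMoves [] M) _)) ⟩
      occ u (keys (concatMap (attach M) Bs)) ℕ.+ (occ u (keys (insertMoves [] M)) ℕ.+ occ u (keys (allowed M (colourMoves [] M))))
        ≤⟨ ℕₚ.+-mono-≤ (attach-keys u M Bs) (ℕₚ.+-mono-≤ (insert-keys u [] M) (ℕₚ.≤-trans al (ℕₚ.≤-trans (colour-keys u [] M) (dr M)))) ⟩
      occS u Bs ℕ.+ (occB u M ℕ.+ occP u M)   ≡⟨ cong (occS u Bs ℕ.+_) (occBP u M) ⟩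
      occS u Bs ℕ.+ occ u (flat M)            ≡⟨ trans (ℕₚ.+-comm (occS u Bs) _) (once i u) ⟩
      1 ∎
      where
      open ℕₚ.≤-Reasoning
      Bs = (B₀ ∷ low) ++ high
      dr : ∀ M → occP u (dropHd M) ℕ.≤ occP u M
      dr []      = z≤n
      dr (i ∷ M) = occP-tail u i M
      al : occ u (keys (allowed M (colourMoves [] M))) ℕ.≤ occ u (keys (colourMoves [] M))
      al with suc d ℕ.≤? D count | suc (nb M) ℕ.≤? Rc
      ... | yes _ | yes _ = ℕₚ.≤-refl
      ... | yes _ | no _  = z≤n
      ... | no _  | _     = z≤n

    private
      l h : ℕ
      l = suc (length low)
      h = length high

    nb-count : ∀ M → MInv d (B₀ ∷ low) high M → nb M ≡ d ℕ.* l ℕ.+ suc d ℕ.* h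
    nb-count M i = ℤₚ.+-injective (begin
      + nb M                                                 ≡⟨ sym (sumBk-1 M) ⟩
      sumBk (λ _ → + 1) M                                    ≡⟨ sumBk-double (λ _ → + 1) Bs M (once≤ i) (All.map (λ {it} → mem it) (blk i)) ⟩
      sumS (λ B → + deg (hd B) M * + 1) Bs                 ≡⟨ sumS-++ (λ B → + deg (hd B) M * + 1) (B₀ ∷ low) high ⟩
      _                                                      ≡⟨ cong₂ ℤ._+_ (cst d (B₀ ∷ low) (degL i)) (cst (suc d) high (degH i)) ⟩
      + (d ℕ.* l) + + (suc d ℕ.* h) ∎)
      where
      open ≡-Reasoning
      Bs = (B₀ ∷ low) ++ high
      mem : ∀ it → BkOk Bs it → Target∈ Bs it
      mem (pl _)       _       = tt
      mem (bk _ _ _ B) (_ , q) = q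
      cst : ∀ k Cs → All (λ B → deg (hd B) M ≡ k) Cs → sumS (λ B → + deg (hd B) M * + 1) Cs ≡ + (k ℕ.* length Cs)
      cst k [] [] = cong +_ (sym (ℕₚ.*-zeroʳ k))
      cst k (C ∷ Cs) (e ∷ es) = trans (cong₂ ℤ._+_ (trans (ℤₚ.*-identityʳ _) (cong +_ e)) (cst k Cs es)) (cong +_ (sym (ℕₚ.*-suc k (length Cs))))

    -- A segment of degree g has 2 ends and 2 g neighbours in blocks as triggers, which gives the
    -- factor 2 (1 + g). Increments affine in size and degree can then be summed over `low` and
    -- `high`, on each of which the degree is constant.
    main-σ : ∀ M → MInv d (B₀ ∷ low) high M → ∀ δ a ω β → (∀ B → δ (rem B) ≡ a + ω * + size B + β * + deg (hd B) M) →
      σ δ (ms M) ≡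
        (+ 2 * (+ 1 + + d)) * ((a + β * + d) * + l + ω * + sizeS (B₀ ∷ low)) +
        (+ 2 * (+ 1 + + suc d)) * ((a + β * + suc d) * + h + ω * + sizeS high) + δ colour * + nAllowed M
    main-σ M i δ a ω β e = begin
      σ δ (ms M)
        ≡⟨ trans (σ-++ δ (concatMap (attach M) Bs) _) (cong (λ z → σ δ (concatMap (attach M) Bs) + z) (σ-++ δ (insertMoves [] M) _)) ⟩
      σ δ (concatMap (attach M) Bs) + (σ δ (insertMoves [] M) + σ δ (allowed M (colourMoves [] M)))
        ≡⟨ cong₂ ℤ._+_ (σ-attach δ M Bs) (cong₂ ℤ._+_ (trans (σ-insert δ [] M) (sumBk-double _ Bs M (once≤ i) (All.map (λ {it} → mem it) (blk i)))) al) ⟩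
      sumS f Bs + (sumS (λ B → + deg (hd B) M * f B) Bs + δ colour * + nAllowed M)
        ≡⟨ sym (ℤₚ.+-assoc (sumS f Bs) _ _) ⟩
      sumS f Bs + sumS (λ B → + deg (hd B) M * f B) Bs + δ colour * + nAllowed M
        ≡⟨ cong (ℤ._+ δ colour * + nAllowed M) (trans (sym (sumS-+ f _ Bs)) (trans (sumS-cong Bs each) (trans (sumS-++ (λ B → (+ 2 * (+ 1 + + deg (hd B) M)) * (a + ω * + size B + β * + deg (hd B) M)) (B₀ ∷ low) high)
             (cong₂ ℤ._+_ (sumS-const-deg M d a ω β (B₀ ∷ low) (degL i)) (sumS-const-deg M (suc d) a ω β high (degH i)))))) ⟩
      _ ∎
      where
      open ≡-Reasoning
      Bs = (B₀ ∷ low) ++ high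
      f = λ B → δ (rem B) + δ (rem B)
      mem : ∀ it → BkOk Bs it → Target∈ Bs it
      mem (pl _)       _       = tt
      mem (bk _ _ _ B) (_ , q) = q
      al : σ δ (allowed M (colourMoves [] M)) ≡ δ colour * + nAllowed M
      al with suc d ℕ.≤? D count | suc (nb M) ℕ.≤? Rc
      ... | yes _ | yes _ = σ-colour δ [] M
      ... | yes _ | no _  = sym (ℤₚ.*-zeroʳ (δ colour))
      ... | no _  | _     = sym (ℤₚ.*-zeroʳ (δ colour))
      each : ∀ B → f B + + deg (hd B) M * f B ≡ (+ 2 * (+ 1 + + deg (hd B) M)) * (a + ω * + size B + β * + deg (hd B) M)
      each B rewrite e B = arr (+ deg (hd B) M) (a + ω * + size B + β * + deg (hd B) M)
        where
        arr : ∀ g x → x + x + g * (x + x) ≡ (+ 2 * (+ 1 + g)) * x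
        arr = ℤS.solve-∀

    nAllowed-≥ : ∀ M → MInv d (B₀ ∷ low) high M → suc d ℕ.≤ D count → suc (nb M) ℕ.≤ Rc →
                 n ℕ.≤ nAllowed M ℕ.+ 5 ℕ.* nb M ℕ.+ 2 ℕ.+ (sizeS (B₀ ∷ low) ℕ.+ sizeS high)
    nAllowed-≥ M i dD nR with suc d ℕ.≤? D count | suc (nb M) ℕ.≤? Rc
    ... | no ¬a | _     = ⊥-elim (¬a dD)
    ... | yes _ | no ¬b = ⊥-elim (¬b nR)
    ... | yes _ | yes _ = ℕₚ.≤-trans (ℕₚ.≤-reflexive (sym (total (flat M) ((B₀ ∷ low) ++ high) (once i))))
      (ℕₚ.≤-trans (ℕₚ.≤-reflexive (cong (length (flat M) ℕ.+_) (sizeS-++ (B₀ ∷ low) high))) (ℕₚ.+-monoˡ-≤ _ (windows [] M)))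

module Effects (n L : ℕ) (D : ℕ → ℕ) (Rc K : ℕ) (D-anti : ∀ {a b} → a ℕ.≤ b → D b ℕ.≤ D a) where

  open Process n L D Rc K
  open Sums n L D Rc K D-anti public
  open MInv

  -- Counts of components, segment vertices and blocks, taken before `mk` restores the normal form;
  -- the change of phase inside `mk` need not be considered when effects are computed.
  record Obs (s : St) (c m r : ℕ) : Set where
    constructor obs
    field
      {d′}         : ℕ
      {low′ high′} : List (Seg n)
      {M′}         : List (Item n (Seg n))
      form : s ≡ mk d′ low′ high′ M′
      cEq  : length low′ ℕ.+ length high′ ≡ c
      mEq  : sizeS low′ ℕ.+ sizeS high′ ≡ m
      rEq  : nb M′ ≡ r

  module EffectsMain (d : ℕ) (B₀ : Seg n) (low high : List (Seg n)) (M : List (Item n (Seg n)))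
                     (i : MInv d (B₀ ∷ low) high M) where

    open Main d B₀ low high hiding (moves)

    Bs : List (Seg n)
    Bs = (B₀ ∷ low) ++ high

    cM mM rM : ℕ
    cM = suc (length low ℕ.+ length high)
    mM = sizeS (B₀ ∷ low) ℕ.+ sizeS high
    rM = nb M

    Effect : Move → Set
    Effect (u , v , s , rem B) = B ∈ Bs × Σ ℕ λ c → Σ ℕ λ m → Σ ℕ λ r →
                                   Obs s c m r × suc c ≡ cM × m ℕ.+ size B ≡ mM × r ℕ.+ deg (hd B) M ≡ rM
    Effect (u , v , s , colour) = Obs s cM mM (suc rM)
    Effect (u , v , s , _)      = ⊥

    private
      weight : ∀ (w : Seg n → ℕ) (wS : List (Seg n) → ℕ) → (∀ C Cs → wS (C ∷ Cs) ≡ w C ℕ.+ wS Cs) →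
               (∀ As Cs → wS (As ++ Cs) ≡ wS As ℕ.+ wS Cs) → ∀ {B} → B ∈ Bs →
               wS (del (hd B) (B₀ ∷ low)) ℕ.+ wS (del (hd B) high) ℕ.+ w B ≡ wS (B₀ ∷ low) ℕ.+ wS high
      weight w wS e app {B} B∈ = trans (ℕₚ.+-comm _ (w B)) (trans (cong (w B ℕ.+_) (trans (sym (app (del (hd B) (B₀ ∷ low)) (del (hd B) high))) (cong wS (sym (del-++ (hd B) (B₀ ∷ low) high)))))
        (trans (sym (del-sum w wS e B∈ (once≤ i))) (app (B₀ ∷ low) high)))

      removed : ∀ {B} M′ → B ∈ Bs → nb M′ ℕ.+ deg (hd B) M ≡ deg (hd B) M′ ℕ.+ nb M →
                B ∈ Bs × Σ ℕ λ c → Σ ℕ λ m → Σ ℕ λ r → Obs (remSt B M′) c m r × suc c ≡ cM × m ℕ.+ size B ≡ mM × r ℕ.+ deg (hd B) M ≡ rM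
      removed {B} M′ B∈ e = B∈ , _ , _ , _ , obs refl refl refl refl ,
        trans (ℕₚ.+-comm 1 _) (weight (λ _ → 1) length (λ _ _ → refl) (λ As Cs → Listₚ.length-++ As) B∈) ,
        weight size sizeS (λ _ _ → refl) sizeS-++ B∈ ,
        ℕₚ.+-cancelʳ-≡ (deg (hd B) M′) _ _ (trans (arr (nb (strip (hd B) M′)) (deg (hd B) M) (deg (hd B) M′))
          (trans (cong (ℕ._+ deg (hd B) M) (nb-strip (hd B) M′)) (trans e (ℕₚ.+-comm (deg (hd B) M′) _))))
        where
        arr : ∀ a b c → a ℕ.+ b ℕ.+ c ≡ a ℕ.+ c ℕ.+ b
        arr = ℕS.solve-∀

      insertEffect : ∀ pre post → pre ++ post ≡ M → All Effect (insertMoves pre post)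
      insertEffect pre [] e = []
      insertEffect pre (pl v ∷ post) e = insertEffect (pre ++ [ pl v ]) post (trans (Listₚ.++-assoc pre [ pl v ] post) e)
      insertEffect pre (bk x r y B ∷ post) refl =
          removed (pre ++ pl x ∷ map pl (toL (rv B)) ++ pl r ∷ pl y ∷ post) B∈ (cnt (pl x ∷ map pl (toL (rv B)) ++ pl r ∷ pl y ∷ post)
            (trans (nb-++ (map pl (toL (rv B))) _) (cong (ℕ._+ nb post) (nb-pl (toL (rv B)))))
            (trans (deg-++ (hd B) (map pl (toL (rv B))) _) (cong (ℕ._+ deg (hd B) post) (deg-pl (hd B) (toL (rv B))))))
        ∷ removed (pre ++ pl x ∷ pl r ∷ map pl (toL B) ++ pl y ∷ post) B∈ (cnt (pl x ∷ pl r ∷ map pl (toL B) ++ pl y ∷ post)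
            (trans (nb-++ (map pl (toL B)) _) (cong (ℕ._+ nb post) (nb-pl (toL B))))
            (trans (deg-++ (hd B) (map pl (toL B)) _) (cong (ℕ._+ deg (hd B) post) (deg-pl (hd B) (toL B)))))
        ∷ insertEffect (pre ++ [ bk x r y B ]) post (Listₚ.++-assoc pre [ bk x r y B ] post)
        where
        B∈ : B ∈ Bs
        B∈ = proj₂ (All.head (Allₚ.++⁻ʳ pre (blk i)))
        cnt : ∀ N → nb N ≡ nb post → deg (hd B) N ≡ deg (hd B) post →
              nb (pre ++ N) ℕ.+ deg (hd B) (pre ++ bk x r y B ∷ post) ≡ deg (hd B) (pre ++ N) ℕ.+ nb (pre ++ bk x r y B ∷ post)
        cnt N e₁ e₂ rewrite nb-++ pre N | deg-++ (hd B) pre (bk x r y B ∷ post) | deg-++ (hd B) pre N | nb-++ pre (bk x r y B ∷ post)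
                          | e₁ | e₂ | ⟦≟⟧-refl (hd B) = arr (nb pre) (nb post) (deg (hd B) pre) (deg (hd B) post)
          where
          arr : ∀ a b c d → a ℕ.+ b ℕ.+ (c ℕ.+ (1 ℕ.+ d)) ≡ c ℕ.+ d ℕ.+ (a ℕ.+ (1 ℕ.+ b))
          arr = ℕS.solve-∀

      attachEffect : ∀ B → B ∈ Bs → All Effect (attach M B)
      attachEffect B B∈ = one (toL B) ∷ one (toL (rv B)) ∷ []
        where
        one : ∀ xs → _
        one xs = removed (M ++ map pl xs) B∈ (trans (cong₂ ℕ._+_ (trans (nb-++ M (map pl xs)) (trans (cong (nb M ℕ.+_) (nb-pl xs)) (ℕₚ.+-identityʳ _))) refl)
          (trans (ℕₚ.+-comm (nb M) _) (cong (ℕ._+ nb M) (sym (trans (deg-++ (hd B) M (map pl xs)) (trans (cong (deg (hd B) M ℕ.+_) (deg-pl (hd B) xs)) (ℕₚ.+-identityʳ _)))))))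

      colourEffect : ∀ pre post → pre ++ post ≡ M → All Effect (colourMoves pre post)
      colourEffect pre [] e = []
      colourEffect pre (it ∷ post) e = Allₚ.++⁺ (here′ it post e) (colourEffect (pre ++ [ it ]) post (trans (Listₚ.++-assoc pre [ it ] post) e))
        where
        here′ : ∀ it post → pre ++ it ∷ post ≡ M → All Effect (colourHere pre (it ∷ post))
        here′ (bk _ _ _ _) post                    e = []
        here′ (pl p) []                            e = []
        here′ (pl p) (bk _ _ _ _ ∷ post)           e = []
        here′ (pl p) (pl u ∷ [])                   e = []
        here′ (pl p) (pl u ∷ bk _ _ _ _ ∷ post)    e = []
        here′ (pl p) (pl u ∷ pl q ∷ post)          refl =
          obs refl (ℕₚ.+-suc (length low) (length high)) (sw (sizeS low) (size B₀) (sizeS high))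
            (trans (nb-++ pre _) (trans (ℕₚ.+-suc (nb pre) (nb post)) (cong suc (sym (nb-++ pre _))))) ∷ []
          where
          sw : ∀ a b c → a ℕ.+ (b ℕ.+ c) ≡ b ℕ.+ a ℕ.+ c
          sw = ℕS.solve-∀

    effects : All Effect (moves (main d B₀ low high M))
    effects = Allₚ.++⁺ (All-concatMap (attach M) Bs (All.tabulate (λ {B} p → attachEffect B p))) (Allₚ.++⁺ (insertEffect [] M refl) al)
      where
      al : All Effect (allowed M (colourMoves [] M))
      al with suc d ℕ.≤? D count | suc (nb M) ℕ.≤? Rc
      ... | yes _ | yes _ = colourEffect [] M refl
      ... | yes _ | no _  = []
      ... | no _  | _     = []

  module EffectsGrow (s : Fin n) (ss : List (Fin n)) (Bs : List (Seg n)) where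

    Effect : Move → Set
    Effect (u , v , s′ , pair) = Σ (List (Fin n)) λ ys → Σ (List (Seg n)) λ Cs →
                                   s′ ≡ toSt ys Cs × 2 ℕ.+ length ys ≡ suc (length ss) × length Cs ≡ suc (length Bs)
    Effect (u , v , s′ , ext)  = Σ (List (Seg n)) λ Cs → s′ ≡ toSt ss Cs × length Cs ≡ length Bs
    Effect (u , v , s′ , _)    = ⊥

    short : List (Seg n) → ℕ
    short []       = 0
    short (B ∷ Cs) with size B ℕ.<? L
    ... | yes _ = suc (short Cs)
    ... | no _  = short Cs

    -- A segment that is not short has at least L vertices, so there are at most `sizeS Cs` / L of
    -- them; multiplied by L to avoid division.
    short-≥ : ∀ Cs → L ℕ.* length Cs ℕ.≤ L ℕ.* short Cs ℕ.+ sizeS Cs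
    short-≥ []       = ℕₚ.≤-trans (ℕₚ.≤-reflexive (ℕₚ.*-zeroʳ L)) z≤n
    short-≥ (B ∷ Cs) with size B ℕ.<? L
    ... | yes _  = ℕₚ.≤-trans (ℕₚ.≤-reflexive (ℕₚ.*-suc L (length Cs))) (ℕₚ.≤-trans (ℕₚ.+-monoʳ-≤ L (short-≥ Cs))
                     (ℕₚ.≤-trans (ℕₚ.≤-reflexive (trans (sym (ℕₚ.+-assoc L _ _)) (cong (ℕ._+ sizeS Cs) (sym (ℕₚ.*-suc L (short Cs))))))
                       (ℕₚ.+-monoʳ-≤ _ (ℕₚ.m≤n+m (sizeS Cs) (size B)))))
    ... | no ≮L  = ℕₚ.≤-trans (ℕₚ.≤-reflexive (ℕₚ.*-suc L (length Cs))) (ℕₚ.≤-trans (ℕₚ.+-mono-≤ (ℕₚ.≮⇒≥ ≮L) (short-≥ Cs))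
                     (ℕₚ.≤-reflexive (sw (size B) (L ℕ.* short Cs) (sizeS Cs))))
      where
      sw : ∀ a b c → a ℕ.+ (b ℕ.+ c) ≡ b ℕ.+ (a ℕ.+ c)
      sw = ℕS.solve-∀

    short-≤ : ∀ Cs → short Cs ℕ.≤ length Cs
    short-≤ []       = z≤n
    short-≤ (B ∷ Cs) with size B ℕ.<? L
    ... | yes _ = s≤s (short-≤ Cs)
    ... | no _  = ℕₚ.m≤n⇒m≤1+n (short-≤ Cs)

    -- The last single vertex has no partner, hence 0 and not 1 for the empty remainder.
    pairsOf : List (Fin n) → ℕ
    pairsOf []       = 0
    pairsOf (y ∷ ys) = suc (suc (length ys))

    pairs : ℕ
    pairs = pairsOf ss

    pairs-≥ : length ss ℕ.≤ pairs
    pairs-≥ = go ss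
      where
      go : ∀ xs → length xs ℕ.≤ pairsOf xs
      go []       = z≤n
      go (x ∷ xs) = ℕₚ.n≤1+n _

    pairs-≤ : pairs ℕ.≤ suc (length ss)
    pairs-≤ = go ss
      where
      go : ∀ xs → pairsOf xs ℕ.≤ suc (length xs)
      go []       = z≤n
      go (x ∷ xs) = ℕₚ.≤-refl

    effects : All Effect (moves (grow s ss Bs))
    effects = Allₚ.++⁺ (All-concatMap (pairMove Bs) _ (All.map (λ {p} → pr p) (picks-↭ (s ∷ ss))))
                (All-concatMap (extMove s ss) _ (All.map (λ {p} → ex p) (picks-↭ Bs)))
      where
      pr : ∀ p → (s ∷ ss) ↭ proj₁ p ∷ proj₂ p → All Effect (pairMove Bs p)
      pr (x , [])     e = []
      pr (x , y ∷ ys) e = (ys , _ , refl , sym (↭ₚ.↭-length e) , refl) ∷ []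
      ex : ∀ p → Bs ↭ proj₁ p ∷ proj₂ p → All Effect (extMove s ss p)
      ex (B , Cs) e with size B ℕ.<? L
      ... | no _  = []
      ... | yes _ = (_ , refl , sym (↭ₚ.↭-length e)) ∷ (_ , refl , sym (↭ₚ.↭-length e)) ∷ []

    private
      picks-occ : ∀ xs → All (λ p → length (proj₂ p) ≡ ℕ.pred (length xs)) (picks {A = Fin n} xs)
      picks-occ xs = All.map (λ e → cong ℕ.pred (sym (↭ₚ.↭-length e))) (picks-↭ xs)

      pairMove-map : ∀ (Cs : List (Seg n)) (x : Fin n) ps → All (λ p → 1 ℕ.≤ length (proj₂ p)) ps →
                     ∀ (δ : Lab → ℤ) → σ δ (concatMap (pairMove Cs) ps) ≡ δ pair * + length ps
      pairMove-map Cs x [] [] δ = sym (ℤₚ.*-zeroʳ (δ pair))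
      pairMove-map Cs x ((y , z ∷ zs) ∷ ps) (_ ∷ a) δ = trans (cong (λ w → δ pair + w) (pairMove-map Cs x ps a δ)) (arr (δ pair) (+ length ps))
        where
        arr : ∀ a b → a + a * b ≡ a * (+ 1 + b)
        arr = ℤS.solve-∀

      length-picks : ∀ {A : Set} (xs : List A) → length (picks xs) ≡ length xs
      length-picks []       = refl
      length-picks (x ∷ xs) = cong suc (trans (Listₚ.length-map _ (picks xs)) (length-picks xs))

      pairMove-keys : ∀ u ps → occ u (keys (concatMap (pairMove Bs) ps)) ℕ.≤ occ u (map proj₁ ps)
      pairMove-keys u []                  = z≤n
      pairMove-keys u ((x , []) ∷ ps)     = ℕₚ.≤-trans (pairMove-keys u ps) (ℕₚ.m≤n+m _ ⟦ u ≟ x ⟧)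
      pairMove-keys u ((x , _ ∷ _) ∷ ps)  = ℕₚ.+-monoʳ-≤ ⟦ u ≟ x ⟧ (pairMove-keys u ps)

      proj₁-picks : ∀ {A : Set} (xs : List A) → map proj₁ (picks xs) ≡ xs
      proj₁-picks []       = refl
      proj₁-picks (x ∷ xs) = cong (x ∷_) (trans (sym (Listₚ.map-∘ (picks xs))) (proj₁-picks xs))

      extMove-keys : ∀ u ps → occ u (keys (concatMap (extMove s ss) ps)) ℕ.≤ occS u (map proj₁ ps)
      extMove-keys u [] = z≤n
      extMove-keys u ((B , Cs) ∷ ps) with size B ℕ.<? L
      ... | no _  = ℕₚ.≤-trans (extMove-keys u ps) (ℕₚ.m≤n+m _ (occ u (toL B)))
      ... | yes _ = ℕₚ.≤-trans (ℕₚ.+-monoʳ-≤ ⟦ u ≟ hd B ⟧ (ℕₚ.+-monoʳ-≤ ⟦ u ≟ tl B ⟧ (extMove-keys u ps)))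
                      (ℕₚ.≤-trans (ℕₚ.m≤n+m _ (occ u (md B))) (ℕₚ.≤-reflexive (trans (arr (occ u (md B)) ⟦ u ≟ hd B ⟧ ⟦ u ≟ tl B ⟧ (occS u (map proj₁ ps)))
                        (cong (λ z → ⟦ u ≟ hd B ⟧ ℕ.+ z ℕ.+ occS u (map proj₁ ps)) (sym (occ-++ u (md B) [ tl B ]))))))
        where
        arr : ∀ a b c d → a ℕ.+ (b ℕ.+ (c ℕ.+ d)) ≡ b ℕ.+ (a ℕ.+ (c ℕ.+ 0)) ℕ.+ d
        arr = ℕS.solve-∀

      σ-ext : ∀ δ ps → σ δ (concatMap (extMove s ss) ps) ≡ δ ext * + (2 ℕ.* short (map proj₁ ps))
      σ-ext δ [] = sym (ℤₚ.*-zeroʳ (δ ext))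
      σ-ext δ ((B , Cs) ∷ ps) with size B ℕ.<? L
      ... | no _  = σ-ext δ ps
      ... | yes _ = trans (cong (λ w → δ ext + (δ ext + w)) (σ-ext δ ps)) (trans (arr (δ ext) (+ (2 ℕ.* short (map proj₁ ps))))
                      (cong (λ w → δ ext * + w) (sym (ℕₚ.*-suc 2 (short (map proj₁ ps))))))
        where
        arr : ∀ a b → a + (a + a * b) ≡ a * (+ 2 + b)
        arr = ℤS.solve-∀

    grow-keys : Inv (grow s ss Bs) → ∀ u → occ u (keys (moves (grow s ss Bs))) ℕ.≤ 1
    grow-keys (o , _) u = begin
      occ u (keys (moves (grow s ss Bs)))
        ≡⟨ occ-keys-++ u (concatMap (pairMove Bs) (picks (s ∷ ss))) _ ⟩
      occ u (keys (concatMap (pairMove Bs) (picks (s ∷ ss)))) ℕ.+ occ u (keys (concatMap (extMove s ss) (picks Bs)))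
        ≤⟨ ℕₚ.+-mono-≤ (pairMove-keys u (picks (s ∷ ss))) (extMove-keys u (picks Bs)) ⟩
      occ u (map proj₁ (picks (s ∷ ss))) ℕ.+ occS u (map proj₁ (picks Bs))
        ≡⟨ cong₂ (λ a b → occ u a ℕ.+ occS u b) (proj₁-picks (s ∷ ss)) (proj₁-picks Bs) ⟩
      occ u (s ∷ ss) ℕ.+ occS u Bs ≡⟨ o u ⟩
      1 ∎
      where open ℕₚ.≤-Reasoning

    grow-σ : ∀ δ → σ δ (moves (grow s ss Bs)) ≡ δ pair * + pairs + δ ext * + (2 ℕ.* short Bs)
    grow-σ δ = trans (σ-++ δ (concatMap (pairMove Bs) (picks (s ∷ ss))) _) (cong₂ ℤ._+_ pr
                 (trans (σ-ext δ (picks Bs)) (cong (λ z → δ ext * + (2 ℕ.* short z)) (proj₁-picks Bs))))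
      where
      go : ∀ xs → σ δ (concatMap (pairMove Bs) (picks (s ∷ xs))) ≡ δ pair * + pairsOf xs
      go []       = sym (ℤₚ.*-zeroʳ (δ pair))
      go (y ∷ ys) = trans (pairMove-map Bs s (picks (s ∷ y ∷ ys)) (All.map (λ e → ℕₚ.≤-trans (s≤s z≤n) (ℕₚ.≤-reflexive (sym e))) (picks-occ (s ∷ y ∷ ys))) δ)
                      (cong (λ z → δ pair * + z) (length-picks (s ∷ y ∷ ys)))
      pr : σ δ (concatMap (pairMove Bs) (picks (s ∷ ss))) ≡ δ pair * + pairs
      pr = go ss

  module EffectsClos (M : List (Item n ⊤)) (e : Fin n) (vs : List (Fin n)) (fl : flat M ≡ e ∷ vs) (o : ∀ v → occ v (flat M) ≡ 1) where

    open Clos e (lastOr e vs) hiding (moves)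

    private
      ms : List Move
      ms = moves (clos M)

      ms≡ : ms ≡ closeMoves M ++ allowed M (colourMoves [] M)
      ms≡ rewrite fl = refl

    Effect : Move → Set
    Effect (u , v , s , close)  = s ≡ done
    Effect (u , v , s , colour) = Σ (List (Item n ⊤)) λ M′ → s ≡ clos M′ × nb M′ ≡ suc (nb M)
    Effect (u , v , s , _)      = ⊥

    nAllowed : ℕ
    nAllowed = length (allowed M (colourMoves [] M))

    private
      closeEffect : ∀ N → All Effect (closeMoves N)
      closeEffect []               = []
      closeEffect (pl v ∷ N)       = closeEffect N
      closeEffect (bk x r y _ ∷ N) = refl ∷ closeEffect N

      colourEffect : ∀ pre post → pre ++ post ≡ M → All Effect (colourMoves pre post)
      colourEffect pre [] e = []
      colourEffect pre (it ∷ post) e = Allₚ.++⁺ (here′ it post e) (colourEffect (pre ++ [ it ]) post (trans (Listₚ.++-assoc pre [ it ] post) e))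
        where
        here′ : ∀ it post → pre ++ it ∷ post ≡ M → All Effect (colourHere pre (it ∷ post))
        here′ (bk _ _ _ _) post                    eq = []
        here′ (pl p) []                            eq = []
        here′ (pl p) (bk _ _ _ _ ∷ post)           eq = []
        here′ (pl p) (pl u ∷ [])                   eq = []
        here′ (pl p) (pl u ∷ bk _ _ _ _ ∷ post)    eq = []
        here′ (pl p) (pl u ∷ pl q ∷ post)          refl =
          (_ , refl , trans (nb-++ pre _) (trans (ℕₚ.+-suc (nb pre) (nb post)) (cong suc (sym (nb-++ pre _))))) ∷ []

      windows : ∀ pre N → length (flat N) ℕ.≤ length (colourMoves pre N) ℕ.+ 5 ℕ.* nb N ℕ.+ 2
      windows pre [] = z≤n
      windows pre (bk x r y B ∷ N) = ℕₚ.≤-trans (ℕₚ.+-monoʳ-≤ 3 (windows (pre ++ [ bk x r y B ]) N))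
        (ℕₚ.≤-trans (ℕₚ.m≤n+m _ 2) (ℕₚ.≤-reflexive (arr (length (colourMoves (pre ++ [ bk x r y B ]) N)) (nb N))))
        where
        arr : ∀ a b → 2 ℕ.+ (3 ℕ.+ (a ℕ.+ 5 ℕ.* b ℕ.+ 2)) ≡ a ℕ.+ 5 ℕ.* (1 ℕ.+ b) ℕ.+ 2
        arr = ℕS.solve-∀
      windows pre (pl p ∷ []) = s≤s z≤n
      windows pre (pl p ∷ bk x r y B ∷ N) = ℕₚ.≤-trans (ℕₚ.+-monoʳ-≤ 4 (windows ((pre ++ [ pl p ]) ++ [ bk x r y B ]) N))
        (ℕₚ.≤-trans (ℕₚ.m≤n+m _ 1) (ℕₚ.≤-reflexive (arr (length (colourMoves ((pre ++ [ pl p ]) ++ [ bk x r y B ]) N)) (nb N))))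
        where
        arr : ∀ a b → 1 ℕ.+ (4 ℕ.+ (a ℕ.+ 5 ℕ.* b ℕ.+ 2)) ≡ a ℕ.+ 5 ℕ.* (1 ℕ.+ b) ℕ.+ 2
        arr = ℕS.solve-∀
      windows pre (pl p ∷ pl u ∷ []) = s≤s (s≤s z≤n)
      windows pre (pl p ∷ pl u ∷ bk x r y B ∷ N) = ℕₚ.≤-trans (ℕₚ.+-monoʳ-≤ 5 (windows (((pre ++ [ pl p ]) ++ [ pl u ]) ++ [ bk x r y B ]) N))
        (ℕₚ.≤-reflexive (arr (length (colourMoves (((pre ++ [ pl p ]) ++ [ pl u ]) ++ [ bk x r y B ]) N)) (nb N)))
        where
        arr : ∀ a b → 5 ℕ.+ (a ℕ.+ 5 ℕ.* b ℕ.+ 2) ≡ a ℕ.+ 5 ℕ.* (1 ℕ.+ b) ℕ.+ 2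
        arr = ℕS.solve-∀
      windows pre (pl p ∷ pl u ∷ pl q ∷ N) = s≤s (windows (pre ++ [ pl p ]) (pl u ∷ pl q ∷ N))

      colour-keys : ∀ u pre N → occ u (keys (colourMoves pre N)) ℕ.≤ occP u (dropHd N)
      colour-keys u pre [] = z≤n
      colour-keys u pre (bk x r y B ∷ N) = ℕₚ.≤-trans (colour-keys u (pre ++ [ bk x r y B ]) N) (dr N)
        where
        dr : ∀ N → occP u (dropHd N) ℕ.≤ occP u N
        dr []      = z≤n
        dr (i ∷ N) = occP-tail u i N
      colour-keys u pre (pl p ∷ []) = z≤n
      colour-keys u pre (pl p ∷ bk x r y B ∷ N) = colour-keys u (pre ++ [ pl p ]) (bk x r y B ∷ N)
      colour-keys u pre (pl p ∷ pl v ∷ []) = z≤n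
      colour-keys u pre (pl p ∷ pl v ∷ bk x r y B ∷ N) = ℕₚ.≤-trans (colour-keys u (pre ++ [ pl p ]) (pl v ∷ bk x r y B ∷ N)) (ℕₚ.m≤n+m _ ⟦ u ≟ v ⟧)
      colour-keys u pre (pl p ∷ pl v ∷ pl q ∷ N) = ℕₚ.+-monoʳ-≤ ⟦ u ≟ v ⟧ (colour-keys u (pre ++ [ pl p ]) (pl v ∷ pl q ∷ N))

      close-keys : ∀ u N → occ u (keys (closeMoves N)) ℕ.≤ occB u N
      close-keys u []               = z≤n
      close-keys u (pl v ∷ N)       = close-keys u N
      close-keys u (bk x r y _ ∷ N) = ℕₚ.+-mono-≤ (ℕₚ.m≤m+n ⟦ u ≟ x ⟧ _) (close-keys u N)

      σ-close : ∀ δ N → σ δ (closeMoves N) ≡ δ close * + nb N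
      σ-close δ []               = sym (ℤₚ.*-zeroʳ (δ close))
      σ-close δ (pl v ∷ N)       = σ-close δ N
      σ-close δ (bk x r y _ ∷ N) = trans (cong (λ z → δ close + z) (σ-close δ N)) (arr (δ close) (+ nb N))
        where
        arr : ∀ a b → a + a * b ≡ a * (+ 1 + b)
        arr = ℤS.solve-∀

      σ-colour : ∀ δ pre N → σ δ (colourMoves pre N) ≡ δ colour * + length (colourMoves pre N)
      σ-colour δ pre [] = sym (ℤₚ.*-zeroʳ (δ colour))
      σ-colour δ pre (bk x r y B ∷ N) = σ-colour δ (pre ++ [ bk x r y B ]) N
      σ-colour δ pre (pl p ∷ []) = sym (ℤₚ.*-zeroʳ (δ colour))
      σ-colour δ pre (pl p ∷ bk x r y B ∷ N) = σ-colour δ (pre ++ [ pl p ]) (bk x r y B ∷ N)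
      σ-colour δ pre (pl p ∷ pl v ∷ []) = sym (ℤₚ.*-zeroʳ (δ colour))
      σ-colour δ pre (pl p ∷ pl v ∷ bk x r y B ∷ N) = σ-colour δ (pre ++ [ pl p ]) (pl v ∷ bk x r y B ∷ N)
      σ-colour δ pre (pl p ∷ pl v ∷ pl q ∷ N) = trans (cong (λ z → δ colour + z) (σ-colour δ (pre ++ [ pl p ]) (pl v ∷ pl q ∷ N)))
          (arr (δ colour) (+ length (colourMoves (pre ++ [ pl p ]) (pl v ∷ pl q ∷ N))))
        where
        arr : ∀ a b → a + a * b ≡ a * (+ 1 + b)
        arr = ℤS.solve-∀

    effects : All Effect ms
    effects = subst (All Effect) (sym ms≡) (Allₚ.++⁺ (closeEffect M) al)
      where
      al : All Effect (allowed M (colourMoves [] M))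
      al with suc (nb M) ℕ.≤? K
      ... | yes _ = colourEffect [] M refl
      ... | no _  = []

    clos-keys : ∀ u → occ u (keys ms) ℕ.≤ 1
    clos-keys u = begin
      occ u (keys ms)   ≡⟨ trans (cong (occ u ∘ keys) ms≡) (occ-keys-++ u (closeMoves M) _) ⟩
      occ u (keys (closeMoves M)) ℕ.+ occ u (keys (allowed M (colourMoves [] M)))
        ≤⟨ ℕₚ.+-mono-≤ (close-keys u M) (ℕₚ.≤-trans al (ℕₚ.≤-trans (colour-keys u [] M) (dr M))) ⟩
      occB u M ℕ.+ occP u M ≡⟨ trans (occBP u M) (o u) ⟩
      1 ∎
      where
      open ℕₚ.≤-Reasoning
      dr : ∀ N → occP u (dropHd N) ℕ.≤ occP u N
      dr []      = z≤n
      dr (i ∷ N) = occP-tail u i N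
      al : occ u (keys (allowed M (colourMoves [] M))) ℕ.≤ occ u (keys (colourMoves [] M))
      al with suc (nb M) ℕ.≤? K
      ... | yes _ = ℕₚ.≤-refl
      ... | no _  = z≤n

    clos-σ : ∀ δ → σ δ ms ≡ δ close * + nb M + δ colour * + nAllowed
    clos-σ δ = trans (cong (σ δ) ms≡) (trans (σ-++ δ (closeMoves M) _) (cong₂ ℤ._+_ (σ-close δ M) al))
      where
      al : σ δ (allowed M (colourMoves [] M)) ≡ δ colour * + nAllowed
      al with suc (nb M) ℕ.≤? K
      ... | yes _ = σ-colour δ [] M
      ... | no _  = sym (ℤₚ.*-zeroʳ (δ colour))

    nAllowed-≥ : suc (nb M) ℕ.≤ K → n ℕ.≤ nAllowed ℕ.+ 5 ℕ.* nb M ℕ.+ 2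
    nAllowed-≥ k with suc (nb M) ℕ.≤? K
    ... | no ¬k = ⊥-elim (¬k k)
    ... | yes _ = ℕₚ.≤-trans (ℕₚ.≤-reflexive (sym (length-once (flat M) o))) (windows [] M)

-- What a system of bounds has to satisfy.

-- Twice the sum of (1 + g)(a + ω size + β g) over l segments of degree g = d and h segments of degree g = d + 1
-- with total sizes ml and mh, plus γ for each of N colouring moves.
drift : (d l h ml mh N : ℕ) (a ω β γ : ℤ) → ℤ
drift d l h ml mh N a ω β γ =
  (+ 2 * (+ 1 + + d)) * ((a + β * + d) * + l + ω * + ml) +
  (+ 2 * (+ 1 + + suc d)) * ((a + β * + suc d) * + h + ω * + mh) + γ * + N

-- All that the drift estimates know of a merging state: l and h segments of degree d and d + 1 with
-- ml and mh vertices, r blocks, and N colouring moves. N is bounded below only while neither cap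
-- forbids colouring.
record Counts (n : ℕ) (D : ℕ → ℕ) (Rc : ℕ) (d l h ml mh N r : ℕ) : Set where
  field
    r≡  : r ≡ d ℕ.* l ℕ.+ suc d ℕ.* h
    l≥1 : 1 ℕ.≤ l
    ml≥ : 2 ℕ.* l ℕ.≤ ml
    mh≥ : 2 ℕ.* h ℕ.≤ mh
    m≤  : ml ℕ.+ mh ℕ.≤ n
    N≥  : suc d ℕ.≤ D (l ℕ.+ h) → suc r ℕ.≤ Rc → n ℕ.≤ N ℕ.+ 5 ℕ.* r ℕ.+ 2 ℕ.+ (ml ℕ.+ mh)
    d≤  : d ℕ.≤ D (l ℕ.+ h)
    h≤  : 0 ℕ.< h → suc d ℕ.≤ D (l ℕ.+ h)
    r≤  : r ℕ.≤ Rc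

reds≤ : ∀ {n D Rc d l h ml mh N r} → Counts n D Rc d l h ml mh N r → r ℕ.≤ D (l ℕ.+ h) ℕ.* (l ℕ.+ h)
reds≤ {n} {D} {Rc} {d} {l} {zero} c = ℕₚ.≤-trans (ℕₚ.≤-reflexive (trans (Counts.r≡ c) (cong (d ℕ.* l ℕ.+_) (trans (ℕₚ.*-zeroʳ (suc d)) (sym (ℕₚ.*-zeroʳ d))))))
  (ℕₚ.≤-trans (ℕₚ.≤-reflexive (sym (ℕₚ.*-distribˡ-+ d l 0))) (ℕₚ.*-monoˡ-≤ (l ℕ.+ 0) (Counts.d≤ c)))
reds≤ {n} {D} {Rc} {d} {l} {h@(suc _)} c = ℕₚ.≤-trans (ℕₚ.≤-reflexive (Counts.r≡ c))
  (ℕₚ.≤-trans (ℕₚ.+-mono-≤ (ℕₚ.*-monoˡ-≤ l (Counts.d≤ c)) (ℕₚ.*-monoˡ-≤ h (Counts.h≤ c (s≤s z≤n)))) (ℕₚ.≤-reflexive (sym (ℕₚ.*-distribˡ-+ (D (l ℕ.+ h)) l h))))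

-- Bounds in terms of the number x of components, scaled by S: G from above for the number of single vertices, R from
-- below for the number of blocks, M from above for the total size of the segments, A for the remaining time. Each functional needs a drift estimate
-- only where it is nonnegative, and only as long as the others stay below b.
record Profile (n L : ℕ) (D : ℕ → ℕ) (Rc K : ℕ) : Set where
  field
    S′ cs ce b K₀ B : ℕ
    ce≤cs : ce ℕ.≤ cs
    G R M A κ ρ μ α : ℕ → ℤ
  S : ℤ
  -- Even, because late in the game a segment vertex weighs S′, half a step.
  S = + 2 * + S′
  field
    dG : ∀ x → cs ℕ.≤ x → x ℕ.< n → G (suc x) ≡ G x + κ (suc x)
    dR : ∀ x → cs ℕ.≤ x → x ℕ.< n → R (suc x) ≡ R x + ρ (suc x)
    dM : ∀ x → cs ℕ.≤ x → x ℕ.< n → M (suc x) ≡ M x + μ (suc x)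
    dA : ∀ x → cs ℕ.< x → x ℕ.< n → A x + α (suc x) ≤ A (suc x)
    -- Crossing `cs` exchanges the table for a potential in which the segment vertices are charged.
    -- Their number is only known through the bound M, and A has to pay for it here.
    dA₀ : cs ℕ.< n → ∀ x m → x ≡ cs → S * + m - M (suc x) < + b → A x + + S′ * + m + α (suc x) ≤ A (suc x)
    dA₁ : ∀ x → x ℕ.< cs → A (suc x) ≡ A x + α (suc x)
    A≥ : ∀ x → x ℕ.< n → 0ℤ ≤ A (suc x)
    A≥₃ : ∀ x r → x ℕ.≤ cs → r ℕ.≤ D x ℕ.* x → S * + r ≤ A x
    A0 : A 0 ≡ + K₀ + S * + (2 ℕ.* K)
    -- Within the tube of G no single vertex survives until the component count has come down to
    -- `cs`.
    zone : ∀ i s → i ℕ.+ s ℕ.< n → S * + suc i - G (suc (i ℕ.+ s)) < + b → cs ℕ.< i ℕ.+ s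
    -- Growth may end at various values of x. Wherever it does, the bounds R and M must hold
    -- trivially, with no block and with at most n segment vertices.
    start : ∀ x → cs ℕ.< x → x ℕ.< n → S * + 1 - G (suc x) < + b → R x ≤ 0ℤ × S * + n ≤ M x
    bound-R : ∀ x → cs ℕ.< x → x ℕ.≤ n → ∀ g → g ℕ.≤ D x → ∣ - ρ x + S * + g ∣ ℕ.≤ B
    bound-M : ∀ x s → cs ℕ.< x → x ℕ.≤ n → s ℕ.≤ L → ∣ μ x - S * + s ∣ ℕ.≤ B
    -- Only above `ce` are degrees, and with them the increments, bounded independently of n.
    bound-A : ∀ x s g → ce ℕ.< x → x ℕ.≤ n → s ℕ.≤ L → g ℕ.≤ D x → ∣ S + (- α x) ∣ ℕ.≤ B × ∣ S + (- α x - + S′ * + s + S * + g) ∣ ℕ.≤ B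
    bound-κ : ∀ x → cs ℕ.< x → x ℕ.≤ n → ∣ κ x - S ∣ ℕ.≤ B × ∣ κ x - + 2 * S ∣ ℕ.≤ B
    bound-S : ∣ S ∣ ℕ.≤ B
    Φmax : ℕ
    A≤ : ∀ x m → x ℕ.≤ ce → m ℕ.≤ L ℕ.* x → A x + + S′ * + m ≤ + Φmax
    growth : ∀ i s p q → i ℕ.+ s ℕ.< n → S * + suc i - G (suc (i ℕ.+ s)) < + b → i ℕ.≤ p → p ℕ.≤ suc i → q ℕ.≤ s →
             0ℤ ≤ S * + suc i - G (suc (i ℕ.+ s)) →
             (κ (suc (i ℕ.+ s)) - + 2 * S) * + p + (κ (suc (i ℕ.+ s)) - S) * + (2 ℕ.* q) ≤ 0ℤ
    growthTime : ∀ i s p q → i ℕ.+ s ℕ.< n → S * + suc i - G (suc (i ℕ.+ s)) < + b → i ℕ.≤ p → L ℕ.* s ℕ.≤ L ℕ.* q ℕ.+ n →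
             + n * S + ((- α (suc (i ℕ.+ s))) * + p + (- α (suc (i ℕ.+ s))) * + (2 ℕ.* q)) ≤ 0ℤ
    reds : ∀ d l h ml mh N r → Counts n D Rc d l h ml mh N r → cs ℕ.< l ℕ.+ h → l ℕ.+ h ℕ.≤ n →
           R (l ℕ.+ h) - S * + r < + b → S * + (ml ℕ.+ mh) - M (l ℕ.+ h) < + b →
           0ℤ ≤ R (l ℕ.+ h) - S * + r → drift d l h ml mh N (- ρ (l ℕ.+ h)) 0ℤ S (- S) ≤ 0ℤ
    mass : ∀ d l h ml mh N r → Counts n D Rc d l h ml mh N r → cs ℕ.< l ℕ.+ h → l ℕ.+ h ℕ.≤ n →
           R (l ℕ.+ h) - S * + r < + b → S * + (ml ℕ.+ mh) - M (l ℕ.+ h) < + b →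
           0ℤ ≤ S * + (ml ℕ.+ mh) - M (l ℕ.+ h) → drift d l h ml mh N (μ (l ℕ.+ h)) (- S) 0ℤ 0ℤ ≤ 0ℤ
    time : ∀ d l h ml mh N r → Counts n D Rc d l h ml mh N r → cs ℕ.< l ℕ.+ h → l ℕ.+ h ℕ.≤ n →
           R (l ℕ.+ h) - S * + r < + b → S * + (ml ℕ.+ mh) - M (l ℕ.+ h) < + b →
           + n * S + drift d l h ml mh N (- α (l ℕ.+ h)) 0ℤ 0ℤ 0ℤ ≤ 0ℤ
    late : ∀ d l h ml mh N r → Counts n D Rc d l h ml mh N r → l ℕ.+ h ℕ.≤ cs →
           + n * S + drift d l h ml mh N (- α (l ℕ.+ h)) (- + S′) S (- S) ≤ 0ℤ
    closing : ∀ k N → k ℕ.< K → n ℕ.≤ N ℕ.+ 5 ℕ.* k ℕ.+ 2 → + n * S ≤ S * + (2 ℕ.* N)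
    closed : + n * S ≤ + K₀ * + K

sq⁺-< : ∀ X b → sq⁺ X ℕ.< b ℕ.* b → X < + b
sq⁺-< (+ x)      b h = ℤ.+<+ (ℕₚ.≰⇒> (λ b≤x → ℕₚ.<-irrefl refl (ℕₚ.<-≤-trans h (ℕₚ.*-mono-≤ b≤x b≤x))))
sq⁺-< (-[1+ x ]) b h = ℤ.-<+

sq⁺-≤0 : ∀ {X} → X ≤ 0ℤ → sq⁺ X ≡ 0
sq⁺-≤0 {X} h = ℕₚ.n≤0⇒n≡0 (sq⁺-mono h)

-- Potentials and their increments under the moves.

module Potential (n L : ℕ) (D : ℕ → ℕ) (Rc K : ℕ) (D-anti : ∀ {a b} → a ℕ.≤ b → D b ℕ.≤ D a) (2≤L : 2 ℕ.≤ L)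
                 (P : Profile n L D Rc K) where

  open Profile P
  open Process n L D Rc K
  open Effects n L D Rc K D-anti

  private
    2S : ℤ
    2S = + 2 * S

  whenEarly : {X : Set} → ℕ → X → X → X
  whenEarly c a z with c ℕ.≤? cs
  ... | yes _ = z
  ... | no _  = a

  early : ∀ {X : Set} {c} {a z : X} → cs ℕ.< c → whenEarly c a z ≡ a
  early {c = c} lt with c ℕ.≤? cs
  ... | yes le = ⊥-elim (ℕₚ.<⇒≱ lt le)
  ... | no _   = refl

  lateV : ∀ {X : Set} {c} {a z : X} → c ℕ.≤ cs → whenEarly c a z ≡ z
  lateV {c = c} le with c ℕ.≤? cs
  ... | yes _  = refl
  ... | no nle = ⊥-elim (nle le)

  -- Below `cs` a block counts as one step of progress at the moment it is made, and is given back
  -- when it dissolves. Half a step per segment vertex makes up for the fact that such vertices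
  -- cannot be coloured.
  ΦM : ℕ → ℕ → ℕ → ℤ
  ΦM c m r = whenEarly c (A c) (A c + + S′ * + m - S * + r)

  RM MM : ℕ → ℕ → ℕ → ℕ
  RM c m r = whenEarly c (sq⁺ (R c - S * + r)) 0
  MM c m r = whenEarly c (sq⁺ (S * + m - M c)) 0

  Φ : St → ℤ
  Φ (grow s ss Bs)        = A (suc (length ss ℕ.+ length Bs))
  Φ (main d B low high N) = ΦM (suc (length low ℕ.+ length high)) (sizeS (B ∷ low) ℕ.+ sizeS high) (nb N)
  -- Two steps for each missing block, as at least half of the vertices can be coloured; K₀ pays for
  -- the wait until one of K blocks is hit.
  Φ (clos N)              = + K₀ + S * + (2 ℕ.* (K ℕ.∸ nb N))
  Φ done                  = 0ℤ

  Yᵢ Yᵣ Yₘ : St → ℕ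
  Yᵢ (grow s ss Bs)        = sq⁺ (S * + suc (length ss) - G (suc (length ss ℕ.+ length Bs)))
  Yᵢ _                     = 0
  Yᵣ (main d B low high N) = RM (suc (length low ℕ.+ length high)) (sizeS (B ∷ low) ℕ.+ sizeS high) (nb N)
  Yᵣ _                     = 0
  Yₘ (main d B low high N) = MM (suc (length low ℕ.+ length high)) (sizeS (B ∷ low) ℕ.+ sizeS high) (nb N)
  Yₘ _                     = 0

  -- Excess of the estimated remaining time over the k steps left. The offset 2 b makes τ ≥ 2 b when
  -- the time is used up, while τ < b still guarantees b / S steps.
  τ : St → ℕ → ℤ
  τ s k = Φ s - S * + k + + (2 ℕ.* b)

  W : St → ℕ → ℕ
  W s k = Yᵢ s ℕ.+ Yᵣ s ℕ.+ Yₘ s ℕ.+ sq⁺ (τ s k)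

  stM : Move → St
  stM mv = proj₁ (proj₂ (proj₂ mv))

  stepAll : ∀ {Q : St → Set} s u → Q s → All (Q ∘ stM) (moves s) → Q (step s u)
  stepAll {Q} s u q a with find u (moves s) in eq
  ... | nothing          = q
  ... | just (v , s′ , l) = find-All {P = Q ∘ stM} u (moves s) a eq

  stepInv : ∀ s u → Inv s → Inv (step s u)
  stepInv s u i = stepAll {Q = Inv} s u i (All.map (λ { {_ , _ , _ , _} f → f tt }) (movesGood 2≤L s i))

  once-keys : ∀ s → Inv s → ∀ u → occ u (keys (moves s)) ℕ.≤ 1
  once-keys (grow s ss Bs)        i = EffectsGrow.grow-keys s ss Bs i
  once-keys (main d B low high N) i = ColourMain.main-keys d B low high N i
  once-keys (clos N) (o , _) u      = go (flat N) refl
    where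
    go : ∀ xs → flat N ≡ xs → occ u (keys (closMoves N xs)) ℕ.≤ 1
    go []       e = z≤n
    go (x ∷ xs) e = subst (λ z → occ u (keys (closMoves N z)) ℕ.≤ 1) e (EffectsClos.clos-keys N x xs e o u)
  once-keys done                  i u = z≤n

  -- X is the present excess, e its increment when nothing happens, and a move adds δ of its label.
  -- Y is only bounded by the squared excess, so a functional that is switched off after a change of
  -- phase is covered as well.
  bridge : ∀ s → Inv s → (X e : ℤ) (δ : Lab → ℤ) (Y : St → ℕ) (Bd : ℕ) → Y s ℕ.≤ sq⁺ (X + e) → ∣ e ∣ ℕ.≤ Bd →
    All (λ mv → Y (stM mv) ℕ.≤ sq⁺ (X + (e + δ (lab mv))) × ∣ e + δ (lab mv) ∣ ℕ.≤ Bd) (moves s) →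
    (0ℤ ≤ X → + n * e + σ δ (moves s) ≤ 0ℤ) → ∑ (λ u → Y (step s u)) ℕ.≤ n ℕ.* (sq⁺ X ℕ.+ Bd ℕ.* Bd)
  bridge s i X e δ Y Bd y0 e≤ a dr = ∑-sq⁺ (λ u → Y (step s u)) D′ X Bd hY hD
      (λ p → ℤₚ.≤-trans (ℤₚ.≤-reflexive sumD) (dr p))
    where
    D′ : Fin n → ℤ
    D′ u = e + maybe′ (δ ∘ proj₂ ∘ proj₂) 0ℤ (find u (moves s))
    both : ∀ u → Y (step s u) ℕ.≤ sq⁺ (X + D′ u) × ∣ D′ u ∣ ℕ.≤ Bd
    both u with find u (moves s) in eq
    ... | nothing = subst (λ z → Y s ℕ.≤ sq⁺ (X + z)) (sym (ℤₚ.+-identityʳ e)) y0 , subst (λ z → ∣ z ∣ ℕ.≤ Bd) (sym (ℤₚ.+-identityʳ e)) e≤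
    ... | just _ = find-All {P = λ mv → Y (stM mv) ℕ.≤ sq⁺ (X + (e + δ (lab mv))) × ∣ e + δ (lab mv) ∣ ℕ.≤ Bd} u (moves s) a eq
    hY : ∀ u → Y (step s u) ℕ.≤ sq⁺ (X + D′ u)
    hY u = proj₁ (both u)
    hD : ∀ u → ∣ D′ u ∣ ℕ.≤ Bd
    hD u = proj₂ (both u)
    sumD : ∑ℤ D′ ≡ + n * e + σ δ (moves s)
    sumD = trans (∑ℤ-+ {n} (λ _ → e) _) (cong₂ ℤ._+_ (∑ℤ-const {n} e) (∑ℤ-find (δ ∘ proj₂ ∘ proj₂) (moves s) (once-keys s i)))

  -- a functional that vanishes on all successors needs no drift estimate
  bridge-0 : ∀ s → Inv s → (Y : St → ℕ) → Y s ≡ 0 → All (λ mv → Y (stM mv) ≡ 0) (moves s) → ∑ (λ u → Y (step s u)) ℕ.≤ n ℕ.* (Y s ℕ.+ B ℕ.* B)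
  bridge-0 s i Y y0 a = ℕₚ.≤-trans (∑-mono {g = λ _ → 0} (λ u → ℕₚ.≤-reflexive (stepAll {Q = λ s′ → Y s′ ≡ 0} s u y0 a)))
    (ℕₚ.≤-trans (ℕₚ.≤-reflexive (trans (∑-const {n} 0) (ℕₚ.*-zeroʳ n))) z≤n)

  -- The first moment counterpart of `bridge`, for the phases where increments are not bounded;
  -- nonnegativity allows absolute values in place of Φ.
  bridgeΦ : ∀ s → Inv s → (δ : Lab → ℤ) → (∀ s′ → Inv s′ → 0ℤ ≤ Φ s′) → All (λ mv → Φ (stM mv) ≤ Φ s + δ (lab mv)) (moves s) →
    + n * S + σ δ (moves s) ≤ 0ℤ → ∑ (λ u → ∣ Φ (step s u) ∣) ℕ.+ n ℕ.* ∣ S ∣ ℕ.≤ n ℕ.* ∣ Φ s ∣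
  bridgeΦ s i δ pos a dr = ℤₚ.drop‿+≤+ (begin
    + ∑ (λ u → ∣ Φ (step s u) ∣) + + (n ℕ.* ∣ S ∣)
      ≤⟨ ℤₚ.+-monoˡ-≤ (+ (n ℕ.* ∣ S ∣)) (castSum (λ u → Φ (step s u)) (λ u → pos _ (stepInv s u i)) D′ each) ⟩
    ∑ℤ (λ u → Φ s + D′ u) + + (n ℕ.* ∣ S ∣)
      ≡⟨ cong₂ ℤ._+_ (trans (∑ℤ-+ {n} (λ _ → Φ s) D′) (cong₂ ℤ._+_ (∑ℤ-const {n} (Φ s)) (∑ℤ-find (δ ∘ proj₂ ∘ proj₂) (moves s) (once-keys s i)))) nS ⟩
    (+ n * Φ s + σ δ (moves s)) + + n * S
      ≡⟨ arr (+ n * Φ s) (σ δ (moves s)) (+ n * S) ⟩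
    + n * Φ s + (+ n * S + σ δ (moves s))
      ≤⟨ ℤₚ.+-monoʳ-≤ (+ n * Φ s) dr ⟩
    + n * Φ s + 0ℤ
      ≡⟨ trans (ℤₚ.+-identityʳ _) (trans (cong (λ z → + n * z) (sym (ℤₚ.0≤i⇒+∣i∣≡i (pos s i)))) (sym (ℤₚ.pos-* n ∣ Φ s ∣))) ⟩
    + (n ℕ.* ∣ Φ s ∣) ∎)
    where
    open ℤₚ.≤-Reasoning
    D′ : Fin n → ℤ
    D′ u = maybe′ (δ ∘ proj₂ ∘ proj₂) 0ℤ (find u (moves s))
    arr : ∀ a b c → (a + b) + c ≡ a + (c + b)
    arr = ℤS.solve-∀
    nS : + (n ℕ.* ∣ S ∣) ≡ + n * S
    nS = trans (ℤₚ.pos-* n ∣ S ∣) (cong (λ z → + n * z) (ℤₚ.0≤i⇒+∣i∣≡i {S} (subst (0ℤ ℤ.≤_) (ℤₚ.pos-* 2 S′) (ℤ.+≤+ z≤n))))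
    each : ∀ u → Φ (step s u) ≤ Φ s + D′ u
    each u with find u (moves s) in eq
    ... | nothing = ℤₚ.≤-reflexive (sym (ℤₚ.+-identityʳ (Φ s)))
    ... | just _ = find-All {P = λ mv → Φ (stM mv) ≤ Φ s + δ (lab mv)} u (moves s) a eq
    castSum : ∀ {m} (f : Fin m → ℤ) → (∀ u → 0ℤ ≤ f u) → (g : Fin m → ℤ) → (∀ u → f u ≤ Φ s + g u) →
              + ∑ (λ u → ∣ f u ∣) ≤ ∑ℤ (λ u → Φ s + g u)
    castSum {zero}  f p g h = ℤₚ.≤-refl
    castSum {suc m} f p g h = ℤₚ.+-mono-≤ (ℤₚ.≤-trans (ℤₚ.≤-reflexive (ℤₚ.0≤i⇒+∣i∣≡i (p zero))) (h zero)) (castSum (f ∘ suc) (p ∘ suc) (g ∘ suc) (h ∘ suc))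

  data Seen (s : St) (c m r : ℕ) : Set where
    seen-main : ∀ d B low high N → s ≡ main d B low high N → suc (length low ℕ.+ length high) ≡ c →
                sizeS (B ∷ low) ℕ.+ sizeS high ≡ m → nb N ≡ r → Seen s c m r
    seen-clos : ∀ N → s ≡ clos N → nb N ≡ 0 → c ≡ 0 → Seen s c m r

  see : ∀ {s c m r} → Obs s c m r → Seen s c m r
  see (obs {d} {B ∷ low} {high} {N} refl refl refl refl) = seen-main d B low high N refl refl refl refl
  see (obs {d} {[]} {B ∷ high} {N} refl refl refl refl)  = seen-main (suc d) B high [] N refl (cong suc (ℕₚ.+-identityʳ _)) (ℕₚ.+-identityʳ _) refl
  see (obs {d} {[]} {[]} {N} refl refl refl refl)        = seen-clos _ refl (nb-pl (flat N)) refl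

  module AtMain (d : ℕ) (B₀ : Seg n) (low high : List (Seg n)) (N : List (Item n (Seg n))) (i : Inv (main d B₀ low high N)) where

    open EffectsMain d B₀ low high N i public
    open MInv

    s₀ : St
    s₀ = main d B₀ low high N

    x l h : ℕ
    x = length low ℕ.+ length high
    l = suc (length low)
    h = length high

    counts : Counts n D Rc d l h (sizeS (B₀ ∷ low)) (sizeS high) (ColourMain.nAllowed d B₀ low high N) (nb N)
    counts = record
      { r≡ = ColourMain.nb-count d B₀ low high N i ; l≥1 = s≤s z≤n ; ml≥ = sizeS-≥ (B₀ ∷ low) ; mh≥ = sizeS-≥ high
      ; m≤ = ℕₚ.≤-trans (ℕₚ.≤-reflexive (sym (sizeS-++ (B₀ ∷ low) high))) (ℕₚ.m+n≤o⇒n≤o (length (flat N)) (ℕₚ.≤-reflexive (total (flat N) ((B₀ ∷ low) ++ high) (once i))))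
      ; N≥ = ColourMain.nAllowed-≥ d B₀ low high N i
      ; d≤ = dbL i (s≤s z≤n) ; h≤ = dbH i ; r≤ = few i }

    size≤ : ∀ {C} → C ∈ Bs → size C ℕ.≤ L
    size≤ p = proj₂ (All.lookup (Allₚ.++⁺ (okL i) (okH i)) p)

    deg≤ : ∀ {C} → C ∈ Bs → deg (hd C) N ℕ.≤ D cM
    deg≤ {C} p with ∈ₚ.∈-++⁻ (B₀ ∷ low) p
    ... | inj₁ q = subst (ℕ._≤ D cM) (sym (All.lookup (degL i) q)) (Counts.d≤ counts)
    ... | inj₂ q = subst (ℕ._≤ D cM) (sym (All.lookup (degH i) q)) (Counts.h≤ counts (nonempty q))
      where
      nonempty : ∀ {C : Seg n} {Cs} → C ∈ Cs → 0 ℕ.< length Cs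
      nonempty (here _)  = s≤s z≤n
      nonempty (there _) = s≤s z≤n

    cM≤n : cM ℕ.≤ n
    cM≤n = ℕₚ.≤-trans (ℕₚ.m≤n*m cM 2) (ℕₚ.≤-trans (ℕₚ.≤-trans (ℕₚ.≤-reflexive (ℕₚ.*-distribˡ-+ 2 l h)) (ℕₚ.+-mono-≤ (Counts.ml≥ counts) (Counts.mh≥ counts))) (Counts.m≤ counts))

    linear : (a ω β γ : ℤ) → Lab → ℤ
    linear a ω β γ (rem C) = a + ω * + size C + β * + deg (hd C) N
    linear a ω β γ _       = γ

    linear-σ : ∀ a ω β γ → σ (linear a ω β γ) (moves s₀) ≡ drift d l h (sizeS (B₀ ∷ low)) (sizeS high) (ColourMain.nAllowed d B₀ low high N) a ω β γ
    linear-σ a ω β γ = ColourMain.main-σ d B₀ low high N i (linear a ω β γ) a ω β (λ _ → refl)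

    -- The last segment is the target of every block. So no block survives its removal, and the
    -- merging potential agrees with that of the closing phase.
    lastRed : ∀ {C} → C ∈ Bs → cM ≡ 1 → deg (hd C) N ≡ nb N
    lastRed p e = go low high refl refl e p
      where
      go : ∀ lo hi → lo ≡ low → hi ≡ high → suc (length lo ℕ.+ length hi) ≡ 1 → ∀ {C} → C ∈ (B₀ ∷ lo) ++ hi → deg (hd C) N ≡ nb N
      go [] [] refl refl _ (here refl) = trans (All.head (degL i)) (sym (trans (Counts.r≡ counts)
        (trans (cong₂ ℕ._+_ (ℕₚ.*-identityʳ d) (ℕₚ.*-zeroʳ (suc d))) (ℕₚ.+-identityʳ d))))
      go (_ ∷ _) hi _ _ () _
      go [] (_ ∷ _) _ _ () _

    RM≤ : ∀ c m r → RM c m r ℕ.≤ sq⁺ (R c - S * + r)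
    RM≤ c m r with c ℕ.≤? cs
    ... | yes _ = z≤n
    ... | no _  = ℕₚ.≤-refl

    MM≤ : ∀ c m r → MM c m r ℕ.≤ sq⁺ (S * + m - M c)
    MM≤ c m r with c ℕ.≤? cs
    ... | yes _ = z≤n
    ... | no _  = ℕₚ.≤-refl

    notGrow : ∀ {s c m r} → Obs s c m r → Yᵢ s ≡ 0
    notGrow o with see o
    ... | seen-main _ _ _ _ _ refl _ _ _ = refl
    ... | seen-clos _ refl _ _           = refl

    Yᵣ≤ : ∀ {s c m r X} → Obs s c m r → R c - S * + r ≤ X → Yᵣ s ℕ.≤ sq⁺ X
    Yᵣ≤ {m = m} o le with see o
    ... | seen-main _ _ _ _ _ refl refl refl refl = ℕₚ.≤-trans (RM≤ _ m _) (sq⁺-mono le)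
    ... | seen-clos _ refl _ _                    = z≤n

    Yₘ≤ : ∀ {s c m r X} → Obs s c m r → S * + m - M c ≤ X → Yₘ s ℕ.≤ sq⁺ X
    Yₘ≤ {r = r} o le with see o
    ... | seen-main _ _ _ _ _ refl refl refl refl = ℕₚ.≤-trans (MM≤ _ _ r) (sq⁺-mono le)
    ... | seen-clos _ refl _ _                    = z≤n

    lateZero : ∀ {s c m r} → Obs s c m r → c ℕ.≤ cs → Yᵣ s ≡ 0 × Yₘ s ≡ 0
    lateZero o le with see o
    ... | seen-main _ _ _ _ _ refl refl refl refl = lateV le , lateV le
    ... | seen-clos _ refl _ _                    = refl , refl

    Yᵢ-sum : ∑ (λ u → Yᵢ (step s₀ u)) ℕ.≤ n ℕ.* (Yᵢ s₀ ℕ.+ B ℕ.* B)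
    Yᵢ-sum = bridge-0 s₀ i Yᵢ refl (All.map (λ {mv} → go mv) effects)
      where
      go : ∀ mv → Effect mv → Yᵢ (stM mv) ≡ 0
      go (_ , _ , _ , rem C)  (_ , _ , _ , _ , o , _) = notGrow o
      go (_ , _ , _ , colour) o                       = notGrow o

    S≥0 : 0ℤ ≤ S
    S≥0 = subst (0ℤ ℤ.≤_) (ℤₚ.pos-* 2 S′) (ℤ.+≤+ z≤n)

    module Early (cs<c : cs ℕ.< cM) where

      cs≤x : cs ℕ.≤ x
      cs≤x = ℕₚ.≤-pred cs<c

      Yᵣ-sum : RM cM mM rM ℕ.< b ℕ.* b → MM cM mM rM ℕ.< b ℕ.* b → ∑ (λ u → Yᵣ (step s₀ u)) ℕ.≤ n ℕ.* (Yᵣ s₀ ℕ.+ B ℕ.* B)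
      Yᵣ-sum tr tm = subst (λ z → ∑ (λ u → Yᵣ (step s₀ u)) ℕ.≤ n ℕ.* (z ℕ.+ B ℕ.* B)) (sym (early cs<c))
        (bridge s₀ i X 0ℤ (linear (- ρ cM) 0ℤ S (- S)) Yᵣ B
          (ℕₚ.≤-reflexive (trans (early cs<c) (cong sq⁺ (sym (ℤₚ.+-identityʳ X))))) z≤n (All.map (λ {mv} → go mv) effects)
          (λ pos → ℤₚ.≤-trans (ℤₚ.≤-reflexive (trans (cong₂ ℤ._+_ (ℤₚ.*-zeroʳ (+ n)) (linear-σ (- ρ cM) 0ℤ S (- S))) (ℤₚ.+-identityˡ _)))
            (reds d l h _ _ _ _ counts cs<c cM≤n (sq⁺-< X b (subst (ℕ._< b ℕ.* b) (early cs<c) tr)) (sq⁺-< _ b (subst (ℕ._< b ℕ.* b) (early cs<c) tm)) pos)))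
        where
        X : ℤ
        X = R cM - S * + rM
        go : ∀ mv → Effect mv → Yᵣ (stM mv) ℕ.≤ sq⁺ (X + (0ℤ + linear (- ρ cM) 0ℤ S (- S) (lab mv))) × ∣ 0ℤ + linear (- ρ cM) 0ℤ S (- S) (lab mv) ∣ ℕ.≤ B
        go (_ , _ , s′ , rem C) (C∈ , c , m , r , o , refl , _ , re) =
          Yᵣ≤ o (ℤₚ.≤-reflexive (trans (eqn (R x) (ρ cM) S (+ r) (+ deg (hd C) N) (+ size C))
            (cong₂ (λ y z → y - S * z + (0ℤ + (- ρ cM + 0ℤ * + size C + S * + deg (hd C) N))) (sym (dR x cs≤x cM≤n)) (cong +_ re)))) ,
          subst (λ z → ∣ z ∣ ℕ.≤ B) (eqn₂ (ρ cM) S (+ deg (hd C) N) (+ size C)) (bound-R cM cs<c cM≤n _ (deg≤ C∈))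
          where
          eqn : ∀ R₁ ρ₁ S₁ r g z → R₁ - S₁ * r ≡ (R₁ + ρ₁) - S₁ * (r + g) + (0ℤ + (- ρ₁ + 0ℤ * z + S₁ * g))
          eqn = ℤS.solve-∀
          eqn₂ : ∀ ρ₁ S₁ g z → - ρ₁ + S₁ * g ≡ 0ℤ + (- ρ₁ + 0ℤ * z + S₁ * g)
          eqn₂ = ℤS.solve-∀
        go (_ , _ , s′ , colour) o = Yᵣ≤ o (ℤₚ.≤-reflexive (eqn (R cM) S (+ rM))) ,
            subst (λ z → z ℕ.≤ B) (sym (trans (cong ∣_∣ (ℤₚ.+-identityˡ (- S))) (ℤₚ.∣-i∣≡∣i∣ S))) bound-S
          where
          eqn : ∀ R₁ S₁ r → R₁ - S₁ * (+ 1 + r) ≡ (R₁ - S₁ * r) + (0ℤ + (- S₁))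
          eqn = ℤS.solve-∀

      Yₘ-sum : RM cM mM rM ℕ.< b ℕ.* b → MM cM mM rM ℕ.< b ℕ.* b → ∑ (λ u → Yₘ (step s₀ u)) ℕ.≤ n ℕ.* (Yₘ s₀ ℕ.+ B ℕ.* B)
      Yₘ-sum tr tm = subst (λ z → ∑ (λ u → Yₘ (step s₀ u)) ℕ.≤ n ℕ.* (z ℕ.+ B ℕ.* B)) (sym (early cs<c))
        (bridge s₀ i X 0ℤ (linear (μ cM) (- S) 0ℤ 0ℤ) Yₘ B
          (ℕₚ.≤-reflexive (trans (early cs<c) (cong sq⁺ (sym (ℤₚ.+-identityʳ X))))) z≤n (All.map (λ {mv} → go mv) effects)
          (λ pos → ℤₚ.≤-trans (ℤₚ.≤-reflexive (trans (cong₂ ℤ._+_ (ℤₚ.*-zeroʳ (+ n)) (linear-σ (μ cM) (- S) 0ℤ 0ℤ)) (ℤₚ.+-identityˡ _)))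
            (mass d l h _ _ _ _ counts cs<c cM≤n (sq⁺-< _ b (subst (ℕ._< b ℕ.* b) (early cs<c) tr)) (sq⁺-< X b (subst (ℕ._< b ℕ.* b) (early cs<c) tm)) pos)))
        where
        X : ℤ
        X = S * + mM - M cM
        go : ∀ mv → Effect mv → Yₘ (stM mv) ℕ.≤ sq⁺ (X + (0ℤ + linear (μ cM) (- S) 0ℤ 0ℤ (lab mv))) × ∣ 0ℤ + linear (μ cM) (- S) 0ℤ 0ℤ (lab mv) ∣ ℕ.≤ B
        go (_ , _ , s′ , rem C) (C∈ , c , m , r , o , refl , me , _) =
          Yₘ≤ o (ℤₚ.≤-reflexive (trans (eqn (M x) (μ cM) S (+ m) (+ deg (hd C) N) (+ size C))
            (cong₂ (λ y z → S * z - y + (0ℤ + (μ cM + (- S) * + size C + 0ℤ * + deg (hd C) N))) (sym (dM x cs≤x cM≤n)) (cong +_ me)))) ,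
          subst (λ z → ∣ z ∣ ℕ.≤ B) (eqn₂ (μ cM) S (+ deg (hd C) N) (+ size C)) (bound-M cM _ cs<c cM≤n (size≤ C∈))
          where
          eqn : ∀ R₁ ρ₁ S₁ r g z → S₁ * r - R₁ ≡ S₁ * (r + z) - (R₁ + ρ₁) + (0ℤ + (ρ₁ + (- S₁) * z + 0ℤ * g))
          eqn = ℤS.solve-∀
          eqn₂ : ∀ ρ₁ S₁ g z → ρ₁ - S₁ * z ≡ 0ℤ + (ρ₁ + (- S₁) * z + 0ℤ * g)
          eqn₂ = ℤS.solve-∀
        go (_ , _ , s′ , colour) o = Yₘ≤ o (ℤₚ.≤-reflexive (sym (ℤₚ.+-identityʳ X))) , z≤n

    δΦ : Lab → ℤ
    δΦ = whenEarly cM (linear (- α cM) 0ℤ 0ℤ 0ℤ) (linear (- α cM) (- + S′) S (- S))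

    Φ-main : ∀ {s c m r} d′ B′ low′ high′ N′ → s ≡ main d′ B′ low′ high′ N′ → suc (length low′ ℕ.+ length high′) ≡ c →
             sizeS (B′ ∷ low′) ℕ.+ sizeS high′ ≡ m → nb N′ ≡ r → Φ s ≡ ΦM c m r
    Φ-main _ _ _ _ _ refl refl refl refl = refl

    Φ-clos : ∀ {s} N′ → s ≡ clos N′ → nb N′ ≡ 0 → Φ s ≡ A 0
    Φ-clos N′ refl e rewrite e = sym A0

    Φ-effects : (cs ℕ.< cM → S * + mM - M cM < + b) → All (λ mv → Φ (stM mv) ≤ Φ s₀ + δΦ (lab mv)) (moves s₀)
    Φ-effects tube with cM ℕ.≤? cs
    ... | no nle = All.map (λ {mv} → go mv) effects
      where
      cs<c : cs ℕ.< cM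
      cs<c = ℕₚ.≰⇒> nle
      eqn : ∀ a al z g → a - al ≡ a + (- al + 0ℤ * z + 0ℤ * g)
      eqn = ℤS.solve-∀
      move : ∀ {a al c} → a + al ≤ c → a ≤ c - al
      move {a} {al} {c} le = subst (ℤ._≤ c - al) (can a al) (ℤₚ.+-monoˡ-≤ (- al) le)
        where
        can : ∀ a al → a + al - al ≡ a
        can = ℤS.solve-∀
      target : ∀ c m r → suc c ≡ cM → m ℕ.≤ mM → ΦM c m r + α cM ≤ A cM
      target c m r refl m≤ with c ℕ.≤? cs
      ... | no c≰ = dA c (ℕₚ.≰⇒> c≰) cM≤n
      -- The move that crosses `cs`: the block term has the favourable sign and is dropped, the size
      -- term is bounded by the tube of M.
      ... | yes c≤ = ℤₚ.≤-trans (ℤₚ.+-monoˡ-≤ (α cM) (ℤₚ.≤-trans (ℤₚ.+-monoʳ-≤ (A c + + S′ * + m) (ℤₚ.neg-mono-≤ (subst (ℤ._≤ S * + r) (ℤₚ.*-zeroʳ S) (mulS (ℤ.+≤+ (z≤n {r}))))))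
                          (ℤₚ.≤-reflexive (ℤₚ.+-identityʳ (A c + + S′ * + m)))))
                        (dA₀ (ℕₚ.<-≤-trans cs<c cM≤n) c m (ℕₚ.≤-antisym c≤ (ℕₚ.≤-pred cs<c)) (ℤₚ.≤-<-trans (ℤₚ.+-monoˡ-≤ (- M (suc c)) (mulS (ℤ.+≤+ m≤))) (tube cs<c)))
        where
        mulS : ∀ {a b} → a ≤ b → S * a ≤ S * b
        mulS {a} {b} le = subst₂ ℤ._≤_ (sS a) (sS b) (ℤₚ.*-monoˡ-≤-nonNeg (+ (2 ℕ.* S′)) le)
          where
          sS : ∀ z → + (2 ℕ.* S′) * z ≡ S * z
          sS z = cong (ℤ._* z) (ℤₚ.pos-* 2 S′)
      go : ∀ mv → Effect mv → Φ (stM mv) ≤ A cM + linear (- α cM) 0ℤ 0ℤ 0ℤ (lab mv)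
      go (_ , _ , s′ , rem C) (C∈ , c , m , r , o , ce , me , re) =
        subst (Φ s′ ℤ.≤_) (eqn (A cM) (α cM) (+ size C) (+ deg (hd C) N)) (move (ℤₚ.≤-trans (ℤₚ.+-monoˡ-≤ (α cM) le) (target c m′ r′ ce m′≤)))
        where
        pair′ : Σ ℕ λ m′ → Σ ℕ λ r′ → m′ ℕ.≤ mM × Φ s′ ≤ ΦM c m′ r′
        pair′ with see o
        ... | seen-main _ _ _ _ _ refl refl refl refl = m , r , ℕₚ.≤-trans (ℕₚ.m≤m+n m (size C)) (ℕₚ.≤-reflexive me) , ℤₚ.≤-refl
        ... | seen-clos N′ e z refl = 0 , 0 , z≤n , ℤₚ.≤-reflexive (trans (Φ-clos N′ e z) (at0))
          where
          at0 : A 0 ≡ ΦM 0 0 0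
          at0 with 0 ℕ.≤? cs
          ... | yes _ = sym (zero′ (A 0) (+ S′) S)
            where
            zero′ : ∀ a b c → a + b * 0ℤ - c * 0ℤ ≡ a
            zero′ = ℤS.solve-∀
          ... | no ¬0 = ⊥-elim (¬0 z≤n)
        m′ = proj₁ pair′
        r′ = proj₁ (proj₂ pair′)
        m′≤ = proj₁ (proj₂ (proj₂ pair′))
        le = proj₂ (proj₂ (proj₂ pair′))
      go (_ , _ , s′ , colour) o with see o
      ... | seen-main d′ B′ lo hi N′ e₁ e₂ e₃ e₄ = ℤₚ.≤-reflexive (trans (trans (Φ-main d′ B′ lo hi N′ e₁ e₂ e₃ e₄) (early cs<c)) (sym (ℤₚ.+-identityʳ (A cM))))
      ... | seen-clos _ _ _ ()
    ... | yes le = All.map (λ {mv} → go mv) effects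
      where
      go : ∀ mv → Effect mv → Φ (stM mv) ≤ (A cM + + S′ * + mM - S * + rM) + linear (- α cM) (- + S′) S (- S) (lab mv)
      go (_ , _ , s′ , rem C) (C∈ , c , m , r , o , refl , me , re) = ℤₚ.≤-reflexive (trans at
          (trans (trans (eqn (A c) (α cM) (+ S′) S (+ m) (+ r) (+ size C) (+ deg (hd C) N))
            (cong₂ (λ y z → y + (- α cM + (- + S′) * + size C + S * + deg (hd C) N))
               (cong₂ (λ y z → y + + S′ * z - S * (+ r + + deg (hd C) N)) (sym (dA₁ c le)) (cong +_ me)) (refl {x = 0ℤ})))
            (cong (λ z → A cM + + S′ * + mM - S * z + (- α cM + (- + S′) * + size C + S * + deg (hd C) N)) (cong +_ re))))
        where
        eqn : ∀ a al s₁ S₁ m r z g → a + s₁ * m - S₁ * r ≡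
              ((a + al) + s₁ * (m + z) - S₁ * (r + g)) + (- al + (- s₁) * z + S₁ * g)
        eqn = ℤS.solve-∀
        at : Φ s′ ≡ A c + + S′ * + m - S * + r
        at with see o
        ... | seen-main d′ B′ lo hi N′ e₁ e₂ e₃ e₄ = trans (Φ-main d′ B′ lo hi N′ e₁ e₂ e₃ e₄) (lateV (ℕₚ.≤-trans (ℕₚ.n≤1+n _) le))
        ... | seen-clos N′ e z c0 = trans (Φ-clos N′ e z) (trans (sym (zero′ (A 0) (+ S′) S))
                (trans (cong₂ (λ y z → A 0 + + S′ * + y - S * + z) (sym m0) (sym r0))
                  (cong (λ y → A y + + S′ * + m - S * + r) (sym c0))))
          where
          zero′ : ∀ a b c → a + b * 0ℤ - c * 0ℤ ≡ a
          zero′ = ℤS.solve-∀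
          r0 : r ≡ 0
          r0 = ℕₚ.+-cancelʳ-≡ (deg (hd C) N) r 0 (trans re (sym (lastRed C∈ (cong suc c0))))
          empties : ∀ (lo hi : List (Seg n)) → length lo ℕ.+ length hi ≡ 0 → sizeS lo ℕ.+ sizeS hi ≡ 0
          empties [] [] _ = refl
          m0 : m ≡ 0
          m0 = trans (sym (Obs.mEq o)) (empties (Obs.low′ o) (Obs.high′ o) (trans (Obs.cEq o) c0))
      go (_ , _ , s′ , colour) o with see o
      ... | seen-main d′ B′ lo hi N′ e₁ e₂ e₃ e₄ = ℤₚ.≤-reflexive (trans (trans (Φ-main d′ B′ lo hi N′ e₁ e₂ e₃ e₄) (lateV le)) (eqn (A cM) (+ S′) S (+ mM) (+ rM)))
        where
        eqn : ∀ a s₁ S₁ m r → a + s₁ * m - S₁ * (+ 1 + r) ≡ (a + s₁ * m - S₁ * r) + (- S₁)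
        eqn = ℤS.solve-∀
      ... | seen-clos _ _ _ ()

-- The supermartingale and the failure bound.

module Supermartingale (n L : ℕ) (D : ℕ → ℕ) (Rc K : ℕ) (D-anti : ∀ {a b} → a ℕ.≤ b → D b ℕ.≤ D a) (2≤L : 2 ℕ.≤ L)
                       (P : Profile n L D Rc K) where

  open Profile P
  open Process n L D Rc K
  open Effects n L D Rc K D-anti
  open Potential n L D Rc K D-anti 2≤L P

  S≡ : + (2 ℕ.* S′) ≡ S
  S≡ = ℤₚ.pos-* 2 S′

  mulS : ∀ {a b} → a ≤ b → S * a ≤ S * b
  mulS {a} {b} le = subst (λ z → z * a ≤ z * b) S≡ (ℤₚ.*-monoˡ-≤-nonNeg (+ (2 ℕ.* S′)) le)

  S*≥0 : ∀ k → 0ℤ ≤ S * + k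
  S*≥0 k = subst (ℤ._≤ S * + k) (ℤₚ.*-zeroʳ S) (mulS (ℤ.+≤+ z≤n))

  S′*≥0 : ∀ k → 0ℤ ≤ + S′ * + k
  S′*≥0 k = subst (0ℤ ℤ.≤_) (ℤₚ.pos-* S′ k) (ℤ.+≤+ z≤n)

  minus≥0 : ∀ {a b} → 0ℤ ≤ b → a - b ≤ a
  minus≥0 {a} {b} h = ℤₚ.≤-trans (ℤₚ.+-monoʳ-≤ a (ℤₚ.neg-mono-≤ h)) (ℤₚ.≤-reflexive (ℤₚ.+-identityʳ a))

  grow<n : ∀ s ss Bs → Inv (grow s ss Bs) → length ss ℕ.+ length Bs ℕ.< n
  grow<n s ss Bs (o , _) = ℕₚ.≤-trans (s≤s (ℕₚ.+-monoʳ-≤ (length ss) (ℕₚ.≤-trans (ℕₚ.m≤n*m (length Bs) 2) (sizeS-≥ Bs)))) (ℕₚ.≤-reflexive (total (s ∷ ss) Bs o))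

  Φ≥0 : ∀ s → Inv s → 0ℤ ≤ Φ s
  Φ≥0 (grow s ss Bs) i = A≥ _ (grow<n s ss Bs i)
  Φ≥0 (main d B low high N) i with suc (length low ℕ.+ length high) ℕ.≤? cs
  ... | no _   = A≥ _ (AtMain.cM≤n d B low high N i)
  ... | yes le = ℤₚ.i≤j⇒0≤j-i (ℤₚ.≤-trans (A≥₃ _ (nb N) le (reds≤ (AtMain.counts d B low high N i)))
                   (ℤₚ.≤-trans (ℤₚ.≤-reflexive (sym (ℤₚ.+-identityʳ (A c)))) (ℤₚ.+-monoʳ-≤ (A c) (S′*≥0 (sizeS (B ∷ low) ℕ.+ sizeS high)))))
    where c = suc (length low ℕ.+ length high)
  Φ≥0 (clos N) i = ℤₚ.+-mono-≤ (ℤ.+≤+ (z≤n {K₀})) (S*≥0 (2 ℕ.* (K ℕ.∸ nb N)))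
  Φ≥0 done i = ℤₚ.≤-refl

  τ-step : ∀ {s s′ k δ} → Φ s′ ≤ Φ s + δ → τ s′ k ≤ τ s (suc k) + (S + δ)
  τ-step {s} {s′} {k} {δ} h = ℤₚ.≤-trans (ℤₚ.+-monoˡ-≤ (+ (2 ℕ.* b)) (ℤₚ.+-monoˡ-≤ (- (S * + k)) h))
    (ℤₚ.≤-reflexive (eqn (Φ s) δ S (+ k) (+ (2 ℕ.* b))))
    where
    eqn : ∀ f d S₁ k b → f + d - S₁ * k + b ≡ f - S₁ * (+ 1 + k) + b + (S₁ + d)
    eqn = ℤS.solve-∀

  time-sum : ∀ s k → Inv s → (δ : Lab → ℤ) → All (λ mv → Φ (stM mv) ≤ Φ s + δ (lab mv) × ∣ S + δ (lab mv) ∣ ℕ.≤ B) (moves s) →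
             + n * S + σ δ (moves s) ≤ 0ℤ →
             ∑ (λ u → sq⁺ (τ (step s u) k)) ℕ.≤ n ℕ.* (sq⁺ (τ s (suc k)) ℕ.+ B ℕ.* B)
  time-sum s k i δ a dr = bridge s i (τ s (suc k)) S δ (λ s′ → sq⁺ (τ s′ k)) B
    (sq⁺-mono (ℤₚ.≤-reflexive (eqn (Φ s) S (+ k) (+ (2 ℕ.* b))))) bound-S
    (All.map (λ {mv} (p , q) → sq⁺-mono (τ-step {s} {stM mv} {k} p) , q) a) (λ _ → dr)
    where
    eqn : ∀ f S₁ k b → f - S₁ * k + b ≡ f - S₁ * (+ 1 + k) + b + S₁
    eqn = ℤS.solve-∀

  W-sum : ∀ s k → ∑ (λ u → Yᵢ (step s u)) ℕ.≤ n ℕ.* (Yᵢ s ℕ.+ B ℕ.* B) → ∑ (λ u → Yᵣ (step s u)) ℕ.≤ n ℕ.* (Yᵣ s ℕ.+ B ℕ.* B) →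
          ∑ (λ u → Yₘ (step s u)) ℕ.≤ n ℕ.* (Yₘ s ℕ.+ B ℕ.* B) →
          ∑ (λ u → sq⁺ (τ (step s u) k)) ℕ.≤ n ℕ.* (sq⁺ (τ s (suc k)) ℕ.+ B ℕ.* B) →
          ∑ (λ u → W (step s u) k) ℕ.≤ n ℕ.* (W s (suc k) ℕ.+ 4 ℕ.* (B ℕ.* B))
  W-sum s k a c e f = ℕₚ.≤-trans (ℕₚ.≤-reflexive
      (trans (∑-+ (λ u → Yᵢ (step s u) ℕ.+ Yᵣ (step s u) ℕ.+ Yₘ (step s u)) (λ u → sq⁺ (τ (step s u) k)))
        (cong (ℕ._+ ∑ (λ u → sq⁺ (τ (step s u) k))) (trans (∑-+ (λ u → Yᵢ (step s u) ℕ.+ Yᵣ (step s u)) (λ u → Yₘ (step s u)))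
          (cong (ℕ._+ ∑ (λ u → Yₘ (step s u))) (∑-+ (λ u → Yᵢ (step s u)) (λ u → Yᵣ (step s u))))))))
    (ℕₚ.≤-trans (ℕₚ.+-mono-≤ (ℕₚ.+-mono-≤ (ℕₚ.+-mono-≤ a c) e) f)
      (ℕₚ.≤-reflexive (eqn n (Yᵢ s) (Yᵣ s) (Yₘ s) (sq⁺ (τ s (suc k))) (B ℕ.* B))))
    where
    eqn : ∀ n a c e f b → n ℕ.* (a ℕ.+ b) ℕ.+ n ℕ.* (c ℕ.+ b) ℕ.+ n ℕ.* (e ℕ.+ b) ℕ.+ n ℕ.* (f ℕ.+ b) ≡ n ℕ.* (a ℕ.+ c ℕ.+ e ℕ.+ f ℕ.+ 4 ℕ.* b)
    eqn = ℕS.solve-∀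

  W-parts : ∀ s k → W s k ℕ.< b ℕ.* b → Yᵢ s ℕ.< b ℕ.* b × Yᵣ s ℕ.< b ℕ.* b × Yₘ s ℕ.< b ℕ.* b × sq⁺ (τ s k) ℕ.< b ℕ.* b
  W-parts s k lt = go (ℕₚ.≤-trans (ℕₚ.m≤m+n _ _) (ℕₚ.≤-trans (ℕₚ.m≤m+n _ (Yₘ s)) (ℕₚ.m≤m+n _ (sq⁺ (τ s k))))) ,
                   go (ℕₚ.≤-trans (ℕₚ.m≤n+m _ (Yᵢ s)) (ℕₚ.≤-trans (ℕₚ.m≤m+n _ (Yₘ s)) (ℕₚ.m≤m+n _ (sq⁺ (τ s k))))) ,
                   go (ℕₚ.≤-trans (ℕₚ.m≤n+m _ (Yᵢ s ℕ.+ Yᵣ s)) (ℕₚ.m≤m+n _ (sq⁺ (τ s k)))) ,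
                   go (ℕₚ.m≤n+m _ (Yᵢ s ℕ.+ Yᵣ s ℕ.+ Yₘ s))
    where
    go : ∀ {z} → z ℕ.≤ W s k → z ℕ.< b ℕ.* b
    go le = ℕₚ.≤-<-trans le lt

  module MainStep (d : ℕ) (B₀ : Seg n) (low high : List (Seg n)) (N : List (Item n (Seg n))) (i : Inv (main d B₀ low high N)) where

    open AtMain d B₀ low high N i

    tubeₘ : MM cM mM rM ℕ.< b ℕ.* b → cs ℕ.< cM → S * + mM - M cM < + b
    tubeₘ tm cs<c = sq⁺-< _ b (subst (ℕ._< b ℕ.* b) (early cs<c) tm)

    drift-Φ : (cs ℕ.< cM → RM cM mM rM ℕ.< b ℕ.* b × MM cM mM rM ℕ.< b ℕ.* b) → + n * S + σ δΦ (moves s₀) ≤ 0ℤ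
    drift-Φ t with cM ℕ.≤? cs
    ... | yes le = ℤₚ.≤-trans (ℤₚ.≤-reflexive (cong (λ z → + n * S + z) (linear-σ (- α cM) (- + S′) S (- S)))) (late d l h _ _ _ _ counts le)
    ... | no nle = ℤₚ.≤-trans (ℤₚ.≤-reflexive (cong (λ z → + n * S + z) (linear-σ (- α cM) 0ℤ 0ℤ 0ℤ)))
        (time d l h _ _ _ _ counts lt cM≤n (sq⁺-< _ b (proj₁ (t lt))) (sq⁺-< _ b (proj₂ (t lt))))
      where
      lt : cs ℕ.< cM
      lt = ℕₚ.≰⇒> nle

    bounds : ce ℕ.< cM → All (λ mv → ∣ S + δΦ (lab mv) ∣ ℕ.≤ B) (moves s₀)
    bounds big with cM ℕ.≤? cs
    ... | yes _ = All.map (λ {mv} → go mv) effects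
      where
      go : ∀ mv → Effect mv → ∣ S + linear (- α cM) (- + S′) S (- S) (lab mv) ∣ ℕ.≤ B
      go (_ , _ , _ , rem C) (C∈ , _) = subst (λ z → ∣ z ∣ ℕ.≤ B) (eqn (α cM) (+ S′) S (+ size C) (+ deg (hd C) N))
          (proj₂ (bound-A cM (size C) (deg (hd C) N) big cM≤n (size≤ C∈) (deg≤ C∈)))
        where
        eqn : ∀ al s₁ S₁ z g → S₁ + (- al - s₁ * z + S₁ * g) ≡ S₁ + (- al + (- s₁) * z + S₁ * g)
        eqn = ℤS.solve-∀
      go (_ , _ , _ , colour) _ = subst (λ z → ∣ z ∣ ℕ.≤ B) (sym (ℤₚ.+-inverseʳ S)) z≤n
    ... | no _ = All.map (λ {mv} → go mv) effects
      where
      go : ∀ mv → Effect mv → ∣ S + linear (- α cM) 0ℤ 0ℤ 0ℤ (lab mv) ∣ ℕ.≤ B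
      go (_ , _ , _ , rem C) (C∈ , _) = subst (λ z → ∣ z ∣ ℕ.≤ B) (eqn (α cM) S (+ size C) (+ deg (hd C) N))
          (proj₁ (bound-A cM (size C) (deg (hd C) N) big cM≤n (size≤ C∈) (deg≤ C∈)))
        where
        eqn : ∀ al S₁ z g → S₁ + (- al) ≡ S₁ + (- al + 0ℤ * z + 0ℤ * g)
        eqn = ℤS.solve-∀
      go (_ , _ , _ , colour) _ = subst (λ z → ∣ z ∣ ℕ.≤ B) (sym (ℤₚ.+-identityʳ S)) bound-S

    main-step : ∀ k → ce ℕ.< cM → W s₀ (suc k) ℕ.< b ℕ.* b → ∑ (λ u → W (step s₀ u) k) ℕ.≤ n ℕ.* (W s₀ (suc k) ℕ.+ 4 ℕ.* (B ℕ.* B))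
    main-step k big lt with W-parts s₀ (suc k) lt
    ... | _ , tr , tm , _ = W-sum s₀ k Yᵢ-sum (proj₁ sums) (proj₂ sums)
            (time-sum s₀ k i δΦ (All.zipWith (λ (p , q) → p , q) (Φ-effects (tubeₘ tm) , bounds big)) (drift-Φ (λ _ → tr , tm)))
      where
      sums : ∑ (λ u → Yᵣ (step s₀ u)) ℕ.≤ n ℕ.* (Yᵣ s₀ ℕ.+ B ℕ.* B) × ∑ (λ u → Yₘ (step s₀ u)) ℕ.≤ n ℕ.* (Yₘ s₀ ℕ.+ B ℕ.* B)
      sums = byPhase (cM ℕ.≤? cs)
       where
       byPhase : Dec (cM ℕ.≤ cs) → ∑ (λ u → Yᵣ (step s₀ u)) ℕ.≤ n ℕ.* (Yᵣ s₀ ℕ.+ B ℕ.* B) × ∑ (λ u → Yₘ (step s₀ u)) ℕ.≤ n ℕ.* (Yₘ s₀ ℕ.+ B ℕ.* B)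
       byPhase (no nle) = Early.Yᵣ-sum (ℕₚ.≰⇒> nle) tr tm , Early.Yₘ-sum (ℕₚ.≰⇒> nle) tr tm
       byPhase (yes le) = bridge-0 s₀ i Yᵣ (lateV le) (All.map (λ {mv} e → proj₁ (zeros mv e)) effects) ,
                     bridge-0 s₀ i Yₘ (lateV le) (All.map (λ {mv} e → proj₂ (zeros mv e)) effects)
        where
        zeros : ∀ mv → Effect mv → Yᵣ (stM mv) ≡ 0 × Yₘ (stM mv) ≡ 0
        zeros (_ , _ , _ , rem C)  (_ , c , _ , _ , o , refl , _) = lateZero o (ℕₚ.≤-trans (ℕₚ.n≤1+n _) le)
        zeros (_ , _ , _ , colour) o = lateZero o le

  module GrowStep (s : Fin n) (ss : List (Fin n)) (Bs : List (Seg n)) (i : Inv (grow s ss Bs)) where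

    open EffectsGrow s ss Bs

    s₀ : St
    s₀ = grow s ss Bs

    x : ℕ
    x = length ss ℕ.+ length Bs

    x<n : x ℕ.< n
    x<n = grow<n s ss Bs i

    X : ℤ
    X = S * + suc (length ss) - G (suc x)

    module Tube (tube : X < + b) where

      cs<x : cs ℕ.< x
      cs<x = zone (length ss) (length Bs) x<n tube

      S1≤ : S * + 1 - G (suc x) < + b
      S1≤ = ℤₚ.≤-<-trans (ℤₚ.+-monoˡ-≤ (- G (suc x)) (mulS (ℤ.+≤+ (s≤s z≤n)))) tube

      δᵢ δₜ : Lab → ℤ
      δᵢ pair = κ (suc x) - + 2 * S
      δᵢ _    = κ (suc x) - S
      δₜ _    = - α (suc x)

      Shape : St → ℕ → Set
      Shape s′ i′ = Σ (List (Fin n)) λ ys → Σ (List (Seg n)) λ Cs → s′ ≡ toSt ys Cs × length ys ≡ i′ × length ys ℕ.+ length Cs ≡ x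

      data After (s′ : St) (i′ : ℕ) : Set where
        still : ∀ y ys Cs → s′ ≡ grow y ys Cs → suc (length ys) ≡ i′ → suc (length ys ℕ.+ length Cs) ≡ x → After s′ i′
        over  : ∀ d B low high N → s′ ≡ main d B low high N → suc (length low ℕ.+ length high) ≡ x → nb N ≡ 0 → After s′ i′
        empty : 0 ≡ x → After s′ i′

      after : ∀ {s′ i′} → Shape s′ i′ → After s′ i′
      after (y ∷ ys , Cs , refl , e , e′) = still y ys Cs refl e e′
      after ([] , B ∷ Cs , refl , e , e′) = over 0 B Cs [] [] refl (trans (cong suc (ℕₚ.+-identityʳ _)) e′) refl
      after ([] , [] , refl , e , e′)     = empty e′

      shapeP : ∀ {u v s′} → Effect (u , v , s′ , pair) → Σ ℕ λ i′ → suc i′ ≡ length ss × Shape s′ i′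
      shapeP (ys , Cs , refl , e , e′) = length ys , ℕₚ.suc-injective e , ys , Cs , refl , refl ,
        trans (cong (length ys ℕ.+_) e′) (trans (ℕₚ.+-suc _ _) (cong (ℕ._+ length Bs) (ℕₚ.suc-injective e)))

      shapeE : ∀ {u v s′} → Effect (u , v , s′ , ext) → Shape s′ (length ss)
      shapeE (Cs , refl , e) = ss , Cs , refl , refl , cong (length ss ℕ.+_) e

      absurd : {Z : Set} → 0 ≡ x → Z
      absurd e = ⊥-elim (ℕₚ.n≮0 (subst (cs ℕ.<_) (sym e) cs<x))

      Yᵢ-after : ∀ {s′ i′ Z} → After s′ i′ → S * + i′ - G x ≤ Z → Yᵢ s′ ℕ.≤ sq⁺ Z
      Yᵢ-after {Z = Z} (still y ys Cs refl refl e) le = sq⁺-mono (subst (λ z → S * + suc (length ys) - G z ≤ Z) (sym e) le)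
      Yᵢ-after (over _ _ _ _ _ refl _ _)   le = z≤n
      Yᵢ-after (empty e)                   le = absurd e

      Φ-after : ∀ {s′ i′} → After s′ i′ → Φ s′ ≡ A x
      Φ-after (still y ys Cs refl _ e)              = cong A e
      Φ-after (over d B low high N refl e _)        = trans (cong (λ z → ΦM z (sizeS (B ∷ low) ℕ.+ sizeS high) (nb N)) e) (early cs<x)
      Φ-after (empty e)                             = absurd e

      -- The block and size functionals are switched on when the last single vertex is used; by
      -- `start` neither has an excess at that moment.
      YZ-after : ∀ {s′ i′} → Inv s′ → After s′ i′ → Yᵣ s′ ≡ 0 × Yₘ s′ ≡ 0
      YZ-after iv (still y ys Cs refl _ _) = refl , refl
      YZ-after iv (over d B low high N refl e z) =
          trans (cong (λ w → RM w m (nb N)) e) (trans (early cs<x) (sq⁺-≤0 (ℤₚ.≤-trans (ℤₚ.≤-reflexive (trans (cong (λ w → R x - S * + w) z) (eqn (R x) S))) (proj₁ st)))) ,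
          trans (cong (λ w → MM w m (nb N)) e) (trans (early cs<x) (sq⁺-≤0 (ℤₚ.i≤j⇒i-j≤0 (ℤₚ.≤-trans (mulS (ℤ.+≤+ (Counts.m≤ (AtMain.counts d B low high N iv)))) (proj₂ st)))))
        where
        m = sizeS (B ∷ low) ℕ.+ sizeS high
        st = start x cs<x x<n S1≤
        eqn : ∀ a b → a - b * 0ℤ ≡ a
        eqn = ℤS.solve-∀
      YZ-after iv (empty e) = absurd e

      invs : All (λ mv → Inv (stM mv)) (moves s₀)
      invs = All.map (λ { {_ , _ , _ , _} f → f tt }) (movesGood 2≤L s₀ i)

      afters : All (λ mv → Σ ℕ λ i′ → After (stM mv) i′ × S * + i′ - G x ≡ X + (0ℤ + δᵢ (lab mv)) × ∣ 0ℤ + δᵢ (lab mv) ∣ ℕ.≤ B) (moves s₀)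
      afters = All.map (λ {mv} → go mv) effects
        where
        eqn₂ : ∀ S₁ i g k → S₁ * i - g ≡ S₁ * (+ 2 + i) - (g + k) + (0ℤ + (k - + 2 * S₁))
        eqn₂ = ℤS.solve-∀
        eqn₁ : ∀ S₁ i g k → S₁ * i - g ≡ S₁ * (+ 1 + i) - (g + k) + (0ℤ + (k - S₁))
        eqn₁ = ℤS.solve-∀
        go : ∀ mv → Effect mv → Σ ℕ λ i′ → After (stM mv) i′ × S * + i′ - G x ≡ X + (0ℤ + δᵢ (lab mv)) × ∣ 0ℤ + δᵢ (lab mv) ∣ ℕ.≤ B
        go (u , v , s′ , pair) e with shapeP {u} {v} e
        ... | i′ , q , sh = i′ , after sh , trans (eqn₂ S (+ i′) (G x) (κ (suc x)))
              (cong₂ (λ y z → S * + y - z + (0ℤ + δᵢ pair)) (cong suc q) (sym (dG x (ℕₚ.<⇒≤ cs<x) x<n))) ,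
              subst (λ z → ∣ z ∣ ℕ.≤ B) (sym (ℤₚ.+-identityˡ (δᵢ pair))) (proj₂ (bound-κ (suc x) (ℕₚ.m<n⇒m<1+n cs<x) x<n))
        go (u , v , s′ , ext) e = length ss , after (shapeE {u} {v} e) , trans (eqn₁ S (+ length ss) (G x) (κ (suc x)))
              (cong (λ z → S * + suc (length ss) - z + (0ℤ + δᵢ ext)) (sym (dG x (ℕₚ.<⇒≤ cs<x) x<n))) ,
              subst (λ z → ∣ z ∣ ℕ.≤ B) (sym (ℤₚ.+-identityˡ (δᵢ ext))) (proj₁ (bound-κ (suc x) (ℕₚ.m<n⇒m<1+n cs<x) x<n))

      grow-step : ∀ k → ∑ (λ u → W (step s₀ u) k) ℕ.≤ n ℕ.* (W s₀ (suc k) ℕ.+ 4 ℕ.* (B ℕ.* B))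
      grow-step k = W-sum s₀ k
        (bridge s₀ i X 0ℤ δᵢ Yᵢ B (ℕₚ.≤-reflexive (cong sq⁺ (sym (ℤₚ.+-identityʳ X)))) z≤n
           (All.map (λ (_ , af , e , bd) → Yᵢ-after af (ℤₚ.≤-reflexive e) , bd) afters)
           (λ pos → ℤₚ.≤-trans (ℤₚ.≤-reflexive (trans (cong₂ ℤ._+_ (ℤₚ.*-zeroʳ (+ n)) (grow-σ δᵢ)) (ℤₚ.+-identityˡ _)))
              (growth (length ss) (length Bs) pairs (short Bs) x<n tube pairs-≥ pairs-≤ (short-≤ Bs) pos)))
        (bridge-0 s₀ i Yᵣ refl (All.zipWith (λ (iv , _ , af , _) → proj₁ (YZ-after iv af)) (invs , afters)))
        (bridge-0 s₀ i Yₘ refl (All.zipWith (λ (iv , _ , af , _) → proj₂ (YZ-after iv af)) (invs , afters)))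
        (time-sum s₀ k i δₜ (All.map (λ {mv} → tm {mv}) afters)
           (ℤₚ.≤-trans (ℤₚ.≤-reflexive (cong (λ z → + n * S + z) (grow-σ δₜ)))
              (growthTime (length ss) (length Bs) pairs (short Bs) x<n tube pairs-≥ sh)))
        where
        sh : L ℕ.* length Bs ℕ.≤ L ℕ.* short Bs ℕ.+ n
        sh = ℕₚ.≤-trans (short-≥ Bs) (ℕₚ.+-monoʳ-≤ (L ℕ.* short Bs) (ℕₚ.m+n≤o⇒n≤o (length (s ∷ ss)) (ℕₚ.≤-reflexive (total (s ∷ ss) Bs (proj₁ i)))))
        can : ∀ {a al c} → a + al ≤ c → a ≤ c + (- al)
        can {a} {al} {c} le = subst (ℤ._≤ c - al) (eqn a al) (ℤₚ.+-monoˡ-≤ (- al) le)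
          where
          eqn : ∀ a al → a + al - al ≡ a
          eqn = ℤS.solve-∀
        tm : ∀ {mv} → (Σ ℕ λ i′ → After (stM mv) i′ × S * + i′ - G x ≡ X + (0ℤ + δᵢ (lab mv)) × ∣ 0ℤ + δᵢ (lab mv) ∣ ℕ.≤ B) →
             Φ (stM mv) ≤ Φ s₀ + (- α (suc x)) × ∣ S + (- α (suc x)) ∣ ℕ.≤ B
        tm (_ , af , _) = ℤₚ.≤-trans (ℤₚ.≤-reflexive (Φ-after af)) (can {A x} {α (suc x)} (dA x cs<x x<n)) ,
          proj₁ (bound-A (suc x) 0 0 (ℕₚ.≤-<-trans ce≤cs (ℕₚ.m<n⇒m<1+n cs<x)) x<n z≤n z≤n)

  -- The region of the second moment argument; outside of it only Φ is followed.
  big : St → Set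
  big (grow _ _ _)          = ⊤
  big (main d B low high N) = ce ℕ.< suc (length low ℕ.+ length high)
  big (clos _)              = ⊥
  big done                  = ⊥

  big? : ∀ s → Dec (big s)
  big? (grow _ _ _)          = yes tt
  big? (main d B low high N) = ce ℕ.<? suc (length low ℕ.+ length high)
  big? (clos _)              = no (λ ())
  big? done                  = no (λ ())

  -- With no step left, τ is at least 2 b because Φ is nonnegative.
  W₀ : ∀ s → Inv s → big s → b ℕ.* b ℕ.≤ W s 0
  W₀ s i _ = ℕₚ.≤-trans (ℕₚ.≤-trans (ℕₚ.≤-refl {b ℕ.* b}) (sq⁺-mono {+ b} {τ s 0} le)) (ℕₚ.m≤n+m _ (Yᵢ s ℕ.+ Yᵣ s ℕ.+ Yₘ s))
    where
    le : + b ≤ τ s 0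
    le = ℤₚ.≤-trans (ℤ.+≤+ (ℕₚ.m≤m+n b (b ℕ.+ 0))) (ℤₚ.≤-trans (ℤₚ.≤-reflexive (sym (ℤₚ.+-identityˡ _)))
           (ℤₚ.+-monoˡ-≤ (+ (2 ℕ.* b)) (ℤₚ.≤-trans (Φ≥0 s i) (ℤₚ.≤-reflexive (eqn (Φ s) S)))))
      where
      eqn : ∀ a b → a ≡ a - b * 0ℤ
      eqn = ℤS.solve-∀

  Wₛ : ∀ s k → Inv s → big s → W s (suc k) ℕ.< b ℕ.* b → ∑ (λ u → W (step s u) k) ℕ.≤ n ℕ.* (W s (suc k) ℕ.+ 4 ℕ.* (B ℕ.* B))
  Wₛ (grow s ss Bs) k i _ lt = GrowStep.Tube.grow-step s ss Bs i (sq⁺-< _ b (proj₁ (W-parts (grow s ss Bs) (suc k) lt))) k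
  Wₛ (main d B low high N) k i bg lt = MainStep.main-step d B low high N i k bg lt

  Z : St → Set
  Z s = ¬ big s

  stepZ : ∀ s u → Inv s → Z s → Z (step s u)
  stepZ (grow _ _ _) u i z = ⊥-elim (z tt)
  stepZ s@(main d B low high N) u i z = stepAll {Q = Z} s u z (All.map (λ {mv} → go mv) effects)
    where
    open AtMain d B low high N i
    down : ∀ {s′ c m r} → Obs s′ c m r → c ℕ.≤ cM → Z s′
    down o le with see o
    ... | seen-main _ _ _ _ _ refl refl _ _ = λ lt → z (ℕₚ.<-≤-trans lt le)
    ... | seen-clos _ refl _ _              = λ ()
    go : ∀ mv → Effect mv → Z (stM mv)
    go (_ , _ , _ , rem C)  (_ , c , _ , _ , o , e , _) = down o (ℕₚ.≤-trans (ℕₚ.n≤1+n c) (ℕₚ.≤-reflexive e))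
    go (_ , _ , _ , colour) o                           = down o ℕₚ.≤-refl
  stepZ s@(clos N) u (o , _) z = stepAll {Q = Z} s u z (go (flat N) refl)
    where
    go : ∀ xs → flat N ≡ xs → All (Z ∘ stM) (closMoves N xs)
    go []       e = []
    go (y ∷ ys) e = subst (λ q → All (Z ∘ stM) (closMoves N q)) e (All.map (λ {mv} → g mv) (EffectsClos.effects N y ys e o))
      where
      g : ∀ mv → EffectsClos.Effect N y ys e o mv → Z (stM mv)
      g (_ , _ , _ , close)  refl           = λ ()
      g (_ , _ , _ , colour) (_ , refl , _) = λ ()
  stepZ done u i z = z

  dead : ∀ s u → alive s ≡ 0 → step s u ≡ s
  dead done u _ = refl

  late-drift : ∀ s → Inv s → Z s → alive s ≡ 1 → ∑ (λ u → ∣ Φ (step s u) ∣) ℕ.+ n ℕ.* ∣ S ∣ ℕ.≤ n ℕ.* ∣ Φ s ∣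
  late-drift (grow _ _ _) i z _ = ⊥-elim (z tt)
  late-drift s@(main d B low high N) i z _ = bridgeΦ s i δΦ Φ≥0 (Φ-effects (λ lt → ⊥-elim (ℕₚ.<⇒≱ lt le))) (MainStep.drift-Φ d B low high N i (λ lt → ⊥-elim (ℕₚ.<⇒≱ lt le)))
    where
    open AtMain d B low high N i
    le : cM ℕ.≤ cs
    le = ℕₚ.≤-trans (ℕₚ.≮⇒≥ z) ce≤cs
  late-drift s@(clos N) i@(o , _) z _ = go (flat N) refl
    where
    go : ∀ xs → flat N ≡ xs → ∑ (λ u → ∣ Φ (step s u) ∣) ℕ.+ n ℕ.* ∣ S ∣ ℕ.≤ n ℕ.* ∣ Φ s ∣
    go [] e with trans (sym (length-once (flat N) o)) (cong length e)
    ... | refl = z≤n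
    go (y ∷ ys) e = bridgeΦ s i δ Φ≥0 (All.map (λ {mv} → g mv) effects) dr
      where
      open EffectsClos N y ys e o
      paint : Dec (suc (nb N) ℕ.≤ K) → ℤ
      paint (yes _) = - (S * + 2)
      paint (no _)  = 0ℤ
      δ : Lab → ℤ
      δ close = - + K₀
      δ _     = paint (suc (nb N) ℕ.≤? K)
      g : ∀ mv → Effect mv → Φ (stM mv) ≤ Φ s + δ (lab mv)
      g (_ , _ , _ , close) refl = subst (0ℤ ℤ.≤_) (eqn (+ K₀) (S * + (2 ℕ.* (K ℕ.∸ nb N)))) (S*≥0 (2 ℕ.* (K ℕ.∸ nb N)))
        where
        eqn : ∀ a b → b ≡ a + b + (- a)
        eqn = ℤS.solve-∀
      g (_ , _ , _ , colour) (N′ , refl , q) with suc (nb N) ℕ.≤? K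
      ... | no ¬k = ℤₚ.≤-reflexive (trans (cong (λ w → + K₀ + S * + (2 ℕ.* w)) (trans (ℕₚ.m≤n⇒m∸n≡0 (ℕₚ.≤-trans K≤ (ℕₚ.≤-trans (ℕₚ.n≤1+n _) (ℕₚ.≤-reflexive (sym q))))) (sym (ℕₚ.m≤n⇒m∸n≡0 K≤)))) (sym (ℤₚ.+-identityʳ _)))
        where
        K≤ : K ℕ.≤ nb N
        K≤ = ℕₚ.≮⇒≥ ¬k
      ... | yes k = ℤₚ.≤-reflexive (trans (cong (λ w → + K₀ + S * + (2 ℕ.* (K ℕ.∸ w))) q) (trans (eqn (+ K₀) S (+ (2 ℕ.* (K ℕ.∸ suc (nb N)))))
                      (cong (λ w → + K₀ + S * w + (- (S * + 2))) (cong +_ (trans (sym (ℕₚ.*-suc 2 (K ℕ.∸ suc (nb N)))) (cong (2 ℕ.*_) (sym (ℕₚ.+-∸-assoc 1 k))))))))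
        where
        eqn : ∀ a S₁ w → a + S₁ * w ≡ a + S₁ * (+ 2 + w) + (- (S₁ * + 2))
        eqn = ℤS.solve-∀
      dr : + n * S + σ δ (moves s) ≤ 0ℤ
      dr = ℤₚ.≤-trans (ℤₚ.≤-reflexive (cong (λ w → + n * S + w) (clos-σ δ))) fin
        where
        fin : + n * S + (- + K₀ * + nb N + δ colour * + nAllowed) ≤ 0ℤ
        fin = byCount (suc (nb N) ℕ.≤? K)
         where
         byCount : (q : Dec (suc (nb N) ℕ.≤ K)) → + n * S + (- + K₀ * + nb N + paint q * + nAllowed) ≤ 0ℤ
         -- While blocks are missing the colouring moves alone pay for the step; once there are K of
         -- them, the closing moves do, each worth K₀.
         byCount (yes k) = ℤₚ.≤-trans (ℤₚ.+-monoˡ-≤ (- + K₀ * + nb N + (- (S * + 2)) * + nAllowed) (closing (nb N) nAllowed k (nAllowed-≥ k)))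
              (ℤₚ.≤-trans (ℤₚ.≤-reflexive (trans (cong (λ w → S * w + (- + K₀ * + nb N + (- (S * + 2)) * + nAllowed)) (ℤₚ.pos-* 2 nAllowed)) (eqn S (+ nAllowed) (+ K₀) (+ nb N))))
                (ℤₚ.neg-mono-≤ (subst (0ℤ ℤ.≤_) (ℤₚ.pos-* K₀ (nb N)) (ℤ.+≤+ z≤n))))
          where
          eqn : ∀ S₁ a k z → S₁ * (+ 2 * a) + ((- k) * z + (- (S₁ * + 2)) * a) ≡ - (k * z)
          eqn = ℤS.solve-∀
         byCount (no ¬k) = ℤₚ.≤-trans (ℤₚ.+-monoˡ-≤ (- + K₀ * + nb N + 0ℤ * + nAllowed) closed) (ℤₚ.≤-trans (ℤₚ.≤-reflexive (eqn (+ K₀) (+ K) (+ nb N) (+ nAllowed)))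
              (ℤₚ.i≤j⇒i-j≤0 (ℤₚ.*-monoˡ-≤-nonNeg (+ K₀) (ℤ.+≤+ (ℕₚ.≮⇒≥ ¬k)))))
          where
          eqn : ∀ a k z w → a * k + ((- a) * z + 0ℤ * w) ≡ a * k - a * z
          eqn = ℤS.solve-∀
  late-drift done i z ()

  open Hit step alive alive≤1 Inv stepInv
  open Markov Z stepZ (λ s → ∣ Φ s ∣) ∣ S ∣ dead late-drift
  open Chain step alive

  sizes≤ : ∀ Bs → All OkSeg Bs → sizeS Bs ℕ.≤ L ℕ.* length Bs
  sizes≤ []       []       = z≤n
  sizes≤ (C ∷ Bs) (p ∷ ps) = ℕₚ.≤-trans (ℕₚ.+-mono-≤ (proj₂ p) (sizes≤ Bs ps)) (ℕₚ.≤-reflexive (sym (ℕₚ.*-suc L (length Bs))))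

  A0+0≤ : A 0 ≤ + Φmax
  A0+0≤ = subst (ℤ._≤ + Φmax) (eqn (A 0) (+ S′)) (A≤ 0 0 z≤n z≤n)
    where
    eqn : ∀ a s → a + s * 0ℤ ≡ a
    eqn = ℤS.solve-∀

  Φ≤ : ∀ s → Inv s → Z s → Φ s ≤ + Φmax
  Φ≤ (grow _ _ _) i z = ⊥-elim (z tt)
  Φ≤ (main d B low high N) i z = ℤₚ.≤-trans (ℤₚ.≤-reflexive (lateV (ℕₚ.≤-trans (ℕₚ.≮⇒≥ z) ce≤cs)))
    (ℤₚ.≤-trans (minus≥0 (S*≥0 (nb N))) (A≤ _ _ (ℕₚ.≮⇒≥ z) (ℕₚ.≤-trans (ℕₚ.+-mono-≤ (sizes≤ (B ∷ low) (WithInv.okL i)) (sizes≤ high (WithInv.okH i)))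
      (ℕₚ.≤-reflexive (sym (ℕₚ.*-distribˡ-+ L (suc (length low)) (length high)))))))
    where
    module WithInv = MInv
  Φ≤ (clos N) i z = ℤₚ.≤-trans (ℤₚ.+-monoʳ-≤ (+ K₀) (mulS (ℤ.+≤+ (ℕₚ.*-monoʳ-≤ 2 (ℕₚ.m∸n≤m K (nb N)))))) (ℤₚ.≤-trans (ℤₚ.≤-reflexive (sym A0)) A0+0≤)
  Φ≤ done i z = ℤ.+≤+ z≤n

  -- A small W forces τ < b, so at least b / S steps are left, a number linear in n, while the
  -- expected remaining time is at most Φmax / S.
  small : ∀ s k → Inv s → Z s → W s k ℕ.< b ℕ.* b → cnt k s ℕ.* (b ℕ.* b) ℕ.≤ n ^ k ℕ.* (Φmax ℕ.* b)
  small s k i z lt = begin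
    cnt k s ℕ.* (b ℕ.* b)                   ≤⟨ ℕₚ.*-monoʳ-≤ (cnt k s) (ℕₚ.*-monoˡ-≤ b b≤) ⟩
    cnt k s ℕ.* (k ℕ.* ∣ S ∣ ℕ.* b)         ≡⟨ sym (ℕₚ.*-assoc (cnt k s) (k ℕ.* ∣ S ∣) b) ⟩
    cnt k s ℕ.* (k ℕ.* ∣ S ∣) ℕ.* b         ≤⟨ ℕₚ.*-monoˡ-≤ b (markov k s i z) ⟩
    n ^ k ℕ.* ∣ Φ s ∣ ℕ.* b                 ≤⟨ ℕₚ.*-monoˡ-≤ b (ℕₚ.*-monoʳ-≤ (n ^ k) (ℤₚ.drop‿+≤+ (ℤₚ.≤-trans (ℤₚ.≤-reflexive (ℤₚ.0≤i⇒+∣i∣≡i (Φ≥0 s i))) (Φ≤ s i z)))) ⟩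
    n ^ k ℕ.* Φmax ℕ.* b                    ≡⟨ ℕₚ.*-assoc (n ^ k) Φmax b ⟩
    n ^ k ℕ.* (Φmax ℕ.* b) ∎
    where
    open ℕₚ.≤-Reasoning
    τ< : τ s k < + b
    τ< = sq⁺-< _ b (proj₂ (proj₂ (proj₂ (W-parts s k lt))))
    Sk : S * + k ≡ + (k ℕ.* ∣ S ∣)
    Sk = trans (cong (ℤ._* + k) (sym (ℤₚ.0≤i⇒+∣i∣≡i {S} (subst (0ℤ ℤ.≤_) S≡ (ℤ.+≤+ z≤n))))) (trans (ℤₚ.*-comm (+ ∣ S ∣) (+ k)) (sym (ℤₚ.pos-* k ∣ S ∣)))
    b≤ : b ℕ.≤ k ℕ.* ∣ S ∣
    b≤ = ℤₚ.drop‿+≤+ (ℤₚ.≤-trans (ℤₚ.0≤i-j⇒j≤i (ℤₚ.≤-trans (ℤₚ.i≤j⇒0≤j-i (ℤₚ.≤-trans (ℤₚ.<⇒≤ τ<) (ℤₚ.≤-refl {+ b}))) fin)) (ℤₚ.≤-reflexive Sk))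
      where
      fin : + b - τ s k ≤ S * + k - + b
      fin = ℤₚ.≤-trans (ℤₚ.≤-reflexive (trans (cong (λ w → + b - (Φ s - S * + k + w)) (ℤₚ.pos-* 2 b)) (eqn (Φ s) (S * + k) (+ b)))) (minus≥0 (Φ≥0 s i))
        where
        eqn : ∀ f z b → b - (f - z + + 2 * b) ≡ z - b - f
        eqn = ℤS.solve-∀

  failures : ∀ k s → Inv s → cnt k s ℕ.* (b ℕ.* b) ℕ.≤ n ^ k ℕ.* (W s k ℕ.+ 4 ℕ.* (B ℕ.* B) ℕ.* k ℕ.+ Φmax ℕ.* b)
  failures = Super.super W (b ℕ.* b) (4 ℕ.* (B ℕ.* B)) (Φmax ℕ.* b) big big? W₀ Wₛ (λ s k p → small s k p)

-- Certificates for inequalities between integers.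

infixl 6 _⊕_
infixl 7 _⊗_

_⊕_ : ∀ {a b} → 0ℤ ≤ a → 0ℤ ≤ b → 0ℤ ≤ a + b
_⊕_ = ℤₚ.+-mono-≤

_⊗_ : ∀ {a b} → 0ℤ ≤ a → 0ℤ ≤ b → 0ℤ ≤ a * b
_⊗_ {+ a} {+ b} _ _ = subst (0ℤ ℤ.≤_) (ℤₚ.pos-* a b) (ℤ.+≤+ z≤n)

nat : ∀ k → 0ℤ ≤ + k
nat k = ℤ.+≤+ z≤n

gap : ∀ {a b} → a ≤ b → 0ℤ ≤ b - a
gap = ℤₚ.i≤j⇒0≤j-i

gapℕ : ∀ {a b} → a ℕ.≤ b → 0ℤ ≤ + b - + a
gapℕ le = gap (ℤ.+≤+ le)

-- The pattern of all later estimates: the difference is identified by the ring solver with an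
-- expression e whose sign can be read off, since e is built by `_⊕_` and `_⊗_` from nonnegative
-- parts.
cert : ∀ {a b} e → 0ℤ ≤ e → b - a ≡ e → a ≤ b
cert e p q = ℤₚ.0≤i-j⇒j≤i (subst (0ℤ ℤ.≤_) (sym q) p)

cancelPos : ∀ s {x} → 1 ℕ.≤ s → 0ℤ ≤ + s * x → 0ℤ ≤ x
cancelPos (suc s) {x} _ h = ℤₚ.*-cancelˡ-≤-pos 0ℤ x (+ suc s) (subst (ℤ._≤ + suc s * x) (sym (ℤₚ.*-zeroʳ (+ suc s))) h)

-- The degree cap and the late phase.

module Degree (n : ℕ) where

  search : ℕ → ℕ → ℕ → ℕ
  search c zero    k = k
  search c (suc f) k with n ℕ.≤? k ℕ.* suc k ℕ.* c
  ... | yes _ = k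
  ... | no _  = search c f (suc k)

  -- the least k with k (k + 1) c ≥ n (and n when c = 0)
  D : ℕ → ℕ
  D c = search c n 0

  search-min : ∀ c f k j → k ℕ.≤ j → n ℕ.≤ j ℕ.* suc j ℕ.* c → search c f k ℕ.≤ j
  search-min c zero    k j k≤j h = k≤j
  search-min c (suc f) k j k≤j h with n ℕ.≤? k ℕ.* suc k ℕ.* c
  ... | yes _ = k≤j
  ... | no ¬p with ℕₚ.m≤n⇒m<n∨m≡n k≤j
  ...   | inj₁ lt   = search-min c f (suc k) j lt h
  ...   | inj₂ refl = ⊥-elim (¬p h)

  search-≤ : ∀ c f k → search c f k ℕ.≤ f ℕ.+ k
  search-≤ c zero    k = ℕₚ.≤-refl
  search-≤ c (suc f) k with n ℕ.≤? k ℕ.* suc k ℕ.* c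
  ... | yes _ = ℕₚ.m≤n+m k (suc f)
  ... | no _  = ℕₚ.≤-trans (search-≤ c f (suc k)) (ℕₚ.≤-reflexive (ℕₚ.+-suc f k))

  search-ok : ∀ c f k → n ℕ.≤ (f ℕ.+ k) ℕ.* suc (f ℕ.+ k) ℕ.* c → n ℕ.≤ search c f k ℕ.* suc (search c f k) ℕ.* c
  search-ok c zero    k h = h
  search-ok c (suc f) k h with n ℕ.≤? k ℕ.* suc k ℕ.* c
  ... | yes p = p
  ... | no _  = search-ok c f (suc k) (subst (λ z → n ℕ.≤ z ℕ.* suc z ℕ.* c) (sym (ℕₚ.+-suc f k)) h)

  D-min : ∀ c j → n ℕ.≤ j ℕ.* suc j ℕ.* c → D c ℕ.≤ j
  D-min c j = search-min c n 0 j z≤n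

  -- The fuel n of `search` suffices: k = n qualifies as soon as c is positive.
  n≤nn : ∀ c → 1 ℕ.≤ c → n ℕ.≤ n ℕ.* suc n ℕ.* c
  n≤nn (suc c) _ = ℕₚ.≤-trans (ℕₚ.m≤m*n n (suc n)) (ℕₚ.m≤m*n (n ℕ.* suc n) (suc c))

  D-ok : ∀ c → 1 ℕ.≤ c → n ℕ.≤ D c ℕ.* suc (D c) ℕ.* c
  D-ok c 1≤c = search-ok c n 0 (subst (λ z → n ℕ.≤ z ℕ.* suc z ℕ.* c) (sym (ℕₚ.+-identityʳ n)) (n≤nn c 1≤c))

  D≤n : ∀ c → D c ℕ.≤ n
  D≤n c = ℕₚ.≤-trans (search-≤ c n 0) (ℕₚ.≤-reflexive (ℕₚ.+-identityʳ n))

  D-anti : ∀ {a b} → a ℕ.≤ b → D b ℕ.≤ D a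
  D-anti {zero}  {b} _  = ℕₚ.≤-trans (D≤n b) (ℕₚ.≤-reflexive (sym zeroCase))
    where
    full : ∀ f k → 1 ℕ.≤ n → search 0 f k ≡ f ℕ.+ k
    full zero    k p = refl
    full (suc f) k p with n ℕ.≤? k ℕ.* suc k ℕ.* 0
    ... | no _  = trans (full f (suc k) p) (ℕₚ.+-suc f k)
    ... | yes q = ⊥-elim (ℕₚ.<⇒≱ p (ℕₚ.≤-trans q (ℕₚ.≤-reflexive (ℕₚ.*-zeroʳ (k ℕ.* suc k)))))
    zeroCase : D 0 ≡ n
    zeroCase with ℕₚ.m≤n⇒m<n∨m≡n (z≤n {n})
    ... | inj₁ p = trans (full n 0 p) (ℕₚ.+-identityʳ n)
    ... | inj₂ e = ℕₚ.≤-antisym (D≤n 0) (subst (ℕ._≤ D 0) e z≤n)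
  D-anti {suc a} {b} le = D-min b (D (suc a)) (ℕₚ.≤-trans (D-ok (suc a) (s≤s z≤n)) (ℕₚ.*-monoʳ-≤ (D (suc a) ℕ.* suc (D (suc a))) le))

  D≥1 : ∀ c → 1 ℕ.≤ n → 1 ℕ.≤ c → 1 ℕ.≤ D c
  D≥1 c p q with D c | D-ok c q
  ... | zero  | h = ⊥-elim (ℕₚ.<⇒≱ p h)
  ... | suc _ | _ = s≤s z≤n

  sumD : ℕ → ℕ
  sumD zero    = 0
  sumD (suc c) = sumD c ℕ.+ D (suc c)

  -- c ↦ k c + n / k is a tangent line of 2√(n c); its slope dominates D as long as D c ≤ k,
  -- and for smaller c the tangent with k + 1 is lower.
  sumD-≤ : ∀ c k → 1 ℕ.≤ k → k ℕ.* sumD c ℕ.≤ k ℕ.* k ℕ.* c ℕ.+ n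
  sumD-≤ zero    k 1≤k = ℕₚ.≤-trans (ℕₚ.≤-reflexive (ℕₚ.*-zeroʳ k)) z≤n
  sumD-≤ (suc c) k 1≤k = go (D (suc c)) k (ℕₚ.m≤n+m (D (suc c)) k) 1≤k
    where
    open ℕₚ.≤-Reasoning
    eqn : ∀ k c n → k ℕ.* k ℕ.* c ℕ.+ n ℕ.+ k ℕ.* k ≡ k ℕ.* k ℕ.* (1 ℕ.+ c) ℕ.+ n
    eqn = ℕS.solve-∀
    eqn₁ : ∀ k s t → (1 ℕ.+ k) ℕ.* (k ℕ.* s) ℕ.+ t ≡ k ℕ.* ((1 ℕ.+ k) ℕ.* s) ℕ.+ t
    eqn₁ = ℕS.solve-∀
    go : ∀ f k → D (suc c) ℕ.≤ k ℕ.+ f → 1 ℕ.≤ k → k ℕ.* sumD (suc c) ℕ.≤ k ℕ.* k ℕ.* suc c ℕ.+ n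
    go f k h 1≤k with D (suc c) ℕ.≤? k
    ... | yes p = ℕₚ.≤-trans (ℕₚ.≤-reflexive (ℕₚ.*-distribˡ-+ k (sumD c) (D (suc c))))
          (ℕₚ.≤-trans (ℕₚ.+-mono-≤ (sumD-≤ c k 1≤k) (ℕₚ.*-monoʳ-≤ k p)) (ℕₚ.≤-reflexive (eqn k c n)))
    go zero k h 1≤k | no ¬p = ⊥-elim (¬p (ℕₚ.≤-trans h (ℕₚ.≤-reflexive (ℕₚ.+-identityʳ k))))
    go (suc f) k h 1≤k | no ¬p = ℕₚ.*-cancelˡ-≤ (suc k) (ℕₚ.+-cancelʳ-≤ (k ℕ.* suc k ℕ.* suc c) _ _ (begin
        suc k ℕ.* (k ℕ.* sumD (suc c)) ℕ.+ k ℕ.* suc k ℕ.* suc c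
          ≡⟨ eqn₁ k (sumD (suc c)) (k ℕ.* suc k ℕ.* suc c) ⟩
        k ℕ.* (suc k ℕ.* sumD (suc c)) ℕ.+ k ℕ.* suc k ℕ.* suc c
          ≤⟨ ℕₚ.+-mono-≤ (ℕₚ.*-monoʳ-≤ k (go f (suc k) (ℕₚ.≤-trans h (ℕₚ.≤-reflexive (ℕₚ.+-suc k f))) (s≤s z≤n)))
               (ℕₚ.<⇒≤ (ℕₚ.≰⇒> (λ q → ¬p (D-min (suc c) k q)))) ⟩
        k ℕ.* (suc k ℕ.* suc k ℕ.* suc c ℕ.+ n) ℕ.+ n
          ≡⟨ eqn₃ k (suc c) n ⟩
        suc k ℕ.* (k ℕ.* k ℕ.* suc c ℕ.+ n) ℕ.+ k ℕ.* suc k ℕ.* suc c ∎))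
      where
      eqn₃ : ∀ k c n → k ℕ.* ((1 ℕ.+ k) ℕ.* (1 ℕ.+ k) ℕ.* c ℕ.+ n) ℕ.+ n ≡ (1 ℕ.+ k) ℕ.* (k ℕ.* k ℕ.* c ℕ.+ n) ℕ.+ k ℕ.* (1 ℕ.+ k) ℕ.* c
      eqn₃ = ℕS.solve-∀

  sumD-≥ : ∀ c → D c ℕ.* c ℕ.≤ sumD c
  sumD-≥ c = go c c ℕₚ.≤-refl
    where
    go : ∀ x c → x ℕ.≤ c → D c ℕ.* x ℕ.≤ sumD x
    go zero    c le = ℕₚ.≤-trans (ℕₚ.≤-reflexive (ℕₚ.*-zeroʳ (D c))) z≤n
    go (suc x) c le = ℕₚ.≤-trans (ℕₚ.≤-reflexive (trans (ℕₚ.*-suc (D c) x) (ℕₚ.+-comm (D c) _)))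
                        (ℕₚ.+-mono-≤ (go x c (ℕₚ.≤-trans (ℕₚ.n≤1+n x) le)) (D-anti le))

  -- (D c − 1) D c c < n, squared up so as to avoid roots
  D*c-small : ∀ c q → 1 ℕ.≤ n → n ℕ.* c ℕ.≤ q ℕ.* q → D c ℕ.* c ℕ.≤ q ℕ.+ c
  D*c-small c q 1≤n h with D c in eq
  ... | zero  = z≤n
  ... | suc k = ℕₚ.≤-trans (ℕₚ.≤-reflexive (ℕₚ.+-comm c (k ℕ.* c))) (ℕₚ.+-monoˡ-≤ c (ℕₚ.≮⇒≥ λ lt → ¬below (below lt)))
    where
    ¬below : ¬ (n ℕ.≤ k ℕ.* suc k ℕ.* c)
    ¬below p = ℕₚ.1+n≰n (ℕₚ.≤-trans (ℕₚ.≤-reflexive (sym eq)) (D-min c k p))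
    below : q ℕ.< k ℕ.* c → n ℕ.≤ k ℕ.* suc k ℕ.* c
    below lt = go c h lt
      where
      eqn : ∀ k c → k ℕ.* c ℕ.* (k ℕ.* c) ℕ.+ k ℕ.* c ℕ.* c ≡ k ℕ.* (1 ℕ.+ k) ℕ.* c ℕ.* c
      eqn = ℕS.solve-∀
      go : ∀ c → n ℕ.* c ℕ.≤ q ℕ.* q → q ℕ.< k ℕ.* c → n ℕ.≤ k ℕ.* suc k ℕ.* c
      go zero     h lt = ⊥-elim (ℕₚ.n≮0 (ℕₚ.<-≤-trans lt (ℕₚ.≤-reflexive (ℕₚ.*-zeroʳ k))))
      go (suc c′) h lt = ℕₚ.*-cancelʳ-≤ n _ (suc c′) (ℕₚ.≤-trans h (ℕₚ.≤-trans (ℕₚ.*-mono-≤ (ℕₚ.<⇒≤ lt) (ℕₚ.<⇒≤ lt))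
                     (ℕₚ.≤-trans (ℕₚ.m≤m+n _ (k ℕ.* suc c′ ℕ.* suc c′)) (ℕₚ.≤-reflexive (eqn k (suc c′))))))

  -- The price of one component, (3 D c + 5) / 2 steps. Of the 3 D c, two thirds repay the blocks
  -- that dissolve with the segment; the last third pays for the step when the caps forbid
  -- colouring. The 5 covers the five positions that a block makes unfit for colouring.
  α₃ : ℕ → ℕ → ℤ
  α₃ S′ c = + S′ * (+ 3 * + D c + + 5)

  module Late (S′ Rc cs : ℕ) (1≤n : 1 ℕ.≤ n) (few : ∀ c → c ℕ.≤ cs → D c ℕ.* c ℕ.< Rc) where

    late : ∀ d l h ml mh N r → Counts n D Rc d l h ml mh N r → l ℕ.+ h ℕ.≤ cs →
           + n * (+ 2 * + S′) + drift d l h ml mh N (- α₃ S′ (l ℕ.+ h)) (- + S′) (+ 2 * + S′) (- (+ 2 * + S′)) ≤ 0ℤ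
    late d l h ml mh N r cn c≤ = byPhase (suc d ℕ.≤? D (l ℕ.+ h))
      where
      open Counts cn
      Dc : ℕ
      Dc = D (l ℕ.+ h)
      D≥ : 1 ℕ.≤ Dc
      D≥ = D≥1 (l ℕ.+ h) 1≤n (ℕₚ.≤-trans l≥1 (ℕₚ.m≤m+n l h))
      caseA : ∀ s n N ml mh l h d D → 0ℤ - (n * (+ 2 * s) +
          ((+ 2 * (+ 1 + d)) * (((- (s * (+ 3 * D + + 5))) + (+ 2 * s) * d) * l + (- s) * ml) +
           (+ 2 * (+ 1 + (+ 1 + d))) * (((- (s * (+ 3 * D + + 5))) + (+ 2 * s) * (+ 1 + d)) * h + (- s) * mh) + (- (+ 2 * s)) * N)) ≡
          s * (+ 2 * (N + + 5 * (d * l + (+ 1 + d) * h) + + 2 + (ml + mh) - n) + + 2 * d * (ml - + 2 * l) + + 2 * (+ 1 + d) * (mh - + 2 * h) +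
            + 6 * (D - (+ 1 + d)) * (d * l + (+ 1 + d) * h) + + 2 * (+ 1 + d) * (d * l + (+ 1 + d) * h) + + 4 * d * l + + 6 * D * (l + h) +
            + 10 * (l - + 1) + + 10 * h + + 6)
      caseA = ℤS.solve-∀
      caseB : ∀ s n N ml mh l d → 0ℤ - (n * (+ 2 * s) +
          ((+ 2 * (+ 1 + d)) * (((- (s * (+ 3 * d + + 5))) + (+ 2 * s) * d) * l + (- s) * ml) +
           (+ 2 * (+ 1 + (+ 1 + d))) * (((- (s * (+ 3 * d + + 5))) + (+ 2 * s) * (+ 1 + d)) * 0ℤ + (- s) * mh) + (- (+ 2 * s)) * N)) ≡
          s * (+ 2 * (d * (+ 1 + d) * l - n) + + 10 * (+ 1 + d) * l + + 2 * (ml + mh) + + 2 * (d * ml + (+ 1 + d) * mh) + + 2 * N)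
      caseB = ℤS.solve-∀
      rℤ : + r ≡ + d * + l + (+ 1 + + d) * + h
      rℤ = trans (cong +_ r≡) (cong₂ ℤ._+_ (ℤₚ.pos-* d l) (ℤₚ.pos-* (suc d) h))
      r≥0 : 0ℤ ≤ + d * + l + (+ 1 + + d) * + h
      r≥0 = subst (0ℤ ℤ.≤_) rℤ (nat r)
      gap₂ : ∀ {a k} → 2 ℕ.* k ℕ.≤ a → 0ℤ ≤ + a - + 2 * + k
      gap₂ {a} {k} le = subst (λ w → 0ℤ ≤ + a - w) (ℤₚ.pos-* 2 k) (gapℕ le)
      byPhase : Dec (suc d ℕ.≤ Dc) →
           + n * (+ 2 * + S′) + drift d l h ml mh N (- α₃ S′ (l ℕ.+ h)) (- + S′) (+ 2 * + S′) (- (+ 2 * + S′)) ≤ 0ℤ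
      -- Colouring is allowed. All vertices outside segments contribute a step of progress, except
      -- for five per block and two more, and removals pay for the deficit.
      byPhase (yes dD) = cert _ (nat S′ ⊗ (nat 2 ⊗ N≥′ ⊕ nat 2 ⊗ nat d ⊗ gap₂ {ml} {l} ml≥ ⊕ nat 2 ⊗ nat (suc d) ⊗ gap₂ {mh} {h} mh≥ ⊕
            nat 6 ⊗ gapℕ dD ⊗ r≥0 ⊕ nat 2 ⊗ nat (suc d) ⊗ r≥0 ⊕ nat 4 ⊗ nat d ⊗ nat l ⊕ nat 6 ⊗ nat Dc ⊗ nat (l ℕ.+ h) ⊕ nat 10 ⊗ gapℕ l≥1 ⊕ nat 10 ⊗ nat h ⊕ nat 6))
          (caseA (+ S′) (+ n) (+ N) (+ ml) (+ mh) (+ l) (+ h) (+ d) (+ Dc))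
        where
        N≥′ : 0ℤ ≤ + N + + 5 * (+ d * + l + (+ 1 + + d) * + h) + + 2 + (+ ml + + mh) - + n
        N≥′ = subst (λ w → 0ℤ ≤ + N + w + + 2 + (+ ml + + mh) - + n) (trans (ℤₚ.pos-* 5 r) (cong (λ w → + 5 * w) rℤ))
                (gapℕ (N≥ dD (ℕₚ.≤-<-trans (reds≤ cn) (few _ c≤))))
      -- All degrees have reached the cap, so none is above it and h = 0. Now d (d + 1) l ≥ n, and
      -- the removals alone pay for the step.
      byPhase (no ¬d) = full h refl
        where
        D≡d : Dc ≡ d
        D≡d = ℕₚ.≤-antisym (ℕₚ.≤-pred (ℕₚ.≰⇒> ¬d)) d≤
        full : ∀ h′ → h′ ≡ h → + n * (+ 2 * + S′) + drift d l h ml mh N (- α₃ S′ (l ℕ.+ h)) (- + S′) (+ 2 * + S′) (- (+ 2 * + S′)) ≤ 0ℤ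
        full (suc h′) e = ⊥-elim (¬d (h≤ (subst (0 ℕ.<_) e (s≤s z≤n))))
        full zero e = subst (λ w → + n * (+ 2 * + S′) + drift d l w ml mh N (- α₃ S′ (l ℕ.+ h)) (- + S′) (+ 2 * + S′) (- (+ 2 * + S′)) ≤ 0ℤ) e
          (subst (λ w → + n * (+ 2 * + S′) + drift d l 0 ml mh N (- (+ S′ * (+ 3 * + w + + 5))) (- + S′) (+ 2 * + S′) (- (+ 2 * + S′)) ≤ 0ℤ) (sym D≡d)
            (cert _ (nat S′ ⊗ (nat 2 ⊗ big ⊕ nat 10 ⊗ nat (suc d) ⊗ nat l ⊕ nat 2 ⊗ nat (ml ℕ.+ mh) ⊕ nat 2 ⊗ (nat d ⊗ nat ml ⊕ nat (suc d) ⊗ nat mh) ⊕ nat 2 ⊗ nat N))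
              (caseB (+ S′) (+ n) (+ N) (+ ml) (+ mh) (+ l) (+ d))))
          where
          big : 0ℤ ≤ + d * (+ 1 + + d) * + l - + n
          big = subst (λ w → 0ℤ ≤ w - + n) (trans (ℤₚ.pos-* (d ℕ.* suc d) l) (cong (ℤ._* + l) (ℤₚ.pos-* d (suc d))))
                  (gapℕ (subst₂ (λ a c → n ℕ.≤ a ℕ.* suc a ℕ.* c) D≡d (trans (cong (l ℕ.+_) (sym e)) (ℕₚ.+-identityʳ l))
                    (D-ok (l ℕ.+ h) (ℕₚ.≤-trans l≥1 (ℕₚ.m≤m+n l h)))))

-- The table and its interpolation.

-- A piece of the table, of width w H in the number of components. The Greek entries are the slopes of the
-- bounds G (single vertices), R (blocks, ρ⁺ − ρ⁻), M (vertices in segments) and A (time); d₀ is a lower bound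
-- for the degree d of the state, and d⋆ the degree at which the sum of squared degrees is estimated.
data Row : Set where
  growing : (w κ α : ℕ) → Row
  merging : (w ρ⁺ ρ⁻ μ α d₀ d⋆ : ℕ) → Row

width : Row → ℕ
width (growing w _ _)           = w
width (merging w _ _ _ _ _ _)   = w

slopeG slopeR slopeM slopeA : Row → ℤ
slopeG (growing _ κ _)            = + κ
slopeG (merging _ _ _ _ _ _ _)    = 0ℤ
slopeR (growing _ _ _)            = 0ℤ
slopeR (merging _ ρ⁺ ρ⁻ _ _ _ _)  = + ρ⁺ - + ρ⁻
slopeM (growing _ _ _)            = 0ℤ
slopeM (merging _ _ _ μ _ _ _)    = + μ
slopeA (growing _ _ α)            = + α
slopeA (merging _ _ _ _ α _ _)    = + α

IsMerging : Row → Set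
IsMerging (growing _ _ _)           = ⊥
IsMerging (merging _ _ _ _ _ _ _)   = ⊤

-- The left end of a piece and the four bounds there, all in units of H.
record Pre : Set where
  constructor pre
  field
    c₁ : ℕ
    G₁ R₁ M₁ A₁ : ℤ
open Pre public

next : Pre → Row → Pre
next p r = pre (c₁ p ℕ.+ width r) (G₁ p + slopeG r * + width r) (R₁ p + slopeR r * + width r)
               (M₁ p + slopeM r * + width r) (A₁ p + slopeA r * + width r)

module Check (S : ℤ) (U β Rc cs₀ αm ρm μm : ℕ) where

  -- R is 0 and M is S U, so both bounds are trivial if growth ends in this piece. The drift of G
  -- needs an argument only for κ > S. The last two conditions are time estimates, one for growing
  -- states and one for merging states with this many components.
  Growing : Pre → (w κ α : ℕ) → Set
  Growing p w κ α =
    cs₀ ℕ.< c₁ p × 0ℤ ≡ R₁ p × S * + U ≡ M₁ p × + κ ≤ + 2 * S × α ℕ.≤ αm ×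
    (+ κ ≤ S ⊎ (S ≤ + κ × 0ℤ ≤ + κ * G₁ p - + 2 * (+ κ - S) * S * + c₁ p - S * S)) ×
    0ℤ ≤ + α * (+ 2 * S * + c₁ p - G₁ p - + β - + 2 * S) - S * S * + U ×
    0ℤ ≤ + 2 * + α * S * + c₁ p - S * S * + U

  -- `Rm` and `Rx` enclose R on the piece, `Q` bounds the sum of squared degrees, `ν` is the value
  -- at 0 of the line that M follows. G₁ = - β puts every state with a single vertex outside the
  -- tube. The alternative for R is that no blocks are claimed yet.
  Merging : Pre → (w ρ⁺ ρ⁻ μ α d₀ d⋆ : ℕ) → Set
  Merging p w ρ⁺ ρ⁻ μ α d₀ d⋆ =
    - + β ≡ G₁ p × 0ℤ ≤ Rm × α ℕ.≤ αm × ρ⁺ ℕ.≤ ρm × ρ⁻ ℕ.≤ ρm × μ ℕ.≤ μm ×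
    0ℤ ≤ + 2 * + α * (S * + c₁ p + Rm - + β) - S * S * + U ×
    ((0ℤ ≡ R₁ p × 0 ≡ ρ⁺ × 0 ≡ ρ⁻) ⊎
     -- Drift of the block bound, with every count at its unfavourable end.
     (0ℤ ≤ + 2 * + ρ⁺ * (S * + c₁ p + Rm - + β) - + 2 * + ρ⁻ * (S * c₀ + Rx) - + 2 * S * Rx - + 2 * S * Q
              + S * (S * (+ U - + 1) - + 5 * Rx - M₀ - + β - + 1) ×
      -- Up to `Rx` blocks neither the degree cap, by this and the next condition, nor the block
      -- cap, by the one after, stops the colouring.
      + 1 ≤ + c₁ p * (S * S * (+ U - + 1) - Rx * S) - Rx * Rx ×
      0ℤ ≤ S * S * (+ U - + 1) - Rx * S ×
      + 1 ≤ S * + Rc - Rx ×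
      -- d⋆ is the greatest possible mean degree rounded down, where the bound for the squares is
      -- attained.
      0ℤ ≤ Rx - + d⋆ * (S * + c₁ p) × 0ℤ ≤ + suc d⋆ * (S * + c₁ p) - Rx)) ×
    0ℤ ≤ ν × + 2 * S ≤ + μ ×
    -- Segments of the higher degree leave sooner and may all have the minimal size 2, each costing
    -- the size bound μ - 2 S. Their number is at most that of the components, or, better for small
    -- degrees, at most that of the blocks.
    (0ℤ ≤ + suc d₀ * ν - (+ μ - + 2 * S) * c₀ ⊎ 0ℤ ≤ ν - (+ μ - + 2 * S) * + Rc) ×
    (0 ≡ d₀ ⊎ 0ℤ ≤ Rm - + β - + d₀ * (S * c₀))
    where
    c₀ Rm Rx M₀ ν Q : ℤ
    c₀ = + c₁ p + + w
    Rm = R₁ p - + ρ⁻ * + w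
    Rx = R₁ p + + ρ⁺ * + w
    M₀ = M₁ p + + μ * + w
    ν  = M₁ p - + μ * + c₁ p
    Q  = (+ 2 * + d⋆ + + 1) * Rx - + d⋆ * (+ 1 + + d⋆) * (S * + c₁ p)

  Ok : Pre → Row → Set
  Ok p (growing w κ α)                 = Growing p w κ α
  Ok p (merging w ρ⁺ ρ⁻ μ α d₀ d⋆)     = Merging p w ρ⁺ ρ⁻ μ α d₀ d⋆

  ok? : ∀ p r → Dec (Ok p r)
  ok? p (growing w κ α) = (_ ℕ.<? _) ×-dec (_ ℤ.≟ _) ×-dec (_ ℤ.≟ _) ×-dec (_ ℤ.≤? _) ×-dec (_ ℕ.≤? _) ×-dec
    ((_ ℤ.≤? _) ⊎-dec ((_ ℤ.≤? _) ×-dec (_ ℤ.≤? _))) ×-dec (_ ℤ.≤? _) ×-dec (_ ℤ.≤? _)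
  ok? p (merging w ρ⁺ ρ⁻ μ α d₀ d⋆) = (_ ℤ.≟ _) ×-dec (_ ℤ.≤? _) ×-dec (_ ℕ.≤? _) ×-dec (_ ℕ.≤? _) ×-dec (_ ℕ.≤? _) ×-dec (_ ℕ.≤? _) ×-dec
    (_ ℤ.≤? _) ×-dec
    (((_ ℤ.≟ _) ×-dec (_ ℕ.≟ _) ×-dec (_ ℕ.≟ _)) ⊎-dec
     ((_ ℤ.≤? _) ×-dec (_ ℤ.≤? _) ×-dec (_ ℤ.≤? _) ×-dec (_ ℤ.≤? _) ×-dec (_ ℤ.≤? _) ×-dec (_ ℤ.≤? _))) ×-dec
    (_ ℤ.≤? _) ×-dec (_ ℤ.≤? _) ×-dec ((_ ℤ.≤? _) ⊎-dec (_ ℤ.≤? _)) ×-dec ((_ ℕ.≟ _) ⊎-dec (_ ℤ.≤? _))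

  AllOk : Pre → Row → List Row → Set
  AllOk p r []        = Ok p r
  AllOk p r (r′ ∷ rs) = Ok p r × AllOk (next p r) r′ rs

  allOk? : ∀ p r rs → Dec (AllOk p r rs)
  allOk? p r []        = ok? p r
  allOk? p r (r′ ∷ rs) = ok? p r ×-dec allOk? (next p r) r′ rs

top : Pre → Row → List Row → Pre
top p r []        = next p r
top p r (r′ ∷ rs) = top (next p r) r′ rs

-- Piecewise linear interpolation: the breakpoints are the multiples c₁ H.
module Interpolation (H : ℕ) where

  pick : ∀ {X : Set} {P : Set} → Dec P → X → X → X
  pick (yes _) a b = a
  pick (no  _) a b = b

  loc : Pre → Row → List Row → ℕ → Pre × Row
  loc p r []        x = p , r
  loc p r (r′ ∷ rs) x = pick (x ℕ.≤? (c₁ p ℕ.+ width r) ℕ.* H) (p , r) (loc (next p r) r′ rs x)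

  line : (Pre → ℤ) → (Row → ℤ) → Pre × Row → ℕ → ℤ
  line v s (p , r) x = v p * + H + s r * (+ x - + c₁ p * + H)

  F : (Pre → ℤ) → (Row → ℤ) → Pre → Row → List Row → ℕ → ℤ
  F v s p r rs x = line v s (loc p r rs x) x

  line-suc : ∀ v s pr x → line v s pr (suc x) ≡ line v s pr x + s (proj₂ pr)
  line-suc v s (p , r) x = eqn (v p) (+ H) (s r) (+ x) (+ c₁ p)
    where
    eqn : ∀ v h s x c → v * h + s * ((+ 1 + x) - c * h) ≡ v * h + s * (x - c * h) + s
    eqn = ℤS.solve-∀

  line-base : ∀ v s p r → line v s (p , r) (c₁ p ℕ.* H) ≡ v p * + H
  line-base v s p r = trans (cong (λ z → v p * + H + s r * (z - + c₁ p * + H)) (ℤₚ.pos-* (c₁ p) H)) (eqn (v p) (+ H) (s r) (+ c₁ p))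
    where
    eqn : ∀ v h s c → v * h + s * (c * h - c * h) ≡ v * h
    eqn = ℤS.solve-∀

  F-base : ∀ v s p r rs → F v s p r rs (c₁ p ℕ.* H) ≡ v p * + H
  F-base v s p r []        = line-base v s p r
  F-base v s p r (r′ ∷ rs) with c₁ p ℕ.* H ℕ.≤? (c₁ p ℕ.+ width r) ℕ.* H
  ... | yes _ = line-base v s p r
  ... | no ¬q = ⊥-elim (¬q (ℕₚ.*-monoˡ-≤ H (ℕₚ.m≤m+n (c₁ p) (width r))))

  -- Pieces are open on the left and closed on the right, so the increment up to suc x is the slope
  -- of the piece of suc x. At a breakpoint this needs the continuity expressed by `nx`.
  F-suc : ∀ v s → (∀ p r → v (next p r) ≡ v p + s r * + width r) → ∀ p r rs x → c₁ p ℕ.* H ℕ.≤ x →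
          F v s p r rs (suc x) ≡ F v s p r rs x + s (proj₂ (loc p r rs (suc x)))
  F-suc v s nx p r [] x le = line-suc v s (p , r) x
  F-suc v s nx p r (r′ ∷ rs) x le with suc x ℕ.≤? (c₁ p ℕ.+ width r) ℕ.* H | x ℕ.≤? (c₁ p ℕ.+ width r) ℕ.* H
  ... | yes _  | yes _ = line-suc v s (p , r) x
  ... | yes q  | no ¬q = ⊥-elim (¬q (ℕₚ.≤-trans (ℕₚ.n≤1+n x) q))
  ... | no ¬q  | no ¬q′ = F-suc v s nx (next p r) r′ rs x (ℕₚ.<⇒≤ (ℕₚ.≰⇒> ¬q′))
  ... | no ¬q  | yes q = trans (F-suc v s nx (next p r) r′ rs x (ℕₚ.≤-reflexive (sym x≡)))
          (cong (ℤ._+ s (proj₂ (loc (next p r) r′ rs (suc x)))) (trans (cong (F v s (next p r) r′ rs) x≡) (trans (F-base v s (next p r) r′ rs)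
            (trans (cong (ℤ._* + H) (nx p r)) (trans (eqn (v p) (+ H) (s r) (+ c₁ p) (+ width r))
              (cong (λ z → v p * + H + s r * (z - + c₁ p * + H)) (sym (trans (cong +_ x≡) (ℤₚ.pos-* (c₁ p ℕ.+ width r) H)))))))))
    where
    x≡ : x ≡ (c₁ p ℕ.+ width r) ℕ.* H
    x≡ = ℕₚ.≤-antisym q (ℕₚ.≤-pred (ℕₚ.≰⇒> ¬q))
    eqn : ∀ v h s c w → (v + s * w) * h ≡ v * h + s * ((c + w) * h - c * h)
    eqn = ℤS.solve-∀

  Located : Pre × Row → ℕ → Set
  Located (p , r) x = c₁ p ℕ.* H ℕ.< x × x ℕ.≤ (c₁ p ℕ.+ width r) ℕ.* H

  located : ∀ p r rs x → c₁ p ℕ.* H ℕ.< x → x ℕ.≤ c₁ (top p r rs) ℕ.* H → Located (loc p r rs x) x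
  located p r []        x lo hi = lo , hi
  located p r (r′ ∷ rs) x lo hi with x ℕ.≤? (c₁ p ℕ.+ width r) ℕ.* H
  ... | yes q = lo , q
  ... | no ¬q = located (next p r) r′ rs x (ℕₚ.≰⇒> ¬q) hi

  module _ {S : ℤ} {U β Rc cs₀ αm ρm μm : ℕ} where
    open Check S U β Rc cs₀ αm ρm μm

    loc-ok : ∀ p r rs x → AllOk p r rs → Ok (proj₁ (loc p r rs x)) (proj₂ (loc p r rs x))
    loc-ok p r []        x a       = a
    loc-ok p r (r′ ∷ rs) x (a , b) with x ℕ.≤? (c₁ p ℕ.+ width r) ℕ.* H
    ... | yes _ = a
    ... | no _  = loc-ok (next p r) r′ rs x b

-- The table ends at 1000 H components, about n / 10000. There are then about 90.2 blocks and 5.87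
-- vertices per segment, and 0.03066 n steps are reserved for the rest. The entry - 20000 is - β.
bottom : Pre
bottom = pre 1000 (- + 20000) (+ 90196120) (+ 5865617) (+ 306576646)

-- Opaque, so that the rows are only ever evaluated here.
abstract

  row₀ : Row
  row₀ = merging 46 41805 0 5819 54839 86 92

  rows : List Row
  rows =
      merging 55 41357 0 5815 53680 83 90 ∷ merging 57 40134 0 5812 52370 81 87 ∷ merging 60 39033 0 5808 51115 79 85 ∷
      merging 64 38019 0 5804 49890 77 83 ∷ merging 67 36931 0 5800 48677 75 81 ∷ merging 71 35931 0 5796 47502 73 78 ∷
      merging 74 34881 0 5792 46347 71 76 ∷ merging 78 33912 0 5788 45234 69 74 ∷ merging 82 32955 0 5784 44147 67 72 ∷
      merging 87 32058 0 5779 43087 65 70 ∷ merging 91 31123 0 5774 42045 63 68 ∷ merging 96 30250 0 5770 41037 62 67 ∷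
      merging 101 29388 0 5765 40050 60 65 ∷ merging 106 28540 0 5759 39090 58 63 ∷ merging 112 27735 0 5755 38156 57 61 ∷
      merging 118 26941 0 5749 37241 55 60 ∷ merging 124 26160 0 5745 36348 54 58 ∷ merging 130 25387 0 5738 35480 52 56 ∷
      merging 137 24659 0 5733 34637 51 55 ∷ merging 145 23955 0 5728 33813 50 53 ∷ merging 152 23245 0 5721 33006 48 52 ∷
      merging 160 22558 0 5716 32222 47 51 ∷ merging 169 21908 0 5710 31458 46 49 ∷ merging 177 21245 0 5702 30710 44 48 ∷
      merging 187 20622 0 5696 29985 43 46 ∷ merging 197 20013 0 5690 29275 42 45 ∷ merging 207 19409 0 5683 28582 41 44 ∷
      merging 218 18825 0 5677 27908 40 43 ∷ merging 229 18249 0 5667 27251 38 41 ∷ merging 241 17699 0 5660 26611 37 40 ∷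
      merging 254 17165 0 5652 25988 36 39 ∷ merging 268 16646 0 5644 25380 35 38 ∷ merging 282 16134 0 5636 24785 34 37 ∷
      merging 296 15630 0 5628 24205 33 36 ∷ merging 312 15148 0 5619 23642 32 35 ∷ merging 328 14674 0 5610 23092 31 34 ∷
      merging 346 14219 0 5604 22556 31 33 ∷ merging 364 13770 0 5595 22033 30 32 ∷ merging 383 13334 0 5585 21523 29 31 ∷
      merging 403 12908 0 5575 21026 28 30 ∷ merging 424 12493 0 5564 20542 27 29 ∷ merging 447 12089 0 5553 20070 26 28 ∷
      merging 470 11698 0 5546 19610 26 28 ∷ merging 495 11322 0 5534 19161 25 27 ∷ merging 521 10953 0 5522 18723 24 26 ∷
      merging 548 10588 0 5509 18297 23 25 ∷ merging 577 10230 0 5501 17881 23 25 ∷ merging 608 9898 0 5488 17476 22 24 ∷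
      merging 640 9567 0 5473 17081 21 23 ∷ merging 673 9237 0 5465 16695 21 22 ∷ merging 709 8925 0 5450 16320 20 22 ∷
      merging 746 8623 0 5442 15953 20 21 ∷ merging 785 8317 0 5425 15596 19 20 ∷ merging 827 8035 0 5408 15248 18 20 ∷
      merging 870 7754 0 5399 14909 18 19 ∷ merging 916 7473 0 5380 14578 17 19 ∷ merging 964 7216 0 5371 14255 17 18 ∷
      merging 1015 6946 0 5350 13940 16 17 ∷ merging 1068 6706 0 5340 13634 16 17 ∷ merging 1125 6454 0 5319 13334 15 16 ∷
      merging 1184 6224 0 5308 13043 15 16 ∷ merging 1246 5987 0 5285 12758 14 15 ∷ merging 1312 5771 0 5274 12481 14 15 ∷
      merging 1381 5544 0 5248 12210 13 14 ∷ merging 1453 5343 0 5236 11947 13 14 ∷ merging 1530 5122 0 5225 11689 13 13 ∷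
      merging 1610 4940 0 5197 11439 12 13 ∷ merging 1695 4736 0 5185 11194 12 13 ∷ merging 1784 4558 0 5153 10955 11 12 ∷
      merging 1878 4376 0 5140 10722 11 12 ∷ merging 1977 4191 0 5128 10495 11 11 ∷ merging 2081 4034 0 5092 10274 10 11 ∷
      merging 2191 3858 0 5079 10058 10 11 ∷ merging 2306 3703 0 5065 9847 10 10 ∷ merging 2427 3556 0 5025 9641 9 10 ∷
      merging 2555 3390 0 5011 9440 9 10 ∷ merging 2690 3256 0 4997 9244 9 9 ∷ merging 2831 3123 0 4951 9052 8 9 ∷ merging 2980 2973 0 4936 8865 8 9 ∷
      merging 3137 2848 0 4920 8683 8 8 ∷ merging 3302 2733 0 4867 8504 7 8 ∷ merging 3476 2604 0 4851 8330 7 8 ∷ merging 3659 2473 0 4834 8160 7 7 ∷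
      merging 3851 2381 0 4818 7994 7 7 ∷ merging 4054 2277 0 4755 7831 6 7 ∷ merging 4267 2159 0 4737 7671 6 7 ∷ merging 4492 2054 0 4719 7516 6 6 ∷
      merging 4728 1978 0 4702 7364 6 6 ∷ merging 4977 1892 0 4684 7214 6 6 ∷ merging 1260 1610 0 4680 7068 6 6 ∷ merging 1276 1579 0 4620 7035 5 6 ∷
      merging 1292 1547 0 4616 7003 5 6 ∷ merging 1308 1526 0 4611 6970 5 5 ∷ merging 1325 1509 0 4606 6938 5 5 ∷ merging 1341 1492 0 4601 6907 5 5 ∷
      merging 1358 1474 0 4597 6875 5 5 ∷ merging 1376 1456 0 4592 6843 5 5 ∷ merging 1393 1436 0 4587 6812 5 5 ∷ merging 1411 1417 0 4583 6780 5 5 ∷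
      merging 1429 1397 0 4578 6749 5 5 ∷ merging 1447 1376 0 4573 6718 5 5 ∷ merging 1465 1355 0 4569 6687 5 5 ∷ merging 1484 1332 0 4564 6657 5 5 ∷
      merging 1502 1310 0 4559 6626 5 5 ∷ merging 1521 1286 0 4555 6596 5 5 ∷ merging 1541 1262 0 4550 6566 5 5 ∷ merging 1560 1237 0 4546 6536 5 5 ∷
      merging 1580 1211 0 4541 6506 5 5 ∷ merging 1600 1185 0 4536 6477 5 5 ∷ merging 1620 1157 0 4461 6447 4 5 ∷ merging 1641 1129 0 4456 6418 4 5 ∷
      merging 1661 1108 0 4450 6390 4 4 ∷ merging 1682 1095 0 4445 6361 4 4 ∷ merging 1704 1082 0 4440 6333 4 4 ∷ merging 1725 1068 0 4435 6305 4 4 ∷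
      merging 1747 1053 0 4430 6276 4 4 ∷ merging 1769 1038 0 4425 6248 4 4 ∷ merging 1792 1023 0 4420 6220 4 4 ∷ merging 1814 1007 0 4414 6192 4 4 ∷
      merging 1837 991 0 4409 6165 4 4 ∷ merging 1860 975 0 4404 6137 4 4 ∷ merging 1884 957 0 4399 6109 4 4 ∷ merging 1908 940 0 4394 6082 4 4 ∷
      merging 1932 921 0 4389 6055 4 4 ∷ merging 1956 902 0 4384 6028 4 4 ∷ merging 1981 883 0 4379 6001 4 4 ∷ merging 2006 863 0 4374 5974 4 4 ∷
      merging 2032 842 0 4369 5947 4 4 ∷ merging 2057 820 0 4364 5921 4 4 ∷ merging 2083 798 0 4359 5895 4 4 ∷ merging 2110 775 0 4354 5869 4 4 ∷
      merging 2137 751 0 4349 5843 4 4 ∷ merging 2164 726 0 4249 5818 3 4 ∷ merging 2191 703 0 4244 5793 3 3 ∷ merging 2219 693 0 4238 5768 3 3 ∷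
      merging 2247 684 0 4232 5743 3 3 ∷ merging 2275 674 0 4227 5718 3 3 ∷ merging 2304 664 0 4221 5693 3 3 ∷ merging 2333 653 0 4216 5669 3 3 ∷
      merging 2363 642 0 4210 5644 3 3 ∷ merging 2393 631 0 4204 5619 3 3 ∷ merging 2423 620 0 4199 5595 3 3 ∷ merging 2454 608 0 4193 5570 3 3 ∷
      merging 2485 595 0 4188 5546 3 3 ∷ merging 2516 583 0 4182 5522 3 3 ∷ merging 2548 570 0 4177 5497 3 3 ∷ merging 2580 556 0 4171 5473 3 3 ∷
      merging 2613 542 0 4166 5449 3 3 ∷ merging 2646 527 0 4160 5426 3 3 ∷ merging 2679 512 0 4155 5402 3 3 ∷ merging 2713 497 0 4149 5378 3 3 ∷
      merging 2748 481 0 4144 5355 3 3 ∷ merging 2782 464 0 4138 5332 3 3 ∷ merging 2818 447 0 4133 5309 3 3 ∷ merging 2853 429 0 4128 5286 3 3 ∷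
      merging 2889 411 0 4122 5263 3 3 ∷ merging 2926 391 0 4117 5241 3 3 ∷ merging 2963 372 0 4112 5218 3 3 ∷ merging 3001 351 0 4106 5196 3 3 ∷
      merging 3039 329 0 3968 5175 2 3 ∷ merging 3077 309 0 3962 5153 2 2 ∷ merging 3116 304 0 3956 5132 2 2 ∷ merging 3155 298 0 3950 5110 2 2 ∷
      merging 3195 292 0 3944 5089 2 2 ∷ merging 3236 286 0 3937 5068 2 2 ∷ merging 3277 279 0 3931 5047 2 2 ∷ merging 3318 272 0 3925 5025 2 2 ∷
      merging 3360 266 0 3919 5004 2 2 ∷ merging 3403 258 0 3913 4983 2 2 ∷ merging 3446 251 0 3907 4962 2 2 ∷ merging 3490 243 0 3901 4941 2 2 ∷
      merging 3534 235 0 3895 4919 2 2 ∷ merging 3578 227 0 3889 4898 2 2 ∷ merging 3624 219 0 3883 4877 2 2 ∷ merging 3670 210 0 3877 4857 2 2 ∷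
      merging 3716 201 0 3871 4836 2 2 ∷ merging 3763 191 0 3865 4815 2 2 ∷ merging 3811 182 0 3859 4794 2 2 ∷ merging 3859 172 0 3853 4774 2 2 ∷
      merging 3908 161 0 3848 4753 2 2 ∷ merging 3957 150 0 3842 4733 2 2 ∷ merging 4007 139 0 3836 4712 2 2 ∷ merging 4058 127 0 3830 4692 2 2 ∷
      merging 4109 115 0 3824 4672 2 2 ∷ merging 4161 102 0 3819 4652 2 2 ∷ merging 4214 89 0 3813 4633 2 2 ∷ merging 4267 75 0 3807 4613 2 2 ∷
      merging 4321 61 0 3801 4593 2 2 ∷ merging 4376 46 0 3796 4574 2 2 ∷ merging 4432 31 0 3790 4555 2 2 ∷ merging 4488 15 0 3784 4536 2 2 ∷
      merging 4544 0 2 3779 4518 2 2 ∷ merging 4602 0 18 3773 4499 2 2 ∷ merging 4660 0 36 3768 4482 2 2 ∷ merging 4719 0 54 3565 4464 1 2 ∷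
      merging 4779 0 60 3558 4446 1 1 ∷ merging 4839 0 62 3551 4429 1 1 ∷ merging 4901 0 64 3545 4411 1 1 ∷ merging 4963 0 67 3538 4393 1 1 ∷
      merging 5026 0 69 3532 4376 1 1 ∷ merging 5089 0 72 3525 4358 1 1 ∷ merging 5154 0 75 3519 4340 1 1 ∷ merging 5219 0 77 3513 4322 1 1 ∷
      merging 5285 0 80 3506 4304 1 1 ∷ merging 5352 0 83 3500 4287 1 1 ∷ merging 5420 0 86 3494 4269 1 1 ∷ merging 5488 0 90 3487 4251 1 1 ∷
      merging 5558 0 93 3481 4233 1 1 ∷ merging 5628 0 97 3475 4215 1 1 ∷ merging 5699 0 100 3469 4197 1 1 ∷ merging 5771 0 104 3463 4179 1 1 ∷
      merging 5844 0 108 3456 4161 1 1 ∷ merging 5918 0 112 3450 4144 1 1 ∷ merging 5993 0 117 3444 4126 1 1 ∷ merging 6069 0 121 3438 4108 1 1 ∷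
      merging 6146 0 126 3432 4090 1 1 ∷ merging 6224 0 131 3426 4072 1 1 ∷ merging 6303 0 136 3420 4055 1 1 ∷ merging 6382 0 141 3414 4037 1 1 ∷
      merging 6463 0 146 3408 4019 1 1 ∷ merging 6545 0 152 3402 4002 1 1 ∷ merging 6628 0 158 3396 3984 1 1 ∷ merging 6712 0 164 3390 3967 1 1 ∷
      merging 6797 0 170 3385 3949 1 1 ∷ merging 6883 0 177 3379 3932 1 1 ∷ merging 6970 0 184 3373 3915 1 1 ∷ merging 7058 0 191 3367 3898 1 1 ∷
      merging 7147 0 199 3361 3881 1 1 ∷ merging 7238 0 206 3356 3864 1 1 ∷ merging 7329 0 215 3350 3847 1 1 ∷ merging 7422 0 223 3344 3830 1 1 ∷
      merging 7516 0 232 3339 3813 1 1 ∷ merging 7611 0 241 3333 3797 1 1 ∷ merging 7708 0 251 3327 3781 1 1 ∷ merging 7805 0 261 3322 3765 1 1 ∷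
      merging 7904 0 272 3316 3749 1 1 ∷ merging 8004 0 283 3311 3733 1 1 ∷ merging 8105 0 294 3305 3717 1 1 ∷ merging 8208 0 306 3300 3702 1 1 ∷
      merging 8312 0 319 3294 3687 1 1 ∷ merging 8417 0 332 3289 3672 1 1 ∷ merging 8524 0 346 3283 3657 1 1 ∷ merging 8632 0 361 3278 3643 1 1 ∷
      merging 8741 0 377 2952 3629 0 1 ∷ merging 8851 0 377 2946 3614 0 0 ∷ merging 8964 0 377 2940 3600 0 0 ∷ merging 9077 0 377 2934 3586 0 0 ∷
      merging 9192 0 377 2929 3572 0 0 ∷ merging 9308 0 376 2923 3557 0 0 ∷ merging 9426 0 376 2917 3543 0 0 ∷ merging 9545 0 376 2911 3528 0 0 ∷
      merging 9666 0 376 2905 3513 0 0 ∷ merging 9789 0 376 2902 3499 0 0 ∷ merging 9912 0 376 2902 3484 0 0 ∷ merging 10038 0 376 2902 3469 0 0 ∷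
      merging 10165 0 376 2902 3454 0 0 ∷ merging 10294 0 375 2902 3439 0 0 ∷ merging 10424 0 375 2902 3424 0 0 ∷ merging 10556 0 375 2902 3409 0 0 ∷
      merging 10690 0 375 2902 3394 0 0 ∷ merging 10825 0 375 2902 3379 0 0 ∷ merging 10962 0 375 2902 3363 0 0 ∷ merging 11101 0 375 2902 3348 0 0 ∷
      merging 11241 0 374 2902 3333 0 0 ∷ merging 11383 0 374 2902 3317 0 0 ∷ merging 11528 0 374 2902 3302 0 0 ∷ merging 11673 0 374 2902 3286 0 0 ∷
      merging 11821 0 374 2902 3271 0 0 ∷ merging 11971 0 373 2902 3255 0 0 ∷ merging 12122 0 373 2902 3239 0 0 ∷ merging 12276 0 373 2902 3224 0 0 ∷
      merging 12431 0 373 2902 3208 0 0 ∷ merging 12589 0 372 2902 3192 0 0 ∷ merging 12748 0 372 2902 3176 0 0 ∷ merging 12909 0 372 2902 3160 0 0 ∷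
      merging 13073 0 372 2902 3144 0 0 ∷ merging 13238 0 371 2902 3128 0 0 ∷ merging 13406 0 371 2902 3112 0 0 ∷ merging 13575 0 371 2902 3096 0 0 ∷
      merging 13747 0 370 2902 3080 0 0 ∷ merging 13921 0 370 2902 3063 0 0 ∷ merging 14098 0 370 2902 3047 0 0 ∷ merging 14276 0 369 2902 3031 0 0 ∷
      merging 14457 0 369 2902 3015 0 0 ∷ merging 14640 0 369 2902 2998 0 0 ∷ merging 14825 0 368 2902 2982 0 0 ∷ merging 15013 0 368 2902 2965 0 0 ∷
      merging 15203 0 367 2902 2949 0 0 ∷ merging 15395 0 367 2902 2932 0 0 ∷ merging 15590 0 366 2902 2916 0 0 ∷ merging 15787 0 366 2902 2899 0 0 ∷
      merging 15987 0 365 2902 2883 0 0 ∷ merging 16190 0 365 2902 2866 0 0 ∷ merging 16395 0 364 2902 2849 0 0 ∷ merging 16602 0 364 2902 2832 0 0 ∷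
      merging 16812 0 363 2902 2816 0 0 ∷ merging 17025 0 362 2902 2799 0 0 ∷ merging 17241 0 361 2902 2782 0 0 ∷ merging 17459 0 361 2902 2765 0 0 ∷
      merging 17680 0 360 2902 2748 0 0 ∷ merging 17904 0 359 2902 2732 0 0 ∷ merging 18130 0 358 2902 2715 0 0 ∷ merging 18360 0 357 2902 2698 0 0 ∷
      merging 18592 0 356 2902 2681 0 0 ∷ merging 18827 0 355 2902 2664 0 0 ∷ merging 19066 0 354 2902 2647 0 0 ∷ merging 19307 0 353 2902 2630 0 0 ∷
      merging 19551 0 352 2902 2613 0 0 ∷ merging 19799 0 351 2902 2596 0 0 ∷ merging 20050 0 350 2902 2578 0 0 ∷ merging 20303 0 348 2902 2561 0 0 ∷
      merging 20560 0 347 2902 2544 0 0 ∷ merging 20821 0 346 2902 2527 0 0 ∷ merging 21084 0 344 2902 2510 0 0 ∷ merging 21351 0 343 2902 2493 0 0 ∷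
      merging 21621 0 341 2902 2475 0 0 ∷ merging 21895 0 339 2902 2458 0 0 ∷ merging 22172 0 337 2902 2441 0 0 ∷ merging 22453 0 336 2902 2423 0 0 ∷
      merging 22737 0 334 2902 2406 0 0 ∷ merging 23025 0 332 2902 2389 0 0 ∷ merging 23316 0 329 2902 2371 0 0 ∷ merging 23611 0 327 2902 2354 0 0 ∷
      merging 23910 0 325 2902 2337 0 0 ∷ merging 24213 0 322 2902 2319 0 0 ∷ merging 24519 0 319 2902 2302 0 0 ∷ merging 24830 0 317 2902 2284 0 0 ∷
      merging 25144 0 314 2902 2267 0 0 ∷ merging 25462 0 311 2902 2249 0 0 ∷ merging 25785 0 307 2902 2231 0 0 ∷ merging 26111 0 304 2902 2214 0 0 ∷
      merging 26442 0 300 2902 2196 0 0 ∷ merging 26776 0 297 2902 2178 0 0 ∷ merging 27115 0 293 2902 2161 0 0 ∷ merging 27459 0 288 2902 2143 0 0 ∷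
      merging 27806 0 284 2902 2125 0 0 ∷ merging 28158 0 280 2902 2107 0 0 ∷ merging 28514 0 275 2902 2089 0 0 ∷ merging 28875 0 270 2902 2072 0 0 ∷
      merging 29241 0 264 2902 2054 0 0 ∷ merging 29611 0 259 2901 2035 0 0 ∷ merging 29986 0 253 2901 2017 0 0 ∷ merging 30365 0 247 2901 1999 0 0 ∷
      merging 30750 0 240 2901 1981 0 0 ∷ merging 31139 0 233 2901 1963 0 0 ∷ merging 31533 0 226 2901 1944 0 0 ∷ merging 31932 0 219 2901 1926 0 0 ∷
      merging 32337 0 211 2901 1908 0 0 ∷ merging 32746 0 202 2901 1889 0 0 ∷ merging 33160 0 194 2901 1871 0 0 ∷ merging 33580 0 185 2901 1852 0 0 ∷
      merging 34005 0 175 2901 1833 0 0 ∷ merging 34436 0 165 2901 1814 0 0 ∷ merging 34872 0 154 2901 1795 0 0 ∷ merging 35313 0 143 2901 1776 0 0 ∷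
      merging 35760 0 132 2901 1757 0 0 ∷ merging 36213 0 119 2901 1738 0 0 ∷ merging 36671 0 107 2901 1719 0 0 ∷ merging 37135 0 93 2901 1699 0 0 ∷
      merging 37605 0 79 2901 1680 0 0 ∷ merging 38081 0 65 2901 1660 0 0 ∷ merging 38563 0 49 2901 1641 0 0 ∷ merging 39051 0 34 2901 1621 0 0 ∷
      merging 39546 0 17 2901 1601 0 0 ∷ merging 40046 0 0 2901 1581 0 0 ∷ growing 1 375 1561 ∷ growing 8293 1000 1561 ∷ growing 32444 1001 1559 ∷
      growing 32772 1006 1551 ∷ growing 33103 1011 1544 ∷ growing 33438 1016 1536 ∷ growing 33775 1021 1528 ∷ growing 34116 1026 1520 ∷
      growing 34461 1031 1513 ∷ growing 34809 1037 1505 ∷ growing 35161 1042 1498 ∷ growing 35516 1047 1490 ∷ growing 35875 1052 1483 ∷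
      growing 36237 1058 1475 ∷ growing 36603 1063 1468 ∷ growing 36973 1068 1460 ∷ growing 37346 1074 1453 ∷ growing 37723 1079 1446 ∷
      growing 38105 1085 1439 ∷ growing 38489 1090 1431 ∷ growing 38878 1096 1424 ∷ growing 39271 1101 1417 ∷ growing 39668 1107 1410 ∷
      growing 40068 1112 1403 ∷ growing 40473 1118 1396 ∷ growing 40882 1124 1389 ∷ growing 41295 1129 1382 ∷ growing 41712 1135 1376 ∷
      growing 42133 1141 1369 ∷ growing 42559 1147 1362 ∷ growing 42989 1153 1355 ∷ growing 43423 1159 1349 ∷ growing 43862 1165 1342 ∷
      growing 44305 1171 1336 ∷ growing 44752 1177 1329 ∷ growing 45204 1183 1323 ∷ growing 45661 1189 1316 ∷ growing 46122 1195 1310 ∷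
      growing 46588 1201 1303 ∷ growing 47058 1208 1297 ∷ growing 47534 1214 1291 ∷ growing 48014 1220 1285 ∷ growing 48499 1227 1279 ∷
      growing 48989 1233 1272 ∷ growing 49484 1240 1266 ∷ growing 49983 1246 1260 ∷ growing 50488 1253 1254 ∷ growing 50998 1260 1249 ∷
      growing 51513 1267 1243 ∷ growing 52034 1273 1237 ∷ growing 52559 1280 1231 ∷ growing 53090 1287 1225 ∷ growing 53627 1294 1220 ∷
      growing 54168 1301 1214 ∷ growing 54715 1308 1209 ∷ growing 55268 1316 1203 ∷ growing 55826 1323 1198 ∷ growing 56390 1330 1192 ∷
      growing 56960 1338 1187 ∷ growing 57535 1345 1182 ∷ growing 58116 1353 1176 ∷ growing 58703 1360 1171 ∷ growing 59296 1368 1166 ∷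
      growing 59895 1376 1161 ∷ growing 60500 1384 1156 ∷ growing 61111 1392 1151 ∷ growing 61729 1400 1146 ∷ growing 62352 1408 1141 ∷
      growing 62982 1416 1137 ∷ growing 63618 1425 1132 ∷ growing 64261 1433 1127 ∷ growing 64910 1442 1123 ∷ growing 65566 1450 1118 ∷
      growing 66228 1459 1114 ∷ growing 66897 1468 1109 ∷ growing 67573 1477 1105 ∷ growing 68255 1486 1100 ∷ growing 68945 1495 1096 ∷
      growing 69641 1505 1092 ∷ growing 70344 1514 1088 ∷ growing 71055 1524 1084 ∷ growing 71773 1534 1080 ∷ growing 72498 1544 1076 ∷
      growing 73230 1554 1072 ∷ growing 73970 1564 1069 ∷ growing 74717 1574 1065 ∷ growing 75472 1585 1061 ∷ growing 76234 1595 1058 ∷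
      growing 77004 1606 1054 ∷ growing 77782 1617 1051 ∷ growing 78567 1629 1048 ∷ growing 79361 1640 1045 ∷ growing 80163 1652 1041 ∷
      growing 80972 1664 1038 ∷ growing 81790 1676 1036 ∷ growing 82616 1688 1033 ∷ growing 83451 1700 1030 ∷ growing 84294 1713 1027 ∷
      growing 85145 1726 1025 ∷ growing 86005 1740 1022 ∷ growing 86874 1753 1020 ∷ growing 87752 1767 1018 ∷ growing 88638 1781 1016 ∷
      growing 89533 1796 1014 ∷ growing 90438 1810 1012 ∷ growing 91351 1825 1010 ∷ growing 92274 1841 1008 ∷ growing 93206 1857 1007 ∷
      growing 94148 1873 1006 ∷ growing 95099 1890 1004 ∷ growing 96059 1907 1003 ∷ growing 97029 1924 1002 ∷ growing 98010 1942 1002 ∷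
      growing 99000 1961 1001 ∷ growing 100000 1980 1001 ∷ []

  rows-ok : Check.AllOk (+ 2 * + 500) 10000000 20000 780000 (c₁ bottom) 500000 100000 10000 bottom row₀ rows
  rows-ok = toWitness {a? = Check.allOk? (+ 2 * + 500) 10000000 20000 780000 (c₁ bottom) 500000 100000 10000 bottom row₀ rows} _

  row₀-merging : IsMerging row₀
  row₀-merging = tt

  c-top : c₁ (top bottom row₀ rows) ≡ 10000000
  c-top = refl

  -- S U + 1: the extra unit, worth H, covers the error from n not being a multiple of U.
  G-top : G₁ (top bottom row₀ rows) ≡ + 10000000001
  G-top = refl

  -- 18170100000 is 1.81701 S U. The spare 1000000 pays for the tube around the time bound and for
  -- rounding.
  A-top : A₁ (top bottom row₀ rows) + + 1000000 ≤ + 18170100000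
  A-top = toWitness {a? = _ ℤ.≤? _} _

-- Drift estimates on one piece of the table.

by : ∀ {X e} → 0ℤ ≤ e → X ≡ e → 0ℤ ≤ X
by p q = subst (0ℤ ≤_) (sym q) p

-- For identities that hold only modulo an equation A = B; k is the cofactor of A - B.
byEq : ∀ {X e A B} k → 0ℤ ≤ e → A ≡ B → X ≡ e + k * (A - B) → 0ℤ ≤ X
byEq {X} {e} {A} k p refl q = subst (0ℤ ≤_) (sym (trans q (trans (cong (λ w → e + k * w) (ℤₚ.+-inverseʳ A))
  (trans (cong (λ w → e + w) (ℤₚ.*-zeroʳ k)) (ℤₚ.+-identityʳ e))))) p

neg≤ : ∀ {X} → 0ℤ ≤ - X → X ≤ 0ℤ
neg≤ {X} h = subst₂ _≤_ (ℤₚ.neg-involutive X) refl (ℤₚ.neg-mono-≤ h)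

-- At or above the bound G there are many single vertices, and a pair move uses up two of them for
-- one component, which outruns the slope κ. Moving right in the piece only adds a nonnegative
-- multiple of z, so the condition at the left end suffices. The factor S avoids dividing G by S.
growth-cert : ∀ {S κ G₁ c₁ z H i s p q} → 0ℤ ≤ S → 0ℤ ≤ κ - S → 0ℤ ≤ + 2 * S - κ →
  0ℤ ≤ κ * G₁ - + 2 * (κ - S) * S * c₁ - S * S → 0ℤ ≤ z → 0ℤ ≤ H - + 1 → 0ℤ ≤ κ →
  0ℤ ≤ S * (+ 1 + i) - (G₁ * H + κ * z) → + 1 + (i + s) ≡ c₁ * H + z → 0ℤ ≤ p - i → 0ℤ ≤ s - q →
  0ℤ ≤ S * (- ((κ - + 2 * S) * p + (κ - S) * (+ 2 * q)))
growth-cert {S} {κ} {G₁} {c₁} {z} {H} {i} {s} {p} {q} S≥ e≥ a≥ t≥ z≥ H≥ κ≥ f≥ eq pi sq =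
  byEq (- (+ 2 * (κ - S) * S))
    (S≥ ⊗ (a≥ ⊗ pi ⊕ nat 2 ⊗ e≥ ⊗ sq) ⊕ κ≥ ⊗ f≥ ⊕ t≥ ⊗ (H≥ ⊕ nat 1) ⊕ S≥ ⊗ S≥ ⊗ H≥ ⊕ S≥ ⊗ e≥ ⊕ (e≥ ⊗ e≥ ⊕ S≥ ⊗ S≥) ⊗ z≥)
    eq (eqn S κ G₁ c₁ z H i s p q)
  where
  eqn : ∀ S κ G₁ c₁ z H i s p q → S * (- ((κ - + 2 * S) * p + (κ - S) * (+ 2 * q))) ≡
    S * ((+ 2 * S - κ) * (p - i) + + 2 * (κ - S) * (s - q)) + κ * (S * (+ 1 + i) - (G₁ * H + κ * z)) +
    (κ * G₁ - + 2 * (κ - S) * S * c₁ - S * S) * ((H - + 1) + + 1) + S * S * (H - + 1) + S * (κ - S) + ((κ - S) * (κ - S) + S * S) * z +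
    (- (+ 2 * (κ - S) * S)) * (+ 1 + (i + s) - (c₁ * H + z))
  eqn = ℤS.solve-∀

growthTime-cert : ∀ {S κ G₁ c₁ z H i s p q α β U n} → 0ℤ ≤ S → 0ℤ ≤ α → 0ℤ ≤ p - i → 0ℤ ≤ + 2 * q + H - + 2 * s →
  0ℤ ≤ G₁ * H + κ * z + β * H - S * (+ 1 + i) → + 1 + (i + s) ≡ c₁ * H + z →
  0ℤ ≤ α * (+ 2 * S * c₁ - G₁ - β - + 2 * S) - S * S * U → 0ℤ ≤ + 2 * S - κ → 0ℤ ≤ z → 0ℤ ≤ H - + 1 → 0ℤ ≤ U * H - n →
  0ℤ ≤ S * (- (n * S + ((- α) * p + (- α) * (+ 2 * q))))
growthTime-cert {S} {κ} {G₁} {c₁} {z} {H} {i} {s} {p} {q} {α} {β} {U} {n} S≥ α≥ pi hq tube eq t≥ a≥ z≥ H≥ un =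
  byEq (+ 2 * α * S) (α≥ ⊗ S≥ ⊗ pi ⊕ α≥ ⊗ S≥ ⊗ hq ⊕ α≥ ⊗ tube ⊕ α≥ ⊗ a≥ ⊗ z≥ ⊕ α≥ ⊗ S≥ ⊗ H≥ ⊕ t≥ ⊗ (H≥ ⊕ nat 1) ⊕ S≥ ⊗ S≥ ⊗ un)
    eq (eqn S κ G₁ c₁ z H i s p q α β U n)
  where
  eqn : ∀ S κ G₁ c₁ z H i s p q α β U n → S * (- (n * S + ((- α) * p + (- α) * (+ 2 * q)))) ≡
    α * S * (p - i) + α * S * (+ 2 * q + H - + 2 * s) + α * (G₁ * H + κ * z + β * H - S * (+ 1 + i)) + α * (+ 2 * S - κ) * z +
    α * S * (H - + 1) + (α * (+ 2 * S * c₁ - G₁ - β - + 2 * S) - S * S * U) * ((H - + 1) + + 1) + S * S * (U * H - n) +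
    (+ 2 * α * S) * (+ 1 + (i + s) - (c₁ * H + z))
  eqn = ℤS.solve-∀

drift-≡ : ∀ d l h ml mh N a ω β γ → drift d l h ml mh N a ω β γ ≡
  + 2 * a * ((+ l + + h) + (+ d * + l + (+ 1 + + d) * + h)) + + 2 * ω * ((+ 1 + + d) * (+ ml + + mh) + + mh) +
  + 2 * β * ((+ d * + l + (+ 1 + + d) * + h) + (+ d * + d * + l + (+ 1 + + d) * (+ 1 + + d) * + h)) + γ * + N
drift-≡ d l h ml mh N a ω β γ = eqn (+ d) (+ l) (+ h) (+ ml) (+ mh) (+ N) a ω β γ
  where
  eqn : ∀ d l h ml mh N a ω β γ →
    (+ 2 * (+ 1 + d)) * ((a + β * d) * l + ω * ml) + (+ 2 * (+ 1 + (+ 1 + d))) * ((a + β * (+ 1 + d)) * h + ω * mh) + γ * N ≡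
    + 2 * a * ((l + h) + (d * l + (+ 1 + d) * h)) + + 2 * ω * ((+ 1 + d) * (ml + mh) + mh) +
    + 2 * β * ((d * l + (+ 1 + d) * h) + (d * d * l + (+ 1 + d) * (+ 1 + d) * h)) + γ * N
  eqn = ℤS.solve-∀

time-cert : ∀ {S α c₁ H lo U n c r} → 0ℤ ≤ S → 0ℤ ≤ α → 0ℤ ≤ c - c₁ * H → 0ℤ ≤ S * r - lo * H → 0ℤ ≤ H →
  0ℤ ≤ + 2 * α * (S * c₁ + lo) - S * S * U → 0ℤ ≤ U * H - n → 0ℤ ≤ S * (- (n * S + + 2 * (- α) * (c + r)))
time-cert {S} {α} {c₁} {H} {lo} {U} {n} {c} {r} S≥ α≥ cc rr H≥ t≥ un =
  by (nat 2 ⊗ α≥ ⊗ S≥ ⊗ cc ⊕ nat 2 ⊗ α≥ ⊗ rr ⊕ t≥ ⊗ H≥ ⊕ S≥ ⊗ S≥ ⊗ un) (eqn S α c₁ H lo U n c r)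
  where
  eqn : ∀ S α c₁ H lo U n c r → S * (- (n * S + + 2 * (- α) * (c + r))) ≡
    + 2 * α * S * (c - c₁ * H) + + 2 * α * (S * r - lo * H) + (+ 2 * α * (S * c₁ + lo) - S * S * U) * H + S * S * (U * H - n)
  eqn = ℤS.solve-∀

-- (1 + d) ν H ≥ (μ − 2S) h is what remains once both sides are linearised along the row.
mass-cert : ∀ {S μ M₁ c₁ H z d l h m mh} → 0ℤ ≤ S → 0ℤ ≤ d → 0ℤ ≤ S * m - (M₁ * H + μ * z) → l + h ≡ c₁ * H + z →
  0ℤ ≤ (+ 1 + d) * (M₁ - μ * c₁) * H - (μ - + 2 * S) * h → 0ℤ ≤ mh - + 2 * h →
  0ℤ ≤ - (+ 2 * μ * ((l + h) + (d * l + (+ 1 + d) * h)) + + 2 * (- S) * ((+ 1 + d) * m + mh))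
mass-cert {S} {μ} {M₁} {c₁} {H} {z} {d} {l} {h} {m} {mh} S≥ d≥ face eq key mh≥ =
  byEq (- (+ 2 * (+ 1 + d) * μ)) (nat 2 ⊗ (nat 1 ⊕ d≥) ⊗ face ⊕ nat 2 ⊗ S≥ ⊗ mh≥ ⊕ nat 2 ⊗ key) eq (eqn S μ M₁ c₁ H z d l h m mh)
  where
  eqn : ∀ S μ M₁ c₁ H z d l h m mh → - (+ 2 * μ * ((l + h) + (d * l + (+ 1 + d) * h)) + + 2 * (- S) * ((+ 1 + d) * m + mh)) ≡
    + 2 * (+ 1 + d) * (S * m - (M₁ * H + μ * z)) + + 2 * S * (mh - + 2 * h) + + 2 * ((+ 1 + d) * (M₁ - μ * c₁) * H - (μ - + 2 * S) * h) +
    (- (+ 2 * (+ 1 + d) * μ)) * (l + h - (c₁ * H + z))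
  eqn = ℤS.solve-∀

-- Q ↦ (2d + 1) X − d (d + 1) Y is maximal at d = ⌊X / Y⌋.
convex-cert : ∀ d d⋆ {X Y} → 0ℤ ≤ Y → 0ℤ ≤ X - + d⋆ * Y → 0ℤ ≤ + suc d⋆ * Y - X →
  0ℤ ≤ ((+ 2 * + d⋆ + + 1) * X - + d⋆ * (+ 1 + + d⋆) * Y) - ((+ 2 * + d + + 1) * X - + d * (+ 1 + + d) * Y)
convex-cert d d⋆ {X} {Y} Y≥ lo hi with ℕₚ.≤-total d d⋆
... | inj₁ le with ℕₚ.m≤n⇒∃[o]m+o≡n le
...   | zero , refl = by (nat 0) (trans (cong (λ w → ((+ 2 * + w + + 1) * X - + w * (+ 1 + + w) * Y) - ((+ 2 * + d + + 1) * X - + d * (+ 1 + + d) * Y)) (ℕₚ.+-identityʳ d)) (ℤₚ.+-inverseʳ ((+ 2 * + d + + 1) * X - + d * (+ 1 + + d) * Y)))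
...   | suc j , refl = by (nat (suc j) ⊗ (nat 2 ⊗ lo ⊕ nat j ⊗ Y≥)) (eqn (+ d) (+ j) X Y)
    where
    eqn : ∀ d j X Y → ((+ 2 * (d + (+ 1 + j)) + + 1) * X - (d + (+ 1 + j)) * (+ 1 + (d + (+ 1 + j))) * Y) - ((+ 2 * d + + 1) * X - d * (+ 1 + d) * Y) ≡
          (+ 1 + j) * (+ 2 * (X - (d + (+ 1 + j)) * Y) + j * Y)
    eqn = ℤS.solve-∀
convex-cert d d⋆ {X} {Y} Y≥ lo hi | inj₂ ge with ℕₚ.m≤n⇒∃[o]m+o≡n ge
...   | zero , refl = by (nat 0) (trans (cong (λ w → ((+ 2 * + d⋆ + + 1) * X - + d⋆ * (+ 1 + + d⋆) * Y) - ((+ 2 * + w + + 1) * X - + w * (+ 1 + + w) * Y)) (ℕₚ.+-identityʳ d⋆)) (ℤₚ.+-inverseʳ ((+ 2 * + d⋆ + + 1) * X - + d⋆ * (+ 1 + + d⋆) * Y)))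
...   | suc j , refl = by (nat (suc j) ⊗ (nat 2 ⊗ hi ⊕ nat j ⊗ Y≥)) (eqn (+ d⋆) (+ j) X Y)
    where
    eqn : ∀ d j X Y → ((+ 2 * d + + 1) * X - d * (+ 1 + d) * Y) - ((+ 2 * (d + (+ 1 + j)) + + 1) * X - (d + (+ 1 + j)) * (+ 1 + (d + (+ 1 + j))) * Y) ≡
          (+ 1 + j) * (+ 2 * ((+ 1 + d) * Y - X) + j * Y)
    eqn = ℤS.solve-∀

Q-cert : ∀ {S X H c₁ d l h Q⋆} → 0ℤ ≤ S → 0ℤ ≤ d → 0ℤ ≤ H → 0ℤ ≤ X * H - S * (d * l + (+ 1 + d) * h) → 0ℤ ≤ (l + h) - c₁ * H →
  0ℤ ≤ Q⋆ - ((+ 2 * d + + 1) * X - d * (+ 1 + d) * (S * c₁)) → 0ℤ ≤ Q⋆ * H - S * (d * d * l + (+ 1 + d) * (+ 1 + d) * h)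
Q-cert {S} {X} {H} {c₁} {d} {l} {h} {Q⋆} S≥ d≥ H≥ hx cc conv =
  by ((nat 2 ⊗ d≥ ⊕ nat 1) ⊗ hx ⊕ d≥ ⊗ (nat 1 ⊕ d≥) ⊗ S≥ ⊗ cc ⊕ conv ⊗ H≥) (eqn S X H c₁ d l h Q⋆)
  where
  eqn : ∀ S X H c₁ d l h Q⋆ → Q⋆ * H - S * (d * d * l + (+ 1 + d) * (+ 1 + d) * h) ≡
    (+ 2 * d + + 1) * (X * H - S * (d * l + (+ 1 + d) * h)) + d * (+ 1 + d) * S * ((l + h) - c₁ * H) + (Q⋆ - ((+ 2 * d + + 1) * X - d * (+ 1 + d) * (S * c₁))) * H
  eqn = ℤS.solve-∀

reds-cert : ∀ {S ρ⁺ ρ⁻ c₁ c₀ Rm X β Q⋆ M₀ U H n N m c r Q} → 0ℤ ≤ S → 0ℤ ≤ ρ⁺ → 0ℤ ≤ ρ⁻ → 0ℤ ≤ H →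
  0ℤ ≤ c - c₁ * H → 0ℤ ≤ c₀ * H - c → 0ℤ ≤ S * r - (Rm - β) * H → 0ℤ ≤ X * H - S * r → 0ℤ ≤ Q⋆ * H - S * Q →
  0ℤ ≤ N + + 5 * r + + 2 + m - n → 0ℤ ≤ (M₀ + β) * H - S * m → 0ℤ ≤ n - (U - + 1) * H → 0ℤ ≤ H - + 2 * S →
  0ℤ ≤ + 2 * ρ⁺ * (S * c₁ + Rm - β) - + 2 * ρ⁻ * (S * c₀ + X) - + 2 * S * X - + 2 * S * Q⋆ + S * (S * (U - + 1) - + 5 * X - M₀ - β - + 1) →
  0ℤ ≤ S * (- (+ 2 * (- (ρ⁺ - ρ⁻)) * (c + r) + + 2 * S * (r + Q) + (- S) * N))
reds-cert {S} {ρ⁺} {ρ⁻} {c₁} {c₀} {Rm} {X} {β} {Q⋆} {M₀} {U} {H} {n} {N} {m} {c} {r} {Q} S≥ p≥ q≥ H≥ lo hi rl rx qq nn mm un hs slack =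
  by (nat 2 ⊗ p≥ ⊗ (S≥ ⊗ lo ⊕ rl) ⊕ nat 2 ⊗ q≥ ⊗ (S≥ ⊗ hi ⊕ rx) ⊕ nat 2 ⊗ S≥ ⊗ rx ⊕ nat 2 ⊗ S≥ ⊗ qq ⊕
      S≥ ⊗ (S≥ ⊗ nn ⊕ nat 5 ⊗ rx ⊕ mm ⊕ S≥ ⊗ un ⊕ hs) ⊕ slack ⊗ H≥) (eqn S ρ⁺ ρ⁻ c₁ c₀ Rm X β Q⋆ M₀ U H n N m c r Q)
  where
  eqn : ∀ S ρ⁺ ρ⁻ c₁ c₀ Rm X β Q⋆ M₀ U H n N m c r Q → S * (- (+ 2 * (- (ρ⁺ - ρ⁻)) * (c + r) + + 2 * S * (r + Q) + (- S) * N)) ≡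
    + 2 * ρ⁺ * (S * (c - c₁ * H) + (S * r - (Rm - β) * H)) + + 2 * ρ⁻ * (S * (c₀ * H - c) + (X * H - S * r)) + + 2 * S * (X * H - S * r) +
    + 2 * S * (Q⋆ * H - S * Q) + S * (S * (N + + 5 * r + + 2 + m - n) + + 5 * (X * H - S * r) + ((M₀ + β) * H - S * m) + S * (n - (U - + 1) * H) + (H - + 2 * S)) +
    (+ 2 * ρ⁺ * (S * c₁ + Rm - β) - + 2 * ρ⁻ * (S * c₀ + X) - + 2 * S * X - + 2 * S * Q⋆ + S * (S * (U - + 1) - + 5 * X - M₀ - β - + 1)) * H
  eqn = ℤS.solve-∀

-- If d (d + 1) c ≥ n then r² + r c ≥ n c, which the bound on r excludes: the scaled difference is at most − H².
degree-cert : ∀ {S X H U n c₁ d l h} → 0ℤ ≤ S → 0ℤ ≤ d → 0ℤ ≤ l → 0ℤ ≤ h → 0ℤ ≤ H → 0ℤ ≤ X → 0ℤ ≤ X * H - S * (d * l + (+ 1 + d) * h) →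
  0ℤ ≤ (l + h) - c₁ * H → 0ℤ ≤ n - (U - + 1) * H → 0ℤ ≤ S * S * (U - + 1) - X * S →
  0ℤ ≤ c₁ * (S * S * (U - + 1) - X * S) - X * X - + 1 → 0ℤ ≤ d * (+ 1 + d) * (l + h) - n → 0ℤ ≤ - (H * H)
degree-cert {S} {X} {H} {U} {n} {c₁} {d} {l} {h} S≥ d≥ l≥ h≥ H≥ X≥ rx cc un k≥ key dn =
  by (rx ⊗ (X≥ ⊗ H≥ ⊕ S≥ ⊗ (d≥ ⊗ l≥ ⊕ (nat 1 ⊕ d≥) ⊗ h≥) ⊕ S≥ ⊗ (l≥ ⊕ h≥)) ⊕
      S≥ ⊗ S≥ ⊗ (nat 2 ⊗ d≥ ⊗ (l≥ ⊕ h≥) ⊗ h≥ ⊕ h≥ ⊗ h≥ ⊕ h≥ ⊗ (l≥ ⊕ h≥)) ⊕ S≥ ⊗ S≥ ⊗ (l≥ ⊕ h≥) ⊗ dn ⊕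
      S≥ ⊗ S≥ ⊗ (l≥ ⊕ h≥) ⊗ un ⊕ cc ⊗ H≥ ⊗ k≥ ⊕ H≥ ⊗ H≥ ⊗ key) (eqn S X H U n c₁ d l h)
  where
  eqn : ∀ S X H U n c₁ d l h → - (H * H) ≡
    (X * H - S * (d * l + (+ 1 + d) * h)) * (X * H + S * (d * l + (+ 1 + d) * h) + S * (l + h)) +
    S * S * (+ 2 * d * (l + h) * h + h * h + h * (l + h)) + S * S * (l + h) * (d * (+ 1 + d) * (l + h) - n) +
    S * S * (l + h) * (n - (U - + 1) * H) + ((l + h) - c₁ * H) * H * (S * S * (U - + 1) - X * S) +
    H * H * (c₁ * (S * S * (U - + 1) - X * S) - X * X - + 1)
  eqn = ℤS.solve-∀

drift-a : ∀ d l h ml mh N a → drift d l h ml mh N a 0ℤ 0ℤ 0ℤ ≡ + 2 * a * ((+ l + + h) + (+ d * + l + (+ 1 + + d) * + h))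
drift-a d l h ml mh N a = trans (drift-≡ d l h ml mh N a 0ℤ 0ℤ 0ℤ) (eqn (+ 2 * a * ((+ l + + h) + (+ d * + l + (+ 1 + + d) * + h))) ((+ 1 + + d) * (+ ml + + mh) + + mh) ((+ d * + l + (+ 1 + + d) * + h) + (+ d * + d * + l + (+ 1 + + d) * (+ 1 + + d) * + h)) (+ N))
  where
  eqn : ∀ x y z w → x + + 2 * 0ℤ * y + + 2 * 0ℤ * z + 0ℤ * w ≡ x
  eqn = ℤS.solve-∀

drift-m : ∀ d l h ml mh N a ω → drift d l h ml mh N a ω 0ℤ 0ℤ ≡
  + 2 * a * ((+ l + + h) + (+ d * + l + (+ 1 + + d) * + h)) + + 2 * ω * ((+ 1 + + d) * (+ ml + + mh) + + mh)
drift-m d l h ml mh N a ω = trans (drift-≡ d l h ml mh N a ω 0ℤ 0ℤ) (eqn (+ 2 * a * ((+ l + + h) + (+ d * + l + (+ 1 + + d) * + h)) + + 2 * ω * ((+ 1 + + d) * (+ ml + + mh) + + mh)) ((+ d * + l + (+ 1 + + d) * + h) + (+ d * + d * + l + (+ 1 + + d) * (+ 1 + + d) * + h)) (+ N))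
  where
  eqn : ∀ x z w → x + + 2 * 0ℤ * z + 0ℤ * w ≡ x
  eqn = ℤS.solve-∀

drift-r : ∀ d l h ml mh N a β γ → drift d l h ml mh N a 0ℤ β γ ≡
  + 2 * a * ((+ l + + h) + (+ d * + l + (+ 1 + + d) * + h)) +
  + 2 * β * ((+ d * + l + (+ 1 + + d) * + h) + (+ d * + d * + l + (+ 1 + + d) * (+ 1 + + d) * + h)) + γ * + N
drift-r d l h ml mh N a β γ = trans (drift-≡ d l h ml mh N a 0ℤ β γ) (eqn (+ 2 * a * ((+ l + + h) + (+ d * + l + (+ 1 + + d) * + h))) ((+ 1 + + d) * (+ ml + + mh) + + mh) (+ 2 * β * ((+ d * + l + (+ 1 + + d) * + h) + (+ d * + d * + l + (+ 1 + + d) * (+ 1 + + d) * + h))) (γ * + N))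
  where
  eqn : ∀ x y z w → x + + 2 * 0ℤ * y + z + w ≡ x + z + w
  eqn = ℤS.solve-∀

¬nonpos : ∀ {l} → 1 ℕ.≤ l → ¬ (0ℤ ≤ - + l)
¬nonpos {suc _} _ ()

-- The profile defined by a table.

incrementR : (S′ U αm ρm k : ℕ) → ℕ
incrementR S′ U αm ρm k = 2 ℕ.* S′ ℕ.+ (αm ℕ.+ S′ ℕ.* (3 ℕ.* k ℕ.+ 5) ℕ.+ S′ ℕ.* (2 ℕ.* U) ℕ.+ 2 ℕ.* S′ ℕ.* k) ℕ.+ (ρm ℕ.+ ρm)

incrementM incrementκ : (S′ U μm : ℕ) → ℕ
incrementM S′ U μm = μm ℕ.+ 2 ℕ.* S′ ℕ.* (2 ℕ.* U)
incrementκ S′ _ _  = 2 ℕ.* (2 ℕ.* S′) ℕ.+ 2 ℕ.* (2 ℕ.* S′)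

-- Opaque: its values at numerals are far too large to be unfolded.
abstract

  incrementBound : (S′ U αm ρm μm k : ℕ) → ℕ
  incrementBound S′ U αm ρm μm k = incrementR S′ U αm ρm k ℕ.+ incrementM S′ U μm ℕ.+ incrementκ S′ U μm

  incrementBound-R : ∀ S′ U αm ρm μm k → incrementR S′ U αm ρm k ℕ.≤ incrementBound S′ U αm ρm μm k
  incrementBound-R S′ U αm ρm μm k = ℕₚ.≤-trans (ℕₚ.m≤m+n (incrementR S′ U αm ρm k) (incrementM S′ U μm)) (ℕₚ.m≤m+n _ _)

  incrementBound-M : ∀ S′ U αm ρm μm k → incrementM S′ U μm ℕ.≤ incrementBound S′ U αm ρm μm k
  incrementBound-M S′ U αm ρm μm k = ℕₚ.≤-trans (ℕₚ.m≤n+m (incrementM S′ U μm) (incrementR S′ U αm ρm k)) (ℕₚ.m≤m+n _ _)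

  incrementBound-κ : ∀ S′ U αm ρm μm k → incrementκ S′ U μm ℕ.≤ incrementBound S′ U αm ρm μm k
  incrementBound-κ S′ U αm ρm μm k = ℕₚ.m≤n+m (incrementκ S′ U μm) (incrementR S′ U αm ρm k ℕ.+ incrementM S′ U μm)

-- n lies between (U - 1) H and U H, so a table in units of H can be used for every large n. k
-- bounds the degrees above `ce`, and K₀ is the time reserved for closing, scaled by S.
record Setting : Set where
  field
    S′ U β Rc αm ρm μm : ℕ
    p₀ : Pre
    r₀ : Row
    rs : List Row
    n H K K₀ k q₀ ce : ℕ
    S≥1 : 1 ℕ.≤ S′
    U≥1 : 1 ℕ.≤ U
    n≥1 : 1 ℕ.≤ n
    H≥1 : 1 ℕ.≤ H
    ok : Check.AllOk (+ 2 * + S′) U β Rc (c₁ p₀) αm ρm μm p₀ r₀ rs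
    first : IsMerging r₀
    topU : c₁ (top p₀ r₀ rs) ≡ U
    A₀≥ : 0ℤ ≤ A₁ p₀
    n≤ : n ℕ.≤ U ℕ.* H
    n≥ : 0ℤ ≤ + n - (+ U - + 1) * + H
    H≥ : 0ℤ ≤ + H - + 2 * (+ 2 * + S′)
    -- q₀ H is at least the root of n c at c = `cs`; with `q-small` this keeps D c · c below the
    -- block cap throughout the late phase.
    q-big : U ℕ.* c₁ p₀ ℕ.≤ q₀ ℕ.* q₀
    q-small : q₀ ℕ.+ c₁ p₀ ℕ.< Rc
    k≥1 : 1 ℕ.≤ k
    ce≤ : ce ℕ.≤ c₁ p₀ ℕ.* H
    ce≥ : n ℕ.≤ k ℕ.* suc k ℕ.* suc ce
    shut : 2 ℕ.* S′ ℕ.* n ℕ.≤ K₀ ℕ.* K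
    n≥K : 10 ℕ.* K ℕ.+ 4 ℕ.≤ n
    -- The two time bounds meet at `cs`: twice the late one, with the segment vertices bounded by M
    -- plus the tube, against twice the one of the table. One slope μm is added because M is read
    -- one component above `cs`.
    base : + 2 * (+ K₀ + (+ 2 * + S′) * + (2 ℕ.* K) + + S′ * (+ 3 * + Degree.sumD n (c₁ p₀ ℕ.* H) + + 5 * + (c₁ p₀ ℕ.* H)))
           + (M₁ p₀ + + μm + + β) * + H ≤ + 2 * A₁ p₀ * + H

module Build (setting : Setting) where

  open Setting setting

  open Check (+ 2 * + S′) U β Rc (c₁ p₀) αm ρm μm
  open Interpolation H
  open Degree n

  S : ℤ
  S = + 2 * + S′

  cs b L : ℕ
  cs = c₁ p₀ ℕ.* H
  b  = β ℕ.* H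
  L  = 2 ℕ.* U

  S≡ : + (2 ℕ.* S′) ≡ S
  S≡ = ℤₚ.pos-* 2 S′

  S≥0 : 0ℤ ≤ S
  S≥0 = subst (0ℤ ≤_) S≡ (nat (2 ℕ.* S′))

  cancelS : ∀ {x} → 0ℤ ≤ S * x → 0ℤ ≤ x
  cancelS {x} h = cancelPos (2 ℕ.* S′) (ℕₚ.≤-trans S≥1 (ℕₚ.m≤m+n S′ (S′ ℕ.+ 0))) (subst (λ s → 0ℤ ≤ s * x) (sym S≡) h)

  bℤ : + b ≡ + β * + H
  bℤ = ℤₚ.pos-* β H

  UH≥n : 0ℤ ≤ + U * + H - + n
  UH≥n = subst (λ w → 0ℤ ≤ w - + n) (ℤₚ.pos-* U H) (gapℕ n≤)

  at : ℕ → Pre × Row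
  at = loc p₀ r₀ rs

  G R M : ℕ → ℤ
  G = F G₁ slopeG p₀ r₀ rs
  R = F R₁ slopeR p₀ r₀ rs
  M = F M₁ slopeM p₀ r₀ rs

  -- A₃ is the time for closing plus the partial sums of `α₃`.
  A₃ A α : ℕ → ℤ
  A₃ x = + K₀ + S * + (2 ℕ.* K) + + S′ * (+ 3 * + sumD x + + 5 * + x)
  A x  = pick (x ℕ.≤? cs) (A₃ x) (F A₁ slopeA p₀ r₀ rs x)
  α x  = pick (x ℕ.≤? cs) (α₃ S′ x) (slopeA (proj₂ (at x)))

  pick-yes : ∀ {X P : Set} (q : Dec P) {a b : X} → P → pick q a b ≡ a
  pick-yes (yes _) p = refl
  pick-yes (no ¬p) p = ⊥-elim (¬p p)

  pick-no : ∀ {X P : Set} (q : Dec P) {a b : X} → ¬ P → pick q a b ≡ b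
  pick-no (yes p) ¬p = ⊥-elim (¬p p)
  pick-no (no _)  ¬p = refl

  A-low : ∀ {x} → x ℕ.≤ cs → A x ≡ A₃ x
  A-low {x} le = pick-yes (x ℕ.≤? cs) le

  α-low : ∀ {x} → x ℕ.≤ cs → α x ≡ α₃ S′ x
  α-low {x} le = pick-yes (x ℕ.≤? cs) le

  A-high : ∀ {x} → cs ℕ.< x → A x ≡ F A₁ slopeA p₀ r₀ rs x
  A-high {x} lt = pick-no (x ℕ.≤? cs) (ℕₚ.<⇒≱ lt)

  α-high : ∀ {x} → cs ℕ.< x → α x ≡ slopeA (proj₂ (at x))
  α-high {x} lt = pick-no (x ℕ.≤? cs) (ℕₚ.<⇒≱ lt)

  data View (x : ℕ) : Set where
    in-growing : ∀ p w κ α → at x ≡ (p , growing w κ α) → Growing p w κ α →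
                 0ℤ ≤ + x - + c₁ p * + H - + 1 → View x
    in-merging : ∀ p w ρ⁺ ρ⁻ μ α d₀ d⋆ → at x ≡ (p , merging w ρ⁺ ρ⁻ μ α d₀ d⋆) → Merging p w ρ⁺ ρ⁻ μ α d₀ d⋆ →
                 0ℤ ≤ + x - + c₁ p * + H - + 1 → 0ℤ ≤ + w * + H - (+ x - + c₁ p * + H) → View x

  view : ∀ x → cs ℕ.< x → x ℕ.≤ n → View x
  view x lo hi = go (at x) refl (loc-ok p₀ r₀ rs x ok)
      (located p₀ r₀ rs x lo (ℕₚ.≤-trans hi (ℕₚ.≤-trans n≤ (ℕₚ.≤-reflexive (cong (ℕ._* H) (sym topU))))))
    where
    low : ∀ p → c₁ p ℕ.* H ℕ.< x → 0ℤ ≤ + x - + c₁ p * + H - + 1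
    low p lt = by (gapℕ lt) (trans (cong (λ w → + x - w - + 1) (sym (ℤₚ.pos-* (c₁ p) H))) (eqn (+ x) (+ (c₁ p ℕ.* H))))
      where
      eqn : ∀ x c → x - c - + 1 ≡ x - (+ 1 + c)
      eqn = ℤS.solve-∀
    high : ∀ p w → x ℕ.≤ (c₁ p ℕ.+ w) ℕ.* H → 0ℤ ≤ + w * + H - (+ x - + c₁ p * + H)
    high p w le = by (gapℕ le) (trans (eqn (+ x) (+ c₁ p) (+ w) (+ H)) (cong (_- + x) (sym (ℤₚ.pos-* (c₁ p ℕ.+ w) H))))
      where
      eqn : ∀ x c w h → w * h - (x - c * h) ≡ (c + w) * h - x
      eqn = ℤS.solve-∀
    go : ∀ pr → at x ≡ pr → Ok (proj₁ (at x)) (proj₂ (at x)) → Located (at x) x → View x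
    go (p , growing w κ α) e o l = in-growing p w κ α e (subst (λ a → Ok (proj₁ a) (proj₂ a)) e o) (low p (proj₁ (subst (λ a → Located a x) e l)))
    go (p , merging w ρ⁺ ρ⁻ μ α d₀ d⋆) e o l = in-merging p w ρ⁺ ρ⁻ μ α d₀ d⋆ e (subst (λ a → Ok (proj₁ a) (proj₂ a)) e o)
      (low p (proj₁ (subst (λ a → Located a x) e l))) (high p w (proj₂ (subst (λ a → Located a x) e l)))

  κ ρ μ : ℕ → ℤ
  κ x = slopeG (proj₂ (at x))
  ρ x = slopeR (proj₂ (at x))
  μ x = slopeM (proj₂ (at x))

  dG : ∀ x → cs ℕ.≤ x → x ℕ.< n → G (suc x) ≡ G x + κ (suc x)
  dG x le _ = F-suc G₁ slopeG (λ _ _ → refl) p₀ r₀ rs x le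

  dR : ∀ x → cs ℕ.≤ x → x ℕ.< n → R (suc x) ≡ R x + ρ (suc x)
  dR x le _ = F-suc R₁ slopeR (λ _ _ → refl) p₀ r₀ rs x le

  dM : ∀ x → cs ℕ.≤ x → x ℕ.< n → M (suc x) ≡ M x + μ (suc x)
  dM x le _ = F-suc M₁ slopeM (λ _ _ → refl) p₀ r₀ rs x le

  FA : ℕ → ℤ
  FA = F A₁ slopeA p₀ r₀ rs

  dFA : ∀ x → cs ℕ.≤ x → FA (suc x) ≡ FA x + slopeA (proj₂ (at (suc x)))
  dFA x le = F-suc A₁ slopeA (λ _ _ → refl) p₀ r₀ rs x le

  slopeA≥0 : ∀ r → 0ℤ ≤ slopeA r
  slopeA≥0 (growing _ _ α)             = nat α
  slopeA≥0 (merging _ _ _ _ α _ _)     = nat α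

  FA≥0 : ∀ j → 0ℤ ≤ FA (cs ℕ.+ j)
  FA≥0 zero    = subst (λ w → 0ℤ ≤ FA w) (sym (ℕₚ.+-identityʳ cs)) (subst (0ℤ ≤_) (sym (F-base A₁ slopeA p₀ r₀ rs)) (A₀≥ ⊗ nat H))
  FA≥0 (suc j) = subst (λ w → 0ℤ ≤ FA w) (sym (ℕₚ.+-suc cs j)) (subst (0ℤ ≤_) (sym (dFA (cs ℕ.+ j) (ℕₚ.m≤m+n cs j)))
                   (FA≥0 j ⊕ slopeA≥0 (proj₂ (at (suc (cs ℕ.+ j))))))

  A₃≥0 : ∀ x → 0ℤ ≤ A₃ x
  A₃≥0 x = nat K₀ ⊕ S≥0 ⊗ nat (2 ℕ.* K) ⊕ nat S′ ⊗ (nat 3 ⊗ nat (sumD x) ⊕ nat 5 ⊗ nat x)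

  A≥ : ∀ x → x ℕ.< n → 0ℤ ≤ A (suc x)
  A≥ x _ with suc x ℕ.≤? cs
  ... | yes _ = A₃≥0 (suc x)
  ... | no q  = subst (λ w → 0ℤ ≤ FA w) (ℕₚ.m+[n∸m]≡n (ℕₚ.<⇒≤ (ℕₚ.≰⇒> q))) (FA≥0 (suc x ℕ.∸ cs))

  dA : ∀ x → cs ℕ.< x → x ℕ.< n → A x + α (suc x) ≤ A (suc x)
  dA x lt _ = ℤₚ.≤-reflexive (trans (cong₂ _+_ (A-high lt) (α-high (ℕₚ.m<n⇒m<1+n lt))) (trans (sym (dFA x (ℕₚ.<⇒≤ lt))) (sym (A-high (ℕₚ.m<n⇒m<1+n lt)))))

  dA₁ : ∀ x → x ℕ.< cs → A (suc x) ≡ A x + α (suc x)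
  dA₁ x lt = trans (A-low lt) (trans (eqn (+ K₀) (S * + (2 ℕ.* K)) (+ S′) (+ sumD x) (+ D (suc x)) (+ x)) (sym (cong₂ _+_ (A-low (ℕₚ.<⇒≤ lt)) (α-low lt))))
    where
    eqn : ∀ k s s′ a d x → k + s + s′ * (+ 3 * (a + d) + + 5 * (+ 1 + x)) ≡ (k + s + s′ * (+ 3 * a + + 5 * x)) + s′ * (+ 3 * d + + 5)
    eqn = ℤS.solve-∀

  slopeM≤ : ∀ x → cs ℕ.< x → x ℕ.≤ n → 0ℤ ≤ + μm - μ x
  slopeM≤ x lo hi with view x lo hi
  ... | in-growing _ _ _ _ e _ _ = subst (λ a → 0ℤ ≤ + μm - slopeM (proj₂ a)) (sym e) (subst (0ℤ ≤_) (sym (ℤₚ.+-identityʳ (+ μm))) (nat μm))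
  ... | in-merging _ _ _ _ _ _ _ _ e (_ , _ , _ , _ , _ , m≤ , _) _ _ = subst (λ a → 0ℤ ≤ + μm - slopeM (proj₂ a)) (sym e) (gapℕ m≤)

  tubeℤ : ∀ {X} → X < + b → 0ℤ ≤ + β * + H - X
  tubeℤ {X} lt = subst (λ w → 0ℤ ≤ w - X) bℤ (gap (ℤₚ.<⇒≤ lt))

  dA₀ : cs ℕ.< n → ∀ x m → x ≡ cs → S * + m - M (suc x) < + b → A x + + S′ * + m + α (suc x) ≤ A (suc x)
  dA₀ lt x m refl tube = subst₂ _≤_ (cong₂ (λ y z → y + + S′ * + m + z) (sym (A-low ℕₚ.≤-refl)) (sym (α-high ℕₚ.≤-refl)))
      (trans (sym (dFA cs ℕₚ.≤-refl)) (sym (A-high ℕₚ.≤-refl)))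
      (ℤₚ.+-monoˡ-≤ (slopeA (proj₂ (at (suc cs)))) (half {A₃ cs + + S′ * + m} {FA cs} doubled))
    where
    mEq : M (suc cs) ≡ M₁ p₀ * + H + μ (suc cs)
    mEq = trans (dM cs ℕₚ.≤-refl lt) (cong (_+ μ (suc cs)) (F-base M₁ slopeM p₀ r₀ rs))
    eqn : ∀ a h a₃ s m m₁ μm β μ Mc → + 2 * (a * h) - + 2 * (a₃ + s * m) ≡
          ((β * h - (+ 2 * s * m - Mc)) + (+ 2 * a * h - (+ 2 * a₃ + (m₁ + μm + β) * h)) + (μm - μ) + μm * (h - + 1)) + (- + 1) * (Mc - (m₁ * h + μ))
    eqn = ℤS.solve-∀
    doubled : 0ℤ ≤ + 2 * FA cs - + 2 * (A₃ cs + + S′ * + m)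
    doubled = subst (λ w → 0ℤ ≤ + 2 * w - + 2 * (A₃ cs + + S′ * + m)) (sym (F-base A₁ slopeA p₀ r₀ rs))
      (byEq (- + 1) (tubeℤ tube ⊕ gap base ⊕ slopeM≤ (suc cs) ℕₚ.≤-refl lt ⊕ nat μm ⊗ gapℕ H≥1) mEq
        (eqn (A₁ p₀) (+ H) (A₃ cs) (+ S′) (+ m) (M₁ p₀) (+ μm) (+ β) (μ (suc cs)) (M (suc cs))))
    half : ∀ {x y} → 0ℤ ≤ + 2 * y - + 2 * x → x ≤ y
    half {x} {y} h = ℤₚ.0≤i-j⇒j≤i (cancelPos 2 (s≤s z≤n) (by h (eqn′ x y)))
      where
      eqn′ : ∀ x y → + 2 * (y - x) ≡ + 2 * y - + 2 * x
      eqn′ = ℤS.solve-∀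

  A≥₃ : ∀ x r → x ℕ.≤ cs → r ℕ.≤ D x ℕ.* x → S * + r ≤ A x
  A≥₃ x r le r≤ = subst (S * + r ≤_) (sym (A-low le))
    (cert _ (nat K₀ ⊕ S≥0 ⊗ nat (2 ℕ.* K) ⊕ nat S′ ⊗ (nat 2 ⊗ gapℕ (ℕₚ.≤-trans r≤ (sumD-≥ x)) ⊕ nat (sumD x) ⊕ nat 5 ⊗ nat x))
      (eqn (+ K₀) (S * + (2 ℕ.* K)) (+ S′) (+ sumD x) (+ r) (+ x)))
    where
    eqn : ∀ k s s′ a r x → (k + s + s′ * (+ 3 * a + + 5 * x)) - (+ 2 * s′) * r ≡ k + s + s′ * (+ 2 * (a - r) + a + + 5 * x)
    eqn = ℤS.solve-∀

  A0 : A 0 ≡ + K₀ + S * + (2 ℕ.* K)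
  A0 = trans (A-low z≤n) (eqn (+ K₀) (S * + (2 ℕ.* K)) (+ S′))
    where
    eqn : ∀ k s s′ → k + s + s′ * (+ 3 * 0ℤ + + 5 * 0ℤ) ≡ k + s
    eqn = ℤS.solve-∀

  Φmax : ℕ
  Φmax = K₀ ℕ.+ 2 ℕ.* S′ ℕ.* (2 ℕ.* K) ℕ.+ S′ ℕ.* (3 ℕ.* sumD ce ℕ.+ 5 ℕ.* ce) ℕ.+ S′ ℕ.* (L ℕ.* ce)

  sumD-mono : ∀ {x y} → x ℕ.≤ y → sumD x ℕ.≤ sumD y
  sumD-mono {x} {y} le = subst (λ w → sumD x ℕ.≤ sumD w) (ℕₚ.m+[n∸m]≡n le) (go (y ℕ.∸ x))
    where
    go : ∀ j → sumD x ℕ.≤ sumD (x ℕ.+ j)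
    go zero    = ℕₚ.≤-reflexive (cong sumD (sym (ℕₚ.+-identityʳ x)))
    go (suc j) = ℕₚ.≤-trans (go j) (subst (λ w → sumD (x ℕ.+ j) ℕ.≤ sumD w) (sym (ℕₚ.+-suc x j)) (ℕₚ.m≤m+n _ _))

  A≤ : ∀ x m → x ℕ.≤ ce → m ℕ.≤ L ℕ.* x → A x + + S′ * + m ≤ + Φmax
  A≤ x m x≤ m≤ = subst (λ w → w + + S′ * + m ≤ + Φmax) (sym (A-low (ℕₚ.≤-trans x≤ ce≤)))
    (ℤₚ.≤-trans (cert _ (nat S′ ⊗ (nat 3 ⊗ gapℕ (sumD-mono x≤) ⊕ nat 5 ⊗ gapℕ x≤ ⊕ gapℕ (ℕₚ.≤-trans m≤ (ℕₚ.*-monoʳ-≤ L x≤))))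
        (eqn (+ K₀) (S * + (2 ℕ.* K)) (+ S′) (+ sumD x) (+ sumD ce) (+ x) (+ ce) (+ m) (+ (L ℕ.* ce)))) (ℤₚ.≤-reflexive cast))
    where
    eqn : ∀ k s s′ a a′ x x′ m m′ → (k + s + s′ * (+ 3 * a′ + + 5 * x′) + s′ * m′) - (k + s + s′ * (+ 3 * a + + 5 * x) + s′ * m) ≡
          s′ * (+ 3 * (a′ - a) + + 5 * (x′ - x) + (m′ - m))
    eqn = ℤS.solve-∀
    cast : A₃ ce + + S′ * + (L ℕ.* ce) ≡ + Φmax
    cast = cong₂ _+_ (cong₂ (λ y z → + K₀ + y + z) (trans (cong (_* + (2 ℕ.* K)) (sym S≡)) (sym (ℤₚ.pos-* (2 ℕ.* S′) (2 ℕ.* K))))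
             (trans (cong (+ S′ *_) (cong₂ _+_ (sym (ℤₚ.pos-* 3 (sumD ce))) (sym (ℤₚ.pos-* 5 ce)))) (sym (ℤₚ.pos-* S′ (3 ℕ.* sumD ce ℕ.+ 5 ℕ.* ce)))))
             (sym (ℤₚ.pos-* S′ (L ℕ.* ce)))

  G-growing : ∀ {x p w κ α} → at x ≡ (p , growing w κ α) → G x ≡ G₁ p * + H + + κ * (+ x - + c₁ p * + H)
  G-growing {x} e = cong (λ a → line G₁ slopeG a x) e

  low₀ : Ok p₀ r₀
  low₀ = go rs ok
    where
    go : ∀ rs′ → AllOk p₀ r₀ rs′ → Ok p₀ r₀
    go []      o = o
    go (_ ∷ _) o = proj₁ o

  -- On merging pieces G is - b, so even one single vertex would exceed its bound by b or more.
  noTube : ∀ {x i p r} → at x ≡ (p , r) → slopeG r ≡ 0ℤ → - + β ≡ G₁ p → S * + suc i - G x < + b → ⊥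
  noTube {x} {i} {p} {r} e s0 g tube = ℤₚ.<-irrefl refl (ℤₚ.≤-<-trans
      (ℤₚ.≤-trans (ℤₚ.0≤i-j⇒j≤i {S * + suc i - G x} {+ b} (by (S≥0 ⊗ nat (suc i)) (trans (cong₂ (λ y z → S * + suc i - y - z) Geq bℤ) (eqn (S * + suc i) (+ β * + H))))) ℤₚ.≤-refl) tube)
    where
    Geq : G x ≡ - (+ β * + H)
    Geq = trans (cong (λ a → line G₁ slopeG a x) e) (trans (cong₂ (λ y z → y * + H + z * (+ x - + c₁ p * + H)) (sym g) s0) (eqn′ (+ β) (+ H) (+ x - + c₁ p * + H)))
      where
      eqn′ : ∀ b h z → (- b) * h + 0ℤ * z ≡ - (b * h)
      eqn′ = ℤS.solve-∀
    eqn : ∀ s b → s - (- b) - b ≡ s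
    eqn = ℤS.solve-∀

  bottomRow : ∀ x → x ℕ.≤ cs → at x ≡ (p₀ , r₀)
  bottomRow x le = go rs
    where
    go : ∀ rs′ → loc p₀ r₀ rs′ x ≡ (p₀ , r₀)
    go []       = refl
    go (r′ ∷ rs′) = pick-yes (x ℕ.≤? (c₁ p₀ ℕ.+ width r₀) ℕ.* H) (ℕₚ.≤-trans le (ℕₚ.*-monoˡ-≤ H (ℕₚ.m≤m+n (c₁ p₀) (width r₀))))

  merging-G : ∀ p r → Ok p r → IsMerging r → slopeG r ≡ 0ℤ × - + β ≡ G₁ p
  merging-G p (merging _ _ _ _ _ _ _) (g , _) _ = refl , g

  zone : ∀ i s → i ℕ.+ s ℕ.< n → S * + suc i - G (suc (i ℕ.+ s)) < + b → cs ℕ.< i ℕ.+ s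
  zone i s x<n tube with suc (i ℕ.+ s) ℕ.≤? cs
  ... | yes le = ⊥-elim (noTube {i = i} (bottomRow _ le) (proj₁ (merging-G p₀ r₀ low₀ first)) (proj₂ (merging-G p₀ r₀ low₀ first)) tube)
  ... | no nle with view (suc (i ℕ.+ s)) (ℕₚ.≰⇒> nle) x<n
  ...   | in-merging p w _ _ _ _ _ _ e (g , _) _ _ = ⊥-elim (noTube {i = i} e refl g tube)
  ...   | in-growing p w _ _ e (c< , _) lo = ℕₚ.≤-pred (ℤₚ.drop‿+≤+ (cert _ (lo ⊕ gapℕ c< ⊗ nat H ⊕ gapℕ H≥1) (trans (cong (λ y → + suc (i ℕ.+ s) - (+ 2 + y)) (ℤₚ.pos-* (c₁ p₀) H)) (eqn (+ suc (i ℕ.+ s)) (+ c₁ p) (+ c₁ p₀) (+ H)))))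
    where
    eqn : ∀ x c c₀ h → x - (+ 2 + c₀ * h) ≡ (x - c * h - + 1) + (c - (+ 1 + c₀)) * h + (h - + 1)
    eqn = ℤS.solve-∀

  start : ∀ x → cs ℕ.< x → x ℕ.< n → S * + 1 - G (suc x) < + b → R x ≤ 0ℤ × S * + n ≤ M x
  start x lo x<n tube with view (suc x) (ℕₚ.m<n⇒m<1+n lo) x<n
  ... | in-merging p w _ _ _ _ _ _ e (g , _) _ _ = ⊥-elim (noTube {i = 0} e refl g tube)
  ... | in-growing p w _ _ e (_ , r0 , m0 , _) _ = ℤₚ.≤-reflexive Rx , ℤₚ.≤-trans (cert _ (S≥0 ⊗ UH≥n) (eqn₂ S (+ U) (+ H) (+ n))) (ℤₚ.≤-reflexive (sym Mx))
    where
    z : ℤ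
    z = + suc x - + c₁ p * + H
    eqn₂ : ∀ s u h n → s * u * h - s * n ≡ s * (u * h - n)
    eqn₂ = ℤS.solve-∀
    level : ∀ v s (X : ℕ → ℤ) → X (suc x) ≡ X x + s (proj₂ (at (suc x))) → X (suc x) ≡ line v s (at (suc x)) (suc x) → s (growing w _ _) ≡ 0ℤ → X x ≡ v p * + H
    level v s X step val s0 = trans (sym (ℤₚ.+-identityʳ (X x))) (trans (cong (λ y → X x + y) (sym (trans (cong (λ a → s (proj₂ a)) e) s0)))
      (trans (sym step) (trans val (trans (cong (λ a → line v s a (suc x)) e) (trans (cong (λ y → v p * + H + y * z) s0) (trans (cong (λ y → v p * + H + y) (ℤₚ.*-zeroˡ z)) (ℤₚ.+-identityʳ (v p * + H))))))))
    Rx : R x ≡ 0ℤ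
    Rx = trans (level R₁ slopeR R (dR x (ℕₚ.<⇒≤ lo) x<n) refl refl) (trans (cong (_* + H) (sym r0)) (ℤₚ.*-zeroˡ (+ H)))
    Mx : M x ≡ S * + U * + H
    Mx = trans (level M₁ slopeM M (dM x (ℕₚ.<⇒≤ lo) x<n) refl refl) (cong (_* + H) (sym m0))

  growth : ∀ i s p q → i ℕ.+ s ℕ.< n → S * + suc i - G (suc (i ℕ.+ s)) < + b → i ℕ.≤ p → p ℕ.≤ suc i → q ℕ.≤ s →
             0ℤ ≤ S * + suc i - G (suc (i ℕ.+ s)) →
             (κ (suc (i ℕ.+ s)) - + 2 * S) * + p + (κ (suc (i ℕ.+ s)) - S) * + (2 ℕ.* q) ≤ 0ℤ
  growth i s p q x<n tube i≤p _ q≤s face with view (suc (i ℕ.+ s)) (ℕₚ.m<n⇒m<1+n (zone i s x<n tube)) x<n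
  ... | in-merging p′ w _ _ _ _ _ _ e (g , _) _ _ = ⊥-elim (noTube {i = i} e refl g tube)
  -- A slope of at most S: neither kind of move can raise the excess.
  ... | in-growing p′ w k′ a e (_ , _ , _ , k≤ , _ , inj₁ k≤S , _) _ =
        subst (λ k → (k - + 2 * S) * + p + (k - S) * + (2 ℕ.* q) ≤ 0ℤ) (sym (cong (λ r → slopeG (proj₂ r)) e))
          (cert _ (gap k≤ ⊗ nat p ⊕ gap k≤S ⊗ nat (2 ℕ.* q)) (eqn (+ k′) S (+ p) (+ (2 ℕ.* q))))
    where
    eqn : ∀ k s p q → 0ℤ - ((k - + 2 * s) * p + (k - s) * q) ≡ (+ 2 * s - k) * p + (s - k) * q
    eqn = ℤS.solve-∀
  ... | in-growing p′ w k′ a e (_ , _ , _ , k≤ , _ , inj₂ (S≤k , key) , _) lo =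
        subst (λ k → (k - + 2 * S) * + p + (k - S) * + (2 ℕ.* q) ≤ 0ℤ) (sym (cong (λ r → slopeG (proj₂ r)) e))
          (neg≤ (cancelS (subst (λ y → 0ℤ ≤ S * (- ((+ k′ - + 2 * S) * + p + (+ k′ - S) * y))) (sym (ℤₚ.pos-* 2 q))
            (growth-cert {S} {+ k′} {G₁ p′} {+ c₁ p′} {z} {+ H} {+ i} {+ s} {+ p} {+ q} S≥0 (gap S≤k) (gap k≤) key z≥ (gapℕ H≥1) (nat k′)
              (subst (λ y → 0ℤ ≤ S * + suc i - y) (G-growing e) face) (eqn (+ c₁ p′ * + H) (+ suc (i ℕ.+ s))) (gapℕ i≤p) (gapℕ q≤s)))))
    where
    z : ℤ
    z = + suc (i ℕ.+ s) - + c₁ p′ * + H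
    z≥ : 0ℤ ≤ z
    z≥ = by (lo ⊕ nat 1) (eqn′ z)
      where
      eqn′ : ∀ z → z ≡ z - + 1 + + 1
      eqn′ = ℤS.solve-∀
    eqn : ∀ c x → x ≡ c + (x - c)
    eqn = ℤS.solve-∀

  growthTime : ∀ i s p q → i ℕ.+ s ℕ.< n → S * + suc i - G (suc (i ℕ.+ s)) < + b → i ℕ.≤ p → L ℕ.* s ℕ.≤ L ℕ.* q ℕ.+ n →
             + n * S + ((- α (suc (i ℕ.+ s))) * + p + (- α (suc (i ℕ.+ s))) * + (2 ℕ.* q)) ≤ 0ℤ
  growthTime i s p q x<n tube i≤p L≤ with view (suc (i ℕ.+ s)) (ℕₚ.m<n⇒m<1+n (zone i s x<n tube)) x<n
  ... | in-merging p′ w _ _ _ _ _ _ e (g , _) _ _ = ⊥-elim (noTube {i = i} e refl g tube)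
  ... | in-growing p′ w k′ a e (_ , _ , _ , k≤ , _ , _ , t≥ , _) lo =
        subst (λ a → + n * S + ((- a) * + p + (- a) * + (2 ℕ.* q)) ≤ 0ℤ) (sym (trans (α-high (ℕₚ.m<n⇒m<1+n (zone i s x<n tube))) (cong (λ r → slopeA (proj₂ r)) e)))
          (neg≤ (cancelS (subst (λ y → 0ℤ ≤ S * (- (+ n * S + ((- + a) * + p + (- + a) * y)))) (sym (ℤₚ.pos-* 2 q))
            (growthTime-cert {S} {+ k′} {G₁ p′} {+ c₁ p′} {z} {+ H} {+ i} {+ s} {+ p} {+ q} {+ a} {+ β} {+ U} {+ n} S≥0 (nat a) (gapℕ i≤p) hq
              (by (tubeℤ tube) (trans (eqn₃ (G₁ p′ * + H + + k′ * z) (+ β * + H) (S * + suc i)) (cong (λ y → + β * + H - (S * + suc i - y)) (sym (G-growing e)))))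
              (eqn (+ c₁ p′ * + H) (+ suc (i ℕ.+ s))) t≥ (gap k≤) z≥ (gapℕ H≥1) UH≥n))))
    where
    z : ℤ
    z = + suc (i ℕ.+ s) - + c₁ p′ * + H
    z≥ : 0ℤ ≤ z
    z≥ = by (lo ⊕ nat 1) (eqn′ z)
      where
      eqn′ : ∀ z → z ≡ z - + 1 + + 1
      eqn′ = ℤS.solve-∀
    eqn : ∀ c x → x ≡ c + (x - c)
    eqn = ℤS.solve-∀
    eqn₃ : ∀ g b s → g + b - s ≡ b - (s - g)
    eqn₃ = ℤS.solve-∀
    -- As L = 2 U and n ≤ U H, at most H / 2 segments are too long to be extended.
    hq : 0ℤ ≤ + 2 * + q + + H - + 2 * + s
    hq = cancelPos U U≥1 (by (gapℕ (ℕₚ.≤-trans L≤ (ℕₚ.+-monoʳ-≤ (L ℕ.* q) n≤)))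
      (trans (eqn₄ (+ U) (+ q) (+ H) (+ s)) (sym (cong₂ _-_ (cong₂ _+_ (Lℤ q) (ℤₚ.pos-* U H)) (Lℤ s)))))
      where
      Lℤ : ∀ y → + (L ℕ.* y) ≡ + 2 * + U * + y
      Lℤ y = trans (ℤₚ.pos-* L y) (cong (_* + y) (ℤₚ.pos-* 2 U))
      eqn₄ : ∀ u q h s → u * (+ 2 * q + h - + 2 * s) ≡ + 2 * u * q + u * h - (+ 2 * u) * s
      eqn₄ = ℤS.solve-∀

  module Merged {x p w ρ⁺ ρ⁻ μ′ a d₀ d⋆} (e : at x ≡ (p , merging w ρ⁺ ρ⁻ μ′ a d₀ d⋆))
    (lo : 0ℤ ≤ + x - + c₁ p * + H - + 1) (hi : 0ℤ ≤ + w * + H - (+ x - + c₁ p * + H)) where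

    z : ℤ
    z = + x - + c₁ p * + H

    z≥ : 0ℤ ≤ z
    z≥ = by (lo ⊕ nat 1) (eqn z)
      where
      eqn : ∀ z → z ≡ z - + 1 + + 1
      eqn = ℤS.solve-∀

    Rm Rx : ℤ
    Rm = R₁ p - + ρ⁻ * + w
    Rx = R₁ p + + ρ⁺ * + w

    R≡ : R x ≡ R₁ p * + H + (+ ρ⁺ - + ρ⁻) * z
    R≡ = cong (λ a → line R₁ slopeR a x) e

    M≡ : M x ≡ M₁ p * + H + + μ′ * z
    M≡ = cong (λ a → line M₁ slopeM a x) e

    R-low : 0ℤ ≤ R x - Rm * + H
    R-low = by (nat ρ⁺ ⊗ z≥ ⊕ nat ρ⁻ ⊗ hi) (trans (cong (_- Rm * + H) R≡) (eqn (R₁ p) (+ H) (+ ρ⁺) (+ ρ⁻) (+ w) z))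
      where
      eqn : ∀ r h a b w z → (r * h + (a - b) * z) - (r - b * w) * h ≡ a * z + b * (w * h - z)
      eqn = ℤS.solve-∀

    R-high : 0ℤ ≤ Rx * + H - R x
    R-high = by (nat ρ⁺ ⊗ hi ⊕ nat ρ⁻ ⊗ z≥) (trans (cong (λ y → Rx * + H - y) R≡) (eqn (R₁ p) (+ H) (+ ρ⁺) (+ ρ⁻) (+ w) z))
      where
      eqn : ∀ r h a b w z → (r + a * w) * h - (r * h + (a - b) * z) ≡ a * (w * h - z) + b * z
      eqn = ℤS.solve-∀

    M-high : 0ℤ ≤ (M₁ p + + μ′ * + w) * + H - M x
    M-high = by (nat μ′ ⊗ hi) (trans (cong (λ y → (M₁ p + + μ′ * + w) * + H - y) M≡) (eqn (M₁ p) (+ H) (+ μ′) (+ w) z))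
      where
      eqn : ∀ m h u w z → (m + u * w) * h - (m * h + u * z) ≡ u * (w * h - z)
      eqn = ℤS.solve-∀

    c-low : 0ℤ ≤ + x - + c₁ p * + H
    c-low = z≥

    c-high : 0ℤ ≤ (+ c₁ p + + w) * + H - + x
    c-high = by hi (eqn (+ x) (+ c₁ p) (+ w) (+ H))
      where
      eqn : ∀ x c w h → (c + w) * h - x ≡ w * h - (x - c * h)
      eqn = ℤS.solve-∀

    reds-low : ∀ {r} → R x - S * r < + b → 0ℤ ≤ S * r - (Rm - + β) * + H
    reds-low {r} tube = by (tubeℤ tube ⊕ R-low) (eqn (R x) (S * r) Rm (+ β) (+ H))
      where
      eqn : ∀ R s m b h → s - (m - b) * h ≡ b * h - (R - s) + (R - m * h)
      eqn = ℤS.solve-∀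

  module WithCounts {d l h ml mh N r} (cn : Counts n D (Rc ℕ.* H) d l h ml mh N r) where

    open Counts cn public

    rZ : ℤ
    rZ = + d * + l + (+ 1 + + d) * + h

    rℤ : + r ≡ rZ
    rℤ = trans (cong +_ r≡) (cong₂ _+_ (ℤₚ.pos-* d l) (ℤₚ.pos-* (suc d) h))

    rZ≥ : 0ℤ ≤ rZ
    rZ≥ = subst (0ℤ ≤_) rℤ (nat r)

    mh≥ℤ : 0ℤ ≤ + mh - + 2 * + h
    mh≥ℤ = subst (λ w → 0ℤ ≤ + mh - w) (ℤₚ.pos-* 2 h) (gapℕ mh≥)

  time : ∀ d l h ml mh N r → Counts n D (Rc ℕ.* H) d l h ml mh N r → cs ℕ.< l ℕ.+ h → l ℕ.+ h ℕ.≤ n →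
           R (l ℕ.+ h) - S * + r < + b → S * + (ml ℕ.+ mh) - M (l ℕ.+ h) < + b →
           + n * S + drift d l h ml mh N (- α (l ℕ.+ h)) 0ℤ 0ℤ 0ℤ ≤ 0ℤ
  time d l h ml mh N r cn lo≤ hi≤ tube _ = subst (_≤ 0ℤ) (sym (cong (λ y → + n * S + y) (drift-a d l h ml mh N (- α (l ℕ.+ h))))) (neg≤ (cancelS (byRow (view (l ℕ.+ h) lo≤ hi≤))))
    where
    open WithCounts cn
    byRow : View (l ℕ.+ h) → 0ℤ ≤ S * (- (+ n * S + + 2 * (- α (l ℕ.+ h)) * ((+ l + + h) + rZ)))
    byRow (in-growing p w κ′ a e (_ , _ , _ , _ , _ , _ , _ , t≥) lo) =
      subst (λ y → 0ℤ ≤ S * (- (+ n * S + + 2 * (- y) * ((+ l + + h) + rZ)))) (sym (trans (α-high lo≤) (cong (λ r → slopeA (proj₂ r)) e)))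
        (time-cert {S} {+ a} {+ c₁ p} {+ H} {0ℤ} {+ U} {+ n} {+ l + + h} {rZ} S≥0 (nat a) (by (lo ⊕ nat 1) (eqn₁ (+ l + + h - + c₁ p * + H)))
          (by (S≥0 ⊗ rZ≥) (eqn₂ S rZ (+ H))) (nat H) (by t≥ (eqn₃ (+ a) S (+ c₁ p) (S * S * + U))) UH≥n)
      where
      eqn₁ : ∀ z → z ≡ z - + 1 + + 1
      eqn₁ = ℤS.solve-∀
      eqn₂ : ∀ s r h → s * r - 0ℤ * h ≡ s * r
      eqn₂ = ℤS.solve-∀
      eqn₃ : ∀ a s c u → + 2 * a * (s * c + 0ℤ) - u ≡ + 2 * a * s * c - u
      eqn₃ = ℤS.solve-∀
    byRow (in-merging p w ρ⁺ ρ⁻ μ′ a d₀ d⋆ e (_ , _ , _ , _ , _ , _ , t≥ , _) lo hi) =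
      subst (λ y → 0ℤ ≤ S * (- (+ n * S + + 2 * (- y) * ((+ l + + h) + rZ)))) (sym (trans (α-high lo≤) (cong (λ r → slopeA (proj₂ r)) e)))
        (time-cert {S} {+ a} {+ c₁ p} {+ H} {Merged.Rm e lo hi - + β} {+ U} {+ n} {+ l + + h} {rZ} S≥0 (nat a) (Merged.c-low e lo hi)
          (Merged.reds-low e lo hi (subst (λ y → R (l ℕ.+ h) - S * y < + b) rℤ tube)) (nat H)
          (by t≥ (eqn₃ (+ a) (S * + c₁ p) (Merged.Rm e lo hi) (+ β) (S * S * + U))) UH≥n)
      where
      eqn₃ : ∀ a s c b u → + 2 * a * (s + (c - b)) - u ≡ + 2 * a * (s + c - b) - u
      eqn₃ = ℤS.solve-∀

  mass : ∀ d l h ml mh N r → Counts n D (Rc ℕ.* H) d l h ml mh N r → cs ℕ.< l ℕ.+ h → l ℕ.+ h ℕ.≤ n →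
           R (l ℕ.+ h) - S * + r < + b → S * + (ml ℕ.+ mh) - M (l ℕ.+ h) < + b →
           0ℤ ≤ S * + (ml ℕ.+ mh) - M (l ℕ.+ h) → drift d l h ml mh N (μ (l ℕ.+ h)) (- S) 0ℤ 0ℤ ≤ 0ℤ
  mass d l h ml mh N r cn lo≤ hi≤ tube _ face = subst (_≤ 0ℤ) (sym (drift-m d l h ml mh N (μ (l ℕ.+ h)) (- S))) (neg≤ (byRow (view (l ℕ.+ h) lo≤ hi≤)))
    where
    open WithCounts cn
    byRow : View (l ℕ.+ h) → 0ℤ ≤ - (+ 2 * μ (l ℕ.+ h) * ((+ l + + h) + rZ) + + 2 * (- S) * ((+ 1 + + d) * (+ ml + + mh) + + mh))
    byRow (in-growing p w κ′ a e _ lo) =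
      subst (λ y → 0ℤ ≤ - (+ 2 * y * ((+ l + + h) + rZ) + + 2 * (- S) * ((+ 1 + + d) * (+ ml + + mh) + + mh))) (sym (cong (λ r → slopeM (proj₂ r)) e))
        (by (nat 2 ⊗ S≥0 ⊗ (nat (suc d) ⊗ nat (ml ℕ.+ mh) ⊕ nat mh)) (eqn S ((+ l + + h) + rZ) ((+ 1 + + d) * (+ ml + + mh) + + mh)))
      where
      eqn : ∀ s x y → - (+ 2 * 0ℤ * x + + 2 * (- s) * y) ≡ + 2 * s * y
      eqn = ℤS.solve-∀
    byRow (in-merging p w ρ⁺ ρ⁻ μ′ a d₀ d⋆ e (_ , _ , _ , _ , _ , _ , _ , _ , ν≥ , μ≥ , alt , deg) lo hi) =
      subst (λ y → 0ℤ ≤ - (+ 2 * y * ((+ l + + h) + rZ) + + 2 * (- S) * ((+ 1 + + d) * (+ ml + + mh) + + mh))) (sym (cong (λ r → slopeM (proj₂ r)) e))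
        (mass-cert {S} {+ μ′} {M₁ p} {+ c₁ p} {+ H} {z} {+ d} {+ l} {+ h} {+ ml + + mh} {+ mh} S≥0 (nat d) (subst (λ y → 0ℤ ≤ S * + (ml ℕ.+ mh) - y) M≡ face)
          (eqn (+ l + + h) (+ c₁ p * + H)) (key alt) mh≥ℤ)
      where
      open Merged e lo hi
      eqn : ∀ x c → x ≡ c + (x - c)
      eqn = ℤS.solve-∀
      ν : ℤ
      ν = M₁ p - + μ′ * + c₁ p
      key : (0ℤ ≤ + suc d₀ * ν - (+ μ′ - + 2 * S) * (+ c₁ p + + w) ⊎ 0ℤ ≤ ν - (+ μ′ - + 2 * S) * + Rc) → 0ℤ ≤ (+ 1 + + d) * ν * + H - (+ μ′ - + 2 * S) * + h
      -- Each segment of degree d + 1 has a block, so h ≤ r, and r is at most the block cap.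
      key (inj₂ q) = by (nat d ⊗ ν≥ ⊗ nat H ⊕ q ⊗ nat H ⊕ gap μ≥ ⊗ (subst (λ y → 0ℤ ≤ + y - + r) refl (gapℕ r≤) ⊕ nat d ⊗ nat (l ℕ.+ h)))
          (trans (eqn₂ (+ d) ν (+ H) (+ μ′ - + 2 * S) (+ l) (+ h) (+ Rc)) (cong (λ y → + d * ν * + H + (ν - (+ μ′ - + 2 * S) * + Rc) * + H + (+ μ′ - + 2 * S) * (y + + d * (+ l + + h)))
             (cong₂ _-_ (sym (ℤₚ.pos-* Rc H)) (sym rℤ))))
        where
        eqn₂ : ∀ d v H u l h R → (+ 1 + d) * v * H - u * h ≡ d * v * H + (v - u * R) * H + u * ((R * H - (d * l + (+ 1 + d) * h)) + d * (l + h))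
        eqn₂ = ℤS.solve-∀
      key (inj₁ q) = by (gapℕ d₀≤d ⊗ ν≥ ⊗ nat H ⊕ q ⊗ nat H ⊕ gap μ≥ ⊗ (c-high ⊕ nat l)) (eqn₂ (+ d) (+ d₀) ν (+ H) (+ μ′ - + 2 * S) (+ l) (+ h) (+ c₁ p + + w))
        where
        eqn₂ : ∀ d d₀ v H u l h c → (+ 1 + d) * v * H - u * h ≡ (d - d₀) * v * H + ((+ 1 + d₀) * v - u * c) * H + u * ((c * H - (l + h)) + l)
        eqn₂ = ℤS.solve-∀
        eqn₃ : ∀ s l h d d₀ R b H c → s * (- l) ≡ (s * (d * l + (+ 1 + d) * h) - (R - b) * H) + (R - b - d₀ * (s * c)) * H + d₀ * s * (c * H - (l + h)) + (d₀ - (+ 1 + d)) * s * (l + h)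
        eqn₃ = ℤS.solve-∀
        least : 0 ≡ d₀ ⊎ 0ℤ ≤ Rm - + β - + d₀ * (S * (+ c₁ p + + w)) → d₀ ℕ.≤ d
        least (inj₁ e₀) = subst (ℕ._≤ d) e₀ z≤n
        -- If d < d₀ then r < d₀ c because l ≥ 1, but the tube keeps r at d₀ c or more.
        least (inj₂ g)  = ℕₚ.≮⇒≥ λ lt → ¬nonpos l≥1 (cancelS (by (reds-low (subst (λ y → R (l ℕ.+ h) - S * y < + b) rℤ tube) ⊕ g ⊗ nat H ⊕ nat d₀ ⊗ S≥0 ⊗ c-high ⊕ gapℕ lt ⊗ S≥0 ⊗ nat (l ℕ.+ h))
                 (eqn₃ S (+ l) (+ h) (+ d) (+ d₀) Rm (+ β) (+ H) (+ c₁ p + + w))))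
        d₀≤d : d₀ ℕ.≤ d
        d₀≤d = least deg

  reds : ∀ d l h ml mh N r → Counts n D (Rc ℕ.* H) d l h ml mh N r → cs ℕ.< l ℕ.+ h → l ℕ.+ h ℕ.≤ n →
           R (l ℕ.+ h) - S * + r < + b → S * + (ml ℕ.+ mh) - M (l ℕ.+ h) < + b →
           0ℤ ≤ R (l ℕ.+ h) - S * + r → drift d l h ml mh N (- ρ (l ℕ.+ h)) 0ℤ S (- S) ≤ 0ℤ
  reds d l h ml mh N r cn lo≤ hi≤ tube tube′ face = subst (_≤ 0ℤ) (sym (drift-r d l h ml mh N (- ρ (l ℕ.+ h)) S (- S))) (neg≤ (byRow (view (l ℕ.+ h) lo≤ hi≤)))
    where
    open WithCounts cn
    Q : ℤ
    Q = + d * + d * + l + (+ 1 + + d) * (+ 1 + + d) * + h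
    Goal : ℤ → Set
    Goal y = 0ℤ ≤ - (+ 2 * (- y) * ((+ l + + h) + rZ) + + 2 * S * (rZ + Q) + (- S) * + N)
    -- Where R is 0, the excess is nonnegative only if there is no block at all, and then no removal
    -- destroys one.
    noReds : R (l ℕ.+ h) ≡ 0ℤ → ρ (l ℕ.+ h) ≡ 0ℤ → Goal (ρ (l ℕ.+ h))
    noReds R0 ρ0 = subst Goal (sym ρ0) (byEq (- (+ 2 * S * (+ 2 + + d))) (S≥0 ⊗ nat N ⊕ nat 2 ⊗ S≥0 ⊗ nat d ⊗ nat l) rZ0 (eqn₂ S (+ d) (+ l) (+ h) (+ N)))
      where
      eqn₁ : ∀ s r → s * (- r) ≡ 0ℤ - s * r
      eqn₁ = ℤS.solve-∀
      rZ0 : rZ ≡ 0ℤ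
      rZ0 = ℤₚ.≤-antisym (neg≤ (cancelS (by (subst₂ (λ y z → 0ℤ ≤ y - S * z) R0 rℤ face) (eqn₁ S rZ)))) rZ≥
      eqn₂ : ∀ s d l h n → - (+ 2 * (- 0ℤ) * ((l + h) + (d * l + (+ 1 + d) * h)) + + 2 * s * ((d * l + (+ 1 + d) * h) + (d * d * l + (+ 1 + d) * (+ 1 + d) * h)) + (- s) * n) ≡
             s * n + + 2 * s * d * l + (- (+ 2 * s * (+ 2 + d))) * ((d * l + (+ 1 + d) * h) - 0ℤ)
      eqn₂ = ℤS.solve-∀
    byRow : View (l ℕ.+ h) → Goal (ρ (l ℕ.+ h))
    byRow (in-growing p w κ′ a e (_ , r0 , _) lo) = noReds
      (trans (cong (λ a → line R₁ slopeR a (l ℕ.+ h)) e) (trans (cong (λ y → y * + H + 0ℤ * (+ (l ℕ.+ h) - + c₁ p * + H)) (sym r0)) (eqn (+ H) (+ (l ℕ.+ h) - + c₁ p * + H))))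
      (cong (λ r → slopeR (proj₂ r)) e)
      where
      eqn : ∀ h z → 0ℤ * h + 0ℤ * z ≡ 0ℤ
      eqn = ℤS.solve-∀
    byRow (in-merging p w ρ⁺ ρ⁻ μ′ a d₀ d⋆ e (_ , _ , _ , _ , _ , _ , _ , inj₁ (r0 , p0 , q0) , _) lo hi) = noReds
      (trans (Merged.R≡ e lo hi) (trans (cong₂ (λ y w → y * + H + w * (+ (l ℕ.+ h) - + c₁ p * + H)) (sym r0) slope0) (eqn (+ H) (+ (l ℕ.+ h) - + c₁ p * + H))))
      (trans (cong (λ r → slopeR (proj₂ r)) e) slope0)
      where
      eqn : ∀ h z → 0ℤ * h + 0ℤ * z ≡ 0ℤ
      eqn = ℤS.solve-∀
      slope0 : + ρ⁺ - + ρ⁻ ≡ 0ℤ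
      slope0 = cong₂ (λ y z → + y - + z) (sym p0) (sym q0)
    byRow (in-merging p w ρ⁺ ρ⁻ μ′ a d₀ d⋆ e (_ , Rm≥ , _ , _ , _ , _ , _ , inj₂ (slack , key , k≥ , cap , d⋆≤ , d⋆≥) , _) lo hi) =
      subst Goal (sym (cong (λ r → slopeR (proj₂ r)) e)) (cancelS
        (reds-cert {S} {+ ρ⁺} {+ ρ⁻} {+ c₁ p} {+ c₁ p + + w} {Rm} {Rx} {+ β} {Q⋆} {M₁ p + + μ′ * + w} {+ U} {+ H} {+ n} {+ N} {+ ml + + mh} {+ l + + h} {rZ} {Q}
          S≥0 (nat ρ⁺) (nat ρ⁻) (nat H) c-low c-high (reds-low (subst (λ y → R (l ℕ.+ h) - S * y < + b) rℤ tube)) rx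
          (Q-cert {S} {Rx} {+ H} {+ c₁ p} {+ d} {+ l} {+ h} {Q⋆} S≥0 (nat d) (nat H) rx c-low (convex-cert d d⋆ (S≥0 ⊗ nat (c₁ p)) d⋆≤ d⋆≥))
          many massTube n≥ H≥ slack))
      where
      open Merged e lo hi
      Q⋆ : ℤ
      Q⋆ = (+ 2 * + d⋆ + + 1) * Rx - + d⋆ * (+ 1 + + d⋆) * (S * + c₁ p)
      rx : 0ℤ ≤ Rx * + H - S * rZ
      rx = by (R-high ⊕ subst (λ y → 0ℤ ≤ R (l ℕ.+ h) - S * y) rℤ face) (eqn (Rx * + H) (R (l ℕ.+ h)) (S * rZ))
        where
        eqn : ∀ a b c → a - c ≡ (a - b) + (b - c)
        eqn = ℤS.solve-∀
      massTube : 0ℤ ≤ (M₁ p + + μ′ * + w + + β) * + H - S * (+ ml + + mh)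
      massTube = by (tubeℤ tube′ ⊕ M-high) (eqn (M₁ p + + μ′ * + w) (+ β) (+ H) (S * (+ ml + + mh)) (M (l ℕ.+ h)))
        where
        eqn : ∀ m b h s M → (m + b) * h - s ≡ (b * h - (s - M)) + (m * h - M)
        eqn = ℤS.solve-∀
      Rx≥ : 0ℤ ≤ Rx
      Rx≥ = by (Rm≥ ⊕ (nat ρ⁺ ⊕ nat ρ⁻) ⊗ nat w) (eqn (R₁ p) (+ ρ⁺) (+ ρ⁻) (+ w))
        where
        eqn : ∀ r a b w → r + a * w ≡ (r - b * w) + (a + b) * w
        eqn = ℤS.solve-∀
      -- Where the excess is nonnegative, r is at most R / S, too few blocks for all segments to
      -- have reached the degree cap.
      spare : suc d ℕ.≤ D (l ℕ.+ h)
      spare = ℕₚ.≮⇒≥ λ { (s≤s le) → ¬nonpos (ℕₚ.*-mono-≤ H≥1 H≥1) (subst (λ y → 0ℤ ≤ - y) (sym (ℤₚ.pos-* H H))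
        (degree-cert {S} {Rx} {+ H} {+ U} {+ n} {+ c₁ p} {+ d} {+ l} {+ h} S≥0 (nat d) (nat l) (nat h) (nat H) Rx≥ rx c-low n≥ k≥ (gap key)
          (subst (λ y → 0ℤ ≤ y - + n) (trans (ℤₚ.pos-* (d ℕ.* suc d) (l ℕ.+ h)) (cong (_* + (l ℕ.+ h)) (ℤₚ.pos-* d (suc d))))
            (gapℕ (ℕₚ.≤-trans (D-ok (l ℕ.+ h) (ℕₚ.≤-trans l≥1 (ℕₚ.m≤m+n l h))) (ℕₚ.*-monoˡ-≤ (l ℕ.+ h) (ℕₚ.*-mono-≤ le (s≤s le)))))))) }
      room : suc r ℕ.≤ Rc ℕ.* H
      room = ℕₚ.≰⇒> λ le → ¬nonpos H≥1 (by (subst (λ y → 0ℤ ≤ Rx * + H - S * y) (sym rℤ) rx ⊕ S≥0 ⊗ gapℕ le ⊕ gap cap ⊗ nat H)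
        (trans (eqn S Rx (+ H) (+ r) (+ Rc)) (cong (λ y → (Rx * + H - S * + r) + S * (+ r - y) + (S * + Rc - Rx - + 1) * + H) (sym (ℤₚ.pos-* Rc H)))))
        where
        eqn : ∀ s x h r c → - h ≡ (x * h - s * r) + s * (r - c * h) + (s * c - x - + 1) * h
        eqn = ℤS.solve-∀
      many : 0ℤ ≤ + N + + 5 * rZ + + 2 + (+ ml + + mh) - + n
      many = subst (λ y → 0ℤ ≤ + N + y + + 2 + (+ ml + + mh) - + n) (trans (ℤₚ.pos-* 5 r) (cong (+ 5 *_) rℤ)) (gapℕ (N≥ spare room))

  few : ∀ c → c ℕ.≤ cs → D c ℕ.* c ℕ.< Rc ℕ.* H
  few c c≤ = ℕₚ.≤-<-trans (D*c-small c (q₀ ℕ.* H) n≥1 (ℕₚ.≤-trans (ℕₚ.*-mono-≤ n≤ c≤) (ℕₚ.≤-trans (ℕₚ.≤-reflexive (square U (c₁ p₀) H))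
      (ℕₚ.≤-trans (ℕₚ.*-monoˡ-≤ (H ℕ.* H) q-big) (ℕₚ.≤-reflexive (sym (square q₀ q₀ H)))))))
    (ℕₚ.≤-<-trans (ℕₚ.+-monoʳ-≤ (q₀ ℕ.* H) c≤) (ℕₚ.≤-<-trans (ℕₚ.≤-reflexive (sym (ℕₚ.*-distribʳ-+ H q₀ (c₁ p₀)))) (ℕₚ.*-monoˡ-< H {{ℕ.>-nonZero H≥1}} q-small)))
    where
    square : ∀ u c h → u ℕ.* h ℕ.* (c ℕ.* h) ≡ u ℕ.* c ℕ.* (h ℕ.* h)
    square = ℕS.solve-∀

  lateDrift : ∀ d l h ml mh N r → Counts n D (Rc ℕ.* H) d l h ml mh N r → l ℕ.+ h ℕ.≤ cs →
           + n * S + drift d l h ml mh N (- α (l ℕ.+ h)) (- + S′) S (- S) ≤ 0ℤ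
  lateDrift d l h ml mh N r cn c≤ = subst (λ a → + n * S + drift d l h ml mh N (- a) (- + S′) S (- S) ≤ 0ℤ) (sym (α-low c≤))
    (Late.late S′ (Rc ℕ.* H) cs n≥1 few d l h ml mh N r cn c≤)

  closing : ∀ k N → k ℕ.< K → n ℕ.≤ N ℕ.+ 5 ℕ.* k ℕ.+ 2 → + n * S ≤ S * + (2 ℕ.* N)
  closing k N lt le = ℤₚ.≤-trans (ℤₚ.≤-reflexive (ℤₚ.*-comm (+ n) S)) (cert _ (S≥0 ⊗ gapℕ half) (eqn S (+ (2 ℕ.* N)) (+ n)))
    where
    eqn : ∀ s a b → s * a - s * b ≡ s * (a - b)
    eqn = ℤS.solve-∀
    eqn₁ : ∀ N k → 2 ℕ.* (N ℕ.+ 5 ℕ.* k ℕ.+ 2) ≡ 2 ℕ.* N ℕ.+ (10 ℕ.* k ℕ.+ 4)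
    eqn₁ = ℕS.solve-∀
    half : n ℕ.≤ 2 ℕ.* N
    half = ℕₚ.+-cancelʳ-≤ n n (2 ℕ.* N) (ℕₚ.≤-trans (ℕₚ.≤-reflexive (cong (n ℕ.+_) (sym (ℕₚ.+-identityʳ n)))) (ℕₚ.≤-trans (ℕₚ.*-monoʳ-≤ 2 le)
      (ℕₚ.≤-trans (ℕₚ.≤-reflexive (eqn₁ N k)) (ℕₚ.+-monoʳ-≤ (2 ℕ.* N) (ℕₚ.≤-trans (ℕₚ.+-monoˡ-≤ 4 (ℕₚ.*-monoʳ-≤ 10 (ℕₚ.<⇒≤ lt))) n≥K)))))

  closed : + n * S ≤ + K₀ * + K
  closed = subst₂ _≤_ (trans (ℤₚ.pos-* (2 ℕ.* S′) n) (trans (ℤₚ.*-comm (+ (2 ℕ.* S′)) (+ n)) (cong (+ n *_) S≡))) (ℤₚ.pos-* K₀ K) (ℤ.+≤+ shut)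

  ∣+∣ : ∀ i j {a b} → ∣ i ∣ ℕ.≤ a → ∣ j ∣ ℕ.≤ b → ∣ i + j ∣ ℕ.≤ a ℕ.+ b
  ∣+∣ i j p q = ℕₚ.≤-trans (ℤₚ.∣i+j∣≤∣i∣+∣j∣ i j) (ℕₚ.+-mono-≤ p q)

  ∣-∣ : ∀ i {a} → ∣ i ∣ ℕ.≤ a → ∣ - i ∣ ℕ.≤ a
  ∣-∣ i p = ℕₚ.≤-trans (ℕₚ.≤-reflexive (ℤₚ.∣-i∣≡∣i∣ i)) p

  ∣S∣ : ∣ S ∣ ≡ 2 ℕ.* S′
  ∣S∣ = ℤₚ.abs-* (+ 2) (+ S′)

  ∣S*∣ : ∀ g {m} → g ℕ.≤ m → ∣ S * + g ∣ ℕ.≤ 2 ℕ.* S′ ℕ.* m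
  ∣S*∣ g {m} le = ℕₚ.≤-trans (ℕₚ.≤-reflexive (trans (ℤₚ.abs-* S (+ g)) (cong (ℕ._* g) ∣S∣))) (ℕₚ.*-monoʳ-≤ (2 ℕ.* S′) le)

  Bα Bᵣ Bₘ Bκ B : ℕ
  Bα = αm ℕ.+ S′ ℕ.* (3 ℕ.* k ℕ.+ 5)
  Bᵣ = 2 ℕ.* S′ ℕ.+ (Bα ℕ.+ S′ ℕ.* L ℕ.+ 2 ℕ.* S′ ℕ.* k) ℕ.+ (ρm ℕ.+ ρm)
  Bₘ = μm ℕ.+ 2 ℕ.* S′ ℕ.* L
  Bκ = 2 ℕ.* (2 ℕ.* S′) ℕ.+ 2 ℕ.* (2 ℕ.* S′)
  B  = incrementBound S′ U αm ρm μm k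

  Bᵣ≤B : Bᵣ ℕ.≤ B
  Bᵣ≤B = incrementBound-R S′ U αm ρm μm k

  Bₘ≤B : Bₘ ℕ.≤ B
  Bₘ≤B = incrementBound-M S′ U αm ρm μm k

  Bκ≤B : Bκ ℕ.≤ B
  Bκ≤B = incrementBound-κ S′ U αm ρm μm k

  D≤ : ∀ x → ce ℕ.< x → D x ℕ.≤ k
  D≤ x lt = D-min x k (ℕₚ.≤-trans ce≥ (ℕₚ.*-monoʳ-≤ (k ℕ.* suc k) lt))

  ∣α∣ : ∀ x → ce ℕ.< x → x ℕ.≤ n → ∣ α x ∣ ℕ.≤ Bα
  ∣α∣ x lt x≤ = byCase (x ℕ.≤? cs)
    where
    byCase : Dec (x ℕ.≤ cs) → ∣ α x ∣ ℕ.≤ Bα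
    byCase (yes le) = subst (λ y → ∣ y ∣ ℕ.≤ Bα) (sym (trans (α-low le) (cong (λ y → + S′ * (y + + 5)) (sym (ℤₚ.pos-* 3 (D x))))))
      (ℕₚ.≤-trans (ℕₚ.≤-reflexive (ℤₚ.abs-* (+ S′) (+ (3 ℕ.* D x ℕ.+ 5)))) (ℕₚ.≤-trans (ℕₚ.*-monoʳ-≤ S′ (ℕₚ.+-monoˡ-≤ 5 (ℕₚ.*-monoʳ-≤ 3 (D≤ x lt)))) (ℕₚ.m≤n+m _ αm)))
    byCase (no nle) = ℕₚ.≤-trans (byRow (view x (ℕₚ.≰⇒> nle) x≤)) (ℕₚ.m≤m+n αm _)
      where
      at-slope : ∀ {p r a} → at x ≡ (p , r) → slopeA r ≡ + a → a ℕ.≤ αm → ∣ α x ∣ ℕ.≤ αm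
      at-slope e s le = subst (λ y → ∣ y ∣ ℕ.≤ αm) (sym (trans (α-high (ℕₚ.≰⇒> nle)) (trans (cong (λ r → slopeA (proj₂ r)) e) s))) le
      byRow : View x → ∣ α x ∣ ℕ.≤ αm
      byRow (in-growing _ _ _ _ e (_ , _ , _ , _ , le , _) _)             = at-slope e refl le
      byRow (in-merging _ _ _ _ _ _ _ _ e (_ , _ , le , _) _ _)           = at-slope e refl le

  ∣ρ∣ : ∀ x → cs ℕ.< x → x ℕ.≤ n → ∣ ρ x ∣ ℕ.≤ ρm ℕ.+ ρm
  ∣ρ∣ x lo hi = byRow (view x lo hi)
    where
    byRow : View x → ∣ ρ x ∣ ℕ.≤ ρm ℕ.+ ρm
    byRow (in-growing _ _ _ _ e _ _) = subst (λ r → ∣ slopeR (proj₂ r) ∣ ℕ.≤ ρm ℕ.+ ρm) (sym e) z≤n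
    byRow (in-merging _ _ a c _ _ _ _ e (_ , _ , _ , le , le′ , _) _ _) =
      subst (λ r → ∣ slopeR (proj₂ r) ∣ ℕ.≤ ρm ℕ.+ ρm) (sym e) (∣+∣ (+ a) (- + c) le (∣-∣ (+ c) le′))

  ∣μ∣ : ∀ x → cs ℕ.< x → x ℕ.≤ n → ∣ μ x ∣ ℕ.≤ μm
  ∣μ∣ x lo hi = byRow (view x lo hi)
    where
    byRow : View x → ∣ μ x ∣ ℕ.≤ μm
    byRow (in-growing _ _ _ _ e _ _)                                       = subst (λ r → ∣ slopeM (proj₂ r) ∣ ℕ.≤ μm) (sym e) z≤n
    byRow (in-merging _ _ _ _ _ _ _ _ e (_ , _ , _ , _ , _ , le , _) _ _)  = subst (λ r → ∣ slopeM (proj₂ r) ∣ ℕ.≤ μm) (sym e) le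

  ∣κ∣ : ∀ x → cs ℕ.< x → x ℕ.≤ n → ∣ κ x ∣ ℕ.≤ 2 ℕ.* (2 ℕ.* S′)
  ∣κ∣ x lo hi = byRow (view x lo hi)
    where
    byRow : View x → ∣ κ x ∣ ℕ.≤ 2 ℕ.* (2 ℕ.* S′)
    byRow (in-growing _ _ a _ e (_ , _ , _ , le , _) _) = subst (λ r → ∣ slopeG (proj₂ r) ∣ ℕ.≤ 2 ℕ.* (2 ℕ.* S′)) (sym e)
      (ℤₚ.drop‿+≤+ (ℤₚ.≤-trans le (ℤₚ.≤-reflexive (trans (cong (+ 2 *_) (sym S≡)) (sym (ℤₚ.pos-* 2 (2 ℕ.* S′)))))))
    byRow (in-merging _ _ _ _ _ _ _ _ e _ _ _) = subst (λ r → ∣ slopeG (proj₂ r) ∣ ℕ.≤ 2 ℕ.* (2 ℕ.* S′)) (sym e) z≤n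

  bound-S : ∣ S ∣ ℕ.≤ B
  bound-S = ℕₚ.≤-trans (ℕₚ.≤-reflexive ∣S∣) (ℕₚ.≤-trans (ℕₚ.m≤m+n _ _) (ℕₚ.≤-trans (ℕₚ.m≤m+n _ _) Bᵣ≤B))

  bound-R : ∀ x → cs ℕ.< x → x ℕ.≤ n → ∀ g → g ℕ.≤ D x → ∣ - ρ x + S * + g ∣ ℕ.≤ B
  bound-R x lo hi g g≤ = ℕₚ.≤-trans (∣+∣ (- ρ x) (S * + g) (∣-∣ (ρ x) (∣ρ∣ x lo hi)) (∣S*∣ g (ℕₚ.≤-trans g≤ (D≤ x (ℕₚ.≤-<-trans ce≤ lo)))))
    (ℕₚ.≤-trans (ℕₚ.m≤m+n _ _) (ℕₚ.≤-trans (ℕₚ.≤-reflexive (eqn (2 ℕ.* S′) (Bα ℕ.+ S′ ℕ.* L) (2 ℕ.* S′ ℕ.* k) (ρm ℕ.+ ρm))) Bᵣ≤B))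
    where
    eqn : ∀ a b c d → d ℕ.+ c ℕ.+ (a ℕ.+ b) ≡ a ℕ.+ (b ℕ.+ c) ℕ.+ d
    eqn = ℕS.solve-∀

  bound-M : ∀ x s → cs ℕ.< x → x ℕ.≤ n → s ℕ.≤ L → ∣ μ x - S * + s ∣ ℕ.≤ B
  bound-M x s lo hi s≤ = ℕₚ.≤-trans (∣+∣ (μ x) (- (S * + s)) (∣μ∣ x lo hi) (∣-∣ (S * + s) (∣S*∣ s s≤))) Bₘ≤B

  bound-A : ∀ x s g → ce ℕ.< x → x ℕ.≤ n → s ℕ.≤ L → g ℕ.≤ D x → ∣ S + (- α x) ∣ ℕ.≤ B × ∣ S + (- α x - + S′ * + s + S * + g) ∣ ℕ.≤ B
  bound-A x s g lt hi s≤ g≤ =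
      ℕₚ.≤-trans (∣+∣ S (- α x) S≤ α≤) (ℕₚ.≤-trans (ℕₚ.+-monoʳ-≤ (2 ℕ.* S′) (ℕₚ.≤-trans (ℕₚ.m≤m+n _ _) (ℕₚ.m≤m+n _ _))) rest)
    , ℕₚ.≤-trans (∣+∣ S _ S≤ (∣+∣ (- α x - + S′ * + s) (S * + g) (∣+∣ (- α x) (- (+ S′ * + s)) α≤ (∣-∣ (+ S′ * + s)
        (ℕₚ.≤-trans (ℕₚ.≤-reflexive (ℤₚ.abs-* (+ S′) (+ s))) (ℕₚ.*-monoʳ-≤ S′ s≤)))) (∣S*∣ g (ℕₚ.≤-trans g≤ (D≤ x lt))))) rest
    where
    S≤ : ∣ S ∣ ℕ.≤ 2 ℕ.* S′
    S≤ = ℕₚ.≤-reflexive ∣S∣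
    α≤ : ∣ - α x ∣ ℕ.≤ Bα
    α≤ = ∣-∣ (α x) (∣α∣ x lt hi)
    rest : 2 ℕ.* S′ ℕ.+ (Bα ℕ.+ S′ ℕ.* L ℕ.+ 2 ℕ.* S′ ℕ.* k) ℕ.≤ B
    rest = ℕₚ.≤-trans (ℕₚ.m≤m+n _ _) Bᵣ≤B

  bound-κ : ∀ x → cs ℕ.< x → x ℕ.≤ n → ∣ κ x - S ∣ ℕ.≤ B × ∣ κ x - + 2 * S ∣ ℕ.≤ B
  bound-κ x lo hi =
      ℕₚ.≤-trans (∣+∣ (κ x) (- S) (∣κ∣ x lo hi) (∣-∣ S (ℕₚ.≤-trans (ℕₚ.≤-reflexive ∣S∣) (ℕₚ.m≤m+n (2 ℕ.* S′) _)))) Bκ≤B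
    , ℕₚ.≤-trans (∣+∣ (κ x) (- (+ 2 * S)) (∣κ∣ x lo hi) (∣-∣ (+ 2 * S) (ℕₚ.≤-reflexive (trans (ℤₚ.abs-* (+ 2) S) (cong (2 ℕ.*_) ∣S∣))))) Bκ≤B

  profile : Profile n L D (Rc ℕ.* H) K
  profile = record
    { S′ = S′ ; cs = cs ; ce = ce ; b = b ; K₀ = K₀ ; B = B ; ce≤cs = ce≤ ; G = G ; R = R ; M = M ; A = A ; κ = κ ; ρ = ρ ; μ = μ ; α = α
    ; dG = dG ; dR = dR ; dM = dM ; dA = dA ; dA₀ = dA₀ ; dA₁ = dA₁ ; A≥ = A≥ ; A≥₃ = A≥₃ ; A0 = A0 ; zone = zone ; start = start
    ; bound-R = bound-R ; bound-M = bound-M ; bound-A = bound-A ; bound-κ = bound-κ ; bound-S = bound-S ; Φmax = Φmax ; A≤ = A≤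
    ; growth = growth ; growthTime = growthTime ; reds = reds ; mass = mass ; time = time ; late = lateDrift ; closing = closing ; closed = closed }

-- From the ends of the table to n, and the arithmetic of the error terms.

module Ends (H : ℕ) {S : ℤ} {U β Rc cs₀ αm ρm μm : ℕ} (v : Pre → ℤ) (s : Row → ℤ) (nx : ∀ p r → v (next p r) ≡ v p + s r * + width r)
  (C : ℤ) (s≤ : ∀ p r → Check.Ok S U β Rc cs₀ αm ρm μm p r → 0ℤ ≤ C - s r) where

  open Check S U β Rc cs₀ αm ρm μm
  open Interpolation H

  top-≤ : ∀ p r rs → AllOk p r rs → 0ℤ ≤ v p + C * (+ c₁ (top p r rs) - + c₁ p) - v (top p r rs)
  top-≤ p r [] o = by (s≤ p r o ⊗ nat (width r)) (trans (cong (λ y → v p + C * (+ c₁ p + + width r - + c₁ p) - y) (nx p r)) (eqn (v p) C (+ c₁ p) (+ width r) (s r)))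
    where
    eqn : ∀ v C c w s → v + C * (c + w - c) - (v + s * w) ≡ (C - s) * w
    eqn = ℤS.solve-∀
  top-≤ p r (r′ ∷ rs) (o , os) = by (top-≤ (next p r) r′ rs os ⊕ s≤ p r o ⊗ nat (width r))
      (trans (eqn (v p) C (+ c₁ p) (+ width r) (s r) (+ c₁ (top (next p r) r′ rs)) (v (top (next p r) r′ rs)))
        (cong (λ y → y + C * (+ c₁ (top (next p r) r′ rs) - (+ c₁ p + + width r)) - v (top (next p r) r′ rs) + (C - s r) * + width r) (sym (nx p r))))
    where
    eqn : ∀ v C c w s t x → v + C * (t - c) - x ≡ ((v + s * w) + C * (t - (c + w)) - x) + (C - s) * w
    eqn = ℤS.solve-∀

  -- n lies slightly below the top of the table; a bound C on the slopes carries the value at the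
  -- top down to n.
  F-≥ : ∀ p r rs x → AllOk p r rs → x ℕ.≤ c₁ (top p r rs) ℕ.* H →
        0ℤ ≤ F v s p r rs x + C * (+ c₁ (top p r rs) * + H - + x) - v (top p r rs) * + H
  F-≥ p r [] x o x≤ = by (s≤ p r o ⊗ subst (λ y → 0ℤ ≤ y - + x) (ℤₚ.pos-* (c₁ p ℕ.+ width r) H) (gapℕ x≤))
      (trans (cong (λ y → v p * + H + s r * (+ x - + c₁ p * + H) + C * ((+ c₁ p + + width r) * + H - + x) - y * + H) (nx p r))
        (eqn (v p) C (+ c₁ p) (+ width r) (s r) (+ H) (+ x)))
    where
    eqn : ∀ v C c w s h x → v * h + s * (x - c * h) + C * ((c + w) * h - x) - (v + s * w) * h ≡ (C - s) * ((c + w) * h - x)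
    eqn = ℤS.solve-∀
  F-≥ p r (r′ ∷ rs) x (o , os) x≤ with x ℕ.≤? (c₁ p ℕ.+ width r) ℕ.* H
  ... | no _  = F-≥ (next p r) r′ rs x os x≤
  ... | yes q = by (top-≤ (next p r) r′ rs os ⊗ nat H ⊕ s≤ p r o ⊗ subst (λ y → 0ℤ ≤ y - + x) (ℤₚ.pos-* (c₁ p ℕ.+ width r) H) (gapℕ q))
      (trans (eqn (v p) C (+ c₁ p) (+ width r) (s r) (+ H) (+ x) (+ c₁ (top (next p r) r′ rs)) (v (top (next p r) r′ rs)))
        (cong (λ y → (y + C * (+ c₁ (top (next p r) r′ rs) - (+ c₁ p + + width r)) - v (top (next p r) r′ rs)) * + H + (C - s r) * ((+ c₁ p + + width r) * + H - + x)) (sym (nx p r))))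
    where
    eqn : ∀ v C c w s h x t y → v * h + s * (x - c * h) + C * (t * h - x) - y * h ≡
          ((v + s * w) + C * (t - (c + w)) - y) * h + (C - s) * ((c + w) * h - x)
    eqn = ℤS.solve-∀

-- t is the parameter of the tangent by which `sumD-≤` bounds the sum x of the degree caps.
base-cert : ∀ {t a m s′ c u H K₀ K x y n} → 0ℤ ≤ t → 0ℤ ≤ s′ → 0ℤ ≤ + 2 * H - K₀ → 0ℤ ≤ H - K → 0ℤ ≤ t * t * y + n - t * x → 0ℤ ≤ u * H - n → 0ℤ ≤ H → y ≡ c * H →
  0ℤ ≤ t * (+ 2 * a - m - + 4 - + 8 * s′) - + 6 * s′ * (t * t * c + u) - + 10 * t * s′ * c →
  0ℤ ≤ t * (+ 2 * a * H - (+ 2 * (K₀ + (+ 2 * s′) * (+ 2 * K) + s′ * (+ 3 * x + + 5 * y)) + m * H))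
base-cert {t} {a} {m} {s′} {c} {u} {H} {K₀} {K} {x} {y} {n} t≥ s≥ k₀ k sum un H≥ ye slack =
  byEq (- (+ 6 * s′ * t * t + + 10 * t * s′)) (nat 2 ⊗ t≥ ⊗ k₀ ⊕ nat 8 ⊗ t≥ ⊗ s≥ ⊗ k ⊕ nat 6 ⊗ s≥ ⊗ sum ⊕ nat 6 ⊗ s≥ ⊗ un ⊕ slack ⊗ H≥) ye
    (eqn t a m s′ c u H K₀ K x y n)
  where
  eqn : ∀ t a m s′ c u H K₀ K x y n → t * (+ 2 * a * H - (+ 2 * (K₀ + (+ 2 * s′) * (+ 2 * K) + s′ * (+ 3 * x + + 5 * y)) + m * H)) ≡
    + 2 * t * (+ 2 * H - K₀) + + 8 * t * s′ * (H - K) + + 6 * s′ * (t * t * y + n - t * x) + + 6 * s′ * (u * H - n) +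
    (t * (+ 2 * a - m - + 4 - + 8 * s′) - + 6 * s′ * (t * t * c + u) - + 10 * t * s′ * c) * H + (- (+ 6 * s′ * t * t + + 10 * t * s′)) * (y - c * H)
  eqn = ℤS.solve-∀

finish-cert : ∀ {S P Q U W A At β e n T H} → 0ℤ ≤ S → 0ℤ ≤ P → 0ℤ ≤ Q → 0ℤ ≤ Q * T + Q - P * n → 0ℤ ≤ n + U - U * H → 0ℤ ≤ At * H - A → S * U ≡ W * Q →
  0ℤ ≤ W * P - (At + e) → 0ℤ ≤ H → 0ℤ ≤ e - + 2 * β - + 1 → 0ℤ ≤ H - (S + W * P) → 0ℤ ≤ Q * (S * T - A - + 2 * (β * H))
finish-cert {S} {P} {Q} {U} {W} {A} {At} {β} {e} {n} {T} {H} S≥ P≥ Q≥ tn un at su slack H≥ e≥ h =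
  byEq (P * (H - + 1)) (S≥ ⊗ tn ⊕ S≥ ⊗ P≥ ⊗ un ⊕ Q≥ ⊗ at ⊕ Q≥ ⊗ slack ⊗ H≥ ⊕ Q≥ ⊗ (e≥ ⊗ H≥ ⊕ h)) su (eqn S P Q U W A At β e n T H)
  where
  eqn : ∀ S P Q U W A At β e n T H → Q * (S * T - A - + 2 * (β * H)) ≡
    S * (Q * T + Q - P * n) + S * P * (n + U - U * H) + Q * (At * H - A) + Q * (W * P - (At + e)) * H +
    Q * ((e - + 2 * β - + 1) * H + (H - (S + W * P))) + P * (H - + 1) * (S * U - W * Q)
  eqn = ℤS.solve-∀

start-cert : ∀ {S U H n g} → 0ℤ ≤ S → 0ℤ ≤ g + (+ 2 * S) * (U * H - n) - (S * U + + 1) * H → 0ℤ ≤ H - S * U → 0ℤ ≤ n + U - U * H → 0ℤ ≤ g - S * n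
start-cert {S} {U} {H} {n} {g} S≥ gt hs un = by (gt ⊕ hs ⊕ S≥ ⊗ un) (eqn S U H n g)
  where
  eqn : ∀ S U H n g → g - S * n ≡ (g + (+ 2 * S) * (U * H - n) - (S * U + + 1) * H) + (H - S * U) + S * (n + U - U * H)
  eqn = ℤS.solve-∀

budget-Φ : ∀ S′ L V β {K₀ K s c d H} → K₀ ℕ.* d ℕ.≤ 2 ℕ.* H → K ℕ.* d ℕ.≤ H → s ℕ.* d ℕ.≤ H → V ℕ.* (c ℕ.* d) ℕ.≤ H → 1 ℕ.≤ V →
  S′ ℕ.* L ℕ.≤ 1000 ℕ.* V → 2 ℕ.* (2 ℕ.+ 12 ℕ.* S′ ℕ.+ 1000) ℕ.≤ β →
  2 ℕ.* ((K₀ ℕ.+ 2 ℕ.* S′ ℕ.* (2 ℕ.* K) ℕ.+ S′ ℕ.* (3 ℕ.* s ℕ.+ 5 ℕ.* c) ℕ.+ S′ ℕ.* (L ℕ.* c)) ℕ.* d) ℕ.≤ β ℕ.* H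
budget-Φ S′ L V β {K₀} {K} {s} {c} {d} {H} k₀ k s≤ c≤ V≥ SL β≥ = begin
  2 ℕ.* ((K₀ ℕ.+ 2 ℕ.* S′ ℕ.* (2 ℕ.* K) ℕ.+ S′ ℕ.* (3 ℕ.* s ℕ.+ 5 ℕ.* c) ℕ.+ S′ ℕ.* (L ℕ.* c)) ℕ.* d)
    ≡⟨ eqn S′ L K₀ K s c d ⟩
  2 ℕ.* (K₀ ℕ.* d ℕ.+ 4 ℕ.* S′ ℕ.* (K ℕ.* d) ℕ.+ 3 ℕ.* S′ ℕ.* (s ℕ.* d) ℕ.+ 5 ℕ.* S′ ℕ.* (c ℕ.* d) ℕ.+ S′ ℕ.* L ℕ.* (c ℕ.* d))
    ≤⟨ ℕₚ.*-monoʳ-≤ 2 (ℕₚ.+-mono-≤ (ℕₚ.+-mono-≤ (ℕₚ.+-mono-≤ (ℕₚ.+-mono-≤ k₀ (ℕₚ.*-monoʳ-≤ (4 ℕ.* S′) k)) (ℕₚ.*-monoʳ-≤ (3 ℕ.* S′) s≤))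
         (ℕₚ.*-monoʳ-≤ (5 ℕ.* S′) c≤H)) Lc) ⟩
  2 ℕ.* (2 ℕ.* H ℕ.+ 4 ℕ.* S′ ℕ.* H ℕ.+ 3 ℕ.* S′ ℕ.* H ℕ.+ 5 ℕ.* S′ ℕ.* H ℕ.+ 1000 ℕ.* H)
    ≡⟨ eqn₁ S′ 1000 H ⟩
  2 ℕ.* (2 ℕ.+ 12 ℕ.* S′ ℕ.+ 1000) ℕ.* H
    ≤⟨ ℕₚ.*-monoˡ-≤ H β≥ ⟩
  β ℕ.* H ∎
  where
  open ℕₚ.≤-Reasoning
  eqn : ∀ S′ L K₀ K s c d → 2 ℕ.* ((K₀ ℕ.+ 2 ℕ.* S′ ℕ.* (2 ℕ.* K) ℕ.+ S′ ℕ.* (3 ℕ.* s ℕ.+ 5 ℕ.* c) ℕ.+ S′ ℕ.* (L ℕ.* c)) ℕ.* d) ≡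
        2 ℕ.* (K₀ ℕ.* d ℕ.+ 4 ℕ.* S′ ℕ.* (K ℕ.* d) ℕ.+ 3 ℕ.* S′ ℕ.* (s ℕ.* d) ℕ.+ 5 ℕ.* S′ ℕ.* (c ℕ.* d) ℕ.+ S′ ℕ.* L ℕ.* (c ℕ.* d))
  eqn = ℕS.solve-∀
  eqn₁ : ∀ S′ t H → 2 ℕ.* (2 ℕ.* H ℕ.+ 4 ℕ.* S′ ℕ.* H ℕ.+ 3 ℕ.* S′ ℕ.* H ℕ.+ 5 ℕ.* S′ ℕ.* H ℕ.+ t ℕ.* H) ≡ 2 ℕ.* (2 ℕ.+ 12 ℕ.* S′ ℕ.+ t) ℕ.* H
  eqn₁ = ℕS.solve-∀
  c≤H : c ℕ.* d ℕ.≤ H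
  c≤H = ℕₚ.≤-trans (ℕₚ.m≤n*m (c ℕ.* d) V {{ℕ.>-nonZero V≥}}) c≤
  Lc : S′ ℕ.* L ℕ.* (c ℕ.* d) ℕ.≤ 1000 ℕ.* H
  Lc = ℕₚ.≤-trans (ℕₚ.*-monoˡ-≤ (c ℕ.* d) SL) (ℕₚ.≤-trans (ℕₚ.≤-reflexive (ℕₚ.*-assoc 1000 V (c ℕ.* d))) (ℕₚ.*-monoʳ-≤ 1000 c≤))

-- The admissible failure probability 1 / d is split in two halves: one for the growth of the
-- squares over T steps, where 16 U ≤ β² and a large H suffice, and one for Markov's inequality
-- after `ce`.
budget : ∀ U β {BB T n H Φ d} → BB ℕ.* d ℕ.≤ H → T ℕ.≤ 2 ℕ.* n → n ℕ.≤ U ℕ.* H → 16 ℕ.* U ℕ.≤ β ℕ.* β → 2 ℕ.* (Φ ℕ.* d) ℕ.≤ β ℕ.* H →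
  (0 ℕ.+ 4 ℕ.* BB ℕ.* T ℕ.+ Φ ℕ.* (β ℕ.* H)) ℕ.* d ℕ.≤ β ℕ.* H ℕ.* (β ℕ.* H)
budget U β {BB} {T} {n} {H} {Φ} {d} b≤ T≤ n≤ U≤ Φ≤ = ℕₚ.*-cancelˡ-≤ 2 (begin
  2 ℕ.* ((0 ℕ.+ 4 ℕ.* BB ℕ.* T ℕ.+ Φ ℕ.* (β ℕ.* H)) ℕ.* d)
    ≡⟨ eqn BB T Φ (β ℕ.* H) d ⟩
  8 ℕ.* (BB ℕ.* d) ℕ.* T ℕ.+ 2 ℕ.* (Φ ℕ.* d) ℕ.* (β ℕ.* H)
    ≤⟨ ℕₚ.+-mono-≤ (ℕₚ.*-mono-≤ (ℕₚ.*-monoʳ-≤ 8 b≤) (ℕₚ.≤-trans T≤ (ℕₚ.*-monoʳ-≤ 2 n≤))) (ℕₚ.*-monoˡ-≤ (β ℕ.* H) Φ≤) ⟩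
  8 ℕ.* H ℕ.* (2 ℕ.* (U ℕ.* H)) ℕ.+ β ℕ.* H ℕ.* (β ℕ.* H)
    ≡⟨ cong (ℕ._+ β ℕ.* H ℕ.* (β ℕ.* H)) (eqn₁ U H) ⟩
  16 ℕ.* U ℕ.* (H ℕ.* H) ℕ.+ β ℕ.* H ℕ.* (β ℕ.* H)
    ≤⟨ ℕₚ.+-monoˡ-≤ (β ℕ.* H ℕ.* (β ℕ.* H)) (ℕₚ.*-monoˡ-≤ (H ℕ.* H) U≤) ⟩
  β ℕ.* β ℕ.* (H ℕ.* H) ℕ.+ β ℕ.* H ℕ.* (β ℕ.* H)
    ≡⟨ eqn₂ β H ⟩
  2 ℕ.* (β ℕ.* H ℕ.* (β ℕ.* H)) ∎)
  where
  open ℕₚ.≤-Reasoning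
  eqn : ∀ BB T Φ b d → 2 ℕ.* ((0 ℕ.+ 4 ℕ.* BB ℕ.* T ℕ.+ Φ ℕ.* b) ℕ.* d) ≡ 8 ℕ.* (BB ℕ.* d) ℕ.* T ℕ.+ 2 ℕ.* (Φ ℕ.* d) ℕ.* b
  eqn = ℕS.solve-∀
  eqn₁ : ∀ U H → 8 ℕ.* H ℕ.* (2 ℕ.* (U ℕ.* H)) ≡ 16 ℕ.* U ℕ.* (H ℕ.* H)
  eqn₁ = ℕS.solve-∀
  eqn₂ : ∀ β H → β ℕ.* β ℕ.* (H ℕ.* H) ℕ.+ β ℕ.* H ℕ.* (β ℕ.* H) ≡ 2 ℕ.* (β ℕ.* H ℕ.* (β ℕ.* H))
  eqn₂ = ℕS.solve-∀

-- The constants, and the game for one large n.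

Bmax : ℕ → ℕ
Bmax k = incrementBound 500 10000000 500000 100000 10000 k

lit≤ : ∀ a b → {p : 0 ≡ a ℕ.∸ b} → a ℕ.≤ b
lit≤ a b {p} = ℕₚ.m∸n≡0⇒m≤n (sym p)

-- V and E are variables lest numerals of this size be unfolded.
module Large (d : ℕ) (d≥1 : 1 ℕ.≤ d) (V E : ℕ) (V≡ : V ≡ 10000000) (E≡ : E ≡ V ℕ.* V) (n H : ℕ) (n≤ : n ℕ.≤ 10000000 ℕ.* H) (n+ : 10000000 ℕ.* H ℕ.≤ n ℕ.+ 10000000)
  (H≥ : 100000000000 ℕ.≤ H) (H≥B : Bmax (E ℕ.* d) ℕ.* Bmax (E ℕ.* d) ℕ.* d ℕ.≤ H) (H≥K : 10 ℕ.* (1000 ℕ.* V ℕ.* d ℕ.* d) ℕ.+ 4 ℕ.≤ H) where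

  U k : ℕ
  U = 10000000
  -- The degree cap reached at `ce`, proportional to d, so that the time left there is at most of
  -- the order H / d. It does not depend on n, nor does the bound on the increments.
  k = E ℕ.* d

  H≥1 : 1 ℕ.≤ H
  H≥1 = ℕₚ.≤-trans (lit≤ 1 100000000000 {refl}) H≥

  E≥1 : 1 ℕ.≤ E
  E≥1 = subst (1 ℕ.≤_) (sym (trans E≡ (cong (λ v → v ℕ.* v) V≡))) (lit≤ 1 100000000000000 {refl})

  V≥1 : 1 ℕ.≤ V
  V≥1 = subst (1 ℕ.≤_) (sym V≡) (lit≤ 1 10000000 {refl})

  k≥1 : 1 ℕ.≤ k
  k≥1 = ℕₚ.*-mono-≤ E≥1 d≥1

  kk≥1 : 1 ℕ.≤ k ℕ.* suc k
  kk≥1 = ℕₚ.*-mono-≤ k≥1 (s≤s z≤n)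

  open Degree n using (sumD; sumD-≤; D)

  abstract

    K K₀ T : ℕ
    -- The wait for one of K blocks takes n / K ≤ H / (1000 d) steps on average; scaled by S this is
    -- H / d, whence K₀.
    K  = 1000 ℕ.* V ℕ.* d
    K₀ = suc ((H ℕ./ d) {{ℕ.>-nonZero d≥1}})
    T  = 181701 ℕ.* n ℕ./ 100000

    ce : ℕ
    ce = (n ℕ./ (k ℕ.* suc k)) {{ℕ.>-nonZero kk≥1}}

    ce-kk : ce ℕ.* (k ℕ.* suc k) ℕ.≤ n
    ce-kk = ℕd.m/n*n≤m n (k ℕ.* suc k) {{ℕ.>-nonZero kk≥1}}

    upper : ∀ m v {{_ : ℕ.NonZero v}} → m ℕ.≤ suc (m ℕ./ v) ℕ.* v
    upper m v = ℕₚ.≤-trans (ℕₚ.≤-reflexive (ℕd.m≡m%n+[m/n]*n m v)) (ℕₚ.+-monoˡ-≤ (m ℕ./ v ℕ.* v) (ℕₚ.<⇒≤ (ℕd.m%n<n m v)))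

    ce≥ : n ℕ.≤ k ℕ.* suc k ℕ.* suc ce
    ce≥ = ℕₚ.≤-trans (upper n (k ℕ.* suc k) {{ℕ.>-nonZero kk≥1}}) (ℕₚ.≤-reflexive (ℕₚ.*-comm (suc ce) (k ℕ.* suc k)))

    k*ce : k ℕ.* ce ℕ.≤ n
    k*ce = ℕₚ.≤-trans (ℕₚ.*-monoˡ-≤ ce (ℕₚ.m≤m*n k (suc k))) (ℕₚ.≤-trans (ℕₚ.≤-reflexive (ℕₚ.*-comm (k ℕ.* suc k) ce)) ce-kk)

    kk*ce : k ℕ.* k ℕ.* ce ℕ.≤ n
    kk*ce = ℕₚ.≤-trans (ℕₚ.*-monoˡ-≤ ce (ℕₚ.*-monoʳ-≤ k (ℕₚ.n≤1+n k))) (ℕₚ.≤-trans (ℕₚ.≤-reflexive (ℕₚ.*-comm (k ℕ.* suc k) ce)) ce-kk)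

    n≤V : n ℕ.≤ V ℕ.* H
    n≤V = subst (λ v → n ℕ.≤ v ℕ.* H) (sym V≡) n≤

    V*ce : V ℕ.* (ce ℕ.* d) ℕ.≤ H
    V*ce = ℕₚ.*-cancelˡ-≤ V {{ℕ.>-nonZero V≥1}} (ℕₚ.≤-trans (ℕₚ.≤-reflexive (trans (eqn V ce d) (cong (λ e → e ℕ.* d ℕ.* ce) (sym E≡)))) (ℕₚ.≤-trans k*ce n≤V))
      where
      eqn : ∀ v c d → v ℕ.* (v ℕ.* (c ℕ.* d)) ≡ v ℕ.* v ℕ.* d ℕ.* c
      eqn = ℕS.solve-∀

    ce≤H : ce ℕ.≤ H
    ce≤H = ℕₚ.≤-trans (ℕₚ.m≤m*n ce d {{ℕ.>-nonZero d≥1}}) (ℕₚ.≤-trans (ℕₚ.m≤n*m (ce ℕ.* d) V {{ℕ.>-nonZero V≥1}}) V*ce)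

    sum*d : sumD ce ℕ.* d ℕ.≤ H
    -- The tangent with parameter k: k times the sum is at most k² ce + n ≤ 2 V H, and 2 V ≤ E.
    sum*d = ℕₚ.*-cancelˡ-≤ E {{ℕ.>-nonZero E≥1}} (ℕₚ.≤-trans (ℕₚ.≤-reflexive (eqn E (sumD ce) d)) (ℕₚ.≤-trans (sumD-≤ ce k k≥1)
        (ℕₚ.≤-trans (ℕₚ.+-mono-≤ (ℕₚ.≤-trans kk*ce n≤V) n≤V) (ℕₚ.≤-trans (ℕₚ.≤-reflexive (eqn₁ V H)) (ℕₚ.*-monoˡ-≤ H V≤)))))
      where
      eqn : ∀ e s d → e ℕ.* (s ℕ.* d) ≡ e ℕ.* d ℕ.* s
      eqn = ℕS.solve-∀
      eqn₁ : ∀ v h → v ℕ.* h ℕ.+ v ℕ.* h ≡ v ℕ.* 2 ℕ.* h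
      eqn₁ = ℕS.solve-∀
      V≤ : V ℕ.* 2 ℕ.≤ E
      V≤ = subst (V ℕ.* 2 ℕ.≤_) (sym E≡) (ℕₚ.*-monoʳ-≤ V (subst (2 ℕ.≤_) (sym V≡) (lit≤ 2 10000000 {refl})))

    K*d : K ℕ.* d ℕ.≤ H
    K*d = ℕₚ.≤-trans (ℕₚ.≤-trans (ℕₚ.m≤n*m (K ℕ.* d) 10) (ℕₚ.m≤m+n _ 4)) H≥K

    K≤ : K ℕ.≤ K ℕ.* d
    K≤ = ℕₚ.m≤m*n K d {{ℕ.>-nonZero d≥1}}

    d≤H : d ℕ.≤ H
    d≤H = ℕₚ.≤-trans (ℕₚ.m≤n*m d K {{ℕ.>-nonZero K≥1}}) K*d
      where
      K≥1 : 1 ℕ.≤ K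
      K≥1 = ℕₚ.*-mono-≤ (ℕₚ.*-mono-≤ {1} {1000} (s≤s z≤n) V≥1) d≥1

    K₀*d : K₀ ℕ.* d ℕ.≤ 2 ℕ.* H
    K₀*d = ℕₚ.≤-trans (ℕₚ.+-mono-≤ d≤H (ℕd.m/n*n≤m H d {{ℕ.>-nonZero d≥1}})) (ℕₚ.≤-reflexive (cong (H ℕ.+_) (sym (ℕₚ.+-identityʳ H))))

    shut : 2 ℕ.* 500 ℕ.* n ℕ.≤ K₀ ℕ.* K
    shut = ℕₚ.≤-trans (ℕₚ.*-monoʳ-≤ 1000 (ℕₚ.≤-trans n≤V (ℕₚ.*-monoʳ-≤ V (upper H d {{ℕ.>-nonZero d≥1}})))) (ℕₚ.≤-reflexive (eqn 1000 V K₀ d))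
      where
      eqn : ∀ t v k d → t ℕ.* (v ℕ.* (k ℕ.* d)) ≡ k ℕ.* (t ℕ.* v ℕ.* d)
      eqn = ℕS.solve-∀

    H≤n : H ℕ.≤ n
    H≤n = ℕₚ.+-cancelʳ-≤ 10000000 H n (ℕₚ.≤-trans (ℕₚ.+-monoʳ-≤ H (ℕₚ.≤-trans (lit≤ 10000000 100000000000 {refl}) H≥)) (ℕₚ.≤-trans H+H n+))
      where
      H+H : H ℕ.+ H ℕ.≤ 10000000 ℕ.* H
      H+H = ℕₚ.≤-trans (ℕₚ.≤-reflexive (cong (H ℕ.+_) (sym (ℕₚ.+-identityʳ H)))) (ℕₚ.*-monoˡ-≤ H (lit≤ 2 10000000 {refl}))

    n≥1 : 1 ℕ.≤ n
    n≥1 = ℕₚ.≤-trans H≥1 H≤n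

    n≥K : 10 ℕ.* K ℕ.+ 4 ℕ.≤ n
    n≥K = ℕₚ.≤-trans (ℕₚ.+-monoˡ-≤ 4 (ℕₚ.*-monoʳ-≤ 10 K≤)) (ℕₚ.≤-trans H≥K H≤n)

    T*100000 : T ℕ.* 100000 ℕ.≤ 181701 ℕ.* n
    T*100000 = ℕd.m/n*n≤m (181701 ℕ.* n) 100000

    T≤2n : T ℕ.≤ 2 ℕ.* n
    T≤2n = ℕₚ.*-cancelʳ-≤ T (2 ℕ.* n) 100000 (ℕₚ.≤-trans T*100000 (ℕₚ.≤-trans (ℕₚ.*-monoˡ-≤ n (lit≤ 181701 (2 ℕ.* 100000) {refl})) (ℕₚ.≤-reflexive (eqn 2 100000 n))))
      where
      eqn : ∀ a b n → a ℕ.* b ℕ.* n ≡ a ℕ.* n ℕ.* b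
      eqn = ℕS.solve-∀

    rounding : 0ℤ ≤ + 100000 * + T + + 100000 - + 181701 * + n
    rounding = by (gapℕ (upper (181701 ℕ.* n) 100000))
      (trans (eqn₁ (+ 100000) (+ T) (+ 181701 * + n)) (cong₂ (λ y z → + 100000 + y - z) (sym (ℤₚ.pos-* T 100000)) (sym (ℤₚ.pos-* 181701 n))))
      where
      eqn₁ : ∀ q t z → q * t + q - z ≡ q + t * q - z
      eqn₁ = ℤS.solve-∀

  n+ℤ : 0ℤ ≤ + n + + U - + U * + H
  n+ℤ = subst (λ y → 0ℤ ≤ + n + + U - y) (ℤₚ.pos-* U H) (gapℕ n+)

  n≤ℤ : 0ℤ ≤ + U * + H - + n
  n≤ℤ = subst (λ y → 0ℤ ≤ y - + n) (ℤₚ.pos-* U H) (gapℕ n≤)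

  n≥ℤ : 0ℤ ≤ + n - (+ U - + 1) * + H
  n≥ℤ = by (n+ℤ ⊕ gapℕ (ℕₚ.≤-trans (lit≤ 10000000 100000000000 {refl}) H≥)) (eqn (+ n) (+ U) (+ H))
    where
    eqn : ∀ n u h → n - (u - + 1) * h ≡ (n + u - u * h) + (h - u)
    eqn = ℤS.solve-∀

  base : + 2 * (+ K₀ + (+ 2 * + 500) * + (2 ℕ.* K) + + 500 * (+ 3 * + sumD (1000 ℕ.* H) + + 5 * + (1000 ℕ.* H))) + (M₁ bottom + + 10000 + + 20000) * + H ≤ + 2 * A₁ bottom * + H
  base = ℤₚ.0≤i-j⇒j≤i (cancelPos 100 (s≤s z≤n) (subst (λ y → 0ℤ ≤ + 100 * (+ 2 * A₁ bottom * + H - (+ 2 * (+ K₀ + (+ 2 * + 500) * y + + 500 * (+ 3 * + sumD (1000 ℕ.* H) + + 5 * + (1000 ℕ.* H))) + (M₁ bottom + + 10000 + + 20000) * + H))) {+ 2 * + K} {+ (2 ℕ.* K)} (sym (ℤₚ.pos-* 2 K))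
      -- The tangent with parameter t touches at c = n / t², and 1000 H is about n / 100².
      (base-cert {+ 100} {A₁ bottom} {M₁ bottom + + 10000 + + 20000} {+ 500} {+ 1000} {+ U} {+ H} {+ K₀} {+ K} {+ sumD (1000 ℕ.* H)} {+ (1000 ℕ.* H)} {+ n}
        (nat 100) (nat 500) K₀≤ (gapℕ (ℕₚ.≤-trans K≤ K*d)) sum≤ n≤ℤ (nat H) (ℤₚ.pos-* 1000 H) (toWitness {a? = _ ℤ.≤? _} _))))
    where
    K₀≤ : 0ℤ ≤ + 2 * + H - + K₀
    K₀≤ = subst (λ y → 0ℤ ≤ y - + K₀) (ℤₚ.pos-* 2 H) (gapℕ (ℕₚ.≤-trans (ℕₚ.m≤m*n K₀ d {{ℕ.>-nonZero d≥1}}) K₀*d))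
    sum≤ : 0ℤ ≤ + 100 * + 100 * + (1000 ℕ.* H) + + n - + 100 * + sumD (1000 ℕ.* H)
    sum≤ = subst₂ (λ y z → 0ℤ ≤ y + + n - z) (ℤₚ.pos-* (100 ℕ.* 100) (1000 ℕ.* H)) (ℤₚ.pos-* 100 (sumD (1000 ℕ.* H))) (gapℕ (sumD-≤ (1000 ℕ.* H) 100 (s≤s z≤n)))

  setting : Setting
  setting = record
    { S′ = 500 ; U = 10000000 ; β = 20000 ; Rc = 780000 ; αm = 500000 ; ρm = 100000 ; μm = 10000 ; p₀ = bottom ; r₀ = row₀ ; rs = rows
    ; n = n ; H = H ; K = K ; K₀ = K₀ ; k = k ; q₀ = 100000 ; ce = ce ; S≥1 = s≤s z≤n ; U≥1 = lit≤ 1 10000000 {refl} ; n≥1 = n≥1 ; H≥1 = H≥1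
    ; ok = rows-ok ; first = row₀-merging ; topU = c-top ; A₀≥ = nat _ ; n≤ = n≤ ; n≥ = n≥ℤ
    ; H≥ = gapℕ (ℕₚ.≤-trans (lit≤ 2000 100000000000 {refl}) H≥) ; q-big = lit≤ (10000000 ℕ.* 1000) (100000 ℕ.* 100000) {refl}
    ; q-small = lit≤ (suc (100000 ℕ.+ 1000)) 780000 {refl} ; k≥1 = k≥1 ; ce≤ = ℕₚ.≤-trans ce≤H (ℕₚ.m≤n*m H 1000) ; ce≥ = ce≥
    ; shut = shut ; n≥K = n≥K ; base = base }

  module Pr = Build setting

  rare : (0 ℕ.+ 4 ℕ.* (Pr.B ℕ.* Pr.B) ℕ.* T ℕ.+ Pr.Φmax ℕ.* Pr.b) ℕ.* d ℕ.≤ Pr.b ℕ.* Pr.b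
  rare = budget 10000000 20000 {Pr.B ℕ.* Pr.B} {T} {n} {H} {Pr.Φmax} {d} H≥B T≤2n n≤ (lit≤ (16 ℕ.* 10000000) (20000 ℕ.* 20000) {refl})
    (budget-Φ 500 (2 ℕ.* 10000000) V 20000 {K₀} {K} {sumD ce} {ce} {d} {H} K₀*d K*d sum*d V*ce V≥1 (subst (λ v → 500 ℕ.* (2 ℕ.* 10000000) ℕ.≤ 1000 ℕ.* v) (sym V≡) (lit≤ (500 ℕ.* (2 ℕ.* 10000000)) (1000 ℕ.* 10000000) {refl}))
      (lit≤ (2 ℕ.* (2 ℕ.+ 12 ℕ.* 500 ℕ.+ 1000)) 20000 {refl}))

  open Interpolation H using (line)

  end : Pre
  end = top bottom row₀ rows

  open Check (+ 2 * + 500) 10000000 20000 780000 (c₁ bottom) 500000 100000 10000 using (Ok)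

  slopeG≤ : ∀ p r → Ok p r → 0ℤ ≤ + 2 * (+ 2 * + 500) - slopeG r
  slopeG≤ _ (growing _ _ _) (_ , _ , _ , k≤ , _) = gap k≤
  slopeG≤ _ (merging _ _ _ _ _ _ _) _            = nat 2000

  module GrowthEnd = Ends H {+ 2 * + 500} {10000000} {20000} {780000} {c₁ bottom} {500000} {100000} {10000} G₁ slopeG (λ _ _ → refl) (+ 2 * (+ 2 * + 500)) slopeG≤

  neg-next : ∀ a s w → - (a + s * w) ≡ - a + (- s) * w
  neg-next = ℤS.solve-∀

  neg-neg : ∀ s → 0ℤ - (- s) ≡ s
  neg-neg = ℤS.solve-∀

  module TimeEnd = Ends H {+ 2 * + 500} {10000000} {20000} {780000} {c₁ bottom} {500000} {100000} {10000} (λ p → - A₁ p) (λ r → - slopeA r)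
    (λ p r → neg-next (A₁ p) (slopeA r) (+ width r)) 0ℤ (λ _ r _ → by (Pr.slopeA≥0 r) (neg-neg (slopeA r)))

  n≤top : n ℕ.≤ c₁ end ℕ.* H
  n≤top = subst (λ u → n ℕ.≤ u ℕ.* H) (sym c-top) n≤

  G-end : 0ℤ ≤ Pr.G n - (+ 2 * + 500) * + n
  G-end = start-cert {+ 2 * + 500} {+ U} {+ H} {+ n} {Pr.G n} (nat 1000)
    (subst₂ (λ u g → 0ℤ ≤ Pr.G n + (+ 2 * (+ 2 * + 500)) * (+ u * + H - + n) - g * + H) c-top G-top (GrowthEnd.F-≥ bottom row₀ rows n rows-ok n≤top))
    (gapℕ (ℕₚ.≤-trans (lit≤ 10000000000 100000000000 {refl}) H≥)) n+ℤ

  cs<n : 1000 ℕ.* H ℕ.< n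
  cs<n = ℕₚ.+-cancelʳ-≤ 10000000 (suc (1000 ℕ.* H)) n (ℕₚ.≤-trans (ℕₚ.+-mono-≤ (ℕₚ.+-monoˡ-≤ (1000 ℕ.* H) H≥1)
      (ℕₚ.≤-trans (lit≤ 10000000 100000000000 {refl}) H≥)) (ℕₚ.≤-trans (ℕₚ.≤-reflexive (eqn 1000 H)) (ℕₚ.≤-trans (ℕₚ.*-monoˡ-≤ H (lit≤ 1002 10000000 {refl})) n+)))
    where
    eqn : ∀ t h → h ℕ.+ t ℕ.* h ℕ.+ h ≡ (2 ℕ.+ t) ℕ.* h
    eqn = ℕS.solve-∀

  A-end : 0ℤ ≤ A₁ end * + H - Pr.A n
  A-end = subst (λ a → 0ℤ ≤ A₁ end * + H - a) (sym (Pr.A-high cs<n))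
    (by (TimeEnd.F-≥ bottom row₀ rows n rows-ok n≤top)
      (trans (eqn (A₁ end * + H) (Pr.FA n) (+ c₁ end * + H - + n) (+ H) (A₁ end) refl) (cong (λ y → y + 0ℤ * (+ c₁ end * + H - + n) - (- A₁ end) * + H) (sym (neg-line (Pr.at n))))))
    where
    neg-line : ∀ pr → line (λ p → - A₁ p) (λ r → - slopeA r) pr n ≡ - line A₁ slopeA pr n
    neg-line (p , r) = eqn₁ (A₁ p) (+ H) (slopeA r) (+ n - + c₁ p * + H)
      where
      eqn₁ : ∀ a h s z → (- a) * h + (- s) * z ≡ - (a * h + s * z)
      eqn₁ = ℤS.solve-∀
    eqn₂ : ∀ f y h a → a * h - f ≡ - f + 0ℤ * y - (- a) * h
    eqn₂ = ℤS.solve-∀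
    eqn : ∀ x f y h a → x ≡ a * h → x - f ≡ - f + 0ℤ * y - (- a) * h
    eqn x f y h a e = trans (cong (_- f) e) (eqn₂ f y h a)

  -- A n is at most 1.81701 S U H minus the spare 1000000 H, of which twice the tube takes 40000 H;
  -- the rest exceeds the rounding of T and n. Hence τ starts without excess.
  time-end : Pr.A n - (+ 2 * + 500) * + T + + (2 ℕ.* Pr.b) ≤ 0ℤ
  time-end = neg≤ (by (cancelPos 100000 (lit≤ 1 100000 {refl})
      (finish-cert {+ 2 * + 500} {+ 181701} {+ 100000} {+ U} {+ 100000} {Pr.A n} {A₁ end} {+ 20000} {+ 1000000} {+ n} {+ T} {+ H}
        (nat 1000) (nat 181701) (nat 100000) rounding n+ℤ A-end refl (gap A-top) (nat H) (nat 959999)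
        (gapℕ (ℕₚ.≤-trans (lit≤ 18170101000 100000000000 {refl}) H≥))))
      (trans (cong (λ y → - (Pr.A n - (+ 2 * + 500) * + T + y)) (trans (ℤₚ.pos-* 2 Pr.b) (cong (+ 2 *_) Pr.bℤ))) (eqn (Pr.A n) ((+ 2 * + 500) * + T) (+ 20000 * + H))))
    where
    eqn : ∀ a s b → - (a - s + + 2 * b) ≡ s - a - + 2 * b
    eqn = ℤS.solve-∀
  2≤L : 2 ℕ.≤ Pr.L
  2≤L = lit≤ 2 20000000 {refl}

  3≤n : 3 ℕ.≤ n
  3≤n = ℕₚ.≤-trans (ℕₚ.≤-trans (lit≤ 3 100000000000 {refl}) H≥) H≤n

  Rc : ℕ
  Rc = 780000 ℕ.* H

  open Degree n using (D-anti)
  open Process n Pr.L D Rc K using (toSt; St; grow; step; alive)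
  open Potential n Pr.L D Rc K D-anti 2≤L Pr.profile using (W)
  module Super′ = Supermartingale n Pr.L D Rc K D-anti 2≤L Pr.profile
  module Game = Assembly n 3≤n Pr.L 2≤L D Rc K D-anti
  open Chain step alive using (cnt)

  W-init : ∀ xs → length xs ≡ n → W (toSt xs []) T ≡ 0
  W-init []       e = ⊥-elim (ℕₚ.<⇒≱ n≥1 (ℕₚ.≤-reflexive (sym e)))
  W-init (x ∷ xs) e = cong₂ (λ y z → y ℕ.+ 0 ℕ.+ 0 ℕ.+ z)
    (sq⁺-≤0 (subst₂ (λ y z → (+ 2 * + 500) * + y - Pr.G z ≤ 0ℤ) (sym e) (sym e₀) (ℤₚ.i≤j⇒i-j≤0 {(+ 2 * + 500) * + n} {Pr.G n} (ℤₚ.0≤i-j⇒j≤i {Pr.G n} {(+ 2 * + 500) * + n} G-end))))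
    (sq⁺-≤0 (subst (λ z → Pr.A z - (+ 2 * + 500) * + T + + (2 ℕ.* Pr.b) ≤ 0ℤ) (sym e₀) time-end))
    where
    e₀ : suc (length xs ℕ.+ 0) ≡ n
    e₀ = trans (cong suc (ℕₚ.+-identityʳ (length xs))) e

  failing : cnt T Game.init ℕ.* d ℕ.≤ n ^ T
  failing = ℕₚ.*-cancelʳ-≤ (cnt T Game.init ℕ.* d) (n ^ T) (Pr.b ℕ.* Pr.b) {{ℕ.>-nonZero (ℕₚ.*-mono-≤ b≥1 b≥1)}} (begin
    cnt T Game.init ℕ.* d ℕ.* (Pr.b ℕ.* Pr.b)     ≡⟨ swap (cnt T Game.init) d (Pr.b ℕ.* Pr.b) ⟩
    cnt T Game.init ℕ.* (Pr.b ℕ.* Pr.b) ℕ.* d     ≤⟨ ℕₚ.*-monoˡ-≤ d (Super′.failures T Game.init (Invariants.WithR.toStInv n Pr.L D Rc K D-anti (λ _ _ → ⊤) (λ _ → tt) (List.allFin n) []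
                                                       (λ v → trans (ℕₚ.+-identityʳ _) (occ-allFin v)) All.[])) ⟩
    n ^ T ℕ.* (W Game.init T ℕ.+ 4 ℕ.* (Pr.B ℕ.* Pr.B) ℕ.* T ℕ.+ Pr.Φmax ℕ.* Pr.b) ℕ.* d
      ≡⟨ cong (λ w → n ^ T ℕ.* (w ℕ.+ 4 ℕ.* (Pr.B ℕ.* Pr.B) ℕ.* T ℕ.+ Pr.Φmax ℕ.* Pr.b) ℕ.* d) (W-init (List.allFin n) (Listₚ.length-tabulate {n = n} (λ i → i))) ⟩
    n ^ T ℕ.* (0 ℕ.+ 4 ℕ.* (Pr.B ℕ.* Pr.B) ℕ.* T ℕ.+ Pr.Φmax ℕ.* Pr.b) ℕ.* d
      ≡⟨ ℕₚ.*-assoc (n ^ T) _ d ⟩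
    n ^ T ℕ.* ((0 ℕ.+ 4 ℕ.* (Pr.B ℕ.* Pr.B) ℕ.* T ℕ.+ Pr.Φmax ℕ.* Pr.b) ℕ.* d)
      ≤⟨ ℕₚ.*-monoʳ-≤ (n ^ T) rare ⟩
    n ^ T ℕ.* (Pr.b ℕ.* Pr.b) ∎)
    where
    open ℕₚ.≤-Reasoning
    b≥1 : 1 ℕ.≤ Pr.b
    b≥1 = ℕₚ.≤-trans H≥1 (ℕₚ.m≤n*m H 20000)
    swap : ∀ c d b → c ℕ.* d ℕ.* b ≡ c ℕ.* b ℕ.* d
    swap = ℕS.solve-∀

  wins : Σ ℕ λ t → t ℕ.* 100000 ℕ.≤ 181701 ℕ.* n × Σ (Strategy n) λ strategy → ∀ q → q ℚ.< toℚ 1 → ↧ₙ q ≡ d → HamProbAtLeast strategy q t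
  wins = T , T*100000 , Game.strategy , λ q q<1 e → Game.hamProb q q<1 T (subst (λ c → cnt T Game.init ℕ.* c ℕ.≤ n ^ T) (sym e) failing)

-- Conclusion for all large n and all q.

abstract

  threshold : ∀ u .{{_ : ℕ.NonZero u}} X Y Z → ∃ λ N → ∀ n → n ℕ.≥ N →
    ∃ λ H → n ℕ.≤ u ℕ.* H × u ℕ.* H ℕ.≤ n ℕ.+ u × X ℕ.≤ H × Y ℕ.≤ H × Z ℕ.≤ H
  threshold u X Y Z = u ℕ.* (X ℕ.+ Y ℕ.+ Z) , λ n n≥ →
    let big = ℕₚ.*-cancelˡ-≤ u (ℕₚ.≤-trans n≥ (above n)) in
    suc (n ℕ./ u) , above n , below n ,
    ℕₚ.≤-trans (ℕₚ.≤-trans (ℕₚ.m≤m+n X Y) (ℕₚ.m≤m+n (X ℕ.+ Y) Z)) big ,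
    ℕₚ.≤-trans (ℕₚ.≤-trans (ℕₚ.m≤n+m Y X) (ℕₚ.m≤m+n (X ℕ.+ Y) Z)) big ,
    ℕₚ.≤-trans (ℕₚ.m≤n+m Z (X ℕ.+ Y)) big
    where
    above : ∀ n → n ℕ.≤ u ℕ.* suc (n ℕ./ u)
    above n = ℕₚ.≤-trans (ℕₚ.≤-reflexive (ℕd.m≡m%n+[m/n]*n n u)) (ℕₚ.≤-trans (ℕₚ.+-monoˡ-≤ (n ℕ./ u ℕ.* u) (ℕₚ.<⇒≤ (ℕd.m%n<n n u)))
      (ℕₚ.≤-reflexive (ℕₚ.*-comm (suc (n ℕ./ u)) u)))
    below : ∀ n → u ℕ.* suc (n ℕ./ u) ℕ.≤ n ℕ.+ u
    below n = ℕₚ.≤-trans (ℕₚ.≤-reflexive (ℕₚ.*-comm u (suc (n ℕ./ u)))) (ℕₚ.≤-trans (ℕₚ.+-monoʳ-≤ u (ℕd.m/n*n≤m n u)) (ℕₚ.≤-reflexive (ℕₚ.+-comm u n)))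

-- q enters only through its denominator d, so the threshold for n and the strategy are fixed before
-- q is.
likely : ∀ d → 1 ℕ.≤ d → ∀ V E → V ≡ 10000000 → E ≡ V ℕ.* V → ∃ λ N → ∀ n → n ℕ.≥ N →
  Σ ℕ λ t → t ℕ.* 100000 ℕ.≤ 181701 ℕ.* n × Σ (Strategy n) λ strategy → ∀ q → q ℚ.< toℚ 1 → ↧ₙ q ≡ d → HamProbAtLeast strategy q t
likely d d≥1 V E V≡ E≡ = proj₁ large , λ n n≥ → go n (proj₂ large n n≥)
  where
  Y Z : ℕ
  Y = Bmax (E ℕ.* d) ℕ.* Bmax (E ℕ.* d) ℕ.* d
  Z = 10 ℕ.* (1000 ℕ.* V ℕ.* d ℕ.* d) ℕ.+ 4
  large = threshold 10000000 100000000000 Y Z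
  go : ∀ n → (∃ λ H → n ℕ.≤ 10000000 ℕ.* H × 10000000 ℕ.* H ℕ.≤ n ℕ.+ 10000000 × 100000000000 ℕ.≤ H × Y ℕ.≤ H × Z ℕ.≤ H) →
    Σ ℕ λ t → t ℕ.* 100000 ℕ.≤ 181701 ℕ.* n × Σ (Strategy n) λ strategy → ∀ q → q ℚ.< toℚ 1 → ↧ₙ q ≡ d → HamProbAtLeast strategy q t
  go n (H , n≤ , n+ , H≥ , H≥B , H≥K) = Large.wins d d≥1 V E V≡ E≡ n H n≤ n+ H≥ H≥B H≥K

toℚ-≤ : ∀ p b .{{_ : ℕ.NonZero b}} m n → m ℕ.* b ℕ.≤ p ℕ.* n → toℚ m ℚ.≤ (+ p / b) ℚ.* toℚ n
toℚ-≤ p (suc b) m n h = ℚₚ.toℚᵘ-cancel-≤ (begin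
    ℚ.toℚᵘ (toℚ m)                                ≃⟨ ℚₚ.toℚᵘ-fromℚᵘ (ℚᵘ.mkℚᵘ (+ m) 0) ⟩
    ℚᵘ.mkℚᵘ (+ m) 0                               ≤⟨ ℚᵘ.*≤* ineq ⟩
    ℚᵘ.mkℚᵘ (+ p) b ℚᵘ.* ℚᵘ.mkℚᵘ (+ n) 0          ≃⟨ ℚᵘₚ.≃-sym (ℚᵘₚ.*-cong (ℚₚ.toℚᵘ-fromℚᵘ (ℚᵘ.mkℚᵘ (+ p) b)) (ℚₚ.toℚᵘ-fromℚᵘ (ℚᵘ.mkℚᵘ (+ n) 0))) ⟩
    ℚ.toℚᵘ (+ p / suc b) ℚᵘ.* ℚ.toℚᵘ (toℚ n)      ≃⟨ ℚᵘₚ.≃-sym (ℚₚ.toℚᵘ-homo-* (+ p / suc b) (toℚ n)) ⟩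
    ℚ.toℚᵘ ((+ p / suc b) ℚ.* toℚ n) ∎)
  where
  open ℚᵘₚ.≤-Reasoning
  ineq : + m * + (suc b ℕ.* 1) ≤ (+ p * + n) * + 1
  ineq = subst₂ _≤_ (trans (ℤₚ.pos-* m (suc b)) (cong (λ z → + m * + z) (sym (ℕₚ.*-identityʳ (suc b)))))
    (trans (ℤₚ.pos-* p n) (sym (ℤₚ.*-identityʳ (+ p * + n)))) (ℤ.+≤+ h)

slack-≤ : ∀ c ε t n → toℚ 0 ℚ.< ε → toℚ t ℚ.≤ c ℚ.* toℚ n → toℚ t ℚ.≤ (c ℚ.+ ε) ℚ.* toℚ n
slack-≤ c ε t n ε>0 h = ℚₚ.≤-trans h
  (ℚₚ.*-monoʳ-≤-nonNeg (toℚ n) {{ℚₚ.normalize-nonNeg n 1}} (ℚₚ.≤-trans (ℚₚ.≤-reflexive (sym (ℚₚ.+-identityʳ c))) (ℚₚ.+-monoʳ-≤ c (ℚₚ.<⇒≤ ε>0))))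

theorem1p1 : CHamAtMost ((+ 181701) / 100000)
theorem1p1 q _ q<1 ε ε>0 = proj₁ large , λ n n≥ → finish n (proj₂ large n n≥)
  where
  large = likely (↧ₙ q) (s≤s z≤n) 10000000 100000000000000 refl refl
  finish : ∀ n → (Σ ℕ λ t → t ℕ.* 100000 ℕ.≤ 181701 ℕ.* n × Σ (Strategy n) λ strategy → ∀ q′ → q′ ℚ.< toℚ 1 → ↧ₙ q′ ≡ ↧ₙ q → HamProbAtLeast strategy q′ t) →
    MHamAtMost q n (((+ 181701) / 100000 ℚ.+ ε) ℚ.* toℚ n)
  finish n (t , t≤ , strategy , wins) = t , slack-≤ ((+ 181701) / 100000) ε t n ε>0 (toℚ-≤ 181701 100000 t n t≤) , strategy , wins q q<1 refl
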